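{- There is a positive constant $c_1$ such that the following holds. Let $p$ be a prime, let $1\le m\le p$ be an integer, and let $A$ be a zero-sum-free sequence of $\mathbb{Z}_p$ with $m(A)\le m$. Then there exist a non-zero residue $b\in\mathbb{Z}_p$ and a subsequence $A^{\flat}\subset A$ with $|A^{\flat}|\le c_1 f(p,m)$ such that $$\sum_{a\in b\cdot (A\setminus A^{\flat})} a<p,$$ where each element of $b\cdot(A\setminus A^\flat)$ is identified with the integer in $\{0,1,\dots,p-1\}$ representing it, and the sum is taken in $\mathbb{Z}$ (with multiplicity).
   Context: $\mathbb{Z}_p$ is the cyclic group (field) of prime order $p$. A sequence of $\mathbb{Z}_p$ is a finite multiset of elements of $\mathbb{Z}_p$; $m_a(A)$ denotes the multiplicity of $a$ in $A$, and $m(A)=\max_{a\in\mathbb{Z}_p} m_a(A)$ is the maximum multiplicity (throughout, sequences are assumed to satisfy $m(A)\le p$). Subsequences, $A\setminus A^\flat$ and cardinalities are taken with multiplicity. $\sum(A)$ is the set of all sums $\sum_{x\in B}x$ over non-empty subsequences $B\subset A$; $A$ is zero-sum-free if $0\notin\sum(A)$. For $b\in\mathbb{Z}_p$, $b\cdot A=\{ba: a\in A\}$ (as a sequence). $f(p,m):=\lfloor (pm)^{6/13}\log^2 p\rfloor$. -}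

module Defs where

open import Data.Nat as ℕ using (ℕ; zero; suc; NonZero; _%_)
open import Data.Integer using (+_)
open import Data.Rational as ℚ using (ℚ; 0ℚ; 1ℚ; _/_)
open import Data.Fin using (Fin; toℕ)
open import Data.Fin.Properties using () renaming (_≟_ to _≟ᶠ_)
open import Data.List using (List; []; _∷_; _++_; map; length)
open import Data.Nat.ListAction using (sum)
open import Data.List.Relation.Binary.Permutation.Propositional using (_↭_)
open import Relation.Binary.PropositionalEquality using (_≡_; _≢_)
open import Relation.Nullary using (yes; no)

ℕtoℚ : ℕ → ℚ
ℕtoℚ n = (+ n) / 1

_^ℚ_ : ℚ → ℕ → ℚ
t ^ℚ zero  = 1ℚ
t ^ℚ suc n = t ^ℚ n ℚ.* t

expTerm : ℚ → ℕ → ℚ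
expTerm t zero    = 1ℚ
expTerm t (suc n) = expTerm t n ℚ.* t ℚ.* ((+ 1) / suc n)

expPartial : ℚ → ℕ → ℚ
expPartial t zero    = 1ℚ
expPartial t (suc N) = expPartial t N ℚ.+ expTerm t (suc N)

-- For a rational t ≥ 0 and a natural x:  exp(t) ≤ x  (i.e. t ≤ ln x),
-- since the partial sums increase to exp(t).
ExpLe : ℚ → ℕ → Set
ExpLe t x = ∀ (N : ℕ) → expPartial t N ℚ.≤ ℕtoℚ x

-- FLeq p m k  :⇔  k ≤ (p m)^{6/13} (ln p)^2   (natural logarithm).
-- Equivalently (ln p)^{26} (pm)^6 ≥ k^{13}, i.e. ln p ≥ s := (k^13/(pm)^6)^{1/26},
-- i.e. every rational t ≥ 0 with t < s (⇔ t^26 (pm)^6 < k^13) satisfies t ≤ ln p.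
FLeq : ℕ → ℕ → ℕ → Set
FLeq p m k = ∀ (t : ℚ) → 0ℚ ℚ.≤ t
  → (t ^ℚ 26) ℚ.* ℕtoℚ ((p ℕ.* m) ℕ.^ 6) ℚ.< ℕtoℚ (k ℕ.^ 13)
  → ExpLe t p

mult : ∀ {p} → Fin p → List (Fin p) → ℕ
mult a [] = 0
mult a (x ∷ xs) with a ≟ᶠ x
... | yes _ = suc (mult a xs)
... | no  _ = mult a xs

sumMod : (p : ℕ) .{{_ : NonZero p}} → List (Fin p) → ℕ
sumMod p B = sum (map toℕ B) % p

ZeroSumFree : (p : ℕ) .{{_ : NonZero p}} → List (Fin p) → Set
ZeroSumFree p A = ∀ (B C : List (Fin p)) → A ↭ B ++ C → B ≢ [] → sumMod p B ≢ 0

scaledSum : (p : ℕ) .{{_ : NonZero p}} → ℕ → List (Fin p) → ℕ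
scaledSum p b R = sum (map (λ r → (b ℕ.* toℕ r) % p) R)

{-# OPTIONS --safe #-}
module Submission where

-- Put n = ⌊(p m)^(6/13)⌋ and N = 128 n; if p m is bounded by a constant, or if A has fewer than 8N terms, all of A is removed.
-- Adding an element a to a set S of residues enlarges it by lam a = |(S + a) \ S|, and few elements have a small lam. Hence
-- O(N) terms of A split into three groups whose subset sums form sets S, V, W of size at least s = N² / 32m, and S can be
-- saturated: lam a ≤ L ≈ p / N for all remaining a. As A is zero-sum-free, x + y + z + a₀ never vanishes on S × V × W for
-- some removed term a₀. Summing over all dilations, with a triangle wave in place of characters, this yields a b for which
-- t ↦ Σ_{x ∈ S} ‖b x + t‖ oscillates by Ω ≥ 2 |S| s / 75, where ‖x‖ is the distance from x to p ℤ. Translating S by a moves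
-- this function by at most p · lam a, so for b with maximal Ω it follows that ‖b a‖ ≤ X with (m X)² ≪ N³.
-- The remaining terms have thus become integers in [−X , X]. Dividing by a common divisor of almost all of them, we may
-- assume that no e ≥ 2 divides all but 2N of them. Then the subsums of O(N) terms contain an interval of length 2X, which
-- every further term lengthens. Zero-sum-freeness keeps the interval away from the multiples of p, so the terms have one
-- sign up to O(N) exceptions and their absolute values add up to less than p.

open import Defs
open import Data.Nat as ℕ using (ℕ; zero; suc; NonZero; z≤n; s≤s)
import Data.Nat.Properties as ℕₚ
import Data.Nat.Divisibility as ℕᵈ
open import Data.Nat.DivMod
  using (_/_; _%_; m/n*n≤m; m*n/n≡m; m≡m%n+[m/n]*n; m%n<n; m%n≤m; m≥n⇒m/n>0; m<n*o⇒m/o<n; /-monoˡ-≤; /-monoʳ-≤)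
open import Data.Nat.GCD using (gcd; gcd-GCD; gcd[m,n]∣m; gcd[m,n]∣n; gcd[m,n]≢0; module Bézout)
open import Data.Nat.Coprimality using (Coprime; coprime-Bézout)
open import Data.Nat.Primality using (Prime; prime⇒irreducible; prime⇒nonTrivial)
open import Data.Nat.ListAction using (sum)
import Data.Nat.Solver
open import Data.Integer as ℤ using (ℤ; +_; -[1+_]; 0ℤ; 1ℤ; +≤+; ∣_∣)
import Data.Integer.Properties as ℤₚ
open import Data.Integer.DivMod using (_%ℕ_; _/ℕ_; a≡a%ℕn+[a/ℕn]*n; n%ℕd<d)
open import Data.Integer.Divisibility.Signed
  using (divides; ∣ᵤ⇒∣; ∣⇒∣ᵤ; ∣m∣n⇒∣m+n; ∣m∣n⇒∣m-n; ∣n⇒∣m*n) renaming (_∣_ to _∣ᶻ_; _∣?_ to _∣?ᶻ_)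
import Data.Integer.Solver
open import Data.Rational as ℚ using (ℚ; 0ℚ; 1ℚ)
import Data.Rational.Properties as ℚₚ
open import Data.Rational.Unnormalised as ℚᵘ using (mkℚᵘ; *≤*)
import Data.Rational.Unnormalised.Properties as ℚᵘₚ
open import Data.Fin using (Fin; zero; suc; toℕ; fromℕ<)
import Data.Fin.Properties as Finₚ
open import Data.List using (List; []; _∷_; _++_; length; map)
import Data.List.Properties as Listₚ
open import Data.List.Relation.Unary.All as All using (All; []; _∷_)
import Data.List.Relation.Unary.All.Properties as Allₚ
open import Data.List.Relation.Binary.Permutation.Propositional as Perm
  using (_↭_; ↭-refl; ↭-sym; ↭-trans; ↭-reflexive; prep; swap)
open import Data.List.Relation.Binary.Permutation.Propositional.Properties
  using (++⁺; ++⁺ˡ; ++⁺ʳ; shifts; shift; ↭-length; All-resp-↭; ++-identityʳ; ++-comm; ++-commutativeMonoid; ++-assoc)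
import Algebra.Solver.CommutativeMonoid
open import Data.Product using (_×_; _,_; proj₁; proj₂; ∃-syntax)
open import Data.Sum using (_⊎_; inj₁; inj₂)
open import Data.Unit using (tt)
open import Data.Empty using (⊥; ⊥-elim)
import Relation.Binary
open import Relation.Nullary using (¬_; Dec; yes; no; ¬?; _×-dec_)
open import Relation.Binary.PropositionalEquality
  using (_≡_; _≢_; refl; sym; trans; cong; cong₂; subst; subst₂; module ≡-Reasoning)

open Data.Integer.Solver.+-*-Solver using (solve; _:=_; con; _:+_; _:*_; _:-_; :-_)
open Data.Nat.Solver.+-*-Solver using () renaming (solve to solveℕ; _:=_ to _≔_; con to lit; _:+_ to _⊹_; _:*_ to _⊛_)

-- The exponent 6/13 comes from one balance. With s ≈ N²/m and L ≈ p/N, an oscillation of order s²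
-- yields X ≈ p²L/s² ≈ p³m²/N⁵, and the interval construction needs (mX)² ≪ N³; together this reads
-- (pm)⁶ ≪ N¹³. The other demands, such as p²L ≪ s³, that is (pm)³ ≪ N⁷, are weaker. The triangle
-- wave keeps the dilation argument inside ℤ: a sum over all b is evaluated by permuting the
-- residues, and each estimate ends in a polynomial identity. The obstacle is that a function hardly
-- changed by the shift b a does not force b a to be near 0; it may be near a fraction r p / q.
-- Averaging over q such shifts turns the wave of b into 1/q² times that of q b (or into a
-- constant), and q b cannot oscillate more than the extremal b. This is why b is chosen with
-- maximal Ω. In the integer problem the obstacle is divisibility: a progression of subsums can only
-- be refined to difference 1 if no e ≥ 2 divides almost all terms, hence the descent on common
-- divisors.

-- Integer inequalities by certificates; finite sums; sums over the residues mod n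

module IntegerSums where

  open import Data.Integer using (_+_; _-_; _*_; -_; _≤_)
  open ℤₚ using (≤-trans; ≤-refl; ≤-reflexive)

  sub≥0 : ∀ {a b} → a ≤ b → 0ℤ ≤ b - a
  sub≥0 = ℤₚ.i≤j⇒0≤j-i

  -- The standard form of an inequality below: the difference b - a is displayed as a sum of
  -- products of nonnegative quantities, and the ring solver checks the identity.
  ≤-by : ∀ {a b} e → 0ℤ ≤ e → b - a ≡ e → a ≤ b
  ≤-by e h eq = ℤₚ.0≤i-j⇒j≤i (subst (0ℤ ≤_) (sym eq) h)

  infixl 6 _⊕_
  infixl 7 _⊗_
  _⊕_ : ∀ {a b} → 0ℤ ≤ a → 0ℤ ≤ b → 0ℤ ≤ a + b
  _⊕_ = ℤₚ.+-mono-≤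

  _⊗_ : ∀ {a b} → 0ℤ ≤ a → 0ℤ ≤ b → 0ℤ ≤ a * b
  _⊗_ {+ m} {+ n} _ _ = subst (0ℤ ≤_) (ℤₚ.pos-* m n) (+≤+ z≤n)

  pos : ∀ {n} → 0ℤ ≤ + n
  pos = +≤+ z≤n

  sq≥0 : ∀ a → 0ℤ ≤ a * a
  sq≥0 (+ n) = pos {n} ⊗ pos {n}
  sq≥0 (-[1+ n ]) = pos

  ≤-absurd : ∀ {a b} → a ≤ b → 1ℤ + b ≤ a → ⊥
  ≤-absurd {a} {b} h k = ℤₚ.<-irrefl refl (ℤₚ.<-≤-trans (ℤₚ.suc[i]≤j⇒i<j k) h)

  ≤-or : ∀ a b → a ≤ b ⊎ 1ℤ + b ≤ a
  ≤-or a b with a ℤₚ.≤? b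
  ... | yes h = inj₁ h
  ... | no h = inj₂ (ℤₚ.i<j⇒suc[i]≤j (ℤₚ.≰⇒> h))

  +≤+⁻ : ∀ {m n} → + m ≤ + n → m ℕ.≤ n
  +≤+⁻ = ℤₚ.drop‿+≤+

  ≥0⇒pos : ∀ {x} → 0ℤ ≤ x → ∃[ n ] x ≡ + n
  ≥0⇒pos {+ n} _ = n , refl

  *-cancel≥0 : ∀ {c x} → 1ℤ ≤ c → 0ℤ ≤ c * x → 0ℤ ≤ x
  *-cancel≥0 {c} {+ n} _ _ = pos
  *-cancel≥0 {c} { -[1+ n ]} h k = ⊥-elim (≤-absurd k (≤-by ((c - 1ℤ) + c * + n) (sub≥0 h ⊕ (≤-trans (+≤+ z≤n) h ⊗ pos))
    (trans (cong (λ z → 0ℤ - (1ℤ + c * z)) (neg-suc n)) (eq c (+ n)))))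
    where
    neg-suc : ∀ n → -[1+ n ] ≡ - (1ℤ + + n)
    neg-suc n = refl
    eq : ∀ c n → 0ℤ - (1ℤ + c * - (1ℤ + n)) ≡ (c - 1ℤ) + c * n
    eq = solve 2 (λ c n → con 0ℤ :- (con 1ℤ :+ c :* :- (con 1ℤ :+ n)) := (c :- con 1ℤ) :+ c :* n) refl

  *-cancel-≤ : ∀ {c x y} → 1ℤ ≤ c → c * x ≤ c * y → x ≤ y
  *-cancel-≤ {c} {x} {y} h k = ℤₚ.0≤i-j⇒j≤i (*-cancel≥0 {c} h (subst (0ℤ ≤_) (eq c x y) (sub≥0 k)))
    where
    eq : ∀ c x y → c * y - c * x ≡ c * (y - x)
    eq = solve 3 (λ c x y → c :* y :- c :* x := c :* (y :- x)) refl

  +-cancel : ∀ a {b c} → a + b ≡ a + c → b ≡ c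
  +-cancel a {b} {c} h = trans (eq a b) (trans (cong (_- a) h) (sym (eq a c)))
    where
    eq : ∀ a b → b ≡ a + b - a
    eq = solve 2 (λ a b → b := a :+ b :- a) refl

  ∑ : ℕ → (ℕ → ℤ) → ℤ
  ∑ zero f = 0ℤ
  ∑ (suc n) f = ∑ n f + f n

  ∑-cong< : ∀ n {f g} → (∀ i → i ℕ.< n → f i ≡ g i) → ∑ n f ≡ ∑ n g
  ∑-cong< zero h = refl
  ∑-cong< (suc n) h = cong₂ _+_ (∑-cong< n (λ i l → h i (ℕₚ.m<n⇒m<1+n l))) (h n ℕₚ.≤-refl)

  ∑-cong : ∀ n {f g} → (∀ i → f i ≡ g i) → ∑ n f ≡ ∑ n g
  ∑-cong n h = ∑-cong< n (λ i _ → h i)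

  ∑-mono< : ∀ n {f g} → (∀ i → i ℕ.< n → f i ≤ g i) → ∑ n f ≤ ∑ n g
  ∑-mono< zero h = ≤-refl
  ∑-mono< (suc n) h = ℤₚ.+-mono-≤ (∑-mono< n (λ i l → h i (ℕₚ.m<n⇒m<1+n l))) (h n ℕₚ.≤-refl)

  ∑-mono : ∀ n {f g} → (∀ i → f i ≤ g i) → ∑ n f ≤ ∑ n g
  ∑-mono n h = ∑-mono< n (λ i _ → h i)

  ∑-+ : ∀ n f g → ∑ n (λ i → f i + g i) ≡ ∑ n f + ∑ n g
  ∑-+ zero f g = refl
  ∑-+ (suc n) f g = trans (cong (_+ (f n + g n)) (∑-+ n f g)) (eq (∑ n f) (∑ n g) (f n) (g n))
    where
    eq : ∀ a b c d → a + b + (c + d) ≡ a + c + (b + d)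
    eq = solve 4 (λ a b c d → a :+ b :+ (c :+ d) := a :+ c :+ (b :+ d)) refl

  ∑-*ˡ : ∀ n c f → ∑ n (λ i → c * f i) ≡ c * ∑ n f
  ∑-*ˡ zero c f = sym (ℤₚ.*-zeroʳ c)
  ∑-*ˡ (suc n) c f = trans (cong (_+ c * f n) (∑-*ˡ n c f)) (sym (ℤₚ.*-distribˡ-+ c _ _))

  ∑-*ʳ : ∀ n c f → ∑ n (λ i → f i * c) ≡ ∑ n f * c
  ∑-*ʳ n c f = trans (∑-cong n (λ i → ℤₚ.*-comm (f i) c)) (trans (∑-*ˡ n c f) (ℤₚ.*-comm c _))

  ∑-- : ∀ n f g → ∑ n (λ i → f i - g i) ≡ ∑ n f - ∑ n g
  ∑-- zero f g = refl
  ∑-- (suc n) f g = trans (cong (_+ (f n - g n)) (∑-- n f g)) (eq (∑ n f) (∑ n g) (f n) (g n))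
    where
    eq : ∀ a b c d → a - b + (c - d) ≡ a + c - (b + d)
    eq = solve 4 (λ a b c d → a :- b :+ (c :- d) := a :+ c :- (b :+ d)) refl

  ∑-const : ∀ n c → ∑ n (λ _ → c) ≡ + n * c
  ∑-const zero c = sym (ℤₚ.*-zeroˡ c)
  ∑-const (suc n) c = trans (cong (_+ c) (∑-const n c)) (eq (+ n) c)
    where
    eq : ∀ a c → a * c + c ≡ (1ℤ + a) * c
    eq = solve 2 (λ a c → a :* c :+ c := (con 1ℤ :+ a) :* c) refl

  ∑-zero : ∀ n → ∑ n (λ _ → 0ℤ) ≡ 0ℤ
  ∑-zero n = trans (∑-const n 0ℤ) (ℤₚ.*-zeroʳ (+ n))

  ∑-≥0 : ∀ n {f} → (∀ i → 0ℤ ≤ f i) → 0ℤ ≤ ∑ n f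
  ∑-≥0 n {f} h = subst (_≤ ∑ n f) (∑-zero n) (∑-mono n {λ _ → 0ℤ} {f} h)

  ∑-swap : ∀ n m (f : ℕ → ℕ → ℤ) → ∑ n (λ i → ∑ m (f i)) ≡ ∑ m (λ j → ∑ n (λ i → f i j))
  ∑-swap zero m f = sym (∑-zero m)
  ∑-swap (suc n) m f = trans (cong (_+ ∑ m (f n)) (∑-swap n m f)) (sym (∑-+ m _ (f n)))

  ∑-first : ∀ n f → ∑ (suc n) f ≡ f 0 + ∑ n (λ i → f (suc i))
  ∑-first zero f = trans (ℤₚ.+-identityˡ (f 0)) (sym (ℤₚ.+-identityʳ (f 0)))
  ∑-first (suc n) f = trans (cong (_+ f (suc n)) (∑-first n f)) (ℤₚ.+-assoc (f 0) _ _)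

  ≡0⊎ : ∀ {x} → 0ℤ ≤ x → x ≡ 0ℤ ⊎ 1ℤ ≤ x
  ≡0⊎ {+ zero} _ = inj₁ refl
  ≡0⊎ {+ suc n} _ = inj₂ (+≤+ (s≤s z≤n))

  ∑-mono-n : ∀ {n m} {f : ℕ → ℤ} → n ℕ.≤ m → (∀ i → 0ℤ ≤ f i) → ∑ n f ≤ ∑ m f
  ∑-mono-n {n} {m} {f} h nn = go (ℕₚ.≤⇒≤′ h)
    where
    go : ∀ {m} → n ℕ.≤′ m → ∑ n f ≤ ∑ m f
    go ℕ.≤′-refl = ≤-refl
    go (ℕ.≤′-step {m} k) = ≤-by ((∑ m f - ∑ n f) + f m) (sub≥0 (go k) ⊕ nn m) (eq (∑ m f) (f m) (∑ n f))
      where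
      eq : ∀ a b c → a + b - c ≡ (a - c) + b
      eq = solve 3 (λ a b c → a :+ b :- c := (a :- c) :+ b) refl

  module Mod (n : ℕ) .{{nz : NonZero n}} where

    -- Wherever `Mod` is open, `N` is this modulus, not the N of the overview.
    N : ℤ
    N = + n

    -- Functions on the residues are represented by n-periodic functions on ℤ, so that their
    -- arguments can be handled by the ring solver.
    Per : (ℤ → ℤ) → Set
    Per f = ∀ x k → f (x + k * N) ≡ f x

    per-shift : ∀ {f} t → Per f → Per (λ x → f (x + t))
    per-shift {f} t h x k = trans (cong f (eq x k N t)) (h (x + t) k)
      where
      eq : ∀ x k n t → x + k * n + t ≡ x + t + k * n
      eq = solve 4 (λ x k n t → x :+ k :* n :+ t := x :+ t :+ k :* n) refl

    per-rev : ∀ {f} t → Per f → Per (λ x → f (t - x))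
    per-rev {f} t h x k = trans (cong f (eq x k N t)) (h (t - x) (- k))
      where
      eq : ∀ x k n t → t - (x + k * n) ≡ t - x + - k * n
      eq = solve 4 (λ x k n t → t :- (x :+ k :* n) := t :- x :+ :- k :* n) refl

    per-* : ∀ {f g} → Per f → Per g → Per (λ x → f x * g x)
    per-* h k x c = cong₂ _*_ (h x c) (k x c)

    per-+ : ∀ {f g} → Per f → Per g → Per (λ x → f x + g x)
    per-+ h k x c = cong₂ _+_ (h x c) (k x c)

    per-- : ∀ {f g} → Per f → Per g → Per (λ x → f x - g x)
    per-- h k x c = cong₂ _-_ (h x c) (k x c)

    per-const : ∀ c → Per (λ _ → c)
    per-const c x k = refl

    per-∑ : ∀ m {f : ℕ → ℤ → ℤ} → (∀ i → Per (f i)) → Per (λ x → ∑ m (λ i → f i x))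
    per-∑ m h x k = ∑-cong m (λ i → h i x k)

    per-≡ : ∀ {f} → Per f → ∀ {x y} → N ∣ᶻ (x - y) → f x ≡ f y
    per-≡ {f} h {x} {y} (divides q e) = trans (cong f (trans (eq x y) (cong (λ z → y + z) e))) (h y q)
      where
      eq : ∀ x y → x ≡ y + (x - y)
      eq = solve 2 (λ x y → x := y :+ (x :- y)) refl

    abstract
      S : (ℤ → ℤ) → ℤ
      S f = ∑ n (λ i → f (+ i))

      S-def : ∀ f → S f ≡ ∑ n (λ i → f (+ i))
      S-def f = refl

      S-mono< : ∀ {f g} → (∀ i → i ℕ.< n → f (+ i) ≤ g (+ i)) → S f ≤ S g
      S-mono< h = ∑-mono< n h

      ∑-S-swap : ∀ m (f : ℕ → ℤ → ℤ) → ∑ m (λ i → S (f i)) ≡ S (λ x → ∑ m (λ i → f i x))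
      ∑-S-swap m f = ∑-swap m n (λ i x → f i (+ x))

      S-cong : ∀ {f g} → (∀ x → f x ≡ g x) → S f ≡ S g
      S-cong h = ∑-cong n (λ i → h (+ i))

      S-mono : ∀ {f g} → (∀ x → f x ≤ g x) → S f ≤ S g
      S-mono h = ∑-mono n (λ i → h (+ i))

      S-≥0 : ∀ {f} → (∀ x → 0ℤ ≤ f x) → 0ℤ ≤ S f
      S-≥0 h = ∑-≥0 n (λ i → h (+ i))

      S-+ : ∀ f g → S (λ x → f x + g x) ≡ S f + S g
      S-+ f g = ∑-+ n _ _

      S-- : ∀ f g → S (λ x → f x - g x) ≡ S f - S g
      S-- f g = ∑-- n _ _

      S-*ˡ : ∀ c f → S (λ x → c * f x) ≡ c * S f
      S-*ˡ c f = ∑-*ˡ n c _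

      S-*ʳ : ∀ c f → S (λ x → f x * c) ≡ S f * c
      S-*ʳ c f = ∑-*ʳ n c _

      S-const : ∀ c → S (λ _ → c) ≡ N * c
      S-const c = ∑-const n c

      S-swap : ∀ (f : ℤ → ℤ → ℤ) → S (λ x → S (f x)) ≡ S (λ y → S (λ x → f x y))
      S-swap f = ∑-swap n n _

    private
      -- After adding f 0 both sides are the sum of f over 0, ..., n, because f n = f 0.
      step : ∀ {f} → Per f → S (λ x → f (x + 1ℤ)) ≡ S f
      step {f} h = +-cancel (f 0ℤ) (begin
          f 0ℤ + S (λ x → f (x + 1ℤ))       ≡⟨ cong (_+_ (f 0ℤ)) (S-def (λ x → f (x + 1ℤ))) ⟩
          f 0ℤ + ∑ n (λ i → f (+ i + 1ℤ))   ≡⟨ cong (_+_ (f 0ℤ)) (∑-cong n (λ i → cong f (ℤₚ.+-comm (+ i) 1ℤ))) ⟩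
          f 0ℤ + ∑ n (λ i → f (+ (suc i)))  ≡⟨ trans (sym (∑-first n (λ i → f (+ i)))) (cong (_+ f (+ n)) (sym (S-def f))) ⟩
          S f + f (+ n)                     ≡⟨ cong (_+_ (S f)) (trans (cong f (eq N)) (h 0ℤ 1ℤ)) ⟩
          S f + f 0ℤ                        ≡⟨ ℤₚ.+-comm (S f) _ ⟩
          f 0ℤ + S f ∎)
        where
        open ≡-Reasoning
        eq : ∀ n → n ≡ 0ℤ + 1ℤ * n
        eq = solve 1 (λ n → n := con 0ℤ :+ con 1ℤ :* n) refl

      steps : ∀ k {f} → Per f → S (λ x → f (x + + k)) ≡ S f
      steps zero {f} h = S-cong (λ x → cong f (ℤₚ.+-identityʳ x))
      steps (suc k) {f} h = trans (S-cong (λ x → cong f (eq x (+ k))))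
                       (trans (step {λ x → f (x + + k)} (per-shift (+ k) h)) (steps k h))
        where
        eq : ∀ x k → x + (1ℤ + k) ≡ x + 1ℤ + k
        eq = solve 2 (λ x k → x :+ (con 1ℤ :+ k) := x :+ con 1ℤ :+ k) refl

    S-shift : ∀ {f} → Per f → ∀ a → S (λ x → f (x + a)) ≡ S f
    S-shift h (+ k) = steps k h
    S-shift {f} h -[1+ k ] = trans (sym (steps (suc k) {λ x → f (x + -[1+ k ])} (per-shift -[1+ k ] h)))
                               (S-cong (λ x → cong f (eq x (+ suc k))))
      where
      eq : ∀ x k → x + k + - k ≡ x
      eq = solve 2 (λ x k → x :+ k :+ :- k := x) refl

    abstract
      δ : ℤ → ℤ
      δ z with N ∣?ᶻ z
      ... | yes _ = 1ℤ
      ... | no _ = 0ℤ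

      δ-yes : ∀ {z} → N ∣ᶻ z → δ z ≡ 1ℤ
      δ-yes {z} h with N ∣?ᶻ z
      ... | yes _ = refl
      ... | no k = ⊥-elim (k h)

      δ-no : ∀ {z} → ¬ (N ∣ᶻ z) → δ z ≡ 0ℤ
      δ-no {z} h with N ∣?ᶻ z
      ... | yes k = ⊥-elim (h k)
      ... | no _ = refl

      δ-case : ∀ z → (N ∣ᶻ z × δ z ≡ 1ℤ) ⊎ (¬ (N ∣ᶻ z) × δ z ≡ 0ℤ)
      δ-case z with N ∣?ᶻ z
      ... | yes k = inj₁ (k , refl)
      ... | no k = inj₂ (k , refl)

    δ≥0 : ∀ z → 0ℤ ≤ δ z
    δ≥0 z with δ-case z
    ... | inj₁ (_ , e) = subst (0ℤ ≤_) (sym e) pos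
    ... | inj₂ (_ , e) = ≤-reflexive (sym e)

    δ-⇔ : ∀ {y z} → (N ∣ᶻ y → N ∣ᶻ z) → (N ∣ᶻ z → N ∣ᶻ y) → δ y ≡ δ z
    δ-⇔ {y} {z} f g with δ-case y | δ-case z
    ... | inj₁ (a , e) | inj₁ (b , e′) = trans e (sym e′)
    ... | inj₁ (a , e) | inj₂ (b , e′) = ⊥-elim (b (f a))
    ... | inj₂ (a , e) | inj₁ (b , e′) = ⊥-elim (a (g b))
    ... | inj₂ (a , e) | inj₂ (b , e′) = trans e (sym e′)

    δ-per : Per δ
    δ-per x k = δ-⇔ (λ { (divides q e) → divides (q - k) (trans (eq₁ x k N) (trans (cong (_- k * N) e) (eq₂ q k N))) })
                    (λ { (divides q e) → divides (q + k) (trans (cong (_+ k * N) e) (eq₃ q k N)) })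
      where
      eq₁ : ∀ x k n → x ≡ x + k * n - k * n
      eq₁ = solve 3 (λ x k n → x := x :+ k :* n :- k :* n) refl
      eq₂ : ∀ q k n → q * n - k * n ≡ (q - k) * n
      eq₂ = solve 3 (λ q k n → q :* n :- k :* n := (q :- k) :* n) refl
      eq₃ : ∀ q k n → q * n + k * n ≡ (q + k) * n
      eq₃ = solve 3 (λ q k n → q :* n :+ k :* n := (q :+ k) :* n) refl

    δ-neg : ∀ z → δ (- z) ≡ δ z
    δ-neg z = δ-⇔ (λ { (divides q e) → divides (- q) (trans (eq z) (trans (cong -_ e) (eq₂ q N))) })
                  (λ { (divides q e) → divides (- q) (trans (cong -_ e) (eq₂ q N)) })
      where
      eq : ∀ z → z ≡ - - z
      eq = solve 1 (λ z → z := :- :- z) refl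
      eq₂ : ∀ q n → - (q * n) ≡ - q * n
      eq₂ = solve 2 (λ q n → :- (q :* n) := :- q :* n) refl

    small-∤ : ∀ {i} → suc i ℕ.< n → ¬ (N ∣ᶻ + suc i)
    small-∤ {i} l (divides (+ zero) ())
    small-∤ {i} l (divides (+ suc q) e) = ℕₚ.<⇒≱ l (subst (n ℕ.≤_) (sym (ℤₚ.+-injective (trans e (sym (ℤₚ.pos-* (suc q) n))))) (ℕₚ.m≤m+n n (q ℕ.* n)))
    small-∤ {i} l (divides -[1+ q ] e) = absurd (subst (0ℤ ≤_) e pos) 
      where
      absurd : 0ℤ ≤ -[1+ q ] * N → ⊥
      absurd h with *-cancel≥0 {N} { -[1+ q ]} (+≤+ (ℕₚ.≤-trans (s≤s z≤n) (ℕₚ.<⇒≤ l))) (subst (0ℤ ≤_) (ℤₚ.*-comm -[1+ q ] N) h)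
      ... | ()

    δ-first : ∀ (f : ℤ → ℤ) → S (λ y → δ (- y) * f y) ≡ f 0ℤ
    δ-first f = trans (S-def (λ y → δ (- y) * f y)) (go n refl)
      where
      g : ℕ → ℤ
      g i = δ (- + i) * f (+ i)
      g0 : g 0 ≡ f 0ℤ
      g0 = trans (cong (_* f 0ℤ) (δ-yes (divides 0ℤ refl))) (ℤₚ.*-identityˡ (f 0ℤ))
      gs : ∀ i → suc i ℕ.< n → g (suc i) ≡ 0ℤ
      gs i l = trans (cong (_* f (+ suc i)) (trans (δ-neg (+ suc i)) (δ-no (small-∤ l)))) (ℤₚ.*-zeroˡ (f (+ suc i)))
      go : ∀ m → m ≡ n → ∑ m g ≡ f 0ℤ
      go zero e = ⊥-elim (ℕ.≢-nonZero⁻¹ n (sym e))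
      go (suc m) e = trans (∑-first m g)
        (trans (cong₂ _+_ g0 (trans (∑-cong< m {λ i → g (suc i)} {λ _ → 0ℤ} (λ i l → gs i (subst (suc i ℕ.<_) e (s≤s l)))) (∑-zero m)))
          (ℤₚ.+-identityʳ (f 0ℤ)))

    δ-sum : ∀ {f} → Per f → ∀ z → S (λ y → δ (z - y) * f y) ≡ f z
    δ-sum {f} h z = trans (sym (S-shift {λ y → δ (z - y) * f y} (per-* {λ y → δ (z - y)} {f} (per-rev {δ} z δ-per) h) z))
      (trans (S-cong (λ y → cong (λ t → δ t * f (y + z)) (eq z y))) (trans (δ-first (λ y → f (y + z))) (cong f (ℤₚ.+-identityˡ z))))
      where
      eq : ∀ z y → z - (y + z) ≡ - y
      eq = solve 2 (λ z y → z :- (y :+ z) := :- y) refl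

    S-δ : ∀ z → S (λ y → δ (y - z)) ≡ 1ℤ
    S-δ z = trans (S-cong (λ y → trans (sym (δ-neg (y - z))) (trans (cong δ (eq y z)) (sym (ℤₚ.*-identityʳ (δ (z - y)))))))
       (δ-sum {λ _ → 1ℤ} (per-const 1ℤ) z)
      where
      eq : ∀ y z → - (y - z) ≡ z - y
      eq = solve 2 (λ y z → :- (y :- z) := z :- y) refl

    -- x ↦ c x + t permutes the residues. Instead of constructing a bijection, f is expanded as a
    -- convolution with `δ` and the two sums are exchanged; c x + t ≡ y then has the single solution
    -- x ≡ c⁻ (y - t).
    S-mult : ∀ {f} → Per f → ∀ c c⁻ → N ∣ᶻ (c * c⁻ - 1ℤ) → ∀ t → S (λ x → f (c * x + t)) ≡ S f
    S-mult {f} h c c⁻ (divides q e) t = begin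
      S (λ x → f (c * x + t))                                ≡⟨ S-cong (λ x → sym (δ-sum h (c * x + t))) ⟩
      S (λ x → S (λ y → δ (c * x + t - y) * f y))            ≡⟨ S-swap (λ x y → δ (c * x + t - y) * f y) ⟩
      S (λ y → S (λ x → δ (c * x + t - y) * f y))            ≡⟨ S-cong (λ y → S-*ʳ (f y) (λ x → δ (c * x + t - y))) ⟩
      S (λ y → S (λ x → δ (c * x + t - y)) * f y)            ≡⟨ S-cong (λ y → cong (_* f y) (trans (S-cong (λ x → δ-⇔ (to x y) (from x y))) (S-δ (c⁻ * (y - t))))) ⟩
      S (λ y → 1ℤ * f y)                                     ≡⟨ S-cong (λ y → ℤₚ.*-identityˡ (f y)) ⟩
      S f ∎
      where
      open ≡-Reasoning
      eq₁ : ∀ c c⁻ x y t → x - c⁻ * (y - t) ≡ c⁻ * (c * x + t - y) - (c * c⁻ - 1ℤ) * x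
      eq₁ = solve 5 (λ c c⁻ x y t → x :- c⁻ :* (y :- t) := c⁻ :* (c :* x :+ t :- y) :- (c :* c⁻ :- con 1ℤ) :* x) refl
      eq₂ : ∀ c⁻ k q x n → c⁻ * (k * n) - q * n * x ≡ (c⁻ * k - q * x) * n
      eq₂ = solve 5 (λ c⁻ k q x n → c⁻ :* (k :* n) :- q :* n :* x := (c⁻ :* k :- q :* x) :* n) refl
      eq₃ : ∀ c c⁻ x y t → c * x + t - y ≡ c * (x - c⁻ * (y - t)) + (c * c⁻ - 1ℤ) * (y - t)
      eq₃ = solve 5 (λ c c⁻ x y t → c :* x :+ t :- y := c :* (x :- c⁻ :* (y :- t)) :+ (c :* c⁻ :- con 1ℤ) :* (y :- t)) refl
      eq₄ : ∀ c k q w n → c * (k * n) + q * n * w ≡ (c * k + q * w) * n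
      eq₄ = solve 5 (λ c k q w n → c :* (k :* n) :+ q :* n :* w := (c :* k :+ q :* w) :* n) refl
      to : ∀ x y → N ∣ᶻ (c * x + t - y) → N ∣ᶻ (x - c⁻ * (y - t))
      to x y (divides k e′) = divides (c⁻ * k - q * x) (trans (eq₁ c c⁻ x y t) (trans (cong₂ (λ a b → c⁻ * a - b * x) e′ e) (eq₂ c⁻ k q x N)))
      from : ∀ x y → N ∣ᶻ (x - c⁻ * (y - t)) → N ∣ᶻ (c * x + t - y)
      from x y (divides k e′) = divides (c * k + q * (y - t)) (trans (eq₃ c c⁻ x y t) (trans (cong₂ (λ a b → c * a + b * (y - t)) e′ e) (eq₄ c k q (y - t) N)))

    abstract
      rep : ℤ → ℕ
      rep x = x %ℕ n

      quo : ℤ → ℤ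
      quo x = x /ℕ n

      rep< : ∀ x → rep x ℕ.< n
      rep< x = n%ℕd<d x n

      rep-≡ : ∀ x → x ≡ + rep x + quo x * N
      rep-≡ x = a≡a%ℕn+[a/ℕn]*n x n

    per-rep : ∀ {f} → Per f → ∀ x → f x ≡ f (+ rep x)
    per-rep {f} h x = trans (cong f (rep-≡ x)) (h (+ rep x) (quo x))

-- Distance to the nearest multiple of n: the triangle wave

module NearestMultiple where

  open import Data.Integer using (_+_; _-_; _*_; -_; _≤_)
  open ℤₚ using (≤-trans; ≤-refl; ≤-reflexive)
  open IntegerSums

  abstract
    abs : ℤ → ℤ
    abs x = + ∣ x ∣

    abs-≥0 : ∀ {x} → 0ℤ ≤ x → abs x ≡ x
    abs-≥0 {+ n} _ = refl

    abs-neg : ∀ x → abs (- x) ≡ abs x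
    abs-neg x = cong +_ (ℤₚ.∣-i∣≡∣i∣ x)

    abs-tri : ∀ x y → abs (x + y) ≤ abs x + abs y
    abs-tri x y = +≤+ (ℤₚ.∣i+j∣≤∣i∣+∣j∣ x y)

    ≤abs : ∀ x → x ≤ abs x
    ≤abs (+ n) = ≤-refl
    ≤abs -[1+ n ] = _≤_.-≤+

    -≤abs : ∀ x → - x ≤ abs x
    -≤abs x = ≤-trans (≤abs (- x)) (≤-reflexive (abs-neg x))

    abs-cases : ∀ x → (0ℤ ≤ x × abs x ≡ x) ⊎ (0ℤ ≤ - x × abs x ≡ - x)
    abs-cases (+ n) = inj₁ (pos , refl)
    abs-cases -[1+ n ] = inj₂ (pos , refl)

    abs-* : ∀ {c} x → 0ℤ ≤ c → abs (c * x) ≡ c * abs x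
    abs-* {c} x h = trans (cong +_ (ℤₚ.∣i*j∣≡∣i∣*∣j∣ c x)) (trans (ℤₚ.pos-* ∣ c ∣ ∣ x ∣) (cong (_* abs x) (abs-≥0 h)))

  abs-≤ : ∀ {x c} → x ≤ c → - x ≤ c → abs x ≤ c
  abs-≤ {x} h k with abs-cases x
  ... | inj₁ (_ , e) = subst (_≤ _) (sym e) h
  ... | inj₂ (_ , e) = subst (_≤ _) (sym e) k

  module Tri (n : ℕ) .{{nz : NonZero n}} where
    open Mod n

    abstract
      tri : ℤ → ℤ
      tri x = + (rep x ℕ.⊓ (n ℕ.∸ rep x))

      tri≥0 : ∀ x → 0ℤ ≤ tri x
      tri≥0 x = pos

      private
        a≤ : ∀ x → tri x ≤ + rep x
        a≤ x = +≤+ (ℕₚ.m⊓n≤m _ _)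
        ∸-eq : ∀ x → + (n ℕ.∸ rep x) ≡ N - + rep x
        ∸-eq x = trans (sym (ℤₚ.⊖-≥ (ℕₚ.<⇒≤ (rep< x)))) (sym (ℤₚ.m-n≡m⊖n n (rep x)))
        b≤ : ∀ x → tri x ≤ N - + rep x
        b≤ x = ≤-trans (+≤+ (ℕₚ.m⊓n≤n _ _)) (≤-reflexive (∸-eq x))

      tri-half : ∀ x → + 2 * tri x ≤ N
      tri-half x = ≤-by _ (sub≥0 (a≤ x) ⊕ sub≥0 (b≤ x)) (eq N (+ rep x) (tri x))
        where
        eq : ∀ n r t → n - + 2 * t ≡ (r - t) + (n - r - t)
        eq = solve 3 (λ n r t → n :- con (+ 2) :* t := (r :- t) :+ (n :- r :- t)) refl

      tri-≤ : ∀ x k → tri x ≤ abs (x - k * N)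
      tri-≤ x k with ≤-or k (quo x)
      ... | inj₁ h = ≤-trans (≤-trans (a≤ x) (≤-by ((quo x - k) * N) (sub≥0 h ⊗ pos)
                (trans (cong (λ z → z - k * N - + rep x) (rep-≡ x)) (eq (+ rep x) (quo x) k N)))) (≤abs (x - k * N))
        where
        eq : ∀ r q k n → r + q * n - k * n - r ≡ (q - k) * n
        eq = solve 4 (λ r q k n → r :+ q :* n :- k :* n :- r := (q :- k) :* n) refl
      ... | inj₂ h = ≤-trans (≤-trans (b≤ x) (≤-by ((k - (1ℤ + quo x)) * N) (sub≥0 h ⊗ pos)
                (trans (cong (λ z → - (z - k * N) - (N - + rep x)) (rep-≡ x)) (eq (+ rep x) (quo x) k N)))) (-≤abs (x - k * N))
        where
        eq : ∀ r q k n → - (r + q * n - k * n) - (n - r) ≡ (k - (1ℤ + q)) * n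
        eq = solve 4 (λ r q k n → :- (r :+ q :* n :- k :* n) :- (n :- r) := (k :- (con 1ℤ :+ q)) :* n) refl

      -- With `tri-≤` this identifies `tri x` as the minimum of |x - k n| over k. Periodicity,
      -- symmetry and the Lipschitz bound are derived from these two facts alone.
      tri-wit : ∀ x → ∃[ k ] tri x ≡ abs (x - k * N)
      tri-wit x with ℕₚ.≤-total (rep x) (n ℕ.∸ rep x)
      ... | inj₁ h = quo x , trans (cong +_ (ℕₚ.m≤n⇒m⊓n≡m h)) (sym (cong abs {y = + rep x}
             (trans (cong (λ z → z - (quo x) * N) (rep-≡ x)) (eq (+ rep x) (quo x) N))))
        where
        eq : ∀ r q n → r + q * n - q * n ≡ r
        eq = solve 3 (λ r q n → r :+ q :* n :- q :* n := r) refl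
      ... | inj₂ h = 1ℤ + quo x , trans (cong +_ (ℕₚ.m≥n⇒m⊓n≡n h)) (trans (trans (∸-eq x) (sym (abs-≥0 (subst (0ℤ ≤_) (∸-eq x) pos))))
             (trans (sym (abs-neg (N - + rep x))) (cong abs (sym
             (trans (cong (λ z → z - (1ℤ + quo x) * N) (rep-≡ x)) (eq (+ rep x) (quo x) N))))))
        where
        eq : ∀ r q n → r + q * n - (1ℤ + q) * n ≡ - (n - r)
        eq = solve 3 (λ r q n → r :+ q :* n :- (con 1ℤ :+ q) :* n := :- (n :- r)) refl

    tri-lip : ∀ x y → tri (x + y) ≤ tri x + abs y
    tri-lip x y with tri-wit x
    ... | k , e = ≤-trans (tri-≤ (x + y) k) (≤-trans (≤-reflexive (cong abs (eq x y (k * N))))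
         (≤-trans (abs-tri (x - k * N) y) (≤-reflexive (cong (_+ abs y) (sym e)))))
      where
      eq : ∀ x y c → x + y - c ≡ x - c + y
      eq = solve 3 (λ x y c → x :+ y :- c := x :- c :+ y) refl

    private
      per≤ : ∀ x k → tri (x + k * N) ≤ tri x
      per≤ x k with tri-wit x
      ... | j , e = ≤-trans (tri-≤ (x + k * N) (j + k)) (≤-reflexive (trans (cong abs (eq x k j N)) (sym e)))
        where
        eq : ∀ x k j n → x + k * n - (j + k) * n ≡ x - j * n
        eq = solve 4 (λ x k j n → x :+ k :* n :- (j :+ k) :* n := x :- j :* n) refl

      neg≤ : ∀ x → tri (- x) ≤ tri x
      neg≤ x with tri-wit x
      ... | j , e = ≤-trans (tri-≤ (- x) (- j)) (≤-reflexive (trans (trans (cong abs (eq x j N)) (abs-neg (x - j * N))) (sym e)))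
        where
        eq : ∀ x j n → - x - - j * n ≡ - (x - j * n)
        eq = solve 3 (λ x j n → :- x :- :- j :* n := :- (x :- j :* n)) refl

    tri-per : Per tri
    tri-per x k = ℤₚ.≤-antisym (per≤ x k) (≤-trans (≤-reflexive (cong tri (eq x k N))) (per≤ (x + k * N) (- k)))
      where
      eq : ∀ x k n → x ≡ x + k * n + - k * n
      eq = solve 3 (λ x k n → x := x :+ k :* n :+ :- k :* n) refl

    tri-neg : ∀ x → tri (- x) ≡ tri x
    tri-neg x = ℤₚ.≤-antisym (neg≤ x) (≤-trans (≤-reflexive (cong tri (sym (ℤₚ.neg-involutive x)))) (neg≤ (- x)))

    tri-small : ∀ {x} → 0ℤ ≤ x → + 2 * x ≤ N → tri x ≡ x
    tri-small {x} h h2 = ℤₚ.≤-antisym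
        (≤-trans (tri-≤ x 0ℤ) (≤-reflexive (trans (cong abs (eq₀ x N)) (abs-≥0 h))))
        (lower (tri-wit x))
      where
      eq₀ : ∀ x n → x - 0ℤ * n ≡ x
      eq₀ = solve 2 (λ x n → x :- con 0ℤ :* n := x) refl
      eq₁ : ∀ x k n → x - k * n - x ≡ (0ℤ - k) * n
      eq₁ = solve 3 (λ x k n → x :- k :* n :- x := (con 0ℤ :- k) :* n) refl
      eq₂ : ∀ x k n → - (x - k * n) - x ≡ (k - (1ℤ + 0ℤ)) * n + (n - + 2 * x)
      eq₂ = solve 3 (λ x k n → :- (x :- k :* n) :- x := (k :- (con 1ℤ :+ con 0ℤ)) :* n :+ (n :- con (+ 2) :* x)) refl
      lower : ∃[ k ] tri x ≡ abs (x - k * N) → x ≤ tri x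
      lower (k , e) with ≤-or k 0ℤ
      ... | inj₁ l = ≤-trans (≤-by _ (sub≥0 l ⊗ pos) (eq₁ x k N)) (≤-trans (≤abs _) (≤-reflexive (sym e)))
      ... | inj₂ l = ≤-trans (≤-by _ ((sub≥0 l ⊗ pos) ⊕ sub≥0 h2) (eq₂ x k N)) (≤-trans (-≤abs _) (≤-reflexive (sym e)))

    tri-abs : ∀ x → tri x ≤ abs x
    tri-abs x = ≤-trans (tri-≤ x 0ℤ) (≤-reflexive (cong abs (eq₀ x N)))
      where
      eq₀ : ∀ x n → x - 0ℤ * n ≡ x
      eq₀ = solve 2 (λ x n → x :- con 0ℤ :* n := x) refl

  -- Folding the wave of period q p into q parts

  module Fold (p q : ℕ) .{{_ : NonZero p}} .{{_ : NonZero q}} where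

    instance
      qp-nonZero : NonZero (q ℕ.* p)
      qp-nonZero = ℕₚ.m*n≢0 q p

    private
      module P = Mod p
      module Q = Mod q
      module PT = Tri p
      module R = Mod (q ℕ.* p)
      module RT = Tri (q ℕ.* p)

      RN : R.N ≡ Q.N * P.N
      RN = ℤₚ.pos-* q p

    tri-scale : ∀ x → RT.tri (Q.N * x) ≡ Q.N * PT.tri x
    tri-scale x = ℤₚ.≤-antisym
        (let k , e = PT.tri-wit x in ≤-trans (RT.tri-≤ (Q.N * x) k) (≤-reflexive (trans (scaled k) (cong (Q.N *_) (sym e)))))
        (let k , e = RT.tri-wit (Q.N * x) in ≤-trans (≤-by _ (pos {q} ⊗ sub≥0 (PT.tri-≤ x k)) (eq′ Q.N (PT.tri x) (abs (x - k * P.N))))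
           (≤-reflexive (sym (trans e (scaled k)))))
      where
      eq : ∀ q x k p → q * x - k * (q * p) ≡ q * (x - k * p)
      eq = solve 4 (λ q x k p → q :* x :- k :* (q :* p) := q :* (x :- k :* p)) refl
      eq′ : ∀ q a b → q * b - q * a ≡ q * (b - a)
      eq′ = solve 3 (λ q a b → q :* b :- q :* a := q :* (b :- a)) refl
      scaled : ∀ k → abs (Q.N * x - k * R.N) ≡ Q.N * abs (x - k * P.N)
      scaled k = trans (cong abs (trans (cong (λ z → Q.N * x - k * z) RN) (eq Q.N x k P.N))) (abs-* {Q.N} (x - k * P.N) (pos {q}))

    h : ℤ → ℤ → ℤ
    h X i = RT.tri (X + i * P.N)

    h-per : ∀ X → Q.Per (h X)
    h-per X i k = trans (cong RT.tri (trans (eq X i k Q.N P.N) (cong (λ z → X + i * P.N + k * z) (sym RN)))) (RT.tri-per (X + i * P.N) k)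
      where
      eq : ∀ X i k q p → X + (i + k * q) * p ≡ X + i * p + k * (q * p)
      eq = solve 5 (λ X i k q p → X :+ (i :+ k :* q) :* p := X :+ i :* p :+ k :* (q :* p)) refl

    F : ℤ → ℤ
    F X = Q.S (h X)

    F-per : P.Per F
    F-per X k = trans (Q.S-cong (λ i → cong RT.tri (eq X k i P.N))) (Q.S-shift (h-per X) k)
      where
      eq : ∀ X k i p → X + k * p + i * p ≡ X + (i + k) * p
      eq = solve 4 (λ X k i p → X :+ k :* p :+ i :* p := X :+ (i :+ k) :* p) refl

    private
      -- For 0 ≤ X ≤ p the point X + j p lies on the rising slope of the wave of period q p if 2 j +
      -- 2 ≤ q. `hi` is the mirror image on the falling slope, and `mid` treats the part that
      -- contains the crest, which exists for odd q.
      lo : ∀ X j → 0ℤ ≤ X → X ≤ P.N → 0ℤ ≤ j → + 2 * j + + 2 ≤ Q.N → h X j ≡ X + j * P.N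
      lo X j h1 h2 h3 h4 = RT.tri-small (h1 ⊕ (h3 ⊗ pos))
          (≤-by _ ((sub≥0 h4 ⊗ pos {p}) ⊕ (pos {2} ⊗ sub≥0 h2)) (trans (cong (λ z → z - + 2 * (X + j * P.N)) RN) (eq X j P.N Q.N)))
        where
        eq : ∀ X j p q → q * p - + 2 * (X + j * p) ≡ (q - (+ 2 * j + + 2)) * p + + 2 * (p - X)
        eq = solve 4 (λ X j p q → q :* p :- con (+ 2) :* (X :+ j :* p) := (q :- (con (+ 2) :* j :+ con (+ 2))) :* p :+ con (+ 2) :* (p :- X)) refl

      hi : ∀ X j → 0ℤ ≤ X → X ≤ P.N → 0ℤ ≤ j → + 2 * j + + 2 ≤ Q.N → h X (Q.N - 1ℤ - j) ≡ (1ℤ + j) * P.N - X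
      hi X j h1 h2 h3 h4 = begin
          RT.tri (X + (Q.N - 1ℤ - j) * P.N) ≡⟨ cong RT.tri (trans (eq₁ X j P.N Q.N) (cong (λ z → - Y + 1ℤ * z) (sym RN))) ⟩
          RT.tri (- Y + 1ℤ * R.N)           ≡⟨ RT.tri-per (- Y) 1ℤ ⟩
          RT.tri (- Y)                      ≡⟨ RT.tri-neg Y ⟩
          RT.tri Y                          ≡⟨ RT.tri-small (subst (0ℤ ≤_) (eq₃ X j P.N) (sub≥0 h2 ⊕ (h3 ⊗ pos)))
                 (≤-by _ ((sub≥0 h4 ⊗ pos {p}) ⊕ (pos {2} ⊗ h1)) (trans (cong (λ z → z - + 2 * Y) RN) (eq₂ X j P.N Q.N))) ⟩
          Y ∎
        where
        open ≡-Reasoning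
        Y = (1ℤ + j) * P.N - X
        eq₁ : ∀ X j p q → X + (q - 1ℤ - j) * p ≡ - ((1ℤ + j) * p - X) + 1ℤ * (q * p)
        eq₁ = solve 4 (λ X j p q → X :+ (q :- con 1ℤ :- j) :* p := :- ((con 1ℤ :+ j) :* p :- X) :+ con 1ℤ :* (q :* p)) refl
        eq₂ : ∀ X j p q → q * p - + 2 * ((1ℤ + j) * p - X) ≡ (q - (+ 2 * j + + 2)) * p + + 2 * X
        eq₂ = solve 4 (λ X j p q → q :* p :- con (+ 2) :* ((con 1ℤ :+ j) :* p :- X) := (q :- (con (+ 2) :* j :+ con (+ 2))) :* p :+ con (+ 2) :* X) refl
        eq₃ : ∀ X j p → (p - X) + j * p ≡ (1ℤ + j) * p - X
        eq₃ = solve 3 (λ X j p → (p :- X) :+ j :* p := (con 1ℤ :+ j) :* p :- X) refl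

      mid : ∀ X j → 0ℤ ≤ X → X ≤ P.N → Q.N ≡ + 2 * j + 1ℤ → 0ℤ ≤ j → h X j ≡ j * P.N + PT.tri X
      mid X j h1 h2 e h3 with ≤-or (+ 2 * X) P.N
      ... | inj₁ l = trans (RT.tri-small (h1 ⊕ (h3 ⊗ pos)) (≤-by _ (sub≥0 l) (trans (cong (λ z → z - + 2 * (X + j * P.N)) (trans RN (cong (_* P.N) e))) (eq X j P.N))))
                       (trans (ℤₚ.+-comm X (j * P.N)) (cong (_+_ (j * P.N)) (sym (PT.tri-small h1 l))))
        where
        eq : ∀ X j p → (+ 2 * j + 1ℤ) * p - + 2 * (X + j * p) ≡ p - + 2 * X
        eq = solve 3 (λ X j p → (con (+ 2) :* j :+ con 1ℤ) :* p :- con (+ 2) :* (X :+ j :* p) := p :- con (+ 2) :* X) refl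
      ... | inj₂ l = begin
          RT.tri (X + j * P.N)        ≡⟨ cong RT.tri (trans (eq₁ X j P.N) (cong (λ z → - Y + 1ℤ * z) (sym (trans RN (cong (_* P.N) e))))) ⟩
          RT.tri (- Y + 1ℤ * R.N)     ≡⟨ RT.tri-per (- Y) 1ℤ ⟩
          RT.tri (- Y)                ≡⟨ RT.tri-neg Y ⟩
          RT.tri Y                    ≡⟨ RT.tri-small ((h3 ⊗ pos) ⊕ sub≥0 h2)
                (≤-by _ (sub≥0 l ⊕ pos {1}) (trans (cong (λ z → z - + 2 * Y) (trans RN (cong (_* P.N) e))) (eq₂ X j P.N))) ⟩
          j * P.N + (P.N - X)         ≡⟨ cong (_+_ (j * P.N)) (sym (begin
               PT.tri X                      ≡⟨ cong PT.tri (eq₃ X P.N) ⟩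
               PT.tri (- (P.N - X) + 1ℤ * P.N)  ≡⟨ PT.tri-per (- (P.N - X)) 1ℤ ⟩
               PT.tri (- (P.N - X))          ≡⟨ PT.tri-neg (P.N - X) ⟩
               PT.tri (P.N - X)              ≡⟨ PT.tri-small (sub≥0 h2) (≤-by _ (sub≥0 l ⊕ pos {1}) (eq₄ X P.N)) ⟩
               P.N - X ∎)) ⟩
          j * P.N + PT.tri X ∎
        where
        open ≡-Reasoning
        Y = j * P.N + (P.N - X)
        eq₁ : ∀ X j p → X + j * p ≡ - (j * p + (p - X)) + 1ℤ * ((+ 2 * j + 1ℤ) * p)
        eq₁ = solve 3 (λ X j p → X :+ j :* p := :- (j :* p :+ (p :- X)) :+ con 1ℤ :* ((con (+ 2) :* j :+ con 1ℤ) :* p)) refl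
        eq₂ : ∀ X j p → (+ 2 * j + 1ℤ) * p - + 2 * (j * p + (p - X)) ≡ (+ 2 * X - (1ℤ + p)) + 1ℤ
        eq₂ = solve 3 (λ X j p → (con (+ 2) :* j :+ con 1ℤ) :* p :- con (+ 2) :* (j :* p :+ (p :- X)) := (con (+ 2) :* X :- (con 1ℤ :+ p)) :+ con 1ℤ) refl
        eq₃ : ∀ X p → X ≡ - (p - X) + 1ℤ * p
        eq₃ = solve 2 (λ X p → X := :- (p :- X) :+ con 1ℤ :* p) refl
        eq₄ : ∀ X p → p - + 2 * (p - X) ≡ (+ 2 * X - (1ℤ + p)) + 1ℤ
        eq₄ = solve 2 (λ X p → p :- con (+ 2) :* (p :- X) := (con (+ 2) :* X :- (con 1ℤ :+ p)) :+ con 1ℤ) refl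

      -- Pairs part i with its mirror image q - 1 - i, so that rising and falling slopes meet.
      double : ∀ X → + 2 * F X ≡ Q.S (λ i → h X i + h X (Q.N - 1ℤ - i))
      double X = sym (trans (Q.S-+ (h X) (λ i → h X (Q.N - 1ℤ - i))) (trans (cong (_+_ (F X)) (trans
          (Q.S-cong (λ i → cong (h X) (eq i (Q.N - 1ℤ)))) (Q.S-mult (h-per X) (- 1ℤ) (- 1ℤ) (divides 0ℤ refl) (Q.N - 1ℤ)))) (eq₂ (F X))))
        where
        eq : ∀ i c → c - i ≡ - 1ℤ * i + c
        eq = solve 2 (λ i c → c :- i := :- con 1ℤ :* i :+ c) refl
        eq₂ : ∀ a → a + a ≡ + 2 * a
        eq₂ = solve 1 (λ a → a :+ a := con (+ 2) :* a) refl

      trichotomy : ∀ i c → 1ℤ + i ≤ c → (+ 2 * i + + 2 ≤ c) ⊎ (c ≡ + 2 * i + 1ℤ) ⊎ (+ 2 * (c - 1ℤ - i) + + 2 ≤ c)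
      trichotomy i c l with ≤-or (+ 2 * i + + 2) c
      ... | inj₁ h = inj₁ h
      ... | inj₂ h with ≤-or c (+ 2 * i)
      ...   | inj₁ k = inj₂ (inj₂ (≤-by _ (sub≥0 k) (eq i c)))
        where
        eq : ∀ i c → c - (+ 2 * (c - 1ℤ - i) + + 2) ≡ + 2 * i - c
        eq = solve 2 (λ i c → c :- (con (+ 2) :* (c :- con 1ℤ :- i) :+ con (+ 2)) := con (+ 2) :* i :- c) refl
      ...   | inj₂ k = inj₂ (inj₁ (ℤₚ.≤-antisym (≤-by _ (sub≥0 h) (eq i c)) (≤-trans (≤-reflexive (ℤₚ.+-comm (+ 2 * i) 1ℤ)) k)))
        where
        eq : ∀ i c → + 2 * i + 1ℤ - c ≡ + 2 * i + + 2 - (1ℤ + c)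
        eq = solve 2 (λ i c → con (+ 2) :* i :+ con 1ℤ :- c := con (+ 2) :* i :+ con (+ 2) :- (con 1ℤ :+ c)) refl

      -- On opposite slopes X enters once with each sign and cancels. Only the central part of an
      -- odd q keeps a dependence on X, and it is its own mirror image, hence the factor 2.
      pair-diff : ∀ X X′ i → i ℕ.< q → 0ℤ ≤ X → X ≤ P.N → 0ℤ ≤ X′ → X′ ≤ P.N →
         let D = (h X (+ i) + h X (Q.N - 1ℤ - + i)) - (h X′ (+ i) + h X′ (Q.N - 1ℤ - + i)) in
         (Q.N ≢ + 2 * + i + 1ℤ → D ≡ 0ℤ) × (Q.N ≡ + 2 * + i + 1ℤ → D ≡ + 2 * (PT.tri X - PT.tri X′))
      pair-diff X X′ i l a b a′ b′ = off , on
        where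
        eqm : ∀ i → (+ 2 * i + 1ℤ) - 1ℤ - i ≡ i
        eqm = solve 1 (λ i → (con (+ 2) :* i :+ con 1ℤ) :- con 1ℤ :- i := i) refl
        eqr : ∀ i p t t′ → (i * p + t + (i * p + t)) - (i * p + t′ + (i * p + t′)) ≡ + 2 * (t - t′)
        eqr = solve 4 (λ i p t t′ → (i :* p :+ t :+ (i :* p :+ t)) :- (i :* p :+ t′ :+ (i :* p :+ t′)) := con (+ 2) :* (t :- t′)) refl
        on : Q.N ≡ + 2 * + i + 1ℤ → _
        on e = trans (cong (λ z → (h X (+ i) + h X z) - (h X′ (+ i) + h X′ z)) (trans (cong (λ z → z - 1ℤ - + i) e) (eqm (+ i))))
           (trans (cong₂ (λ y z → (y + y) - (z + z)) (mid X (+ i) a b e pos) (mid X′ (+ i) a′ b′ e pos)) (eqr (+ i) P.N (PT.tri X) (PT.tri X′)))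
        eqc : ∀ X X′ j p → (X + j * p + ((1ℤ + j) * p - X)) - (X′ + j * p + ((1ℤ + j) * p - X′)) ≡ 0ℤ
        eqc = solve 4 (λ X X′ j p → (X :+ j :* p :+ ((con 1ℤ :+ j) :* p :- X)) :- (X′ :+ j :* p :+ ((con 1ℤ :+ j) :* p :- X′)) := con 0ℤ) refl
        eqc′ : ∀ X X′ j p → (((1ℤ + j) * p - X) + (X + j * p)) - (((1ℤ + j) * p - X′) + (X′ + j * p)) ≡ 0ℤ
        eqc′ = solve 4 (λ X X′ j p → (((con 1ℤ :+ j) :* p :- X) :+ (X :+ j :* p)) :- (((con 1ℤ :+ j) :* p :- X′) :+ (X′ :+ j :* p)) := con 0ℤ) refl
        eqj : ∀ i q → i ≡ q - 1ℤ - (q - 1ℤ - i)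
        eqj = solve 2 (λ i q → i := q :- con 1ℤ :- (q :- con 1ℤ :- i)) refl
        off : Q.N ≢ + 2 * + i + 1ℤ → _
        off ne with trichotomy (+ i) Q.N (+≤+ l)
        ... | inj₁ k = trans (cong₂ _-_ (cong₂ _+_ (lo X (+ i) a b pos k) (hi X (+ i) a b pos k)) (cong₂ _+_ (lo X′ (+ i) a′ b′ pos k) (hi X′ (+ i) a′ b′ pos k)))
                         (eqc X X′ (+ i) P.N)
        ... | inj₂ (inj₁ e) = ⊥-elim (ne e)
        ... | inj₂ (inj₂ k) = trans (cong₂ _-_ (cong₂ _+_ (tr X a b) (lo X j a b j0 k)) (cong₂ _+_ (tr X′ a′ b′) (lo X′ j a′ b′ j0 k)))
                         (eqc′ X X′ j P.N)
          where
          j = Q.N - 1ℤ - + i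
          j0 : 0ℤ ≤ j
          j0 = subst (0ℤ ≤_) (eq Q.N (+ i)) (sub≥0 (+≤+ l))
            where
            eq : ∀ q i → q - (1ℤ + i) ≡ q - 1ℤ - i
            eq = solve 2 (λ q i → q :- (con 1ℤ :+ i) := q :- con 1ℤ :- i) refl
          tr : ∀ X → 0ℤ ≤ X → X ≤ P.N → h X (+ i) ≡ (1ℤ + j) * P.N - X
          tr X a b = trans (cong (h X) (eqj (+ i) Q.N)) (hi X j a b j0 k)

      -- The parity e of q, written as a sum over the parts of the indicator of the central one, in
      -- the form that `pair-diff` can be summed against.
      odd-indicator : ∃[ e ] (0ℤ ≤ e × e ≤ 1ℤ × ∃[ f ] (∑ q f ≡ e × (∀ i → i ℕ.< q → (Q.N ≢ + 2 * + i + 1ℤ → f i ≡ 0ℤ) × (Q.N ≡ + 2 * + i + 1ℤ → f i ≡ 1ℤ))))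
      odd-indicator with ℕ.⌊_/2⌋ q | parity q
        where
        parity : ∀ n → (n ≡ 2 ℕ.* ℕ.⌊ n /2⌋) ⊎ (n ≡ 2 ℕ.* ℕ.⌊ n /2⌋ ℕ.+ 1)
        parity zero = inj₁ refl
        parity (suc zero) = inj₂ refl
        parity (suc (suc n)) with parity n
        ... | inj₁ e = inj₁ (trans (cong (λ z → suc (suc z)) e) (sym (ℕₚ.*-distribˡ-+ 2 1 ℕ.⌊ n /2⌋)))
        ... | inj₂ e = inj₂ (trans (cong (λ z → suc (suc z)) e) (cong (ℕ._+ 1) (sym (ℕₚ.*-distribˡ-+ 2 1 ℕ.⌊ n /2⌋))))
      ... | c | inj₁ e = 0ℤ , pos , pos , (λ _ → 0ℤ) , ∑-zero q , λ i l → (λ _ → refl) , (λ e′ → ⊥-elim (evenodd c i (trans (sym e) (ℤₚ.+-injective (trans e′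
                 (trans (cong (_+ 1ℤ) (sym (ℤₚ.pos-* 2 i))) refl))))))
        where
        evenodd : ∀ c i → 2 ℕ.* c ≢ 2 ℕ.* i ℕ.+ 1
        evenodd zero i e with trans e (ℕₚ.+-comm (2 ℕ.* i) 1)
        ... | ()
        evenodd (suc c) zero e with trans (sym (ℕₚ.*-distribˡ-+ 2 1 c)) e
        ... | ()
        evenodd (suc c) (suc i) e = evenodd c i (ℕₚ.+-cancelˡ-≡ 2 _ _ (trans (sym (ℕₚ.*-distribˡ-+ 2 1 c)) (trans e (cong (ℕ._+ 1) (ℕₚ.*-distribˡ-+ 2 1 i)))))
      ... | c | inj₂ e = 1ℤ , pos , ≤-refl , (λ i → Q.δ (+ i - + c)) , trans (sym (Q.S-def (λ i → Q.δ (i - + c)))) (Q.S-δ (+ c)) , λ i l → (λ ne → Q.δ-no (λ d → ne (eqn i (close i l d)))) ,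
                (λ e′ → Q.δ-yes (divides 0ℤ (trans (cong (λ z → + z - + c) (half i e′)) (ℤₚ.+-inverseʳ (+ c)))))
        where
        QN : Q.N ≡ + 2 * + c + 1ℤ
        QN = trans (cong +_ e) (cong (_+ 1ℤ) (ℤₚ.pos-* 2 c))
        half : ∀ i → Q.N ≡ + 2 * + i + 1ℤ → i ≡ c
        half i e′ = ℕₚ.*-cancelˡ-≡ i c 2 (ℕₚ.+-cancelʳ-≡ 1 _ _ (trans (sym (ℤₚ.+-injective (trans e′ (cong (_+ 1ℤ) (sym (ℤₚ.pos-* 2 i)))))) e))
        eqn : ∀ i → i ≡ c → Q.N ≡ + 2 * + i + 1ℤ
        eqn i refl = QN
        c< : c ℕ.< q
        c< = subst (c ℕ.<_) (sym e) (ℕₚ.≤-trans (s≤s (ℕₚ.m≤m+n c (c ℕ.+ 0))) (ℕₚ.≤-reflexive (ℕₚ.+-comm 1 (2 ℕ.* c))))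
        close : ∀ i → i ℕ.< q → Q.N ∣ᶻ (+ i - + c) → i ≡ c
        close i l d with ℕₚ.<-cmp i c
        ... | Relation.Binary.tri≈ _ e′ _ = e′
        ... | Relation.Binary.tri< lt _ _ = ⊥-elim (gap i c lt c< (neg d))
          where
          neg : Q.N ∣ᶻ (+ i - + c) → Q.N ∣ᶻ (+ c - + i)
          neg (divides k e″) = divides (- k) (trans (eq (+ i) (+ c)) (trans (cong -_ e″) (eq₂ k Q.N)))
            where
            eq : ∀ i c → c - i ≡ - (i - c)
            eq = solve 2 (λ i c → c :- i := :- (i :- c)) refl
            eq₂ : ∀ k n → - (k * n) ≡ - k * n
            eq₂ = solve 2 (λ k n → :- (k :* n) := :- k :* n) refl
          gap : ∀ i c → i ℕ.< c → c ℕ.< q → ¬ (Q.N ∣ᶻ (+ c - + i))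
          gap i c lt cq d with ℕₚ.m≤n⇒∃[o]m+o≡n lt
          ... | o , refl = Q.small-∤ {o} (ℕₚ.≤-<-trans (ℕₚ.≤-trans (s≤s (ℕₚ.m≤n+m o i)) ℕₚ.≤-refl) cq) (subst (Q.N ∣ᶻ_) (eq (+ i) (+ o)) d)
            where
            eq : ∀ i o → 1ℤ + (i + o) - i ≡ 1ℤ + o
            eq = solve 2 (λ i o → con 1ℤ :+ (i :+ o) :- i := con 1ℤ :+ o) refl
        ... | Relation.Binary.tri> _ _ gt with ℕₚ.m≤n⇒∃[o]m+o≡n gt
        ...   | o , refl = ⊥-elim (Q.small-∤ {o} (ℕₚ.≤-<-trans (s≤s (ℕₚ.m≤n+m o c)) l) (subst (Q.N ∣ᶻ_) (eq (+ c) (+ o)) d))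
            where
            eq : ∀ i o → 1ℤ + (i + o) - i ≡ 1ℤ + o
            eq = solve 2 (λ i o → con 1ℤ :+ (i :+ o) :- i := con 1ℤ :+ o) refl

    -- Summing the triangle wave over the q-th parts of its period leaves its q-th dilate if q is odd, and a constant if q is even.
    fold-diff : ∃[ e ] (0ℤ ≤ e × e ≤ 1ℤ × (∀ X X′ → F X - F X′ ≡ e * (PT.tri X - PT.tri X′)))
    fold-diff with odd-indicator
    ... | e , e0 , e1 , f , fs , fi = e , e0 , e1 , λ X X′ →
          trans (cong₂ _-_ (P.per-rep F-per X) (P.per-rep F-per X′)) (trans (main (P.rep X) (P.rep X′) (P.rep< X) (P.rep< X′))
            (cong₂ (λ y z → e * (y - z)) (sym (P.per-rep PT.tri-per X)) (sym (P.per-rep PT.tri-per X′))))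
      where
      main : ∀ X X′ → X ℕ.< p → X′ ℕ.< p → F (+ X) - F (+ X′) ≡ e * (PT.tri (+ X) - PT.tri (+ X′))
      main X X′ l l′ = ℤₚ.*-cancelˡ-≡ (+ 2) _ _ (begin
          + 2 * (F (+ X) - F (+ X′))                      ≡⟨ eq₁ (F (+ X)) (F (+ X′)) ⟩
          + 2 * F (+ X) - + 2 * F (+ X′)                  ≡⟨ cong₂ _-_ (double (+ X)) (double (+ X′)) ⟩
          Q.S (G (+ X)) - Q.S (G (+ X′))                  ≡⟨ sym (Q.S-- (G (+ X)) (G (+ X′))) ⟩
          Q.S (λ i → G (+ X) i - G (+ X′) i)              ≡⟨ trans (Q.S-def (λ i → G (+ X) i - G (+ X′) i)) (∑-cong< q {λ i → G (+ X) (+ i) - G (+ X′) (+ i)} {λ i → f i * t} each) ⟩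
          ∑ q (λ i → f i * t)                             ≡⟨ ∑-*ʳ q t f ⟩
          ∑ q f * t                                       ≡⟨ cong (_* t) fs ⟩
          e * (+ 2 * (PT.tri (+ X) - PT.tri (+ X′)))      ≡⟨ eq₂ e (PT.tri (+ X) - PT.tri (+ X′)) ⟩
          + 2 * (e * (PT.tri (+ X) - PT.tri (+ X′))) ∎)
        where
        open ≡-Reasoning
        G : ℤ → ℤ → ℤ
        G Y i = h Y i + h Y (Q.N - 1ℤ - i)
        t = + 2 * (PT.tri (+ X) - PT.tri (+ X′))
        eq₁ : ∀ a b → + 2 * (a - b) ≡ + 2 * a - + 2 * b
        eq₁ = solve 2 (λ a b → con (+ 2) :* (a :- b) := con (+ 2) :* a :- con (+ 2) :* b) refl
        eq₂ : ∀ a b → a * (+ 2 * b) ≡ + 2 * (a * b)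
        eq₂ = solve 2 (λ a b → a :* (con (+ 2) :* b) := con (+ 2) :* (a :* b)) refl
        each : ∀ i → i ℕ.< q → G (+ X) (+ i) - G (+ X′) (+ i) ≡ f i * t
        each i li with Q.N ℤₚ.≟ (+ 2 * + i + 1ℤ)
        ... | yes ee = trans (proj₂ (pair-diff (+ X) (+ X′) i li pos (+≤+ (ℕₚ.<⇒≤ l)) pos (+≤+ (ℕₚ.<⇒≤ l′))) ee)
                         (sym (trans (cong (_* t) (proj₂ (fi i li) ee)) (ℤₚ.*-identityˡ t)))
        ... | no ne = trans (proj₁ (pair-diff (+ X) (+ X′) i li pos (+≤+ (ℕₚ.<⇒≤ l)) pos (+≤+ (ℕₚ.<⇒≤ l′))) ne)
                         (sym (trans (cong (_* t) (proj₁ (fi i li) ne)) (ℤₚ.*-zeroˡ t)))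

-- Sets of residues and their growth under translation

module Translates where

  open import Data.Integer using (_+_; _-_; _*_; -_; _≤_)
  open ℤₚ using (≤-trans; ≤-refl; ≤-reflexive)
  open IntegerSums

  ∑ˡ : List ℤ → (ℤ → ℤ) → ℤ
  ∑ˡ [] f = 0ℤ
  ∑ˡ (t ∷ ts) f = f t + ∑ˡ ts f

  ind : ∀ {P : Set} → Dec P → ℤ
  ind (yes _) = 1ℤ
  ind (no _) = 0ℤ

  ind≥0 : ∀ {P : Set} (d : Dec P) → 0ℤ ≤ ind d
  ind≥0 (yes _) = pos
  ind≥0 (no _) = pos

  ind-yes : ∀ {P : Set} (d : Dec P) → P → ind d ≡ 1ℤ
  ind-yes (yes _) _ = refl
  ind-yes (no k) h = ⊥-elim (k h)

  ind-⇔ : ∀ {P Q : Set} (d : Dec P) (e : Dec Q) → (P → Q) → (Q → P) → ind d ≡ ind e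
  ind-⇔ (yes _) (yes _) f g = refl
  ind-⇔ (no _) (no _) f g = refl
  ind-⇔ (yes h) (no k) f g = ⊥-elim (k (f h))
  ind-⇔ (no k) (yes h) f g = ⊥-elim (k (g h))

  search : ∀ n {P Q : ℕ → Set} → (∀ i → P i ⊎ Q i) → (∃[ i ] (i ℕ.< n × P i)) ⊎ (∀ i → i ℕ.< n → Q i)
  search zero d = inj₂ (λ i ())
  search (suc n) {P} {Q} d with search n d | d n
  ... | inj₁ (i , l , h) | _ = inj₁ (i , ℕₚ.m<n⇒m<1+n l , h)
  ... | inj₂ _ | inj₁ h = inj₁ (n , ℕₚ.≤-refl , h)
  ... | inj₂ f | inj₂ h = inj₂ all
    where
    all : ∀ i → i ℕ.< suc n → Q i
    all i (s≤s l) with ℕₚ.m≤n⇒m<n∨m≡n l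
    ... | inj₁ lt = f i lt
    ... | inj₂ refl = h

  -- A discrete intermediate value theorem: going down from J, at the first index whose predecessor
  -- lies below c the overshoot is at most one step.
  crossing : ∀ (g : ℕ → ℤ) ℓ c → g 0 ≡ 0ℤ → 0ℤ ≤ ℓ → (∀ j → g (suc j) ≤ g j + ℓ) → 0ℤ ≤ c → ∀ J → c ≤ g J → ∃[ j ] (c ≤ g j × g j ≤ c + ℓ)
  crossing g ℓ c g0 hℓ st hc zero h = 0 , h , ≤-trans (≤-reflexive g0) (hc ⊕ hℓ)
  crossing g ℓ c g0 hℓ st hc (suc J) h with ≤-or c (g J)
  ... | inj₁ k = crossing g ℓ c g0 hℓ st hc J k
  ... | inj₂ k = suc J , h , ≤-by _ (sub≥0 (st J) ⊕ sub≥0 k ⊕ pos {1}) (eq (g (suc J)) (g J) c ℓ)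
    where
    eq : ∀ a b c ℓ → c + ℓ - a ≡ (b + ℓ - a) + (c - (1ℤ + b)) + 1ℤ
    eq = solve 4 (λ a b c ℓ → c :+ ℓ :- a := (b :+ ℓ :- a) :+ (c :- (con 1ℤ :+ b)) :+ con 1ℤ) refl

  lam≢0 : ∀ {s l j L} → 1ℤ ≤ s → s ≤ + 2 * l → l ≤ j * L → L ≡ 0ℤ → ⊥
  lam≢0 {s} {l} {j} h k m refl = ≤-absurd {1ℤ} {0ℤ} (≤-by _ (sub≥0 h ⊕ sub≥0 k ⊕ pos {2} ⊗ sub≥0 (subst (l ≤_) (ℤₚ.*-zeroʳ j) m)) (eq s l)) ≤-refl
    where
    eq : ∀ s l → 0ℤ - 1ℤ ≡ (s - 1ℤ) + (+ 2 * l - s) + + 2 * (0ℤ - l)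
    eq = solve 2 (λ s l → con 0ℤ :- con 1ℤ := (s :- con 1ℤ) :+ (con (+ 2) :* l :- s) :+ con (+ 2) :* (con 0ℤ :- l)) refl

  module Growth (p : ℕ) .{{nz : NonZero p}} where
    open Mod p

    record Sub : Set where
      field
        χ : ℤ → ℤ
        per : Per χ
        bin : ∀ x → χ x ≡ 0ℤ ⊎ χ x ≡ 1ℤ

      χ≥0 : ∀ x → 0ℤ ≤ χ x
      χ≥0 x with bin x
      ... | inj₁ e = ≤-reflexive (sym e)
      ... | inj₂ e = subst (0ℤ ≤_) (sym e) pos

      1-χ≥0 : ∀ x → 0ℤ ≤ 1ℤ - χ x
      1-χ≥0 x with bin x
      ... | inj₁ e = subst (λ z → 0ℤ ≤ 1ℤ - z) (sym e) pos
      ... | inj₂ e = subst (λ z → 0ℤ ≤ 1ℤ - z) (sym e) pos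

      χ² : ∀ x → χ x * χ x ≡ χ x
      χ² x with bin x
      ... | inj₁ e = trans (cong₂ _*_ e e) (sym e)
      ... | inj₂ e = trans (cong₂ _*_ e e) (sym e)

      size : ℤ
      size = S χ

      size≥0 : 0ℤ ≤ size
      size≥0 = S-≥0 χ≥0

      size≤ : size ≤ N
      size≤ = ≤-trans (S-mono (λ x → ℤₚ.0≤i-j⇒j≤i (1-χ≥0 x))) (≤-reflexive (trans (S-const 1ℤ) (ℤₚ.*-identityʳ N)))

      lam : ℤ → ℤ
      lam a = S (λ x → (1ℤ - χ x) * χ (x - a))

      r : ℤ → ℤ
      r a = S (λ x → χ x * χ (x - a))

      lam≥0 : ∀ a → 0ℤ ≤ lam a
      lam≥0 a = S-≥0 (λ x → 1-χ≥0 x ⊗ χ≥0 (x - a))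

      r≥0 : ∀ a → 0ℤ ≤ r a
      r≥0 a = S-≥0 (λ x → χ≥0 x ⊗ χ≥0 (x - a))

      lam+r : ∀ a → lam a + r a ≡ size
      lam+r a = trans (sym (S-+ (λ x → (1ℤ - χ x) * χ (x - a)) (λ x → χ x * χ (x - a))))
          (trans (S-cong (λ x → eq (χ x) (χ (x - a)))) (S-shift per (- a)))
        where
        eq : ∀ a b → (1ℤ - a) * b + a * b ≡ b
        eq = solve 2 (λ a b → (con 1ℤ :- a) :* b :+ a :* b := b) refl

      lam-per : Per lam
      lam-per a k = S-cong (λ x → cong ((1ℤ - χ x) *_) (trans (cong χ (eq x a k N)) (per (x - a) (- k))))
        where
        eq : ∀ x a k n → x - (a + k * n) ≡ x - a + - k * n
        eq = solve 4 (λ x a k n → x :- (a :+ k :* n) := x :- a :+ :- k :* n) refl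

      r-per : Per r
      r-per a k = S-cong (λ x → cong (χ x *_) (trans (cong χ (eq x a k N)) (per (x - a) (- k))))
        where
        eq : ∀ x a k n → x - (a + k * n) ≡ x - a + - k * n
        eq = solve 4 (λ x a k n → x :- (a :+ k :* n) := x :- a :+ :- k :* n) refl

      r-neg : ∀ a → r (- a) ≡ r a
      r-neg a = trans (S-cong (λ x → eq₁ x)) (S-shift {λ x → χ x * χ (x - a)} (per-* {χ} {λ x → χ (x - a)} per (per-shift {χ} (- a) per)) a)
        where
        eq₂ : ∀ x a → x ≡ x + a - a
        eq₂ = solve 2 (λ x a → x := x :+ a :- a) refl
        eq₃ : ∀ x a → x - - a ≡ x + a
        eq₃ = solve 2 (λ x a → x :- :- a := x :+ a) refl
        eq₁ : ∀ x → χ x * χ (x - - a) ≡ χ (x + a) * χ (x + a - a)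
        eq₁ x = trans (ℤₚ.*-comm (χ x) _) (cong₂ (λ y z → χ y * χ z) (eq₃ x a) (eq₂ x a))

      -- `lam` and the autocorrelation `r` add up to the size, and `r` is symmetric.
      lam-neg : ∀ a → lam (- a) ≡ lam a
      lam-neg a = +-cancel (r a) (trans (ℤₚ.+-comm (r a) (lam (- a))) (trans (cong (_+_ (lam (- a))) (sym (r-neg a)))
        (trans (lam+r (- a)) (trans (sym (lam+r a)) (ℤₚ.+-comm (lam a) (r a))))))

      lam-0 : lam 0ℤ ≡ 0ℤ
      lam-0 = trans (S-cong (λ x → trans (cong (λ z → (1ℤ - χ x) * χ z) (ℤₚ.+-identityʳ x)) (trans (eq (χ x)) (trans (cong (λ z → χ x - z) (χ² x)) (ℤₚ.+-inverseʳ (χ x))))))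
         (trans (S-const 0ℤ) (ℤₚ.*-zeroʳ N))
        where
        eq : ∀ a → (1ℤ - a) * a ≡ a - a * a
        eq = solve 1 (λ a → (con 1ℤ :- a) :* a := a :- a :* a) refl

      -- Let x lie outside A but in A + a + b. Either x lies in A + a and is counted by `lam a`, or
      -- x - a lies outside A but in A + b and is counted by `lam b`.
      lam-+ : ∀ a b → lam (a + b) ≤ lam a + lam b
      lam-+ a b = ≤-trans (S-mono pt) (≤-reflexive (trans (S-+ (λ x → (1ℤ - χ x) * χ (x - a)) (λ x → (1ℤ - χ (x - a)) * χ (x - a - b)))
          (cong (_+_ (lam a)) (S-shift {λ x → (1ℤ - χ x) * χ (x - b)}
             (per-* {λ x → 1ℤ - χ x} {λ x → χ (x - b)} (per-- {λ _ → 1ℤ} {χ} (per-const 1ℤ) per) (per-shift {χ} (- b) per)) (- a)))))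
        where
        eq : ∀ x a b → x - (a + b) ≡ x - a - b
        eq = solve 3 (λ x a b → x :- (a :+ b) := x :- a :- b) refl
        eq₂ : ∀ u v w → (1ℤ - u) * v + (1ℤ - v) * w - (1ℤ - u) * w ≡ (1ℤ - u) * (v * (1ℤ - w)) + u * ((1ℤ - v) * w)
        eq₂ = solve 3 (λ u v w → (con 1ℤ :- u) :* v :+ (con 1ℤ :- v) :* w :- (con 1ℤ :- u) :* w := (con 1ℤ :- u) :* (v :* (con 1ℤ :- w)) :+ u :* ((con 1ℤ :- v) :* w)) refl
        pt : ∀ x → (1ℤ - χ x) * χ (x - (a + b)) ≤ (1ℤ - χ x) * χ (x - a) + (1ℤ - χ (x - a)) * χ (x - a - b)
        pt x = ≤-by _ ((1-χ≥0 x ⊗ (χ≥0 (x - a) ⊗ 1-χ≥0 (x - a - b))) ⊕ (χ≥0 x ⊗ (1-χ≥0 (x - a) ⊗ χ≥0 (x - a - b))))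
          (trans (cong (λ z → (1ℤ - χ x) * χ (x - a) + (1ℤ - χ (x - a)) * χ (x - a - b) - (1ℤ - χ x) * χ z) (eq x a b)) (eq₂ (χ x) (χ (x - a)) (χ (x - a - b))))

      lam-mul : ∀ k a → lam (+ k * a) ≤ + k * lam a
      lam-mul zero a = ≤-reflexive (trans (cong lam (ℤₚ.*-zeroˡ a)) (trans lam-0 (sym (ℤₚ.*-zeroˡ (lam a)))))
      lam-mul (suc k) a = ≤-trans (≤-reflexive (cong lam (eq (+ k) a))) (≤-trans (lam-+ (+ k * a) a)
          (≤-by _ (sub≥0 (lam-mul k a)) (eq₂ (+ k) (lam a) (lam (+ k * a)))))
        where
        eq : ∀ k a → (1ℤ + k) * a ≡ k * a + a
        eq = solve 2 (λ k a → (con 1ℤ :+ k) :* a := k :* a :+ a) refl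
        eq₂ : ∀ k l m → (1ℤ + k) * l - (m + l) ≡ k * l - m
        eq₂ = solve 3 (λ k l m → (con 1ℤ :+ k) :* l :- (m :+ l) := k :* l :- m) refl

      S-r : S r ≡ size * size
      S-r = trans (S-swap (λ a x → χ x * χ (x - a))) (trans (S-cong (λ x → trans (S-*ˡ (χ x) (λ a → χ (x - a))) (cong (χ x *_) (inner x)))) (S-*ʳ size χ))
        where
        eq : ∀ x a → x - a ≡ - 1ℤ * a + x
        eq = solve 2 (λ x a → x :- a := :- con 1ℤ :* a :+ x) refl
        inner : ∀ x → S (λ a → χ (x - a)) ≡ size
        inner x = trans (S-cong (λ a → cong χ (eq x a))) (S-mult per (- 1ℤ) (- 1ℤ) (divides 0ℤ refl) x)

      -- By `S-r` the mean of `r` over all translations is size²/p ≤ size/2, so some x has r x ≤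
      -- size/2.
      half-lam : + 2 * size ≤ N → ∃[ x ] (size ≤ + 2 * lam x)
      half-lam h with search p {λ i → size ≤ + 2 * lam (+ i)} {λ i → 1ℤ + + 2 * lam (+ i) ≤ size} (λ i → ≤-or size (+ 2 * lam (+ i)))
      ... | inj₁ (i , _ , k) = + i , k
      ... | inj₂ f = ⊥-elim (≤-absurd {+ 2 * (size * size)} {N * size} (≤-by _ (sub≥0 h ⊗ size≥0) (eq₀ N size))
            (≤-trans (≤-by _ (sub≥0 (≤-N p refl)) (eq₁ N size)) step))
        where
        eq₀ : ∀ n s → n * s - + 2 * (s * s) ≡ (n - + 2 * s) * s
        eq₀ = solve 2 (λ n s → n :* s :- con (+ 2) :* (s :* s) := (n :- con (+ 2) :* s) :* s) refl
        eq₁ : ∀ n s → n * (1ℤ + s) - (1ℤ + n * s) ≡ n - 1ℤ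
        eq₁ = solve 2 (λ n s → n :* (con 1ℤ :+ s) :- (con 1ℤ :+ n :* s) := n :- con 1ℤ) refl
        ≤-N : ∀ m → m ≡ p → 1ℤ ≤ N
        ≤-N zero e = ⊥-elim (ℕ.≢-nonZero⁻¹ p (sym e))
        ≤-N (suc m) refl = +≤+ (s≤s z≤n)
        eq₂ : ∀ l r → + 2 * r - (1ℤ + (l + r)) ≡ (l + r) - (1ℤ + + 2 * l)
        eq₂ = solve 2 (λ l r → con (+ 2) :* r :- (con 1ℤ :+ (l :+ r)) := (l :+ r) :- (con 1ℤ :+ con (+ 2) :* l)) refl
        step : N * (1ℤ + size) ≤ + 2 * (size * size)
        step = ≤-trans (≤-reflexive (sym (S-const (1ℤ + size)))) (≤-trans (S-mono< (λ i l →
                ≤-by _ (sub≥0 (f i l)) (trans (cong (λ z → + 2 * r (+ i) - (1ℤ + z)) (sym (lam+r (+ i))))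
                   (trans (eq₂ (lam (+ i)) (r (+ i))) (cong (λ z → z - (1ℤ + + 2 * lam (+ i))) (lam+r (+ i)))))))
               (≤-reflexive (trans (S-*ˡ (+ 2) r) (cong (+ 2 *_) S-r))))

      -- The x of `half-lam` is congruent to the multiple j a with j ≡ x a⁻.
      reach : + 2 * size ≤ N → ∀ a a⁻ → N ∣ᶻ (a * a⁻ - 1ℤ) → ∃[ j ] (size ≤ + 2 * lam (+ j * a))
      reach h a a⁻ (divides q e) with half-lam h
      ... | x , k = j , subst (λ z → size ≤ + 2 * z) (per-≡ lam-per {x} {+ j * a} (divides (u * a - x * q) eqn)) k
        where
        j = rep (x * a⁻)
        u = quo (x * a⁻)
        eqa : ∀ x a a⁻ j u n → x - j * a ≡ (x * a⁻ - j) * a - x * (a * a⁻ - 1ℤ)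
        eqa = solve 6 (λ x a a⁻ j u n → x :- j :* a := (x :* a⁻ :- j) :* a :- x :* (a :* a⁻ :- con 1ℤ)) refl
        eqb : ∀ j u n a x q → (j + u * n - j) * a - x * (q * n) ≡ (u * a - x * q) * n
        eqb = solve 6 (λ j u n a x q → (j :+ u :* n :- j) :* a :- x :* (q :* n) := (u :* a :- x :* q) :* n) refl
        eqn : x - + j * a ≡ (u * a - x * q) * N
        eqn = trans (eqa x a a⁻ (+ j) u N) (trans (cong₂ (λ y z → (y - + j) * a - x * z) (rep-≡ (x * a⁻)) e) (eqb (+ j) u N a x q))

      -- If `lam a` were 0, subadditivity would make `lam` vanish on all multiples of a, against
      -- `reach`.
      lam≥1 : + 2 * size ≤ N → 1ℤ ≤ size → ∀ a a⁻ → N ∣ᶻ (a * a⁻ - 1ℤ) → 1ℤ ≤ lam a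
      lam≥1 h h1 a a⁻ d = go (≡0⊎ (lam≥0 a)) (reach h a a⁻ d)
        where
        go : lam a ≡ 0ℤ ⊎ 1ℤ ≤ lam a → ∃[ j ] (size ≤ + 2 * lam (+ j * a)) → 1ℤ ≤ lam a
        go (inj₂ k) _ = k
        go (inj₁ z) (j , k) = ⊥-elim (lam≢0 {size} {lam (+ j * a)} {+ j} {lam a} h1 k (lam-mul j a) z)

      module Layers (ℓ m : ℕ) (I : ℕ) (hI : + 2 * ((+ 3 * + ℓ + 1ℤ) * + I) ≤ size) (half : + 2 * size ≤ N)
                    (T : List ℤ) (small : All (λ t → lam t ≤ + ℓ) T) (mu : ∀ x → ∑ˡ T (λ t → δ (t - x)) ≤ + m)
                    (a a⁻ : ℤ) (inv : N ∣ᶻ (a * a⁻ - 1ℤ)) (la : lam a ≤ + ℓ) where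
        -- A layer `InL i` comprises the 3ℓ + 1 integers from st i - ℓ to st i + 2ℓ, so this is the
        -- smallest spacing that makes the layers disjoint.
        st : ℤ
        st = + 3 * + ℓ + 1ℤ

        g : ℕ → ℤ
        g j = lam (+ j * a)

        y : ∀ i → i ℕ.< I → ∃[ j ] (st * + i ≤ g j × g j ≤ st * + i + + ℓ)
        y i l = go (reach half a a⁻ inv)
          where
          eq : ∀ s I i → + 2 * (s * I) - + 2 * (s * i) ≡ + 2 * (s * (I - i))
          eq = solve 3 (λ s I i → con (+ 2) :* (s :* I) :- con (+ 2) :* (s :* i) := con (+ 2) :* (s :* (I :- i))) refl
          eq₂ : ∀ j a → (1ℤ + j) * a ≡ j * a + a
          eq₂ = solve 2 (λ j a → (con 1ℤ :+ j) :* a := j :* a :+ a) refl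
          stp : ∀ j → g (suc j) ≤ g j + + ℓ
          stp j = ≤-trans (≤-reflexive (cong lam (eq₂ (+ j) a))) (≤-trans (lam-+ (+ j * a) a) (ℤₚ.+-monoʳ-≤ (lam (+ j * a)) la))
          go : ∃[ J ] (size ≤ + 2 * lam (+ J * a)) → ∃[ j ] (st * + i ≤ g j × g j ≤ st * + i + + ℓ)
          go (J , k) = crossing g (+ ℓ) (st * + i) (trans (cong lam (ℤₚ.*-zeroˡ a)) lam-0) pos stp ((pos {3} ⊗ pos {ℓ} ⊕ pos {1}) ⊗ pos {i}) J
              (*-cancel-≤ {+ 2} (+≤+ (s≤s z≤n)) (≤-trans (≤-by _ (pos {2} ⊗ ((pos {3} ⊗ pos {ℓ} ⊕ pos {1}) ⊗ sub≥0 (+≤+ (ℕₚ.<⇒≤ l)))) (eq st (+ I) (+ i))) (≤-trans hI k)))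

        -- The point found by `y i` has `lam` between st i and st i + ℓ, and adding a term of T
        -- changes `lam` by at most ℓ either way. The layer is just wide enough for all these
        -- translates.
        InL : ℕ → ℤ → Set
        InL i x = st * + i - + ℓ ≤ lam x × lam x ≤ st * + i + + 2 * + ℓ

        inL? : ∀ i x → Dec (InL i x)
        inL? i x = (st * + i - + ℓ ℤₚ.≤? lam x) ×-dec (lam x ℤₚ.≤? st * + i + + 2 * + ℓ)

        w : ℕ → ℤ → ℤ
        w i x = ind (inL? i x)

        w-yes : ∀ {i x} → InL i x → w i x ≡ 1ℤ
        w-yes {i} {x} h = ind-yes (inL? i x) h

        w≥0 : ∀ i x → 0ℤ ≤ w i x
        w≥0 i x = ind≥0 (inL? i x)

        w-per : ∀ i → Per (w i)
        w-per i x k = ind-⇔ (inL? i (x + k * N)) (inL? i x)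
           (λ h → subst (st * + i - + ℓ ≤_) (lam-per x k) (proj₁ h) , subst (_≤ st * + i + + 2 * + ℓ) (lam-per x k) (proj₂ h))
           (λ h → subst (st * + i - + ℓ ≤_) (sym (lam-per x k)) (proj₁ h) , subst (_≤ st * + i + + 2 * + ℓ) (sym (lam-per x k)) (proj₂ h))

        -- Strengthened for the induction: a point covered by one of the first J layers also lies
        -- strictly below layer J.
        Dis : ℕ → ℤ → Set
        Dis J x = (∑ J (λ i → w i x) ≡ 0ℤ) ⊎ (∑ J (λ i → w i x) ≡ 1ℤ × 1ℤ + lam x ≤ st * + J - + ℓ)

        disjoint : ∀ J x → Dis J x
        disjoint zero x = inj₁ refl
        disjoint (suc J) x = go (∑ J (λ i → w i x)) (inL? J x) (disjoint J x)
          where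
          eq₁ : ∀ l J → (+ 3 * l + 1ℤ) * (1ℤ + J) - l - ((+ 3 * l + 1ℤ) * J - l) ≡ + 3 * l + 1ℤ
          eq₁ = solve 2 (λ l J → (con (+ 3) :* l :+ con 1ℤ) :* (con 1ℤ :+ J) :- l :- ((con (+ 3) :* l :+ con 1ℤ) :* J :- l) := con (+ 3) :* l :+ con 1ℤ) refl
          eq₂ : ∀ l J z → (+ 3 * l + 1ℤ) * (1ℤ + J) - l - (1ℤ + z) ≡ (+ 3 * l + 1ℤ) * J + + 2 * l - z
          eq₂ = solve 3 (λ l J z → (con (+ 3) :* l :+ con 1ℤ) :* (con 1ℤ :+ J) :- l :- (con 1ℤ :+ z) := (con (+ 3) :* l :+ con 1ℤ) :* J :+ con (+ 2) :* l :- z) refl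
          go : ∀ P (d : Dec (InL J x)) → (P ≡ 0ℤ) ⊎ (P ≡ 1ℤ × 1ℤ + lam x ≤ st * + J - + ℓ) →
               (P + ind d ≡ 0ℤ) ⊎ (P + ind d ≡ 1ℤ × 1ℤ + lam x ≤ st * + suc J - + ℓ)
          go P (no _) (inj₁ e) = inj₁ (trans (ℤₚ.+-identityʳ P) e)
          go P (no _) (inj₂ (e , b)) = inj₂ (trans (ℤₚ.+-identityʳ P) e , ≤-trans b (≤-by _ (pos {3} ⊗ pos {ℓ} ⊕ pos {1}) (eq₁ (+ ℓ) (+ J))))
          go P (yes (u , v)) (inj₁ e) = inj₂ (cong (_+ 1ℤ) e , ≤-by _ (sub≥0 v) (eq₂ (+ ℓ) (+ J) (lam x)))
          go P (yes (u , v)) (inj₂ (e , b)) = ⊥-elim (≤-absurd u b)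

        ∑w≤1 : ∀ x → ∑ I (λ i → w i x) ≤ 1ℤ
        ∑w≤1 x = go (disjoint I x)
          where
          go : Dis I x → ∑ I (λ i → w i x) ≤ 1ℤ
          go (inj₁ e) = ≤-trans (≤-reflexive e) pos
          go (inj₂ (e , _)) = ≤-reflexive e

        rw : ℕ → ℤ → ℤ
        rw i x = r x * w i x

        rw-per : ∀ i → Per (rw i)
        rw-per i = per-* {r} {w i} r-per (w-per i)

        -- The translate Y + T lies in layer i, where `lam` is at most size/2 and hence `r` at least
        -- size/2; each residue is hit by at most m of its terms.
        each : ∀ i → i ℕ.< I → + length T * size ≤ + 2 * (+ m * S (rw i))
        each i l = go (y i l)
         where
         go : ∃[ j ] (st * + i ≤ g j × g j ≤ st * + i + + ℓ) → + length T * size ≤ + 2 * (+ m * S (rw i))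
         go (j , lo , hi) = ≤-trans (low T small) (≤-trans (≤-reflexive (high T))
              (≤-by _ (pos {2} ⊗ sub≥0 up) (eq₄ (+ m * S (rw i)) (S (λ x → rw i x * ∑ˡ T (λ t → δ (t - (x - Y))))))))
          where
          Y = + j * a
          eq₄ : ∀ a b → + 2 * a - + 2 * b ≡ + 2 * (a - b)
          eq₄ = solve 2 (λ a b → con (+ 2) :* a :- con (+ 2) :* b := con (+ 2) :* (a :- b)) refl
          up : S (λ x → rw i x * ∑ˡ T (λ t → δ (t - (x - Y)))) ≤ + m * S (rw i)
          up = ≤-trans (S-mono (λ x → ≤-by _ ((r≥0 x ⊗ w≥0 i x) ⊗ sub≥0 (mu (x - Y))) (eq (rw i x) (+ m) (∑ˡ T (λ t → δ (t - (x - Y)))))))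
              (≤-reflexive (S-*ˡ (+ m) (rw i)))
            where
            eq : ∀ u m s → m * u - u * s ≡ u * (m - s)
            eq = solve 3 (λ u m s → m :* u :- u :* s := u :* (m :- s)) refl
          low : ∀ T → All (λ t → lam t ≤ + ℓ) T → + length T * size ≤ + 2 * ∑ˡ T (λ t → rw i (Y + t))
          low [] [] = ≤-reflexive (ℤₚ.*-zeroˡ size)
          low (t ∷ T) (h ∷ hs) = ≤-by _ (sub≥0 (low T hs) ⊕ sub≥0 one) (eq (+ length T) size (rw i (Y + t)) (∑ˡ T (λ t → rw i (Y + t))))
            where
            eq : ∀ n s a b → + 2 * (a + b) - (1ℤ + n) * s ≡ (+ 2 * b - n * s) + (+ 2 * a - s)
            eq = solve 4 (λ n s a b → con (+ 2) :* (a :+ b) :- (con 1ℤ :+ n) :* s := (con (+ 2) :* b :- n :* s) :+ (con (+ 2) :* a :- s)) refl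
            upper : lam (Y + t) ≤ st * + i + + 2 * + ℓ
            upper = ≤-trans (lam-+ Y t) (≤-by _ (sub≥0 hi ⊕ sub≥0 h) (eq₁ (st * + i) (+ ℓ) (lam Y) (lam t)))
              where
              eq₁ : ∀ s l u v → s + + 2 * l - (u + v) ≡ (s + l - u) + (l - v)
              eq₁ = solve 4 (λ s l u v → s :+ con (+ 2) :* l :- (u :+ v) := (s :+ l :- u) :+ (l :- v)) refl
            lower : st * + i - + ℓ ≤ lam (Y + t)
            lower = ≤-by _ (sub≥0 lo ⊕ sub≥0 (lam-+ (Y + t) (- t)) ⊕ sub≥0 h)
                (trans (eq₁ (st * + i) (+ ℓ) (lam Y) (lam t) (lam (Y + t))) (cong₂ (λ u v → (lam Y - st * + i) + (lam (Y + t) + u - v) + (+ ℓ - lam t))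
                  (sym (lam-neg t)) (cong lam (eq₂ Y t))))
              where
              eq₁ : ∀ s l u v w → w - (s - l) ≡ (u - s) + (w + v - u) + (l - v)
              eq₁ = solve 5 (λ s l u v w → w :- (s :- l) := (u :- s) :+ (w :+ v :- u) :+ (l :- v)) refl
              eq₂ : ∀ y t → y ≡ y + t + - t
              eq₂ = solve 2 (λ y t → y := y :+ t :+ :- t) refl
            one : size ≤ + 2 * rw i (Y + t)
            one = ≤-trans (≤-by _ (sub≥0 hI ⊕ (pos {2} ⊗ ((pos {3} ⊗ pos {ℓ} ⊕ pos {1}) ⊗ sub≥0 (+≤+ l))) ⊕ (pos {2} ⊗ sub≥0 upper) ⊕ (pos {2} ⊗ pos {ℓ} ⊕ pos {2}))
                   (trans (cong (λ z → + 2 * r (Y + t) - z) (sym (lam+r (Y + t))))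
                    (trans (eq₃ (lam (Y + t)) (r (Y + t)) (+ ℓ) (+ I) (+ i)) (cong (λ z → (z - + 2 * (st * + I)) + + 2 * (st * (+ I - (1ℤ + + i))) + + 2 * (st * + i + + 2 * + ℓ - lam (Y + t)) + (+ 2 * + ℓ + + 2)) (lam+r (Y + t))))))
                 (≤-reflexive (cong (+ 2 *_) (sym (trans (cong (r (Y + t) *_) (w-yes (lower , upper))) (ℤₚ.*-identityʳ (r (Y + t)))))))
              where
              eq₃ : ∀ L R l I i → + 2 * R - (L + R) ≡ ((L + R) - + 2 * ((+ 3 * l + 1ℤ) * I)) + + 2 * ((+ 3 * l + 1ℤ) * (I - (1ℤ + i))) + + 2 * ((+ 3 * l + 1ℤ) * i + + 2 * l - L) + (+ 2 * l + + 2)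
              eq₃ = solve 5 (λ L R l I i → con (+ 2) :* R :- (L :+ R) := ((L :+ R) :- con (+ 2) :* ((con (+ 3) :* l :+ con 1ℤ) :* I)) :+ con (+ 2) :* ((con (+ 3) :* l :+ con 1ℤ) :* (I :- (con 1ℤ :+ i))) :+ con (+ 2) :* ((con (+ 3) :* l :+ con 1ℤ) :* i :+ con (+ 2) :* l :- L) :+ (con (+ 2) :* l :+ con (+ 2))) refl
          high : ∀ T → + 2 * ∑ˡ T (λ t → rw i (Y + t)) ≡ + 2 * S (λ x → rw i x * ∑ˡ T (λ t → δ (t - (x - Y))))
          high T = cong (+ 2 *_) (spread T)
            where
            eq : ∀ Y t x → Y + t - x ≡ t - (x - Y)
            eq = solve 3 (λ Y t x → Y :+ t :- x := t :- (x :- Y)) refl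
            spread : ∀ T → ∑ˡ T (λ t → rw i (Y + t)) ≡ S (λ x → rw i x * ∑ˡ T (λ t → δ (t - (x - Y))))
            spread [] = sym (trans (S-cong (λ x → ℤₚ.*-zeroʳ (rw i x))) (trans (S-const 0ℤ) (ℤₚ.*-zeroʳ N)))
            spread (t ∷ T) = trans (cong₂ _+_ (sym (δ-sum {rw i} (rw-per i) (Y + t))) (spread T))
              (trans (sym (S-+ (λ x → δ (Y + t - x) * rw i x) (λ x → rw i x * ∑ˡ T (λ t → δ (t - (x - Y))))))
                (S-cong (λ x → trans (cong (_+ (rw i x * ∑ˡ T (λ t → δ (t - (x - Y))))) (trans (ℤₚ.*-comm (δ (Y + t - x)) (rw i x)) (cong (λ z → rw i x * δ z) (eq Y t x))))
                  (sym (ℤₚ.*-distribˡ-+ (rw i x) (δ (t - (x - Y))) (∑ˡ T (λ t → δ (t - (x - Y)))))))))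

        count : + I * (+ length T * size) ≤ + 2 * (+ m * (size * size))
        count = ≤-trans (≤-reflexive (sym (∑-const I (+ length T * size)))) (≤-trans (∑-mono< I (λ i l → each i l))
            (≤-trans (≤-reflexive (trans (∑-*ˡ I (+ 2) (λ i → + m * S (rw i))) (cong (+ 2 *_) (trans (∑-*ˡ I (+ m) (λ i → S (rw i))) (cong (+ m *_) tot)))))
             (≤-by _ (pos {2} ⊗ (pos {m} ⊗ sub≥0 bound)) (eq (+ m) (size * size) (S (λ x → r x * ∑ I (λ i → w i x)))))))
          where
          eq : ∀ m a b → + 2 * (m * a) - + 2 * (m * b) ≡ + 2 * (m * (a - b))
          eq = solve 3 (λ m a b → con (+ 2) :* (m :* a) :- con (+ 2) :* (m :* b) := con (+ 2) :* (m :* (a :- b))) refl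
          tot : ∑ I (λ i → S (rw i)) ≡ S (λ x → r x * ∑ I (λ i → w i x))
          tot = trans (∑-S-swap I rw) (S-cong (λ x → ∑-*ˡ I (r x) (λ i → w i x)))
          bound : S (λ x → r x * ∑ I (λ i → w i x)) ≤ size * size
          bound = ≤-trans (S-mono (λ x → ≤-by _ (r≥0 x ⊗ sub≥0 (∑w≤1 x)) (eq₂ (r x) (∑ I (λ i → w i x))))) (≤-reflexive S-r)
            where
            eq₂ : ∀ r w → r - r * w ≡ r * (1ℤ - w)
            eq₂ = solve 2 (λ r w → r :- r :* w := r :* (con 1ℤ :- w)) refl

      -- Along the multiples of one t in T the function lam grows by at most ℓ per step, so it takes a value in every interval
      -- [3ℓi , 3ℓi + ℓ); the corresponding translates of T lie in disjoint layers, while r has total mass size².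
      few-small : ∀ ℓ m → + 2 * (+ 3 * + ℓ + 1ℤ) ≤ size → + 2 * size ≤ N → ∀ T → All (λ t → lam t ≤ + ℓ) T →
                  (∀ x → ∑ˡ T (λ t → δ (t - x)) ≤ + m) → All (λ t → ∃[ t⁻ ] (N ∣ᶻ (t * t⁻ - 1ℤ))) T → + length T ≤ + 8 * (+ m * (+ 3 * + ℓ + 1ℤ))
      few-small ℓ m h half [] _ _ _ = pos {8} ⊗ (pos {m} ⊗ (pos {3} ⊗ pos {ℓ} ⊕ pos {1}))
      few-small ℓ m h half T@(t ∷ _) small@(lt ∷ _) mu ((t⁻ , inv) ∷ _) = go (≥0⇒pos size≥0)
       where
       go : ∃[ n ] size ≡ + n → + length T ≤ + 8 * (+ m * (+ 3 * + ℓ + 1ℤ))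
       go (s , se) = *-cancel-≤ {+ I} (+≤+ I≥1) (*-cancel-≤ {size} size≥1 (≤-by _ (sub≥0 (L.count) ⊕ (pos {2} ⊗ (pos {m} ⊗ (size≥0 ⊗ sub≥0 s≤4)))) (eq size (+ I) (+ length T) (+ m) st)))
        where
        st = + 3 * + ℓ + 1ℤ
        stN = suc (3 ℕ.* ℓ)
        stE : + stN ≡ st
        stE = trans (ℤₚ.+-comm 1ℤ (+ (3 ℕ.* ℓ))) (cong (_+ 1ℤ) (ℤₚ.pos-* 3 ℓ))
        -- As many layers as fit below size/2. Since the quotient is not 0, rounding costs at most a
        -- factor 2, so size ≤ 4 st I.
        I = s ℕ./ (2 ℕ.* stN)
        open import Data.Nat.DivMod using (m/n*n≤m; m≡m%n+[m/n]*n; m%n<n; m≥n⇒m/n>0)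
        2st≤s : 2 ℕ.* stN ℕ.≤ s
        2st≤s = +≤+⁻ (subst₂ _≤_ (sym (trans (ℤₚ.pos-* 2 stN) (cong (+ 2 *_) stE))) se h)
        I≥1 : 1 ℕ.≤ I
        I≥1 = m≥n⇒m/n>0 2st≤s
        size≥1 : 1ℤ ≤ size
        size≥1 = subst (1ℤ ≤_) (sym se) (+≤+ (ℕₚ.≤-trans (s≤s z≤n) 2st≤s))
        posE : ∀ k → + (k ℕ.* (2 ℕ.* stN)) ≡ + 2 * (st * + k)
        posE k = trans (ℤₚ.pos-* k (2 ℕ.* stN)) (trans (cong (+ k *_) (trans (ℤₚ.pos-* 2 stN) (cong (+ 2 *_) stE))) (eqp (+ k) st))
          where
          eqp : ∀ k s → k * (+ 2 * s) ≡ + 2 * (s * k)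
          eqp = solve 2 (λ k s → k :* (con (+ 2) :* s) := con (+ 2) :* (s :* k)) refl
        hI : + 2 * (st * + I) ≤ size
        hI = subst₂ _≤_ (posE I) (sym se) (+≤+ (m/n*n≤m s (2 ℕ.* stN)))
        s≤4 : size ≤ + 4 * (st * + I)
        s≤4 = ≤-trans (≤-trans (≤-reflexive se) (+≤+ (ℕₚ.≤-trans (ℕₚ.≤-reflexive (m≡m%n+[m/n]*n s (2 ℕ.* stN)))
                (ℕₚ.+-monoˡ-≤ (I ℕ.* (2 ℕ.* stN)) (ℕₚ.≤-trans (ℕₚ.<⇒≤ (m%n<n s (2 ℕ.* stN))) (ℕₚ.m≤n*m (2 ℕ.* stN) I {{ℕ.>-nonZero I≥1}}))))))
             (≤-reflexive (trans (ℤₚ.pos-+ (I ℕ.* (2 ℕ.* stN)) (I ℕ.* (2 ℕ.* stN))) (trans (cong₂ _+_ (posE I) (posE I)) (eq₁ (st * + I)))))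
          where
          eq₁ : ∀ a → + 2 * a + + 2 * a ≡ + 4 * a
          eq₁ = solve 1 (λ a → con (+ 2) :* a :+ con (+ 2) :* a := con (+ 4) :* a) refl
        module L = Layers ℓ m I hI half T small mu t t⁻ inv lt
        eq : ∀ s I T m st → s * (I * (+ 8 * (m * st))) - s * (I * T) ≡ (+ 2 * (m * (s * s)) - I * (T * s)) + + 2 * (m * (s * (+ 4 * (st * I) - s)))
        eq = solve 5 (λ s I T m st → s :* (I :* (con (+ 8) :* (m :* st))) :- s :* (I :* T) := (con (+ 2) :* (m :* (s :* s)) :- I :* (T :* s)) :+ con (+ 2) :* (m :* (s :* (con (+ 4) :* (st :* I) :- s)))) refl

-- Oscillation forced when x + y + z + w₀ has no zero on A × V × W

module FourfoldOscillation where

  open import Data.Integer using (_+_; _-_; _*_; -_; _≤_)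
  open ℤₚ using (≤-trans; ≤-refl; ≤-reflexive)
  open IntegerSums
  open NearestMultiple
  open Translates

  -- The sum of min(i, j) over 1 ≤ i, j ≤ n, which equals 1² + ... + n². It bounds Ψ 0 from below.
  minSum : ℕ → ℤ
  minSum n = ∑ n (λ i → ∑ n (λ j → + suc (i ℕ.⊓ j)))

  ∑-suc : ∀ n → + 2 * ∑ n (λ i → + suc i) ≡ + n * (+ n + 1ℤ)
  ∑-suc zero = refl
  ∑-suc (suc n) = trans (eq₁ (∑ n (λ i → + suc i)) (+ n)) (trans (cong (_+ + 2 * (1ℤ + + n)) (∑-suc n)) (eq₂ (+ n)))
    where
    eq₁ : ∀ a n → + 2 * (a + (1ℤ + n)) ≡ + 2 * a + + 2 * (1ℤ + n)
    eq₁ = solve 2 (λ a n → con (+ 2) :* (a :+ (con 1ℤ :+ n)) := con (+ 2) :* a :+ con (+ 2) :* (con 1ℤ :+ n)) refl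
    eq₂ : ∀ n → n * (n + 1ℤ) + + 2 * (1ℤ + n) ≡ (1ℤ + n) * ((1ℤ + n) + 1ℤ)
    eq₂ = solve 1 (λ n → n :* (n :+ con 1ℤ) :+ con (+ 2) :* (con 1ℤ :+ n) := (con 1ℤ :+ n) :* ((con 1ℤ :+ n) :+ con 1ℤ)) refl

  minSum-suc : ∀ n → minSum (suc n) ≡ minSum n + (+ n + 1ℤ) * (+ n + 1ℤ)
  minSum-suc n = begin
      ∑ n (λ i → ∑ n (m i) + m i n) + (∑ n (m n) + m n n)
        ≡⟨ cong₂ _+_ (∑-+ n (λ i → ∑ n (m i)) (λ i → m i n)) (cong₂ _+_ (∑-cong< n {m n} {λ j → + suc j} (λ j l → cong (λ z → + suc z) (ℕₚ.m≥n⇒m⊓n≡n (ℕₚ.<⇒≤ l)))) (cong (λ z → + suc z) (ℕₚ.⊓-idem n))) ⟩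
      minSum n + ∑ n (λ i → m i n) + (∑ n (λ j → + suc j) + + suc n)
        ≡⟨ cong (λ z → minSum n + z + (∑ n (λ j → + suc j) + + suc n)) (∑-cong< n {λ i → m i n} {λ j → + suc j} (λ i l → cong (λ z → + suc z) (ℕₚ.m≤n⇒m⊓n≡m (ℕₚ.<⇒≤ l)))) ⟩
      minSum n + ∑ n (λ j → + suc j) + (∑ n (λ j → + suc j) + + suc n)
        ≡⟨ eq (minSum n) (∑ n (λ j → + suc j)) (+ n) ⟩
      minSum n + (+ 2 * ∑ n (λ j → + suc j) + (1ℤ + + n))
        ≡⟨ cong (λ z → minSum n + (z + (1ℤ + + n))) (∑-suc n) ⟩
      minSum n + (+ n * (+ n + 1ℤ) + (1ℤ + + n))
        ≡⟨ eq₂ (minSum n) (+ n) ⟩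
      minSum n + (+ n + 1ℤ) * (+ n + 1ℤ) ∎
    where
    open ≡-Reasoning
    m : ℕ → ℕ → ℤ
    m i j = + suc (i ℕ.⊓ j)
    eq : ∀ a b n → a + b + (b + (1ℤ + n)) ≡ a + (+ 2 * b + (1ℤ + n))
    eq = solve 3 (λ a b n → a :+ b :+ (b :+ (con 1ℤ :+ n)) := a :+ (con (+ 2) :* b :+ (con 1ℤ :+ n))) refl
    eq₂ : ∀ a n → a + (n * (n + 1ℤ) + (1ℤ + n)) ≡ a + (n + 1ℤ) * (n + 1ℤ)
    eq₂ = solve 2 (λ a n → a :+ (n :* (n :+ con 1ℤ) :+ (con 1ℤ :+ n)) := a :+ (n :+ con 1ℤ) :* (n :+ con 1ℤ)) refl

  minSum-≥ : ∀ n → + n * (+ n * + n) ≤ + 3 * minSum n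
  minSum-≥ zero = ≤-refl
  minSum-≥ (suc n) = ≤-by _ (sub≥0 (minSum-≥ n) ⊕ (pos {3} ⊗ pos {n} ⊕ pos {2}))
      (trans (cong (λ z → + 3 * z - + suc n * (+ suc n * + suc n)) (minSum-suc n)) (eq (minSum n) (+ n)))
    where
    eq : ∀ a n → + 3 * (a + (n + 1ℤ) * (n + 1ℤ)) - (1ℤ + n) * ((1ℤ + n) * (1ℤ + n)) ≡ (+ 3 * a - n * (n * n)) + (+ 3 * n + + 2)
    eq = solve 2 (λ a n → con (+ 3) :* (a :+ (n :+ con 1ℤ) :* (n :+ con 1ℤ)) :- (con 1ℤ :+ n) :* ((con 1ℤ :+ n) :* (con 1ℤ :+ n)) := (con (+ 3) :* a :- n :* (n :* n)) :+ (con (+ 3) :* n :+ con (+ 2))) refl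

  -- The squares (f + h)² and (f - h)² are added with the nonnegative weights Ω + n and Ω - n.
  cross-bound : ∀ {Ω n} f h → - n ≤ Ω → n ≤ Ω → 0ℤ ≤ + 2 * (n * f * h) + Ω * (f * f + h * h)
  cross-bound {Ω} {n} f h h1 h2 = *-cancel≥0 {+ 2} (+≤+ (s≤s z≤n)) (subst (0ℤ ≤_) (eq Ω n f h) ((sub≥0 h1 ⊗ sq≥0 (f + h)) ⊕ (sub≥0 h2 ⊗ sq≥0 (f - h))))
    where
    eq : ∀ Om n f g → (Om - - n) * ((f + g) * (f + g)) + (Om - n) * ((f - g) * (f - g)) ≡ + 2 * (+ 2 * (n * f * g) + Om * (f * f + g * g))
    eq = solve 4 (λ Om n f g → (Om :- :- n) :* ((f :+ g) :* (f :+ g)) :+ (Om :- n) :* ((f :- g) :* (f :- g)) := con (+ 2) :* (con (+ 2) :* (n :* f :* g) :+ Om :* (f :* f :+ g :* g))) refl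

  module Oscillation (p : ℕ) .{{nz : NonZero p}} (inv : ∀ x → ¬ (+ p ∣ᶻ x) → ∃[ x⁻ ] (+ p ∣ᶻ (x * x⁻ - 1ℤ)))
                     (g : ℕ) (4g≤p : + 4 * + g ≤ + p) where
    open Mod p
    open Tri p
    open Growth p

    -- An antisymmetric difference over the window ±1, ..., ±g. As it kills constants, `Ψ` and `X`
    -- have sum 0 over the residues, and so has a smeared set; this plays the part of discarding the
    -- trivial character.
    D : (ℤ → ℤ) → ℤ
    D F = ∑ g (λ i → F (+ suc i) - F (- + suc i))

    D-cong : ∀ {F G} → (∀ u → F u ≡ G u) → D F ≡ D G
    D-cong h = ∑-cong g (λ i → cong₂ _-_ (h (+ suc i)) (h (- + suc i)))

    D-const : ∀ c → D (λ _ → c) ≡ 0ℤ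
    D-const c = trans (∑-cong g {λ _ → c - c} {λ _ → 0ℤ} (λ _ → ℤₚ.+-inverseʳ c)) (∑-zero g)

    D-S : ∀ (c : ℤ → ℤ) (K : ℤ → ℤ → ℤ) → D (λ u → S (λ z → c z * K z u)) ≡ S (λ z → c z * D (K z))
    D-S c K = trans (∑-cong g (λ i → sym (S-- (λ z → c z * K z (+ suc i)) (λ z → c z * K z (- + suc i)))))
       (trans (∑-S-swap g (λ i z → c z * K z (+ suc i) - c z * K z (- + suc i)))
         (S-cong (λ z → trans (∑-cong g (λ i → eq (c z) (K z (+ suc i)) (K z (- + suc i)))) (∑-*ˡ g (c z) (λ i → K z (+ suc i) - K z (- + suc i))))))
      where
      eq : ∀ c a b → c * a - c * b ≡ c * (a - b)
      eq = solve 3 (λ c a b → c :* a :- c :* b := c :* (a :- b)) refl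

    -- The kernel of `D`: 1 at 1, ..., g and -1 at the negatives of these.
    φ : ℤ → ℤ
    φ t = ∑ g (λ i → δ (t - + suc i) - δ (t + + suc i))

    φ-per : Per φ
    φ-per = per-∑ g (λ i → per-- {λ t → δ (t - + suc i)} {λ t → δ (t + + suc i)} (per-shift {δ} (- + suc i) δ-per) (per-shift {δ} (+ suc i) δ-per))

    φ-sum : ∀ {F} → Per F → S (λ u → F u * φ u) ≡ D F
    φ-sum {F} per = trans (S-cong (λ u → sym (∑-*ˡ g (F u) (λ i → δ (u - + suc i) - δ (u + + suc i)))))
        (trans (sym (∑-S-swap g (λ i u → F u * (δ (u - + suc i) - δ (u + + suc i))))) (∑-cong g each))
      where
      eq : ∀ f a b → f * (a - b) ≡ a * f - b * f
      eq = solve 3 (λ f a b → f :* (a :- b) := a :* f :- b :* f) refl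
      neg₁ : ∀ u i → u - i ≡ - (i - u)
      neg₁ = solve 2 (λ u i → u :- i := :- (i :- u)) refl
      neg₂ : ∀ u i → u + i ≡ - (- i - u)
      neg₂ = solve 2 (λ u i → u :+ i := :- (:- i :- u)) refl
      each : ∀ i → S (λ u → F u * (δ (u - + suc i) - δ (u + + suc i))) ≡ F (+ suc i) - F (- + suc i)
      each i = trans (S-cong (λ u → trans (eq (F u) (δ (u - + suc i)) (δ (u + + suc i)))
           (cong₂ (λ a b → a * F u - b * F u) (trans (cong δ (neg₁ u (+ suc i))) (δ-neg (+ suc i - u))) (trans (cong δ (neg₂ u (+ suc i))) (δ-neg (- + suc i - u))))))
        (trans (S-- (λ u → δ (+ suc i - u) * F u) (λ u → δ (- + suc i - u) * F u)) (cong₂ _-_ (δ-sum per (+ suc i)) (δ-sum per (- + suc i))))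

    -- The dilate of V by b, convolved with φ.
    smear : Sub → ℤ → ℤ → ℤ
    smear V b u = S (λ y → Sub.χ V y * φ (u - b * y))

    smear-per : ∀ V b → Per (smear V b)
    smear-per V b x k = S-cong (λ y → cong (Sub.χ V y *_) (trans (cong φ (eq x k N (b * y))) (φ-per (x - b * y) k)))
      where
      eq : ∀ x k n c → x + k * n - c ≡ x - c + k * n
      eq = solve 4 (λ x k n c → x :+ k :* n :- c := x :- c :+ k :* n) refl

    smear-sum : ∀ V b {K} → Per K → S (λ u → K u * smear V b u) ≡ S (λ y → Sub.χ V y * D (λ u → K (u + b * y)))
    smear-sum V b {K} per = begin
        S (λ u → K u * smear V b u)                              ≡⟨ S-cong (λ u → sym (S-*ˡ (K u) (λ y → χ y * φ (u - b * y)))) ⟩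
        S (λ u → S (λ y → K u * (χ y * φ (u - b * y))))          ≡⟨ S-swap (λ u y → K u * (χ y * φ (u - b * y))) ⟩
        S (λ y → S (λ u → K u * (χ y * φ (u - b * y))))          ≡⟨ S-cong (λ y → trans (S-cong (λ u → eq (K u) (χ y) (φ (u - b * y)))) (S-*ˡ (χ y) (λ u → K u * φ (u - b * y)))) ⟩
        S (λ y → χ y * S (λ u → K u * φ (u - b * y)))            ≡⟨ S-cong (λ y → cong (χ y *_) (inner y)) ⟩
        S (λ y → χ y * D (λ u → K (u + b * y))) ∎
      where
      open ≡-Reasoning
      χ = Sub.χ V
      eq : ∀ k c f → k * (c * f) ≡ c * (k * f)
      eq = solve 3 (λ k c f → k :* (c :* f) := c :* (k :* f)) refl
      eq₂ : ∀ u c → u + c - c ≡ u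
      eq₂ = solve 2 (λ u c → u :+ c :- c := u) refl
      inner : ∀ y → S (λ u → K u * φ (u - b * y)) ≡ D (λ u → K (u + b * y))
      inner y = trans (sym (S-shift {λ u → K u * φ (u - b * y)} (per-* {K} {λ u → φ (u - b * y)} per (per-shift {φ} (- (b * y)) φ-per)) (b * y)))
         (trans (S-cong (λ u → cong (λ z → K (u + b * y) * φ z) (eq₂ u (b * y)))) (φ-sum {λ u → K (u + b * y)} (per-shift {K} (b * y) per)))

    smear-total : ∀ V b → S (smear V b) ≡ 0ℤ
    smear-total V b = trans (S-cong (λ u → sym (ℤₚ.*-identityˡ (smear V b u)))) (trans (smear-sum V b {λ _ → 1ℤ} (per-const 1ℤ))
        (trans (S-cong (λ y → trans (cong (Sub.χ V y *_) (D-const 1ℤ)) (ℤₚ.*-zeroʳ (Sub.χ V y)))) (trans (S-const 0ℤ) (ℤₚ.*-zeroʳ N))))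

    conv : Sub → ℤ → ℤ → ℤ
    conv A b t = S (λ x → Sub.χ A x * tri (b * x + t))

    conv-per : ∀ A b → Per (conv A b)
    conv-per A b t k = S-cong (λ x → cong (Sub.χ A x *_) (trans (cong tri (eq (b * x) t k N)) (tri-per (b * x + t) k)))
      where
      eq : ∀ c t k n → c + (t + k * n) ≡ c + t + k * n
      eq = solve 4 (λ c t k n → c :+ (t :+ k :* n) := c :+ t :+ k :* n) refl

    -- What the wave becomes after testing against two smeared sets, one `D` for each of them.
    Ψ : ℤ → ℤ
    Ψ t = D (λ u → D (λ u′ → tri (t + u + u′)))

    Ψ-per : Per Ψ
    Ψ-per t k = D-cong (λ u → D-cong (λ u′ → trans (cong tri (eq t k N u u′)) (tri-per (t + u + u′) k)))
      where
      eq : ∀ t k n u v → t + k * n + u + v ≡ t + u + v + k * n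
      eq = solve 5 (λ t k n u v → t :+ k :* n :+ u :+ v := t :+ u :+ v :+ k :* n) refl

    -- The autocorrelation of φ, which is the kernel of the quadratic form `norm`.
    X : ℤ → ℤ
    X t = D (λ u → φ (t + u))

    X-per : Per X
    X-per t k = D-cong (λ u → trans (cong φ (eq t k N u)) (φ-per (t + u) k))
      where
      eq : ∀ t k n u → t + k * n + u ≡ t + u + k * n
      eq = solve 4 (λ t k n u → t :+ k :* n :+ u := t :+ u :+ k :* n) refl

    S* : (ℤ → ℤ) → ℤ
    S* F = S (λ b → (1ℤ - δ b) * F b)

    S*-eq : ∀ F → S* F ≡ S F - F 0ℤ
    S*-eq F = trans (S-cong (λ b → trans (eq (δ b) (F b)) (cong (λ z → F b - z * F b) (sym (δ-neg b))))) (trans (S-- F (λ b → δ (- b) * F b)) (cong (λ z → S F - z) (δ-first F)))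
      where
      eq : ∀ d f → (1ℤ - d) * f ≡ f - d * f
      eq = solve 2 (λ d f → (con 1ℤ :- d) :* f := f :- d :* f) refl

    S*-S : ∀ (c : ℤ → ℤ) (F : ℤ → ℤ → ℤ) → S* (λ b → S (λ y → c y * F b y)) ≡ S (λ y → c y * S* (λ b → F b y))
    S*-S c F = trans (S-cong (λ b → sym (S-*ˡ (1ℤ - δ b) (λ y → c y * F b y)))) (trans (S-swap (λ b y → (1ℤ - δ b) * (c y * F b y)))
        (S-cong (λ y → trans (S-cong (λ b → eq (1ℤ - δ b) (c y) (F b y))) (S-*ˡ (c y) (λ b → (1ℤ - δ b) * F b y)))))
      where
      eq : ∀ k c f → k * (c * f) ≡ c * (k * f)
      eq = solve 3 (λ k c f → k :* (c :* f) := c :* (k :* f)) refl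

    S*-mono : ∀ {F G} → (∀ b → ¬ (N ∣ᶻ b) → F b ≤ G b) → S* F ≤ S* G
    S*-mono {F} {G} h = S-mono (λ b → go b (δ-case b))
      where
      go : ∀ b → (N ∣ᶻ b × δ b ≡ 1ℤ) ⊎ (¬ (N ∣ᶻ b) × δ b ≡ 0ℤ) → (1ℤ - δ b) * F b ≤ (1ℤ - δ b) * G b
      go b (inj₁ (_ , e)) = ≤-reflexive (trans (cong (λ z → (1ℤ - z) * F b) e) (trans (ℤₚ.*-zeroˡ (F b)) (sym (trans (cong (λ z → (1ℤ - z) * G b) e) (ℤₚ.*-zeroˡ (G b))))))
      go b (inj₂ (n , e)) = subst₂ _≤_ (sym (trans (cong (λ z → (1ℤ - z) * F b) e) (ℤₚ.*-identityˡ (F b)))) (sym (trans (cong (λ z → (1ℤ - z) * G b) e) (ℤₚ.*-identityˡ (G b)))) (h b n)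

    -- The substitute for orthogonality of characters. Multiplication by x permutes the residues b,
    -- so all of them together contribute S F = 0; leaving out b = 0 leaves - F 0.
    S*-orth : ∀ {F} → Per F → S F ≡ 0ℤ → ∀ x → ¬ (N ∣ᶻ x) → S* (λ b → F (b * x)) ≡ - F 0ℤ
    S*-orth {F} per z x n = go (inv x n)
      where
      go : ∃[ x⁻ ] (N ∣ᶻ (x * x⁻ - 1ℤ)) → S* (λ b → F (b * x)) ≡ - F 0ℤ
      go (x⁻ , d) = trans (S*-eq (λ b → F (b * x))) (trans (cong₂ _-_ (trans (S-cong (λ b → cong F (trans (ℤₚ.*-comm b x) (sym (ℤₚ.+-identityʳ (x * b))))))
         (trans (S-mult per x x⁻ d 0ℤ) z)) (cong F (ℤₚ.*-zeroˡ x))) (ℤₚ.+-identityˡ (- F 0ℤ)))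

    S-D : ∀ (K : ℤ → ℤ → ℤ) → (∀ u → S (λ t → K t u) ≡ S (λ t → K t 0ℤ)) → S (λ t → D (K t)) ≡ 0ℤ
    S-D K h = trans (sym (∑-S-swap g (λ i t → K t (+ suc i) - K t (- + suc i))))
       (trans (∑-cong g {_} {λ _ → 0ℤ} (λ i → trans (S-- (λ t → K t (+ suc i)) (λ t → K t (- + suc i))) (trans (cong₂ _-_ (h (+ suc i)) (h (- + suc i))) (ℤₚ.+-inverseʳ (S (λ t → K t 0ℤ)))))) (∑-zero g))

    S-Ψ : S Ψ ≡ 0ℤ
    S-Ψ = S-D (λ t u → D (λ u′ → tri (t + u + u′))) (λ u → S-shift₂ u)
      where
      eq : ∀ t u v → t + u + v ≡ t + v + u
      eq = solve 3 (λ t u v → t :+ u :+ v := t :+ v :+ u) refl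
      K : ℤ → ℤ
      K t = D (λ u′ → tri (t + u′))
      K-per : Per K
      K-per t k = D-cong (λ u → trans (cong tri (eq₁ t k N u)) (tri-per (t + u) k))
        where
        eq₁ : ∀ t k n u → t + k * n + u ≡ t + u + k * n
        eq₁ = solve 4 (λ t k n u → t :+ k :* n :+ u := t :+ u :+ k :* n) refl
      S-shift₂ : ∀ u → S (λ t → D (λ u′ → tri (t + u + u′))) ≡ S (λ t → D (λ u′ → tri (t + 0ℤ + u′)))
      S-shift₂ u = trans (S-shift {K} K-per u) (sym (S-shift {K} K-per 0ℤ))

    S-X : S X ≡ 0ℤ
    S-X = S-D (λ t u → φ (t + u)) (λ u → trans (S-shift {φ} φ-per u) (sym (S-shift {φ} φ-per 0ℤ)))

    gate : ∀ (A : Sub) {F G : ℤ → ℤ} → (∀ y → Sub.χ A y ≡ 1ℤ → F y ≡ G y) → S (λ y → Sub.χ A y * F y) ≡ S (λ y → Sub.χ A y * G y)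
    gate A {F} {G} h = S-cong (λ y → go y (Sub.bin A y))
      where
      go : ∀ y → Sub.χ A y ≡ 0ℤ ⊎ Sub.χ A y ≡ 1ℤ → Sub.χ A y * F y ≡ Sub.χ A y * G y
      go y (inj₁ e) = trans (cong (_* F y) e) (trans (ℤₚ.*-zeroˡ (F y)) (sym (trans (cong (_* G y) e) (ℤₚ.*-zeroˡ (G y)))))
      go y (inj₂ e) = cong (Sub.χ A y *_) (h y e)

    φ≤1 : ∀ t → φ t ≤ 1ℤ
    φ≤1 t = ≤-trans (∑-mono g (λ i → ≤-by _ (δ≥0 (t + + suc i)) (eq (δ (t - + suc i)) (δ (t + + suc i)))))
        (≤-trans (∑-mono-n {g} {p} {λ i → δ (t - + suc i)} g≤p (λ i → δ≥0 (t - + suc i))) (≤-reflexive (trans (sym (S-def (λ i → δ (t - (1ℤ + i)))))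
          (trans (S-cong (λ i → trans (cong δ (eq₂ t i)) (δ-neg (i - (t - 1ℤ))))) (S-δ (t - 1ℤ))))))
      where
      eq : ∀ a b → a - (a - b) ≡ b
      eq = solve 2 (λ a b → a :- (a :- b) := b) refl
      eq₂ : ∀ t i → t - (1ℤ + i) ≡ - (i - (t - 1ℤ))
      eq₂ = solve 2 (λ t i → t :- (con 1ℤ :+ i) := :- (i :- (t :- con 1ℤ))) refl
      g≤p : g ℕ.≤ p
      g≤p = +≤+⁻ (≤-trans (≤-by _ (pos {3} ⊗ pos {g}) (eq₃ (+ g))) 4g≤p)
        where
        eq₃ : ∀ g → + 4 * g - g ≡ + 3 * g
        eq₃ = solve 1 (λ g → con (+ 4) :* g :- g := con (+ 3) :* g) refl

    φ-odd : ∀ t → φ (- t) ≡ - φ t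
    φ-odd t = trans (∑-cong g (λ i → trans (cong₂ _-_ (trans (cong δ (eq₁ t (+ suc i))) (δ-neg (t + + suc i))) (trans (cong δ (eq₂ t (+ suc i))) (δ-neg (t - + suc i))))
         (eq₃ (δ (t - + suc i)) (δ (t + + suc i))))) (trans (∑-*ˡ g (- 1ℤ) (λ i → δ (t - + suc i) - δ (t + + suc i))) (eq₄ (φ t)))
      where
      eq₁ : ∀ t i → - t - i ≡ - (t + i)
      eq₁ = solve 2 (λ t i → :- t :- i := :- (t :+ i)) refl
      eq₂ : ∀ t i → - t + i ≡ - (t - i)
      eq₂ = solve 2 (λ t i → :- t :+ i := :- (t :- i)) refl
      eq₃ : ∀ a b → b - a ≡ - 1ℤ * (a - b)
      eq₃ = solve 2 (λ a b → b :- a := :- con 1ℤ :* (a :- b)) refl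
      eq₄ : ∀ a → - 1ℤ * a ≡ - a
      eq₄ = solve 1 (λ a → :- con 1ℤ :* a := :- a) refl

    X0 : ℤ
    X0 = X 0ℤ

    X0-φ : X0 ≡ D φ
    X0-φ = D-cong (λ u → cong φ (ℤₚ.+-identityˡ u))

    X0≤ : X0 ≤ + 2 * + g
    X0≤ = ≤-trans (≤-reflexive X0-φ) (≤-trans (∑-mono g {λ i → φ (+ suc i) - φ (- + suc i)} {λ _ → + 2} (λ i → ≤-by _ (sub≥0 (φ≤1 (+ suc i)) ⊕ sub≥0 (φ≤1 (+ suc i)))
          (trans (cong (λ z → + 2 - (φ (+ suc i) - z)) (φ-odd (+ suc i))) (eq (φ (+ suc i)))))) (≤-reflexive (trans (∑-const g (+ 2)) (ℤₚ.*-comm (+ g) (+ 2)))))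
      where
      eq : ∀ a → + 2 - (a - - a) ≡ (1ℤ - a) + (1ℤ - a)
      eq = solve 1 (λ a → con (+ 2) :- (a :- :- a) := (con 1ℤ :- a) :+ (con 1ℤ :- a)) refl

    X0≥0 : 0ℤ ≤ X0
    X0≥0 = ≤-trans (S-≥0 {λ u → φ u * φ u} (λ u → sq≥0 (φ u))) (≤-reflexive (trans (φ-sum {φ} φ-per) (sym X0-φ)))

    -- The term of a and b is 2 (a + b) - 2 ‖a - b‖ ≥ 4 min(a, b). Here 4 g ≤ p ensures 2 (a + b) ≤
    -- p, so that ‖a + b‖ = a + b. The sum of the minima is at least g³/3.
    Ψ0≥ : + 4 * (+ g * (+ g * + g)) ≤ + 3 * Ψ 0ℤ
    Ψ0≥ = ≤-by _ (pos {3} ⊗ sub≥0 low ⊕ pos {4} ⊗ sub≥0 (minSum-≥ g)) (eq (Ψ 0ℤ) (minSum g) (+ g))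
      where
      eq : ∀ a m g → + 3 * a - + 4 * (g * (g * g)) ≡ + 3 * (a - + 4 * m) + + 4 * (+ 3 * m - g * (g * g))
      eq = solve 3 (λ a m g → con (+ 3) :* a :- con (+ 4) :* (g :* (g :* g)) := con (+ 3) :* (a :- con (+ 4) :* m) :+ con (+ 4) :* (con (+ 3) :* m :- g :* (g :* g))) refl
      absdiff : ∀ i j → abs (+ suc i - + suc j) + + 2 * + suc (i ℕ.⊓ j) ≤ + suc i + + suc j
      absdiff i j with ℕₚ.≤-total i j
      ... | inj₁ l = ≤-trans (≤-reflexive (cong₂ (λ a b → a + + 2 * + suc b) (trans (sym (abs-neg (+ suc i - + suc j))) (abs-≥0 (subst (0ℤ ≤_) (e₁ (+ i) (+ j)) (sub≥0 (+≤+ l))))) (ℕₚ.m≤n⇒m⊓n≡m l))) (≤-reflexive (e₂ (+ i) (+ j)))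
        where
        e₁ : ∀ i j → j - i ≡ - ((1ℤ + i) - (1ℤ + j))
        e₁ = solve 2 (λ i j → j :- i := :- ((con 1ℤ :+ i) :- (con 1ℤ :+ j))) refl
        e₂ : ∀ i j → - ((1ℤ + i) - (1ℤ + j)) + + 2 * (1ℤ + i) ≡ (1ℤ + i) + (1ℤ + j)
        e₂ = solve 2 (λ i j → :- ((con 1ℤ :+ i) :- (con 1ℤ :+ j)) :+ con (+ 2) :* (con 1ℤ :+ i) := (con 1ℤ :+ i) :+ (con 1ℤ :+ j)) refl
      ... | inj₂ l = ≤-trans (≤-reflexive (cong₂ (λ a b → a + + 2 * + suc b) (abs-≥0 (subst (0ℤ ≤_) (e₁ (+ i) (+ j)) (sub≥0 (+≤+ l)))) (ℕₚ.m≥n⇒m⊓n≡n l))) (≤-reflexive (e₂ (+ i) (+ j)))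
        where
        e₁ : ∀ i j → i - j ≡ (1ℤ + i) - (1ℤ + j)
        e₁ = solve 2 (λ i j → i :- j := (con 1ℤ :+ i) :- (con 1ℤ :+ j)) refl
        e₂ : ∀ i j → ((1ℤ + i) - (1ℤ + j)) + + 2 * (1ℤ + j) ≡ (1ℤ + i) + (1ℤ + j)
        e₂ = solve 2 (λ i j → ((con 1ℤ :+ i) :- (con 1ℤ :+ j)) :+ con (+ 2) :* (con 1ℤ :+ j) := (con 1ℤ :+ i) :+ (con 1ℤ :+ j)) refl
      term : ∀ i → i ℕ.< g → ∀ j → j ℕ.< g → + 4 * + suc (i ℕ.⊓ j) ≤ (tri (0ℤ + + suc i + + suc j) - tri (0ℤ + + suc i + - + suc j)) - (tri (0ℤ + - + suc i + + suc j) - tri (0ℤ + - + suc i + - + suc j))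
      term i li j lj = ≤-by _ (pos {2} ⊗ sub≥0 (absdiff i j) ⊕ pos {2} ⊗ sub≥0 (tri-abs (a - b)))
          (trans (cong₂ (λ y z → (y - tri (0ℤ + a + - b)) - (tri (0ℤ + - a + b) - z) - + 4 * + suc (i ℕ.⊓ j)) t₁ t₄)
           (trans (cong₂ (λ y z → ((a + b) - y) - (z - (a + b)) - + 4 * + suc (i ℕ.⊓ j)) t₂ t₃) (e a b (tri (a - b)) (abs (a - b)) (+ suc (i ℕ.⊓ j)))))
        where
        a = + suc i
        b = + suc j
        e : ∀ a b t s m → ((a + b) - t) - (t - (a + b)) - + 4 * m ≡ + 2 * (a + b - (s + + 2 * m)) + + 2 * (s - t)
        e = solve 5 (λ a b t s m → ((a :+ b) :- t) :- (t :- (a :+ b)) :- con (+ 4) :* m := con (+ 2) :* (a :+ b :- (s :+ con (+ 2) :* m)) :+ con (+ 2) :* (s :- t)) refl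
        e₀ : ∀ a b → 0ℤ + a + b ≡ a + b
        e₀ = solve 2 (λ a b → con 0ℤ :+ a :+ b := a :+ b) refl
        e₂ : ∀ a b → 0ℤ + a + - b ≡ a - b
        e₂ = solve 2 (λ a b → con 0ℤ :+ a :+ :- b := a :- b) refl
        e₃ : ∀ a b → 0ℤ + - a + b ≡ - (a - b)
        e₃ = solve 2 (λ a b → con 0ℤ :+ :- a :+ b := :- (a :- b)) refl
        e₄ : ∀ a b → 0ℤ + - a + - b ≡ - (a + b)
        e₄ = solve 2 (λ a b → con 0ℤ :+ :- a :+ :- b := :- (a :+ b)) refl
        e₅ : ∀ a b g p → p - + 2 * (a + b) ≡ (p - + 4 * g) + (+ 2 * (g - a) + + 2 * (g - b))
        e₅ = solve 4 (λ a b g p → p :- con (+ 2) :* (a :+ b) := (p :- con (+ 4) :* g) :+ (con (+ 2) :* (g :- a) :+ con (+ 2) :* (g :- b))) refl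
        small : tri (a + b) ≡ a + b
        small = tri-small (pos {suc i} ⊕ pos {suc j}) (≤-by _ (sub≥0 4g≤p ⊕ (pos {2} ⊗ sub≥0 (+≤+ li) ⊕ pos {2} ⊗ sub≥0 (+≤+ lj))) (e₅ a b (+ g) N))
        t₁ : tri (0ℤ + a + b) ≡ a + b
        t₁ = trans (cong tri (e₀ a b)) small
        t₂ : tri (0ℤ + a + - b) ≡ tri (a - b)
        t₂ = cong tri (e₂ a b)
        t₃ : tri (0ℤ + - a + b) ≡ tri (a - b)
        t₃ = trans (cong tri (e₃ a b)) (tri-neg (a - b))
        t₄ : tri (0ℤ + - a + - b) ≡ a + b
        t₄ = trans (cong tri (e₄ a b)) (trans (tri-neg (a + b)) small)
      low : + 4 * minSum g ≤ Ψ 0ℤ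
      low = ≤-trans (≤-reflexive (trans (sym (∑-*ˡ g (+ 4) (λ i → ∑ g (λ j → + suc (i ℕ.⊓ j))))) (∑-cong g (λ i → sym (∑-*ˡ g (+ 4) (λ j → + suc (i ℕ.⊓ j)))))))
         (∑-mono< g (λ i li → ≤-trans (∑-mono< g (λ j lj → term i li j lj))
           (≤-reflexive (∑-- g (λ j → tri (0ℤ + + suc i + + suc j) - tri (0ℤ + + suc i + - + suc j)) (λ j → tri (0ℤ + - + suc i + + suc j) - tri (0ℤ + - + suc i + - + suc j))))))

    norm : Sub → ℤ → ℤ
    norm V b = S (λ u → smear V b u * smear V b u)

    norm-eq : ∀ V b → norm V b ≡ S (λ y → Sub.χ V y * S (λ y′ → Sub.χ V y′ * X (b * (y - y′))))
    norm-eq V b = trans (smear-sum V b (smear-per V b)) (S-cong (λ y → cong (Sub.χ V y *_) (trans (D-cong (λ u → S-cong (λ y′ → cong (λ z → Sub.χ V y′ * φ z) (eq u b y y′))))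
         (D-S (Sub.χ V) (λ y′ u → φ (b * (y - y′) + u))))))
      where
      eq : ∀ u b y z → u + b * y - b * z ≡ b * (y - z) + u
      eq = solve 4 (λ u b y z → u :+ b :* y :- b :* z := b :* (y :- z) :+ u) refl

    -- Off the diagonal the sum over b equals - X0 ≤ 0 by `S*-orth`; on the diagonal each of at most
    -- p dilations contributes X0.
    norm-sum : ∀ V → S* (norm V) ≤ N * X0 * Sub.size V
    norm-sum V = ≤-trans (≤-reflexive (trans (S-cong (λ b → cong ((1ℤ - δ b) *_) (norm-eq V b)))
          (trans (S*-S χ (λ b y → S (λ y′ → χ y′ * X (b * (y - y′))))) (S-cong (λ y → cong (χ y *_) (S*-S χ (λ b y′ → X (b * (y - y′)))))))))
       (≤-trans (S-mono (λ y → mul (χ≥0 y) (S-mono (λ y′ → mul (χ≥0 y′) (each (y - y′))))))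
         (≤-reflexive (trans (S-cong (λ y → cong (χ y *_) (trans (S-cong (λ y′ → eq₁ (χ y′) (N * X0) (δ (y - y′)))) (trans (S-*ˡ (N * X0) (λ y′ → δ (y - y′) * χ y′)) (cong (N * X0 *_) (δ-sum per y))))))
           (trans (S-cong (λ y → trans (eq₂ (χ y) (N * X0)) (cong (N * X0 *_) (χ² y)))) (S-*ˡ (N * X0) χ)))))
      where
      open Sub V
      mul : ∀ {c a b} → 0ℤ ≤ c → a ≤ b → c * a ≤ c * b
      mul {c} {a} {b} h k = ≤-by (c * (b - a)) (h ⊗ sub≥0 k) (e c a b)
        where
        e : ∀ c a b → c * b - c * a ≡ c * (b - a)
        e = solve 3 (λ c a b → c :* b :- c :* a := c :* (b :- a)) refl
      eq₁ : ∀ c k d → c * (k * d) ≡ k * (d * c)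
      eq₁ = solve 3 (λ c k d → c :* (k :* d) := k :* (d :* c)) refl
      eq₂ : ∀ c k → c * (k * c) ≡ k * (c * c)
      eq₂ = solve 2 (λ c k → c :* (k :* c) := k :* (c :* c)) refl
      each : ∀ x → S* (λ b → X (b * x)) ≤ N * X0 * δ x
      each x = go (δ-case x)
        where
        eq₄ : ∀ b q n → b * (q * n) ≡ 0ℤ + (b * q) * n
        eq₄ = solve 3 (λ b q n → b :* (q :* n) := con 0ℤ :+ (b :* q) :* n) refl
        go : (N ∣ᶻ x × δ x ≡ 1ℤ) ⊎ (¬ (N ∣ᶻ x) × δ x ≡ 0ℤ) → S* (λ b → X (b * x)) ≤ N * X0 * δ x
        go (inj₂ (n , e)) = ≤-trans (≤-reflexive (S*-orth {X} X-per S-X x n)) (≤-trans (≤-by _ X0≥0 (eq₃ X0)) (≤-reflexive (sym (trans (cong (N * X0 *_) e) (ℤₚ.*-zeroʳ (N * X0))))))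
          where
          eq₃ : ∀ a → 0ℤ - - a ≡ a
          eq₃ = solve 1 (λ a → con 0ℤ :- :- a := a) refl
        go (inj₁ (divides q e′ , e)) = ≤-trans (S-mono (λ b → ≤-trans (≤-reflexive (cong ((1ℤ - δ b) *_) (trans (cong (λ z → X (b * z)) e′) (trans (cong X (eq₄ b q N)) (X-per 0ℤ (b * q))))))
             (≤-by _ (δ≥0 b ⊗ X0≥0) (eq₅ (δ b) X0)))) (≤-reflexive (trans (S-const X0) (sym (trans (cong (N * X0 *_) e) (ℤₚ.*-identityʳ (N * X0))))))
          where
          eq₅ : ∀ d x → x - (1ℤ - d) * x ≡ d * x
          eq₅ = solve 2 (λ d x → x :- (con 1ℤ :- d) :* x := d :* x) refl

    -- As x + y + z + w₀ never vanishes, S*-orth evaluates exactly the sum over b ≠ 0 of the product of the three smeared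
    -- sets; bounding the factor of A by its oscillation Ω and the other two by 2fh ≤ f² + h² gives osc-lower.
    module Main (A V W : Sub) (w₀ : ℤ)
        (nosol : ∀ x y z → Sub.χ A x ≡ 1ℤ → Sub.χ V y ≡ 1ℤ → Sub.χ W z ≡ 1ℤ → ¬ (N ∣ᶻ (x + y + z + w₀)))
        (Ω : ℤ) (osc : ∀ b → ¬ (N ∣ᶻ b) → ∀ t t′ → conv A b t - conv A b t′ ≤ Ω) where

      K : ℤ → ℤ → ℤ
      K b t = S (λ u′ → conv A b (t + u′ + b * w₀) * smear W b u′)

      K-per : ∀ b → Per (K b)
      K-per b t k = S-cong (λ u′ → cong (_* smear W b u′) (trans (cong (conv A b) (eq t k N u′ (b * w₀))) (conv-per A b (t + u′ + b * w₀) k)))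
        where
        eq : ∀ t k n u c → t + k * n + u + c ≡ t + u + c + k * n
        eq = solve 5 (λ t k n u c → t :+ k :* n :+ u :+ c := t :+ u :+ c :+ k :* n) refl

      E : ℤ → ℤ
      E b = S (λ u → K b u * smear V b u)

      E-eq : ∀ b → E b ≡ S (λ y → Sub.χ V y * S (λ z → Sub.χ W z * S (λ x → Sub.χ A x * Ψ (b * (x + y + z + w₀)))))
      E-eq b = trans (smear-sum V b (K-per b)) (S-cong (λ y → cong (Sub.χ V y *_)
          (trans (D-cong (λ u → smear-sum W b {λ u′ → conv A b (u + b * y + u′ + b * w₀)} (per₁ (u + b * y))))
          (trans (D-S (Sub.χ W) (λ z u → D (λ u′ → conv A b (u + b * y + (u′ + b * z) + b * w₀))))
            (S-cong (λ z → cong (Sub.χ W z *_) (trans (D-cong (λ u → D-S (Sub.χ A) (λ x u′ → tri (b * x + (u + b * y + (u′ + b * z) + b * w₀)))))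
              (trans (D-S (Sub.χ A) (λ x u → D (λ u′ → tri (b * x + (u + b * y + (u′ + b * z) + b * w₀)))))
                (S-cong (λ x → cong (Sub.χ A x *_) (D-cong (λ u → D-cong (λ u′ → cong tri (eq b x y z w₀ u u′))))))))))))))
        where
        per₁ : ∀ t → Per (λ u′ → conv A b (t + u′ + b * w₀))
        per₁ t x k = trans (cong (conv A b) (e t x k N (b * w₀))) (conv-per A b (t + x + b * w₀) k)
          where
          e : ∀ t x k n c → t + (x + k * n) + c ≡ t + x + c + k * n
          e = solve 5 (λ t x k n c → t :+ (x :+ k :* n) :+ c := t :+ x :+ c :+ k :* n) refl
        eq : ∀ b x y z w u v → b * x + (u + b * y + (v + b * z) + b * w) ≡ b * (x + y + z + w) + u + v
        eq = solve 7 (λ b x y z w u v → b :* x :+ (u :+ b :* y :+ (v :+ b :* z) :+ b :* w) := b :* (x :+ y :+ z :+ w) :+ u :+ v) refl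

      E-total : S* E ≡ - (Ψ 0ℤ) * (Sub.size A * (Sub.size V * Sub.size W))
      E-total = begin
          S* E
            ≡⟨ S-cong (λ b → cong ((1ℤ - δ b) *_) (E-eq b)) ⟩
          S* (λ b → S (λ y → Sub.χ V y * S (λ z → Sub.χ W z * S (λ x → Sub.χ A x * Ψ (b * (x + y + z + w₀))))))
            ≡⟨ S*-S (Sub.χ V) (λ b y → S (λ z → Sub.χ W z * S (λ x → Sub.χ A x * Ψ (b * (x + y + z + w₀))))) ⟩
          S (λ y → Sub.χ V y * S* (λ b → S (λ z → Sub.χ W z * S (λ x → Sub.χ A x * Ψ (b * (x + y + z + w₀))))))
            ≡⟨ gate V (λ y hy → trans (S*-S (Sub.χ W) (λ b z → S (λ x → Sub.χ A x * Ψ (b * (x + y + z + w₀)))))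
                 (gate W (λ z hz → trans (S*-S (Sub.χ A) (λ b x → Ψ (b * (x + y + z + w₀))))
                   (gate A (λ x hx → S*-orth {Ψ} Ψ-per S-Ψ (x + y + z + w₀) (nosol x y z hx hy hz)))))) ⟩
          S (λ y → Sub.χ V y * S (λ z → Sub.χ W z * S (λ x → Sub.χ A x * - Ψ 0ℤ)))
            ≡⟨ S-cong (λ y → cong (Sub.χ V y *_) (trans (S-cong (λ z → cong (Sub.χ W z *_) (S-*ʳ (- Ψ 0ℤ) (Sub.χ A)))) (S-*ʳ (Sub.size A * - Ψ 0ℤ) (Sub.χ W)))) ⟩
          S (λ y → Sub.χ V y * (Sub.size W * (Sub.size A * - Ψ 0ℤ)))
            ≡⟨ S-*ʳ (Sub.size W * (Sub.size A * - Ψ 0ℤ)) (Sub.χ V) ⟩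
          Sub.size V * (Sub.size W * (Sub.size A * - Ψ 0ℤ))
            ≡⟨ eq (Sub.size A) (Sub.size V) (Sub.size W) (- Ψ 0ℤ) ⟩
          - Ψ 0ℤ * (Sub.size A * (Sub.size V * Sub.size W)) ∎
        where
        open ≡-Reasoning
        eq : ∀ a v w c → v * (w * (a * c)) ≡ c * (a * (v * w))
        eq = solve 4 (λ a v w c → v :* (w :* (a :* c)) := c :* (a :* (v :* w))) refl

      E-low : ∀ b → ¬ (N ∣ᶻ b) → - + 2 * E b ≤ Ω * N * (norm V b + norm W b)
      E-low b nb = ≤-by _ (S-≥0 {λ u → S (λ u′ → term u u′)} (λ u → S-≥0 {term u} (λ u′ → cross-bound {Ω} {n u u′} (f u) (h u′) (lo u u′) (up u u′)))) (sym total)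
        where
        f = smear V b
        h = smear W b
        -- Subtracting a constant from `conv` does not change E b, because the smeared set W has
        -- total 0. Afterwards the factor n is at most Ω in absolute value.
        c₀ = conv A b 0ℤ
        n : ℤ → ℤ → ℤ
        n u u′ = conv A b (u + u′ + b * w₀) - c₀
        term : ℤ → ℤ → ℤ
        term u u′ = + 2 * (n u u′ * f u * h u′) + Ω * (f u * f u + h u′ * h u′)
        up : ∀ u u′ → n u u′ ≤ Ω
        up u u′ = osc b nb (u + u′ + b * w₀) 0ℤ
        lo : ∀ u u′ → - n u u′ ≤ Ω
        lo u u′ = ≤-trans (≤-reflexive (e (conv A b (u + u′ + b * w₀)) c₀)) (osc b nb 0ℤ (u + u′ + b * w₀))
          where
          e : ∀ a c → - (a - c) ≡ c - a
          e = solve 2 (λ a c → :- (a :- c) := c :- a) refl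
        inner : ∀ u → S (term u) ≡ + 2 * (K b u * f u) + (Ω * (N * (f u * f u)) + Ω * norm W b)
        inner u = trans (S-cong (λ u′ → e (conv A b (u + u′ + b * w₀)) c₀ (f u) (h u′) Ω))
            (trans (S-+ (λ u′ → + 2 * f u * (conv A b (u + u′ + b * w₀) * h u′) - + 2 * f u * c₀ * h u′) (λ u′ → Ω * (f u * f u) + Ω * (h u′ * h u′)))
              (trans (cong₂ _+_ (trans (S-- (λ u′ → + 2 * f u * (conv A b (u + u′ + b * w₀) * h u′)) (λ u′ → + 2 * f u * c₀ * h u′))
                 (cong₂ _-_ (S-*ˡ (+ 2 * f u) (λ u′ → conv A b (u + u′ + b * w₀) * h u′)) (trans (S-*ˡ (+ 2 * f u * c₀) h) (cong (+ 2 * f u * c₀ *_) (smear-total W b)))))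
                 (trans (S-+ (λ _ → Ω * (f u * f u)) (λ u′ → Ω * (h u′ * h u′))) (cong₂ _+_ (S-const (Ω * (f u * f u))) (S-*ˡ Ω (λ u′ → h u′ * h u′)))))
                (e₂ (f u) (K b u) c₀ N Ω (norm W b))))
          where
          e : ∀ a c f h o → + 2 * ((a - c) * f * h) + o * (f * f + h * h) ≡ + 2 * f * (a * h) - + 2 * f * c * h + (o * (f * f) + o * (h * h))
          e = solve 5 (λ a c f h o → con (+ 2) :* ((a :- c) :* f :* h) :+ o :* (f :* f :+ h :* h) := con (+ 2) :* f :* (a :* h) :- con (+ 2) :* f :* c :* h :+ (o :* (f :* f) :+ o :* (h :* h))) refl
          e₂ : ∀ f k c n o w → + 2 * f * k - + 2 * f * c * 0ℤ + (n * (o * (f * f)) + o * w) ≡ + 2 * (k * f) + (o * (n * (f * f)) + o * w)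
          e₂ = solve 6 (λ f k c n o w → con (+ 2) :* f :* k :- con (+ 2) :* f :* c :* con 0ℤ :+ (n :* (o :* (f :* f)) :+ o :* w) := con (+ 2) :* (k :* f) :+ (o :* (n :* (f :* f)) :+ o :* w)) refl
        total : S (λ u → S (term u)) ≡ Ω * N * (norm V b + norm W b) - - + 2 * E b
        total = trans (S-cong inner) (trans (S-+ (λ u → + 2 * (K b u * f u)) (λ u → Ω * (N * (f u * f u)) + Ω * norm W b))
            (trans (cong₂ _+_ (S-*ˡ (+ 2) (λ u → K b u * f u)) (trans (S-+ (λ u → Ω * (N * (f u * f u))) (λ _ → Ω * norm W b))
              (cong₂ _+_ (trans (S-*ˡ Ω (λ u → N * (f u * f u))) (cong (Ω *_) (S-*ˡ N (λ u → f u * f u)))) (S-const (Ω * norm W b))))) (e (E b) Ω N (norm V b) (norm W b))))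
          where
          e : ∀ E o n v w → + 2 * E + (o * (n * v) + n * (o * w)) ≡ o * n * (v + w) - - + 2 * E
          e = solve 5 (λ E o n v w → con (+ 2) :* E :+ (o :* (n :* v) :+ n :* (o :* w)) := o :* n :* (v :+ w) :- :- con (+ 2) :* E) refl

      bound : 0ℤ ≤ Ω → + 2 * Ψ 0ℤ * (Sub.size A * (Sub.size V * Sub.size W)) ≤ Ω * N * (N * X0 * (Sub.size V + Sub.size W))
      bound Ω≥0 = ≤-trans (≤-reflexive (sym lhs)) (≤-trans (S*-mono {λ b → - + 2 * E b} {λ b → Ω * N * (norm V b + norm W b)} E-low)
           (≤-trans (≤-reflexive rhs) (≤-by _ ((Ω≥0 ⊗ pos {p}) ⊗ (sub≥0 (norm-sum V) ⊕ sub≥0 (norm-sum W))) (e (Ω * N) (N * X0) (Sub.size V) (Sub.size W) (S* (norm V)) (S* (norm W))))))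
        where
        e : ∀ o x v w a b → o * (x * (v + w)) - o * (a + b) ≡ o * ((x * v - a) + (x * w - b))
        e = solve 6 (λ o x v w a b → o :* (x :* (v :+ w)) :- o :* (a :+ b) := o :* ((x :* v :- a) :+ (x :* w :- b))) refl
        e₁ : ∀ d x → (1ℤ - d) * (- + 2 * x) ≡ - + 2 * ((1ℤ - d) * x)
        e₁ = solve 2 (λ d x → (con 1ℤ :- d) :* (:- con (+ 2) :* x) := :- con (+ 2) :* ((con 1ℤ :- d) :* x)) refl
        e₂ : ∀ p s → - + 2 * (- p * s) ≡ + 2 * p * s
        e₂ = solve 2 (λ p s → :- con (+ 2) :* (:- p :* s) := con (+ 2) :* p :* s) refl
        e₃ : ∀ d o v w → (1ℤ - d) * (o * (v + w)) ≡ o * ((1ℤ - d) * v + (1ℤ - d) * w)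
        e₃ = solve 4 (λ d o v w → (con 1ℤ :- d) :* (o :* (v :+ w)) := o :* ((con 1ℤ :- d) :* v :+ (con 1ℤ :- d) :* w)) refl
        lhs : S* (λ b → - + 2 * E b) ≡ + 2 * Ψ 0ℤ * (Sub.size A * (Sub.size V * Sub.size W))
        lhs = trans (S-cong (λ b → e₁ (δ b) (E b))) (trans (S-*ˡ (- + 2) (λ b → (1ℤ - δ b) * E b)) (trans (cong (- + 2 *_) E-total) (e₂ (Ψ 0ℤ) (Sub.size A * (Sub.size V * Sub.size W)))))
        rhs : S* (λ b → Ω * N * (norm V b + norm W b)) ≡ Ω * N * (S* (norm V) + S* (norm W))
        rhs = trans (S-cong (λ b → e₃ (δ b) (Ω * N) (norm V b) (norm W b))) (trans (S-*ˡ (Ω * N) (λ b → (1ℤ - δ b) * norm V b + (1ℤ - δ b) * norm W b))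
            (cong (Ω * N *_) (S-+ (λ b → (1ℤ - δ b) * norm V b) (λ b → (1ℤ - δ b) * norm W b))))

      -- `bound` with Ψ 0 ≥ 4g³/3 and X0 ≤ 2g inserted; the common factor 2g is then cancelled.
      osc-lower : 0ℤ ≤ Ω → 1ℤ ≤ + g → + 4 * (+ g * + g) * (Sub.size A * (Sub.size V * Sub.size W)) ≤ + 3 * Ω * (N * N) * (Sub.size V + Sub.size W)
      osc-lower Ω≥0 g≥1 = *-cancel-≤ {+ 2 * + g} (≤-by _ (sub≥0 g≥1 ⊕ pos {g}) (e₁ (+ g)))
          (≤-by _ (pos {3} ⊗ sub≥0 (bound Ω≥0) ⊕ pos {2} ⊗ (sub≥0 Ψ0≥ ⊗ sz) ⊕ pos {3} ⊗ ((Ω≥0 ⊗ (pos {p} ⊗ pos {p})) ⊗ (sub≥0 X0≤ ⊗ (Sub.size≥0 V ⊕ Sub.size≥0 W))))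
            (e (+ g) sA (Sub.size V) (Sub.size W) Ω N (Ψ 0ℤ) X0))
        where
        sA = Sub.size A * (Sub.size V * Sub.size W)
        sz : 0ℤ ≤ sA
        sz = Sub.size≥0 A ⊗ (Sub.size≥0 V ⊗ Sub.size≥0 W)
        e₁ : ∀ g → + 2 * g - 1ℤ ≡ (g - 1ℤ) + g
        e₁ = solve 1 (λ g → con (+ 2) :* g :- con 1ℤ := (g :- con 1ℤ) :+ g) refl
        e : ∀ g s v w o n ψ x → + 2 * g * (+ 3 * o * (n * n) * (v + w)) - + 2 * g * (+ 4 * (g * g) * s)
             ≡ + 3 * (o * n * (n * x * (v + w)) - + 2 * ψ * s) + + 2 * ((+ 3 * ψ - + 4 * (g * (g * g))) * s) + + 3 * ((o * (n * n)) * ((+ 2 * g - x) * (v + w)))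
        e = solve 8 (λ g s v w o n ψ x → con (+ 2) :* g :* (con (+ 3) :* o :* (n :* n) :* (v :+ w)) :- con (+ 2) :* g :* (con (+ 4) :* (g :* g) :* s) := con (+ 3) :* (o :* n :* (n :* x :* (v :+ w)) :- con (+ 2) :* ψ :* s) :+ con (+ 2) :* ((con (+ 3) :* ψ :- con (+ 4) :* (g :* (g :* g))) :* s) :+ con (+ 3) :* ((o :* (n :* n)) :* ((con (+ 2) :* g :- x) :* (v :+ w)))) refl

-- From slow variation under translation to small dilated residues

module Rectification where

  open import Data.Integer using (_+_; _-_; _*_; -_; _≤_)
  open ℤₚ using (≤-trans; ≤-refl; ≤-reflexive)
  open IntegerSums
  open NearestMultiple
  open Translates
  open FourfoldOscillation

  coprime-inv : ∀ (r : ℤ) (q : ℕ) → Coprime ∣ r ∣ q → ∃[ r⁻ ] (+ q ∣ᶻ (r * r⁻ - 1ℤ))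
  coprime-inv (+ m) q c = go (coprime-Bézout c)
    where
    e₁ : ∀ m x y q → 1ℤ + y * q ≡ x * m → m * x - 1ℤ ≡ y * q
    e₁ m x y q e = trans (trans (cong (_- 1ℤ) (ℤₚ.*-comm m x)) (cong (_- 1ℤ) (sym e))) (h y q)
      where
      h : ∀ y q → 1ℤ + y * q - 1ℤ ≡ y * q
      h = solve 2 (λ y q → con 1ℤ :+ y :* q :- con 1ℤ := y :* q) refl
    e₂ : ∀ m x y q → 1ℤ + x * m ≡ y * q → m * - x - 1ℤ ≡ - y * q
    e₂ m x y q e = trans (h m x) (trans (cong -_ e) (h′ y q))
      where
      h : ∀ m x → m * - x - 1ℤ ≡ - (1ℤ + x * m)
      h = solve 2 (λ m x → m :* :- x :- con 1ℤ := :- (con 1ℤ :+ x :* m)) refl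
      h′ : ∀ y q → - (y * q) ≡ - y * q
      h′ = solve 2 (λ y q → :- (y :* q) := :- y :* q) refl
    lift : ∀ a b c d → 1 ℕ.+ a ℕ.* b ≡ c ℕ.* d → 1ℤ + + a * + b ≡ + c * + d
    lift a b c d e = trans (cong (_+_ 1ℤ) (sym (ℤₚ.pos-* a b))) (trans (cong +_ e) (ℤₚ.pos-* c d))
    go : Bézout.Identity 1 m q → ∃[ r⁻ ] (+ q ∣ᶻ (+ m * r⁻ - 1ℤ))
    go (Bézout.+- x y eq) = + x , divides (+ y) (e₁ (+ m) (+ x) (+ y) (+ q) (lift y q x m eq))
    go (Bézout.-+ x y eq) = - (+ x) , divides (- (+ y)) (e₂ (+ m) (+ x) (+ y) (+ q) (lift x m y q eq))
  coprime-inv -[1+ m ] q c = go (coprime-inv (+ suc m) q c)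
    where
    e : ∀ m r → - m * - r ≡ m * r
    e = solve 2 (λ m r → :- m :* :- r := m :* r) refl
    go : ∃[ r⁻ ] (+ q ∣ᶻ (+ suc m * r⁻ - 1ℤ)) → ∃[ r⁻ ] (+ q ∣ᶻ (-[1+ m ] * r⁻ - 1ℤ))
    go (r , d) = - r , subst (λ z → + q ∣ᶻ (z - 1ℤ)) (sym (e (+ suc m) r)) d

  least : ∀ {P : ℕ → Set} → (∀ k → Dec (P k)) → ∀ n → P n → ∃[ m ] (m ℕ.≤ n × P m × (∀ k → k ℕ.< m → ¬ P k))
  least {P} P? n h = go (search (suc n) {λ k → P k × (∀ j → j ℕ.< k → ¬ P j)} {λ k → ¬ P k ⊎ (∃[ j ] (j ℕ.< k × P j))} dec)
    where
    dec : ∀ k → (P k × (∀ j → j ℕ.< k → ¬ P j)) ⊎ (¬ P k ⊎ (∃[ j ] (j ℕ.< k × P j)))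
    dec k with P? k | search k {P} {λ j → ¬ P j} (λ j → split (P? j))
      where
      split : ∀ {A : Set} → Dec A → A ⊎ ¬ A
      split (yes a) = inj₁ a
      split (no a) = inj₂ a
    ... | no n | _ = inj₂ (inj₁ n)
    ... | yes y | inj₁ j = inj₂ (inj₂ j)
    ... | yes y | inj₂ f = inj₁ (y , f)
    go : _ → _
    go (inj₁ (m , l , p , f)) = m , ℕₚ.≤-pred l , p , f
    go (inj₂ f) = ⊥-elim (none (suc n) n ℕₚ.≤-refl ℕₚ.≤-refl h)
      where
      none : ∀ fuel k → k ℕ.< fuel → k ℕ.≤ n → ¬ P k
      none (suc fuel) k (s≤s l) kn pk with f k (s≤s kn)
      ... | inj₁ np = np pk
      ... | inj₂ (j , jk , pj) = none fuel j (ℕₚ.<-≤-trans jk l) (ℕₚ.≤-trans (ℕₚ.<⇒≤ jk) kn) pj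

  argmax : ∀ n (f : ℕ → ℤ) → ∃[ i ] (i ℕ.< suc n × (∀ j → j ℕ.< suc n → f j ≤ f i))
  argmax zero f = 0 , s≤s z≤n , λ { zero _ → ≤-refl ; (suc j) (s≤s ()) }
  argmax (suc n) f with argmax n f
  ... | i , l , h with ≤-or (f i) (f (suc n))
  ...   | inj₁ k = suc n , ℕₚ.≤-refl , all
    where
    all : ∀ j → j ℕ.< suc (suc n) → f j ≤ f (suc n)
    all j (s≤s jl) with ℕₚ.m≤n⇒m<n∨m≡n jl
    ... | inj₁ lt = ≤-trans (h j lt) k
    ... | inj₂ refl = ≤-refl
  ...   | inj₂ k = i , ℕₚ.m<n⇒m<1+n l , all
    where
    all : ∀ j → j ℕ.< suc (suc n) → f j ≤ f i
    all j (s≤s jl) with ℕₚ.m≤n⇒m<n∨m≡n jl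
    ... | inj₁ lt = h j lt
    ... | inj₂ refl = ≤-trans (ℤₚ.i≤suc[i] (f (suc n))) k

  abs-≡ : ∀ x → ∃[ σ ] (σ * σ ≡ 1ℤ × x ≡ σ * abs x)
  abs-≡ x with abs-cases x
  ... | inj₁ (_ , e) = 1ℤ , refl , sym (trans (ℤₚ.*-identityˡ (abs x)) e)
  ... | inj₂ (_ , e) = - 1ℤ , refl , trans (eq x) (cong (- 1ℤ *_) (sym e))
    where
    eq : ∀ x → x ≡ - 1ℤ * - x
    eq = solve 1 (λ x → x := :- con 1ℤ :* :- x) refl

  module Rectify (p : ℕ) .{{nz : NonZero p}} (inv : ∀ x → ¬ (+ p ∣ᶻ x) → ∃[ x⁻ ] (+ p ∣ᶻ (x * x⁻ - 1ℤ)))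
                 (A : Growth.Sub p) where
    open Mod p
    open Tri p
    open Growth p
    open Sub A hiding (r)

    conv : ℤ → ℤ → ℤ
    conv b t = S (λ x → χ x * tri (b * x + t))

    conv-per : ∀ b → Per (conv b)
    conv-per b t k = S-cong (λ x → cong (χ x *_) (trans (cong tri (eq (b * x) t k N)) (tri-per (b * x + t) k)))
      where
      eq : ∀ c t k n → c + (t + k * n) ≡ c + t + k * n
      eq = solve 4 (λ c t k n → c :+ (t :+ k :* n) := c :+ t :+ k :* n) refl

    conv-per′ : ∀ t → Per (λ b → conv b t)
    conv-per′ t b k = S-cong (λ x → cong (χ x *_) (trans (cong tri (eq b x t k N)) (tri-per (b * x + t) (k * x))))
      where
      eq : ∀ b x t k n → (b + k * n) * x + t ≡ b * x + t + k * x * n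
      eq = solve 5 (λ b x t k n → (b :+ k :* n) :* x :+ t := b :* x :+ t :+ k :* x :* n) refl

    conv-lip : ∀ b t e → conv b (t + e) ≤ conv b t + size * abs e
    conv-lip b t e = ≤-trans (S-mono (λ x → ≤-by _ (χ≥0 x ⊗ sub≥0 (tri-lip (b * x + t) e))
          (trans (cong (λ z → χ x * tri (b * x + t) + χ x * abs e - χ x * tri z) (sym (ℤₚ.+-assoc (b * x) t e))) (eq (χ x) (tri (b * x + t)) (abs e) (tri (b * x + t + e))))))
        (≤-reflexive (trans (S-+ (λ x → χ x * tri (b * x + t)) (λ x → χ x * abs e)) (cong (_+_ (conv b t)) (S-*ʳ (abs e) χ))))
      where
      eq : ∀ c t a u → c * t + c * a - c * u ≡ c * (t + a - u)
      eq = solve 4 (λ c t a u → c :* t :+ c :* a :- c :* u := c :* (t :+ a :- u)) refl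

    -- Shifting t by b a amounts to translating A by a. Only points of A + a outside A can increase
    -- the sum, there are `lam a` of them, and each adds at most p/2.
    conv-shift : ∀ b a t → + 2 * (conv b (t + b * a) - conv b t) ≤ N * lam a
    conv-shift b a t = ≤-trans (≤-reflexive (cong (+ 2 *_) (trans (cong (_- conv b t) moved) (sym (S-- (λ x → χ (x - a) * T x) (λ x → χ x * T x))))))
        (≤-trans (≤-reflexive (sym (S-*ˡ (+ 2) (λ x → χ (x - a) * T x - χ x * T x))))
        (≤-trans (S-mono (λ x → ≤-by _ ((1-χ≥0 x ⊗ χ≥0 (x - a)) ⊗ sub≥0 (tri-half (b * x + t)) ⊕ pos {2} ⊗ ((χ≥0 x ⊗ 1-χ≥0 (x - a)) ⊗ tri≥0 (b * x + t)))
            (eq (χ x) (χ (x - a)) (T x) N))) (≤-reflexive (S-*ˡ N (λ x → (1ℤ - χ x) * χ (x - a))))))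
      where
      T : ℤ → ℤ
      T x = tri (b * x + t)
      T-per : Per T
      T-per x k = trans (cong tri (e b x k N t)) (tri-per (b * x + t) (b * k))
        where
        e : ∀ b x k n t → b * (x + k * n) + t ≡ b * x + t + b * k * n
        e = solve 5 (λ b x k n t → b :* (x :+ k :* n) :+ t := b :* x :+ t :+ b :* k :* n) refl
      eq : ∀ c d t n → n * ((1ℤ - c) * d) - + 2 * (d * t - c * t) ≡ ((1ℤ - c) * d) * (n - + 2 * t) + + 2 * ((c * (1ℤ - d)) * t)
      eq = solve 4 (λ c d t n → n :* ((con 1ℤ :- c) :* d) :- con (+ 2) :* (d :* t :- c :* t) := ((con 1ℤ :- c) :* d) :* (n :- con (+ 2) :* t) :+ con (+ 2) :* ((c :* (con 1ℤ :- d)) :* t)) refl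
      moved : conv b (t + b * a) ≡ S (λ x → χ (x - a) * T x)
      moved = trans (S-cong (λ x → cong₂ (λ y z → χ y * tri z) (e₁ x a) (e₂ b x a t))) (S-shift {λ x → χ (x - a) * T x} (per-* {λ x → χ (x - a)} {T} (per-shift {χ} (- a) per) T-per) a)
        where
        e₁ : ∀ x a → x ≡ x + a - a
        e₁ = solve 2 (λ x a → x := x :+ a :- a) refl
        e₂ : ∀ b x a t → b * x + (t + b * a) ≡ b * (x + a) + t
        e₂ = solve 4 (λ b x a t → b :* x :+ (t :+ b :* a) := b :* (x :+ a) :+ t) refl

    conv-up : ∀ b a t i → + 2 * conv b (t + + i * (b * a)) ≤ + 2 * conv b t + N * (+ i * lam a)
    conv-up b a t i = ≤-trans (≤-reflexive (cong (λ z → + 2 * conv b (t + z)) (e b a (+ i))))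
         (≤-by _ (sub≥0 (conv-shift b (+ i * a) t) ⊕ pos {p} ⊗ sub≥0 (lam-mul i a)) (eq (conv b t) (conv b (t + b * (+ i * a))) N (+ i * lam a) (lam (+ i * a))))
      where
      e : ∀ b a i → i * (b * a) ≡ b * (i * a)
      e = solve 3 (λ b a i → i :* (b :* a) := b :* (i :* a)) refl
      eq : ∀ c d n l m → + 2 * c + n * l - + 2 * d ≡ (n * m - + 2 * (d - c)) + n * (l - m)
      eq = solve 5 (λ c d n l m → con (+ 2) :* c :+ n :* l :- con (+ 2) :* d := (n :* m :- con (+ 2) :* (d :- c)) :+ n :* (l :- m)) refl

    -- `conv-shift` for the translation back by - i a, which has the same `lam`.
    conv-down : ∀ b a t i → + 2 * conv b t ≤ + 2 * conv b (t + + i * (b * a)) + N * (+ i * lam a)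
    conv-down b a t i = ≤-by _ (sub≥0 (conv-shift b (- (+ i * a)) t′) ⊕ pos {p} ⊗ sub≥0 (lam-mul i a))
         (trans (eq (conv b t) (conv b t′) N (+ i * lam a) (lam (+ i * a)))
           (cong₂ (λ y z → (N * y - + 2 * (z - conv b t′)) + N * (+ i * lam a - lam (+ i * a))) (sym (lam-neg (+ i * a))) (cong (conv b) (e t b a (+ i)))))
      where
      t′ = t + + i * (b * a)
      e : ∀ t b a i → t ≡ t + i * (b * a) + b * - (i * a)
      e = solve 4 (λ t b a i → t := t :+ i :* (b :* a) :+ b :* :- (i :* a)) refl
      eq : ∀ c d n l m → + 2 * d + n * l - + 2 * c ≡ (n * m - + 2 * (c - d)) + n * (l - m)
      eq = solve 5 (λ c d n l m → con (+ 2) :* d :+ n :* l :- con (+ 2) :* c := (n :* m :- con (+ 2) :* (c :- d)) :+ n :* (l :- m)) refl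

    -- The extremal dilation b with the two arguments at which its oscillation is attained.
    -- Maximality over all nonzero b′ is used both for `osc-lower` and to compare b with q b.
    record Peak : Set where
      field
        b t₀ t₁ : ℤ
        b≢0 : ¬ (N ∣ᶻ b)
      Ω : ℤ
      Ω = conv b t₁ - conv b t₀
      field
        osc : ∀ b′ → ¬ (N ∣ᶻ b′) → ∀ t t′ → conv b′ t - conv b′ t′ ≤ Ω

    peak : 2 ℕ.≤ p → Peak
    peak 2≤p = go p refl
      where
      ext : ∀ b → ∃[ t₁ ] ∃[ t₀ ] (∀ t t′ → conv b t - conv b t′ ≤ conv b t₁ - conv b t₀)
      ext b = fin p refl
        where
        fin : ∀ m → m ≡ p → ∃[ t₁ ] ∃[ t₀ ] (∀ t t′ → conv b t - conv b t′ ≤ conv b t₁ - conv b t₀)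
        fin zero e = ⊥-elim (ℕ.≢-nonZero⁻¹ p (sym e))
        fin (suc m) e = combine (argmax m (λ i → conv b (+ i))) (argmax m (λ i → - conv b (+ i)))
          where
          r< : ∀ t → rep t ℕ.< suc m
          r< t = subst (rep t ℕ.<_) (sym e) (rep< t)
          combine : _ → _ → _
          combine (i , _ , hi) (j , _ , hj) = + i , + j , λ t t′ → ≤-trans (≤-reflexive (cong₂ _-_ (per-rep (conv-per b) t) (per-rep (conv-per b) t′)))
              (ℤₚ.+-mono-≤ (hi (rep t) (r< t)) (hj (rep t′) (r< t′)))
      o : ℤ → ℤ
      o b = conv b (proj₁ (ext b)) - conv b (proj₁ (proj₂ (ext b)))
      go : ∀ m → m ≡ p → Peak
      go zero e = ⊥-elim (ℕ.≢-nonZero⁻¹ p (sym e))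
      go (suc zero) e = ⊥-elim (ℕₚ.<⇒≱ 2≤p (ℕₚ.≤-reflexive (sym e)))
      go (suc (suc m)) e = combine (argmax m (λ i → o (+ suc i)))
        where
        combine : _ → Peak
        combine (i , l , h) = record { b = + suc i ; t₀ = proj₁ (proj₂ (ext (+ suc i))) ; t₁ = proj₁ (ext (+ suc i))
                   ; b≢0 = small-∤ {i} (subst (suc i ℕ.<_) e (s≤s l))
                   ; osc = λ b′ nb t t′ → all (rep b′) refl nb t t′ }
          where
          all : ∀ r {b′} → r ≡ rep b′ → ¬ (N ∣ᶻ b′) → ∀ t t′ → conv b′ t - conv b′ t′ ≤ o (+ suc i)
          all zero {b′} er nb t t′ = ⊥-elim (nb (divides (quo b′) (trans (rep-≡ b′) (trans (cong (λ z → + z + quo b′ * N) (sym er)) (ℤₚ.+-identityˡ (quo b′ * N))))))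
          all (suc r) {b′} er nb t t′ = ≤-trans (≤-reflexive (cong₂ _-_ (eqb t) (eqb t′))) (≤-trans (proj₂ (proj₂ (ext (+ suc r))) t t′)
                 (h r (ℕₚ.≤-pred (subst₂ ℕ._<_ (sym er) (sym e) (rep< b′)))))
            where
            eqb : ∀ t → conv b′ t ≡ conv (+ suc r) t
            eqb t = trans (per-rep (conv-per′ t) b′) (cong (λ z → conv (+ z) t) (sym er))

    -- w is a first, coarse bound. Because of 8 |A| w ≤ Ω, moving t by w changes `conv` by at most
    -- Ω/8. `near` shows ‖b a‖ ≤ w, and from that `far` obtains the sharper ‖b a‖ < p/J.
    module Use (P : Peak) (Ω≥1 : 1ℤ ≤ Peak.Ω P) (w : ℕ) (w≥1 : 1 ℕ.≤ w) (w≤p : w ℕ.≤ p) (Q<p : suc (p / suc (w ℕ.∸ 1)) ℕ.< p)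
               (8sw : + 8 * (size * + w) ≤ Peak.Ω P) where
      open Peak P

      instance
        w-nz : NonZero w
        w-nz = ℕ.>-nonZero w≥1

      Q : ℕ
      Q = suc (p / w)

      Q<p′ : Q ℕ.< p
      Q<p′ = subst (λ z → suc z ℕ.< p) (go w w≥1) Q<p
        where
        go : ∀ w (h : 1 ℕ.≤ w) → p / suc (w ℕ.∸ 1) ≡ _/_ p w {{ℕ.>-nonZero h}}
        go (suc w) h = refl

      -- Dirichlet's argument: of the Q + 1 multiples 0 y, ..., Q y two have residues in the same
      -- one of Q boxes of length w.
      dirichlet : ∀ y → ∃[ q ] (1 ℕ.≤ q × q ℕ.≤ Q × tri (+ q * y) ≤ + w)
      dirichlet y = go (Finₚ.pigeonhole {Q} {suc Q} ℕₚ.≤-refl box)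
        where
        box< : ∀ i → rep (+ i * y) / w ℕ.< Q
        box< i = s≤s (/-monoˡ-≤ w (ℕₚ.<⇒≤ (rep< (+ i * y))))
        box : Fin (suc Q) → Fin Q
        box i = fromℕ< (box< (toℕ i))
        boxeq : ∀ i j → box i ≡ box j → rep (+ toℕ i * y) / w ≡ rep (+ toℕ j * y) / w
        boxeq i j e = trans (sym (Finₚ.toℕ-fromℕ< (box< (toℕ i)))) (trans (cong toℕ e) (Finₚ.toℕ-fromℕ< (box< (toℕ j))))
        diff : ∀ a b → a / w ≡ b / w → + a - + b ≤ + w
        diff a b e = ≤-by _ (sub≥0 (+≤+ (ℕₚ.<⇒≤ (m%n<n a w))) ⊕ pos {b % w}) (trans (cong₂ (λ y z → + w - (y - z)) (dm a) (trans (dm b) (cong (λ z → + (b % w) + + z * + w) (sym e)))) (eq (+ (a % w)) (+ (b % w)) (+ (a / w)) (+ w)))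
          where
          dm : ∀ a → + a ≡ + (a % w) + + (a / w) * + w
          dm a = trans (cong +_ (m≡m%n+[m/n]*n a w)) (trans (ℤₚ.pos-+ (a % w) (a / w ℕ.* w)) (cong (_+_ (+ (a % w))) (ℤₚ.pos-* (a / w) w)))
          eq : ∀ r s d w → w - ((r + d * w) - (s + d * w)) ≡ (w - r) + s
          eq = solve 4 (λ r s d w → w :- ((r :+ d :* w) :- (s :+ d :* w)) := (w :- r) :+ s) refl
        go : ∃[ i ] ∃[ j ] (toℕ i ℕ.< toℕ j × box i ≡ box j) → ∃[ q ] (1 ℕ.≤ q × q ℕ.≤ Q × tri (+ q * y) ≤ + w)
        go (i , j , l , e) = toℕ j ℕ.∸ toℕ i , ℕₚ.m<n⇒0<n∸m l , ℕₚ.≤-trans (ℕₚ.m∸n≤m (toℕ j) (toℕ i)) (ℕₚ.≤-pred (Finₚ.toℕ<n j)) ,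
            ≤-trans (tri-≤ (+ (toℕ j ℕ.∸ toℕ i) * y) (quo yj - quo yi)) (≤-trans (≤-reflexive (cong abs eqn))
              (abs-≤ (diff (rep yj) (rep yi) (sym (boxeq i j e))) (≤-trans (≤-reflexive (eqm (+ rep yj) (+ rep yi))) (diff (rep yi) (rep yj) (boxeq i j e)))))
          where
          yi = + toℕ i * y
          yj = + toℕ j * y
          eqm : ∀ a b → - (a - b) ≡ b - a
          eqm = solve 2 (λ a b → :- (a :- b) := b :- a) refl
          eqs : ∀ j i y u v n → (j - i) * y - (v - u) * n ≡ (j * y - v * n) - (i * y - u * n)
          eqs = solve 6 (λ j i y u v n → (j :- i) :* y :- (v :- u) :* n := (j :* y :- v :* n) :- (i :* y :- u :* n)) refl
          eqr : ∀ r q n → r + q * n - q * n ≡ r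
          eqr = solve 3 (λ r q n → r :+ q :* n :- q :* n := r) refl
          red : ∀ x → x - quo x * N ≡ + rep x
          red x = trans (cong (_- quo x * N) (rep-≡ x)) (eqr (+ rep x) (quo x) N)
          eqn : + (toℕ j ℕ.∸ toℕ i) * y - (quo yj - quo yi) * N ≡ + rep yj - + rep yi
          eqn = trans (cong (λ z → z * y - (quo yj - quo yi) * N) (trans (sym (ℤₚ.⊖-≥ (ℕₚ.<⇒≤ l))) (sym (ℤₚ.m-n≡m⊖n (toℕ j) (toℕ i)))))
            (trans (eqs (+ toℕ j) (+ toℕ i) y (quo yi) (quo yj) N) (cong₂ _-_ (red yj) (red yi)))

      module Torsion (a : ℤ) (hλ : + 8 * (N * (N * lam a)) ≤ + w * Ω) (q : ℕ) (2≤q : 2 ℕ.≤ q) (q≤Q : q ℕ.≤ Q)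
                     (hq : tri (+ q * (b * a)) ≤ + w) (minimal : ∀ k → k ℕ.< q → ¬ (1 ℕ.≤ k × tri (+ k * (b * a)) ≤ + w)) where
        instance
          q-nz : NonZero q
          q-nz = ℕ.>-nonZero (ℕₚ.≤-trans (s≤s z≤n) 2≤q)

        open Fold p q
        private
          module Qm = Mod q
          module RT = Tri (q ℕ.* p)

        y : ℤ
        y = b * a

        r : ℤ
        r = proj₁ (tri-wit (+ q * y))

        d : ℤ
        d = + q * y - r * N

        abs-d : abs d ≤ + w
        abs-d = ≤-trans (≤-reflexive (sym (proj₂ (tri-wit (+ q * y))))) hq

        -- A common factor g ≥ 2 of r and q would make q/g an admissible multiplier, against the
        -- minimality of q.
        coprime : Coprime ∣ r ∣ q
        coprime {zero} (_ , ℕᵈ.divides k e) = ⊥-elim (ℕ.≢-nonZero⁻¹ q (trans e (ℕₚ.*-zeroʳ k)))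
        coprime {suc zero} _ = refl
        coprime {suc (suc h)} (dr , ℕᵈ.divides zero e) = ⊥-elim (ℕ.≢-nonZero⁻¹ q e)
        coprime {g@(suc (suc h))} (dr , ℕᵈ.divides k@(suc k′) e) = ⊥-elim (minimal k k<q (s≤s z≤n , small (∣ᵤ⇒∣ {+ g} {r} dr)))
          where
          k<q : k ℕ.< q
          k<q = subst (k ℕ.<_) (sym e) (ℕₚ.m<m*n k g (s≤s (s≤s z≤n)))
          small : + g ∣ᶻ r → tri (+ k * y) ≤ + w
          small (divides r′ er) = ≤-trans (tri-≤ (+ k * y) r′) (≤-trans (≤-by (+ suc h * abs z) (pos {suc h} ⊗ abs≥0) (trans (cong (_- abs z) absd) (eqh (+ suc h) (abs z)))) abs-d)
            where
            z = + k * y - r′ * N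
            abs≥0 : 0ℤ ≤ abs z
            abs≥0 = ≤-trans (tri≥0 (+ k * y)) (tri-≤ (+ k * y) r′)
            eqh : ∀ h z → (1ℤ + h) * z - z ≡ h * z
            eqh = solve 2 (λ h z → (con 1ℤ :+ h) :* z :- z := h :* z) refl
            eqd : ∀ k g y r n → k * g * y - r * g * n ≡ g * (k * y - r * n)
            eqd = solve 5 (λ k g y r n → k :* g :* y :- r :* g :* n := g :* (k :* y :- r :* n)) refl
            absd : abs d ≡ + g * abs z
            absd = trans (cong abs (trans (cong₂ (λ u v → u * y - v * N) (trans (cong +_ e) (ℤₚ.pos-* k g)) er) (eqd (+ k) (+ g) y r′ N))) (abs-* z (pos {g}))

        -- By `AA-lo` and `AA-hi` this sum stays close to q `conv b t`, as each of its shifts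
        -- changes `conv` little. Computing it through the fold gives the contradiction.
        AA : ℤ → ℤ
        AA t = ∑ q (λ i → conv b (t + + i * y))

        AA-lo : ∀ t → + 2 * (+ q * conv b t) ≤ + 2 * AA t + N * (+ q * (+ q * lam a))
        AA-lo t = ≤-trans (≤-reflexive (trans (eq₀ (+ q) (conv b t)) (sym (∑-const q (+ 2 * conv b t)))))
            (≤-trans (∑-mono< q {λ _ → + 2 * conv b t} {λ i → + 2 * conv b (t + + i * y) + N * (+ q * lam a)} (λ i l → ≤-trans (conv-down b a t i)
               (≤-by _ (pos {p} ⊗ (sub≥0 (+≤+ (ℕₚ.<⇒≤ l)) ⊗ lam≥0 a)) (eq₁ (+ 2 * conv b (t + + i * y)) N (+ q) (+ i) (lam a)))))
             (≤-reflexive (trans (∑-+ q (λ i → + 2 * conv b (t + + i * y)) (λ _ → N * (+ q * lam a)))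
                (cong₂ _+_ (∑-*ˡ q (+ 2) (λ i → conv b (t + + i * y))) (trans (∑-const q (N * (+ q * lam a))) (eq₂ N (+ q) (lam a)))))))
          where
          eq₀ : ∀ q c → + 2 * (q * c) ≡ q * (+ 2 * c)
          eq₀ = solve 2 (λ q c → con (+ 2) :* (q :* c) := q :* (con (+ 2) :* c)) refl
          eq₁ : ∀ c n q i l → (c + n * (q * l)) - (c + n * (i * l)) ≡ n * ((q - i) * l)
          eq₁ = solve 5 (λ c n q i l → (c :+ n :* (q :* l)) :- (c :+ n :* (i :* l)) := n :* ((q :- i) :* l)) refl
          eq₂ : ∀ n q l → q * (n * (q * l)) ≡ n * (q * (q * l))
          eq₂ = solve 3 (λ n q l → q :* (n :* (q :* l)) := n :* (q :* (q :* l))) refl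

        AA-hi : ∀ t → + 2 * AA t ≤ + 2 * (+ q * conv b t) + N * (+ q * (+ q * lam a))
        AA-hi t = ≤-trans (≤-reflexive (sym (∑-*ˡ q (+ 2) (λ i → conv b (t + + i * y)))))
            (≤-trans (∑-mono< q {λ i → + 2 * conv b (t + + i * y)} {λ _ → + 2 * conv b t + N * (+ q * lam a)} (λ i l → ≤-trans (conv-up b a t i)
               (≤-by _ (pos {p} ⊗ (sub≥0 (+≤+ (ℕₚ.<⇒≤ l)) ⊗ lam≥0 a)) (eq₁ (+ 2 * conv b t) N (+ q) (+ i) (lam a)))))
             (≤-reflexive (trans (∑-const q (+ 2 * conv b t + N * (+ q * lam a))) (eq₂ (conv b t) N (+ q) (lam a)))))
          where
          eq₁ : ∀ c n q i l → (c + n * (q * l)) - (c + n * (i * l)) ≡ n * ((q - i) * l)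
          eq₁ = solve 5 (λ c n q i l → (c :+ n :* (q :* l)) :- (c :+ n :* (i :* l)) := n :* ((q :- i) :* l)) refl
          eq₂ : ∀ c n q l → q * (+ 2 * c + n * (q * l)) ≡ + 2 * (q * c) + n * (q * (q * l))
          eq₂ = solve 4 (λ c n q l → q :* (con (+ 2) :* c :+ n :* (q :* l)) := con (+ 2) :* (q :* c) :+ n :* (q :* (q :* l))) refl

        -- r is invertible mod q, so r i runs through all q parts of the period.
        F-reindex : ∀ Z → ∑ q (λ i → h Z (r * + i)) ≡ F Z
        F-reindex Z = trans (trans (∑-cong q (λ i → cong (h Z) (sym (ℤₚ.+-identityʳ (r * + i))))) (sym (Qm.S-def (λ i → h Z (r * i + 0ℤ))))) (go (coprime-inv r q coprime))
          where
          go : ∃[ r⁻ ] (+ q ∣ᶻ (r * r⁻ - 1ℤ)) → Qm.S (λ i → h Z (r * i + 0ℤ)) ≡ F Z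
          go (r⁻ , dv) = Qm.S-mult (h-per Z) r r⁻ dv 0ℤ

        Z : ℤ → ℤ → ℤ
        Z x t = + q * (b * x + t)

        -- `tri-scale` passes to the wave of period q p. There q y = r p + d moves the i-th
        -- translate to part r i, up to the small error i d.
        point : ∀ x t i → + q * tri (b * x + (t + + i * y)) ≡ RT.tri (Z x t + r * + i * N + + i * d)
        point x t i = trans (sym (tri-scale (b * x + (t + + i * y)))) (cong RT.tri (eq (+ q) (b * x) t (+ i) y r N))
          where
          eq : ∀ q c t i y r n → q * (c + (t + i * y)) ≡ q * (c + t) + r * i * n + i * (q * y - r * n)
          eq = solve 7 (λ q c t i y r n → q :* (c :+ (t :+ i :* y)) := q :* (c :+ t) :+ r :* i :* n :+ i :* (q :* y :- r :* n)) refl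

        i*d : ∀ i → i ℕ.< q → abs (+ i * d) ≤ + q * + w
        i*d i l = ≤-trans (≤-reflexive (abs-* d (pos {i}))) (≤-by _ (sub≥0 (+≤+ (ℕₚ.<⇒≤ l)) ⊗ pos {w} ⊕ pos {i} ⊗ sub≥0 abs-d) (eq (+ q) (+ i) (+ w) (abs d)))
          where
          eq : ∀ q i w d → q * w - i * d ≡ (q - i) * w + i * (w - d)
          eq = solve 4 (λ q i w d → q :* w :- i :* d := (q :- i) :* w :+ i :* (w :- d)) refl

        row-hi : ∀ x t → + q * ∑ q (λ i → tri (b * x + (t + + i * y))) ≤ F (Z x t) + + q * (+ q * + w)
        row-hi x t = ≤-trans (≤-reflexive (sym (∑-*ˡ q (+ q) (λ i → tri (b * x + (t + + i * y))))))
           (≤-trans (∑-mono< q {_} {λ i → h (Z x t) (r * + i) + + q * + w} (λ i l → ≤-trans (≤-reflexive (point x t i))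
                (≤-trans (RT.tri-lip (Z x t + r * + i * N) (+ i * d)) (ℤₚ.+-monoʳ-≤ (h (Z x t) (r * + i)) (i*d i l)))))
             (≤-reflexive (trans (∑-+ q (λ i → h (Z x t) (r * + i)) (λ _ → + q * + w)) (cong₂ _+_ (F-reindex (Z x t)) (∑-const q (+ q * + w))))))

        row-lo : ∀ x t → F (Z x t) ≤ + q * ∑ q (λ i → tri (b * x + (t + + i * y))) + + q * (+ q * + w)
        row-lo x t = ≤-trans (≤-reflexive (sym (F-reindex (Z x t))))
           (≤-trans (∑-mono< q {λ i → h (Z x t) (r * + i)} {λ i → + q * tri (b * x + (t + + i * y)) + + q * + w} (λ i l →
                ≤-trans (≤-trans (≤-reflexive (cong RT.tri (eq (Z x t + r * + i * N) (+ i * d)))) (RT.tri-lip (Z x t + r * + i * N + + i * d) (- (+ i * d))))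
                   (ℤₚ.+-mono-≤ (≤-reflexive (sym (point x t i))) (≤-trans (≤-reflexive (abs-neg (+ i * d))) (i*d i l)))))
             (≤-reflexive (trans (∑-+ q (λ i → + q * tri (b * x + (t + + i * y))) (λ _ → + q * + w)) (cong₂ _+_ (∑-*ˡ q (+ q) (λ i → tri (b * x + (t + + i * y)))) (∑-const q (+ q * + w))))))
          where
          eq : ∀ z c → z ≡ z + c + - c
          eq = solve 2 (λ z c → z := z :+ c :+ :- c) refl

        AA-S : ∀ t → + q * AA t ≡ S (λ x → χ x * (+ q * ∑ q (λ i → tri (b * x + (t + + i * y)))))
        AA-S t = trans (cong (+ q *_) (trans (∑-S-swap q (λ i x → χ x * tri (b * x + (t + + i * y)))) (S-cong (λ x → ∑-*ˡ q (χ x) (λ i → tri (b * x + (t + + i * y)))))))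
           (trans (sym (S-*ˡ (+ q) (λ x → χ x * ∑ q (λ i → tri (b * x + (t + + i * y)))))) (S-cong (λ x → eq (+ q) (χ x) (∑ q (λ i → tri (b * x + (t + + i * y)))))))
          where
          eq : ∀ q c s → q * (c * s) ≡ c * (q * s)
          eq = solve 3 (λ q c s → q :* (c :* s) := c :* (q :* s)) refl

        G : ℤ → ℤ
        G t = S (λ x → χ x * F (Z x t))

        qAA-hi : ∀ t → + q * AA t ≤ G t + size * (+ q * (+ q * + w))
        qAA-hi t = ≤-trans (≤-reflexive (AA-S t)) (≤-trans (S-mono (λ x → ≤-by _ (χ≥0 x ⊗ sub≥0 (row-hi x t)) (eq (χ x) (F (Z x t)) (+ q * (+ q * + w)) (+ q * ∑ q (λ i → tri (b * x + (t + + i * y)))))))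
             (≤-reflexive (trans (S-+ (λ x → χ x * F (Z x t)) (λ x → χ x * (+ q * (+ q * + w)))) (cong (_+_ (G t)) (S-*ʳ (+ q * (+ q * + w)) χ)))))
          where
          eq : ∀ c f e s → (c * f + c * e) - c * s ≡ c * (f + e - s)
          eq = solve 4 (λ c f e s → (c :* f :+ c :* e) :- c :* s := c :* (f :+ e :- s)) refl

        qAA-lo : ∀ t → G t ≤ + q * AA t + size * (+ q * (+ q * + w))
        qAA-lo t = ≤-trans (S-mono (λ x → ≤-by _ (χ≥0 x ⊗ sub≥0 (row-lo x t)) (eq (χ x) (F (Z x t)) (+ q * (+ q * + w)) (+ q * ∑ q (λ i → tri (b * x + (t + + i * y)))))))
             (≤-reflexive (trans (S-+ (λ x → χ x * (+ q * ∑ q (λ i → tri (b * x + (t + + i * y))))) (λ x → χ x * (+ q * (+ q * + w)))) (cong₂ _+_ (sym (AA-S t)) (S-*ʳ (+ q * (+ q * + w)) χ))))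
          where
          eq : ∀ c f e s → (c * s + c * e) - c * f ≡ c * (s + e - f)
          eq = solve 4 (λ c f e s → (c :* s :+ c :* e) :- c :* f := c :* (s :+ e :- f)) refl

        qb≢0 : ¬ (N ∣ᶻ (+ q * b))
        qb≢0 (divides k e) = go (inv b b≢0)
          where
          eq : ∀ q b c → q ≡ q * b * c - q * (b * c - 1ℤ)
          eq = solve 3 (λ q b c → q := q :* b :* c :- q :* (b :* c :- con 1ℤ)) refl
          eq′ : ∀ k n c q m → k * n * c - q * (m * n) ≡ (k * c - q * m) * n
          eq′ = solve 5 (λ k n c q m → k :* n :* c :- q :* (m :* n) := (k :* c :- q :* m) :* n) refl
          not : ∀ q → 1 ℕ.≤ q → q ℕ.< p → ¬ (N ∣ᶻ + q)
          not (suc i) _ l = small-∤ l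
          go : ∃[ c ] (N ∣ᶻ (b * c - 1ℤ)) → ⊥
          go (c , divides m e′) = not q (ℕₚ.≤-trans (s≤s z≤n) 2≤q) (ℕₚ.≤-<-trans q≤Q Q<p′) (divides (k * c - + q * m) (trans (eq (+ q) b c) (trans (cong₂ (λ u v → u * c - + q * v) e e′) (eq′ k N c (+ q) m))))

        -- By `fold-diff` the left side is e times a difference of `conv` for the dilation q b, with
        -- e ∈ {0, 1}. As q b is not 0 mod p, its oscillation is at most Ω.
        G-diff : G t₁ - G t₀ ≤ Ω
        G-diff = go fold-diff
          where
          eq : ∀ q b x t → q * (b * x + t) ≡ q * b * x + q * t
          eq = solve 4 (λ q b x t → q :* (b :* x :+ t) := q :* b :* x :+ q :* t) refl
          eq₁ : ∀ c f g → c * f - c * g ≡ c * (f - g)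
          eq₁ = solve 3 (λ c f g → c :* f :- c :* g := c :* (f :- g)) refl
          eq₂ : ∀ c e f g → c * (e * (f - g)) ≡ e * (c * f - c * g)
          eq₂ = solve 4 (λ c e f g → c :* (e :* (f :- g)) := e :* (c :* f :- c :* g)) refl
          eq₃ : ∀ o e c → o - e * c ≡ e * (o - c) + (1ℤ - e) * o
          eq₃ = solve 3 (λ o e c → o :- e :* c := e :* (o :- c) :+ (con 1ℤ :- e) :* o) refl
          go : ∃[ e ] (0ℤ ≤ e × e ≤ 1ℤ × (∀ X X′ → F X - F X′ ≡ e * (tri X - tri X′))) → G t₁ - G t₀ ≤ Ω
          go (e , e0 , e1 , fd) = ≤-trans (≤-reflexive (trans (sym (S-- (λ x → χ x * F (Z x t₁)) (λ x → χ x * F (Z x t₀))))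
              (trans (S-cong (λ x → trans (eq₁ (χ x) (F (Z x t₁)) (F (Z x t₀))) (trans (cong (χ x *_) (fd (Z x t₁) (Z x t₀)))
                 (trans (eq₂ (χ x) e (tri (Z x t₁)) (tri (Z x t₀))) (cong₂ (λ u v → e * (χ x * tri u - χ x * tri v)) (eq (+ q) b x t₁) (eq (+ q) b x t₀))))))
               (trans (S-*ˡ e (λ x → χ x * tri (+ q * b * x + + q * t₁) - χ x * tri (+ q * b * x + + q * t₀)))
                 (cong (e *_) (S-- (λ x → χ x * tri (+ q * b * x + + q * t₁)) (λ x → χ x * tri (+ q * b * x + + q * t₀))))))))
            (≤-by _ (e0 ⊗ sub≥0 (osc (+ q * b) qb≢0 (+ q * t₁) (+ q * t₀)) ⊕ sub≥0 e1 ⊗ ≤-trans (+≤+ z≤n) Ω≥1) (eq₃ Ω e (conv (+ q * b) (+ q * t₁) - conv (+ q * b) (+ q * t₀))))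

        4Nqλ : + 4 * (N * (+ q * lam a)) ≤ Ω
        4Nqλ = *-cancel-≤ {+ w} (+≤+ w≥1) (≤-trans (≤-by _ ((pos {4} ⊗ pos {p}) ⊗ (sub≥0 qw ⊗ lam≥0 a)) (eq (+ w) N (+ q) (lam a))) hλ)
          where
          eq : ∀ w n q l → + 8 * (n * (n * l)) - w * (+ 4 * (n * (q * l))) ≡ (+ 4 * n) * ((+ 2 * n - q * w) * l)
          eq = solve 4 (λ w n q l → con (+ 8) :* (n :* (n :* l)) :- w :* (con (+ 4) :* (n :* (q :* l))) := (con (+ 4) :* n) :* ((con (+ 2) :* n :- q :* w) :* l)) refl
          qw : + q * + w ≤ + 2 * N
          qw = ≤-trans (≤-reflexive (sym (ℤₚ.pos-* q w))) (≤-trans (+≤+ (ℕₚ.≤-trans (ℕₚ.*-monoˡ-≤ w q≤Q) (ℕₚ.+-mono-≤ w≤p (m/n*n≤m p w)))) (≤-reflexive (trans (ℤₚ.pos-+ p p) (eq₂ N))))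
            where
            eq₂ : ∀ n → n + n ≡ + 2 * n
            eq₂ = solve 1 (λ n → n :+ n := con (+ 2) :* n) refl

        absurd : ⊥
        -- By `8sw` and `4Nqλ` both error terms are at most q²Ω/4, whence (q² - 1) Ω ≤ q²Ω/2,
        -- impossible for q ≥ 2 and Ω ≥ 1.
        absurd = ≤-absurd {0ℤ} {0ℤ} ≤-refl (≤-by _ (
               (pos {2} ⊗ pos {q}) ⊗ sub≥0 (AA-lo t₁) ⊕ (pos {2} ⊗ pos {q}) ⊗ sub≥0 (AA-hi t₀)
               ⊕ pos {4} ⊗ sub≥0 (qAA-hi t₁) ⊕ pos {4} ⊗ sub≥0 (qAA-lo t₀) ⊕ pos {4} ⊗ sub≥0 G-diff
               ⊕ (pos {q} ⊗ pos {q}) ⊗ sub≥0 4Nqλ ⊕ (pos {q} ⊗ pos {q}) ⊗ sub≥0 8sw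
               ⊕ pos {2} ⊗ (((sub≥0 2≤ ⊗ sub≥0 2≤) ⊕ pos {4} ⊗ sub≥0 2≤) ⊗ Ω≥0) ⊕ pos {3} ⊗ Ω≥0 ⊕ sub≥0 Ω≥1)
               (eq (+ q) (conv b t₁) (conv b t₀) (AA t₁) (AA t₀) (G t₁) (G t₀) N (lam a) size (+ w)))
          where
          2≤ : + 2 ≤ + q
          2≤ = +≤+ 2≤q
          Ω≥0 : 0ℤ ≤ Ω
          Ω≥0 = ≤-trans (+≤+ z≤n) Ω≥1
          eq : ∀ q c₁ c₀ A₁ A₀ G₁ G₀ n l s w → 0ℤ - (1ℤ + 0ℤ) ≡
               + 2 * q * (+ 2 * A₁ + n * (q * (q * l)) - + 2 * (q * c₁)) + + 2 * q * (+ 2 * (q * c₀) + n * (q * (q * l)) - + 2 * A₀)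
               + + 4 * (G₁ + s * (q * (q * w)) - q * A₁) + + 4 * (q * A₀ + s * (q * (q * w)) - G₀) + + 4 * ((c₁ - c₀) - (G₁ - G₀))
               + q * q * ((c₁ - c₀) - + 4 * (n * (q * l))) + q * q * ((c₁ - c₀) - + 8 * (s * w))
               + + 2 * (((q - + 2) * (q - + 2) + + 4 * (q - + 2)) * (c₁ - c₀)) + + 3 * (c₁ - c₀) + ((c₁ - c₀) - 1ℤ)
          eq = solve 11 (λ q c₁ c₀ A₁ A₀ G₁ G₀ n l s w → con 0ℤ :- (con 1ℤ :+ con 0ℤ) := con (+ 2) :* q :* (con (+ 2) :* A₁ :+ n :* (q :* (q :* l)) :- con (+ 2) :* (q :* c₁)) :+ con (+ 2) :* q :* (con (+ 2) :* (q :* c₀) :+ n :* (q :* (q :* l)) :- con (+ 2) :* A₀) :+ con (+ 4) :* (G₁ :+ s :* (q :* (q :* w)) :- q :* A₁) :+ con (+ 4) :* (q :* A₀ :+ s :* (q :* (q :* w)) :- G₀) :+ con (+ 4) :* ((c₁ :- c₀) :- (G₁ :- G₀)) :+ q :* q :* ((c₁ :- c₀) :- con (+ 4) :* (n :* (q :* l))) :+ q :* q :* ((c₁ :- c₀) :- con (+ 8) :* (s :* w)) :+ con (+ 2) :* (((q :- con (+ 2)) :* (q :- con (+ 2)) :+ con (+ 4) :* (q :- con (+ 2))) :* (c₁ :- c₀)) :+ con (+ 3) :* (c₁ :- c₀) :+ ((c₁ :- c₀) :- con 1ℤ)) refl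

      -- Let q be least with tri (q b a) ≤ w. If q were at least 2, averaging over the translates by 0, a, …, (q − 1) a and folding
      -- the period into q parts would give (q² − 1) Ω ≤ 2 |A| q² w + p q³ lam a, which is too small.
      near : ∀ a → + 8 * (N * (N * lam a)) ≤ + w * Ω → tri (b * a) ≤ + w
      near a hλ = go (dirichlet (b * a))
        where
        P? : ∀ k → Dec (1 ℕ.≤ k × tri (+ k * (b * a)) ≤ + w)
        P? k with 1 ℕ.≤? k | tri (+ k * (b * a)) ℤₚ.≤? + w
        ... | yes u | yes v = yes (u , v)
        ... | no u | _ = no (λ z → u (proj₁ z))
        ... | _ | no v = no (λ z → v (proj₂ z))
        go : ∃[ q ] (1 ℕ.≤ q × q ℕ.≤ Q × tri (+ q * (b * a)) ≤ + w) → tri (b * a) ≤ + w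
        go (q , q1 , qQ , hq) = go′ (least P? q (q1 , hq))
          where
          go′ : ∃[ m ] (m ℕ.≤ q × (1 ℕ.≤ m × tri (+ m * (b * a)) ≤ + w) × (∀ k → k ℕ.< m → ¬ (1 ℕ.≤ k × tri (+ k * (b * a)) ≤ + w))) → tri (b * a) ≤ + w
          go′ (zero , _ , (() , _) , _)
          go′ (suc zero , _ , (_ , hm) , _) = ≤-trans (≤-reflexive (cong tri (sym (ℤₚ.*-identityˡ (b * a))))) hm
          go′ (m@(suc (suc _)) , mq , (_ , hm) , mn) = ⊥-elim (Torsion.absurd a hλ m (s≤s (s≤s z≤n)) (ℕₚ.≤-trans mq qQ) hm mn)

      -- If ‖b a‖ J were at least p, at most J steps of length ‖b a‖ would lead from t₀ to within ‖b
      -- a‖ ≤ w of t₁. The steps raise `conv` by at most p J L / 2 ≤ Ω/2 and the remainder by at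
      -- most |A| w ≤ Ω/8, which is less than the required Ω.
      far : ∀ a L J → lam a ≤ + L → N * (+ J * + L) ≤ Ω → tri (b * a) ≤ + w → 1ℤ + tri (b * a) * + J ≤ N
      far a L J hL hJ ht = go (≤-or N (tri (b * a) * + J)) (≥0⇒pos (tri≥0 (b * a))) (tri-wit (b * a))
        where
        y = b * a
        go : N ≤ tri y * + J ⊎ 1ℤ + tri y * + J ≤ N → ∃[ n ] tri y ≡ + n → ∃[ k ] tri y ≡ abs (y - k * N) → 1ℤ + tri y * + J ≤ N
        go (inj₂ h) _ _ = h
        go (inj₁ h) (zero , e) _ = ⊥-elim (zero-case p refl (≤-trans h (≤-reflexive (trans (cong (_* + J) e) (ℤₚ.*-zeroˡ (+ J))))))
          where
          zero-case : ∀ m → m ≡ p → N ≤ 0ℤ → ⊥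
          zero-case zero e _ = ℕ.≢-nonZero⁻¹ p (sym e)
          zero-case (suc m) refl (+≤+ ())
        go (inj₁ h) (τ@(suc _) , e) (k , ek) = ⊥-elim (body (abs-≡ (y - k * N)))
          where
          body : ∃[ σ ] (σ * σ ≡ 1ℤ × y - k * N ≡ σ * abs (y - k * N)) → ⊥
          body (σ , σσ , eσ) = ≤-absurd {0ℤ} {0ℤ} ≤-refl (≤-by _
                (pos {8} ⊗ sub≥0 lip ⊕ pos {4} ⊗ sub≥0 (conv-up b a t₀ j) ⊕ (pos {4} ⊗ pos {p}) ⊗ (sub≥0 jJ ⊗ lam≥0 a) ⊕ ((pos {4} ⊗ pos {p}) ⊗ pos {J}) ⊗ sub≥0 hL ⊕ pos {4} ⊗ sub≥0 hJ
                 ⊕ pos {8} ⊗ (size≥0 ⊗ sub≥0 ρw) ⊕ sub≥0 8sw ⊕ pos {3} ⊗ sub≥0 Ω≥1 ⊕ pos {2})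
                (eq (conv b t₁) (conv b t₀) (conv b (t₀ + + j * y)) size (abs (σ * + ρ)) (+ w) N (+ j) (+ J) (lam a) (+ L)))
            where
            z : ℕ
            z = rep (σ * (t₁ - t₀))
            -- σ is the sign of the representative of b a nearest to 0 and τ its absolute value. The
            -- distance z from t₀ to t₁ in the direction σ is j steps of length τ and a rest ρ < τ.
            j ρ : ℕ
            j = z / τ
            ρ = z % τ
            zE : + z ≡ + ρ + + j * + τ
            zE = trans (cong +_ (m≡m%n+[m/n]*n z τ)) (trans (ℤₚ.pos-+ ρ (j ℕ.* τ)) (cong (_+_ (+ ρ)) (ℤₚ.pos-* j τ)))
            yE : y ≡ σ * + τ + k * N
            yE = trans (e₀ y (k * N)) (cong (_+ k * N) (trans eσ (cong (σ *_) (trans (sym ek) e))))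
              where
              e₀ : ∀ y c → y ≡ y - c + c
              e₀ = solve 2 (λ y c → y := y :- c :+ c) refl
            t₁E : conv b t₁ ≡ conv b (t₀ + + j * y + σ * + ρ)
            t₁E = per-≡ (conv-per b) (divides (σ * quo (σ * (t₁ - t₀)) - + j * k) (trans (cong (λ z → t₁ - (t₀ + + j * z + σ * + ρ)) yE)
                (trans (e₁ t₁ t₀ σ (+ j) (+ τ) k N (+ ρ)) (trans (cong (λ z → 1ℤ * (t₁ - t₀) - σ * z - + j * k * N) (sym zE))
                 (trans (cong (λ s → s * (t₁ - t₀) - σ * + z - + j * k * N) (sym σσ)) (trans (e₂ σ (t₁ - t₀) (+ z) (+ j * k * N))
                   (trans (cong (λ s → σ * (s - + z) - + j * k * N) (rep-≡ (σ * (t₁ - t₀)))) (e₃ σ (+ z) (quo (σ * (t₁ - t₀))) N (+ j) k))))))))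
              where
              e₁ : ∀ t u σ j τ k n ρ → t - (u + j * (σ * τ + k * n) + σ * ρ) ≡ 1ℤ * (t - u) - σ * (ρ + j * τ) - j * k * n
              e₁ = solve 8 (λ t u σ j τ k n ρ → t :- (u :+ j :* (σ :* τ :+ k :* n) :+ σ :* ρ) := con 1ℤ :* (t :- u) :- σ :* (ρ :+ j :* τ) :- j :* k :* n) refl
              e₂ : ∀ σ d z c → σ * σ * d - σ * z - c ≡ σ * (σ * d - z) - c
              e₂ = solve 4 (λ σ d z c → σ :* σ :* d :- σ :* z :- c := σ :* (σ :* d :- z) :- c) refl
              e₃ : ∀ σ z q n j k → σ * (z + q * n - z) - j * k * n ≡ (σ * q - j * k) * n
              e₃ = solve 6 (λ σ z q n j k → σ :* (z :+ q :* n :- z) :- j :* k :* n := (σ :* q :- j :* k) :* n) refl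
            lip : conv b t₁ ≤ conv b (t₀ + + j * y) + size * abs (σ * + ρ)
            lip = ≤-trans (≤-reflexive t₁E) (conv-lip b (t₀ + + j * y) (σ * + ρ))
            absσ : abs (σ * + ρ) ≤ + ρ
            absσ = sgn (abs-cases (σ * + ρ))
              where
              σ≤1 : ∀ s → s * s ≡ 1ℤ → s ≤ 1ℤ × - s ≤ 1ℤ
              σ≤1 (+ zero) ()
              σ≤1 (+ suc zero) _ = ≤-refl , _≤_.-≤+
              σ≤1 (+ suc (suc n)) ()
              σ≤1 -[1+ zero ] _ = _≤_.-≤+ , ≤-refl
              σ≤1 -[1+ suc n ] ()
              e₄ : ∀ s r → r - s * r ≡ (1ℤ - s) * r
              e₄ = solve 2 (λ s r → r :- s :* r := (con 1ℤ :- s) :* r) refl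
              e₅ : ∀ s r → r - - (s * r) ≡ (1ℤ - - s) * r
              e₅ = solve 2 (λ s r → r :- :- (s :* r) := (con 1ℤ :- :- s) :* r) refl
              sgn : _ → _
              sgn _ = abs-≤ (≤-by _ (sub≥0 (proj₁ (σ≤1 σ σσ)) ⊗ pos {ρ}) (e₄ σ (+ ρ))) (≤-by _ (sub≥0 (proj₂ (σ≤1 σ σσ)) ⊗ pos {ρ}) (e₅ σ (+ ρ)))
            ρw : abs (σ * + ρ) ≤ + w
            ρw = ≤-trans absσ (≤-trans (+≤+ (ℕₚ.<⇒≤ (m%n<n z τ))) (≤-trans (≤-reflexive (sym e)) ht))
            jJ : + j ≤ + J
            jJ = +≤+ (ℕₚ.<⇒≤ (m<n*o⇒m/o<n (ℕₚ.<-≤-trans (rep< (σ * (t₁ - t₀))) (+≤+⁻ (≤-trans h (≤-reflexive (trans (cong (_* + J) e) (trans (sym (ℤₚ.pos-* τ J)) (cong +_ (ℕₚ.*-comm τ J))))))))))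
            eq : ∀ c₁ c₀ cj s u w n j J l L → 0ℤ - (1ℤ + 0ℤ) ≡
                 + 8 * (cj + s * u - c₁) + + 4 * (+ 2 * c₀ + n * (j * l) - + 2 * cj) + + 4 * n * ((J - j) * l) + + 4 * n * J * (L - l) + + 4 * ((c₁ - c₀) - n * (J * L))
                 + + 8 * (s * (w - u)) + ((c₁ - c₀) - + 8 * (s * w)) + + 3 * ((c₁ - c₀) - 1ℤ) + + 2
            eq = solve 11 (λ c₁ c₀ cj s u w n j J l L → con 0ℤ :- (con 1ℤ :+ con 0ℤ) := con (+ 8) :* (cj :+ s :* u :- c₁) :+ con (+ 4) :* (con (+ 2) :* c₀ :+ n :* (j :* l) :- con (+ 2) :* cj) :+ con (+ 4) :* n :* ((J :- j) :* l) :+ con (+ 4) :* n :* J :* (L :- l) :+ con (+ 4) :* ((c₁ :- c₀) :- n :* (J :* L)) :+ con (+ 8) :* (s :* (w :- u)) :+ ((c₁ :- c₀) :- con (+ 8) :* (s :* w)) :+ con (+ 3) :* ((c₁ :- c₀) :- con 1ℤ) :+ con (+ 2)) refl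

-- Arithmetic progressions of subsums

module Progressions where

  open import Data.Integer using (_+_; _-_; _*_; -_; _≤_)
  open ℤₚ using (≤-trans; ≤-refl; ≤-reflexive)
  open IntegerSums

  module PermSolver {E : Set} = Algebra.Solver.CommutativeMonoid (++-commutativeMonoid {A = E})

  module _ {A : Set} where

    split : ∀ {P : A → Set} → (∀ x → Dec (P x)) → ∀ xs → ∃[ ys ] ∃[ zs ] (xs ↭ ys ++ zs × All P ys × All (λ x → ¬ P x) zs)
    split P? [] = [] , [] , ↭-refl , [] , []
    split P? (x ∷ xs) with P? x | split P? xs
    ... | yes h | ys , zs , e , a , b = x ∷ ys , zs , prep x e , h ∷ a , b
    ... | no h | ys , zs , e , a , b = ys , x ∷ zs , ↭-trans (prep x e) (↭-sym (shift x ys zs)) , a , h ∷ b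

    find : ∀ {P : A → Set} → (∀ x → Dec (P x)) → ∀ xs → (∃[ y ] ∃[ zs ] (xs ↭ y ∷ zs × P y)) ⊎ All (λ x → ¬ P x) xs
    find P? xs with split P? xs
    ... | [] , zs , e , _ , b = inj₂ (All-resp-↭ (↭-sym e) b)
    ... | y ∷ ys , zs , e , h ∷ _ , _ = inj₁ (y , ys ++ zs , e , h)

    takeN : ∀ n (xs : List A) → n ℕ.≤ length xs → ∃[ ys ] ∃[ zs ] (xs ≡ ys ++ zs × length ys ≡ n)
    takeN zero xs _ = [] , xs , refl , refl
    takeN (suc n) (x ∷ xs) (s≤s l) with takeN n xs l
    ... | ys , zs , e , h = x ∷ ys , zs , cong (x ∷_) e , cong suc h

    pigeonhole : ∀ K c (f : A → ℕ) xs → All (λ x → f x ℕ.< K) xs → K ℕ.* c ℕ.< length xs →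
                 ∃[ k ] ∃[ ys ] ∃[ zs ] (xs ↭ ys ++ zs × All (λ x → f x ≡ k) ys × c ℕ.< length ys)
    pigeonhole zero c f (x ∷ xs) (() ∷ _) l
    pigeonhole (suc K) c f xs h l with split (λ x → f x ℕ.≟ K) xs
    ... | ys , zs , e , a , b with c ℕₚ.<? length ys
    ...   | yes lt = K , ys , zs , e , a , lt
    ...   | no nlt = lift (pigeonhole K c f zs small big)
      where
      small : All (λ x → f x ℕ.< K) zs
      small = All.zipWith (λ { (s≤s l , n) → ℕₚ.≤∧≢⇒< l n }) (Allₚ.++⁻ʳ ys (All-resp-↭ e h) , b)
      big : K ℕ.* c ℕ.< length zs
      big = ℕₚ.+-cancelˡ-< c (K ℕ.* c) (length zs) (ℕₚ.<-≤-trans l (ℕₚ.≤-trans (ℕₚ.≤-reflexive (trans (↭-length e) (Listₚ.length-++ ys))) (ℕₚ.+-monoˡ-≤ (length zs) (ℕₚ.≮⇒≥ nlt))))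
      lift : _ → _
      lift (k , us , vs , e′ , a′ , l′) = k , us , vs ++ ys , ↭-trans e (↭-trans (++-comm ys zs) (↭-trans (++⁺ʳ ys e′) (++-assoc us vs ys))) , a′ , l′

    minimum : ∀ (f : A → ℕ) xs → 1 ℕ.≤ length xs → ∃[ x ] ∃[ ys ] (xs ↭ x ∷ ys × All (λ y → f x ℕ.≤ f y) ys)
    minimum f (x ∷ []) _ = x , [] , ↭-refl , []
    minimum f (x ∷ x′ ∷ xs) _ with minimum f (x′ ∷ xs) (s≤s z≤n)
    ... | y , ys , e , h with ℕₚ.≤-total (f x) (f y)
    ...   | inj₁ l = x , y ∷ ys , prep x e , l ∷ All.map (ℕₚ.≤-trans l) h
    ...   | inj₂ l = y , x ∷ ys , ↭-trans (prep x e) (swap x y ↭-refl) , l ∷ h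

  -- 1 stands for failure, so that `cnt` counts the elements not divisible by e.
  bit : ∀ {P : Set} → Dec P → ℕ
  bit (yes _) = 0
  bit (no _) = 1

  bit≤1 : ∀ {P : Set} (h : Dec P) → bit h ℕ.≤ 1
  bit≤1 (yes _) = z≤n
  bit≤1 (no _) = s≤s z≤n

  bit-yes : ∀ {P : Set} (h : Dec P) → P → bit h ≡ 0
  bit-yes (yes _) _ = refl
  bit-yes (no n) h = ⊥-elim (n h)

  -- min(z, 0), the lower of the two subsums 0 and z of a single term.
  base : ℤ → ℤ
  base (+ n) = 0ℤ
  base -[1+ n ] = -[1+ n ]

  module _ {E : Set} where

    sumv : (E → ℤ) → List E → ℤ
    sumv v [] = 0ℤ
    sumv v (x ∷ xs) = v x + sumv v xs

    sumv-++ : ∀ v xs ys → sumv v (xs ++ ys) ≡ sumv v xs + sumv v ys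
    sumv-++ v [] ys = sym (ℤₚ.+-identityˡ (sumv v ys))
    sumv-++ v (x ∷ xs) ys = trans (cong (_+_ (v x)) (sumv-++ v xs ys)) (sym (ℤₚ.+-assoc (v x) (sumv v xs) (sumv v ys)))

    sumv-↭ : ∀ v {xs ys} → xs ↭ ys → sumv v xs ≡ sumv v ys
    sumv-↭ v Perm.refl = refl
    sumv-↭ v (prep x p) = cong (_+_ (v x)) (sumv-↭ v p)
    sumv-↭ v (swap {xs} {ys} x y p) = trans (cong (λ z → v x + (v y + z)) (sumv-↭ v p)) (eq (v x) (v y) (sumv v ys))
      where
      eq : ∀ a b c → a + (b + c) ≡ b + (a + c)
      eq = solve 3 (λ a b c → a :+ (b :+ c) := b :+ (a :+ c)) refl
    sumv-↭ v (Perm.trans p q) = trans (sumv-↭ v p) (sumv-↭ v q)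

    -- The empty subsequence is allowed; where a non-empty one is required, a term is set aside
    -- later.
    Real : (E → ℤ) → List E → ℤ → Set
    Real v L z = ∃[ C ] ∃[ C′ ] (L ↭ C ++ C′ × sumv v C ≡ z)

    real-++ : ∀ v {L L′ z z′} → Real v L z → Real v L′ z′ → Real v (L ++ L′) (z + z′)
    real-++ v (C , C′ , e , s) (D , D′ , f , t) = C ++ D , C′ ++ D′ , ↭-trans (++⁺ e f) (perm C C′ D D′) , trans (sumv-++ v C D) (cong₂ _+_ s t)
      where
      perm : ∀ (a b c d : List E) → (a ++ b) ++ (c ++ d) ↭ (a ++ c) ++ (b ++ d)
      perm = PS.solve 4 (λ a b c d → ((a PS.⊕ b) PS.⊕ (c PS.⊕ d)) PS.⊜ ((a PS.⊕ c) PS.⊕ (b PS.⊕ d))) ↭-refl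
        where module PS = PermSolver

    real-↭ : ∀ v {L L′ z} → L ↭ L′ → Real v L z → Real v L′ z
    real-↭ v e (C , C′ , f , s) = C , C′ , ↭-trans (↭-sym e) f , s

    real-none : ∀ v L → Real v L 0ℤ
    real-none v L = [] , L , ↭-refl , refl

    real-all : ∀ v L → Real v L (sumv v L)
    real-all v L = L , [] , ↭-sym (++-identityʳ L) , refl

    real-≡ : ∀ v {L z z′} → z ≡ z′ → Real v L z → Real v L z′
    real-≡ v refl h = h

    real-weak : ∀ v {L z} L′ → Real v L z → Real v (L ++ L′) z
    real-weak v {L} {z} L′ h = real-≡ v (ℤₚ.+-identityʳ z) (real-++ v h (real-none v L′))

    -- ℓ counts the steps, so there are ℓ + 1 terms.
    record AP (v : E → ℤ) (U : List E) (u : ℤ) (d ℓ : ℕ) : Set where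
      constructor progression
      field at : ∀ i → i ℕ.≤ ℓ → Real v U (u + + i * + d)

    open AP

    AP-↭ : ∀ v {U U′ u d ℓ} → U ↭ U′ → AP v U u d ℓ → AP v U′ u d ℓ
    AP-↭ v e h = progression λ i l → real-↭ v e (at h i l)

    AP-weak : ∀ v {U u d ℓ} L → AP v U u d ℓ → AP v (U ++ L) u d ℓ
    AP-weak v L h = progression λ i l → real-weak v L (at h i l)

    -- Two subsums of a few elements that differ by δ: interchanging them moves a subsum by δ.
    record Gadget (v : E → ℤ) (W : ℕ) : Set where
      field
        es : List E
        β : ℤ
        δ : ℕ
        lo : Real v es β
        hi : Real v es (β + + δ)
        δ≥1 : 1 ℕ.≤ δ
        δ≤W : δ ℕ.≤ W

    open Gadget

    elems : ∀ {v W} → List (Gadget v W) → List E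
    elems [] = []
    elems (γ ∷ γs) = es γ ++ elems γs

    sumβ : ∀ {v W} → List (Gadget v W) → ℤ
    sumβ [] = 0ℤ
    sumβ (γ ∷ γs) = β γ + sumβ γs

    sumδ : ∀ {v W} → ℕ → List (Gadget v W) → ℕ
    sumδ zero γs = 0
    sumδ (suc j) [] = 0
    sumδ (suc j) (γ ∷ γs) = δ γ ℕ.+ sumδ j γs

    elems-++ : ∀ {v W} (γs γs′ : List (Gadget v W)) → elems (γs ++ γs′) ≡ elems γs ++ elems γs′
    elems-++ [] γs′ = refl
    elems-++ (γ ∷ γs) γs′ = trans (cong (es γ ++_) (elems-++ γs γs′)) (sym (Listₚ.++-assoc (es γ) (elems γs) (elems γs′)))

    elems-↭ : ∀ {v W} {γs γs′ : List (Gadget v W)} → γs ↭ γs′ → elems γs ↭ elems γs′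
    elems-↭ Perm.refl = ↭-refl
    elems-↭ (prep γ p) = ++⁺ˡ (es γ) (elems-↭ p)
    elems-↭ (swap γ γ′ p) = ↭-trans (++⁺ˡ (es γ) (++⁺ˡ (es γ′) (elems-↭ p))) (shifts (es γ) (es γ′))
    elems-↭ (Perm.trans p q) = ↭-trans (elems-↭ p) (elems-↭ q)

    prefix-real : ∀ {v W} (γs : List (Gadget v W)) j → Real v (elems γs) (sumβ γs + + sumδ j γs)
    prefix-real {v} [] zero = real-none v []
    prefix-real {v} [] (suc j) = real-none v []
    prefix-real {v} (γ ∷ γs) zero = real-≡ v (eq (β γ) (sumβ γs)) (real-++ v (lo γ) (prefix-real γs zero))
      where
      eq : ∀ a b → a + (b + 0ℤ) ≡ a + b + 0ℤ
      eq = solve 2 (λ a b → a :+ (b :+ con 0ℤ) := a :+ b :+ con 0ℤ) refl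
    prefix-real {v} (γ ∷ γs) (suc j) = real-≡ v (trans (eq (β γ) (+ δ γ) (sumβ γs) (+ sumδ j γs)) (cong (_+_ (β γ + sumβ γs)) (sym (ℤₚ.pos-+ (δ γ) (sumδ j γs))))) (real-++ v (hi γ) (prefix-real γs j))
      where
      eq : ∀ a b c d → a + b + (c + d) ≡ a + c + (b + d)
      eq = solve 4 (λ a b c d → a :+ b :+ (c :+ d) := a :+ c :+ (b :+ d)) refl

    -- The lower and the upper subsum of the gadget give two copies of the progression, k steps
    -- apart; for k ≤ ℓ + 1 their union has no gap.
    extend : ∀ v {W U u d ℓ} → AP v U u d ℓ → (γ : Gadget v W) → ∀ k → δ γ ≡ k ℕ.* d → k ℕ.≤ suc ℓ → AP v (U ++ es γ) (u + β γ) d (ℓ ℕ.+ k)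
    extend v {W} {U} {u} {d} {ℓ} ap γ k e kl = progression λ i l → go i l (i ℕₚ.≤? ℓ)
     where
     go : ∀ i → i ℕ.≤ ℓ ℕ.+ k → Dec (i ℕ.≤ ℓ) → Real v (U ++ es γ) (u + β γ + + i * + d)
     go i l (yes il) = real-≡ v (eq u (β γ) (+ i * + d)) (real-++ v (at ap i il) (lo γ))
      where
      eq : ∀ u b c → u + c + b ≡ u + b + c
      eq = solve 3 (λ u b c → u :+ c :+ b := u :+ b :+ c) refl
     go i l (no il) = real-≡ v (trans (cong (λ z → u + + (i ℕ.∸ k) * + d + (β γ + z)) (trans (cong +_ e) (ℤₚ.pos-* k d)))
            (trans (eq u (+ (i ℕ.∸ k)) (+ k) (+ d) (β γ)) (cong (λ z → u + β γ + z * + d) (trans (sym (ℤₚ.pos-+ (i ℕ.∸ k) k)) (cong +_ (ℕₚ.m∸n+n≡m (ℕₚ.≤-trans kl (ℕₚ.≰⇒> il))))))))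
         (real-++ v (at ap (i ℕ.∸ k) (ℕₚ.≤-trans (ℕₚ.∸-monoˡ-≤ k l) (ℕₚ.≤-reflexive (ℕₚ.m+n∸n≡m ℓ k)))) (hi γ))
      where
      eq : ∀ u i k d b → u + i * d + (b + k * d) ≡ u + b + (i + k) * d
      eq = solve 5 (λ u i k d b → u :+ i :* d :+ (b :+ k :* d) := u :+ b :+ (i :+ k) :* d) refl

    AP-const : ∀ v {W} d (γs : List (Gadget v W)) → All (λ γ → δ γ ≡ d) γs → AP v (elems γs) (sumβ γs) d (length γs)
    AP-const v d γs h = progression λ i l → real-≡ v (cong (_+_ (sumβ γs)) (trans (cong +_ (go i γs h l)) (ℤₚ.pos-* i d))) (prefix-real γs i)
      where
      go : ∀ i {W} (γs : List (Gadget v W)) → All (λ γ → δ γ ≡ d) γs → i ℕ.≤ length γs → sumδ i γs ≡ i ℕ.* d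
      go zero γs h l = refl
      go (suc i) (γ ∷ γs) (e ∷ h) (s≤s l) = cong₂ ℕ._+_ e (go i γs h l)

    module Refine {v : E → ℤ} {W : ℕ} (d ρ : ℕ) .{{_ : NonZero d}} (ρ≥1 : 1 ℕ.≤ ρ) (ρ<d : ρ ℕ.< d) where

      g : ℕ
      g = gcd ρ d

      g≥1 : 1 ℕ.≤ g
      g≥1 = ℕₚ.n≢0⇒n>0 (gcd[m,n]≢0 ρ d (inj₁ (λ e → ℕₚ.<⇒≢ ρ≥1 (sym e))))

      g∣d : g ℕᵈ.∣ d
      g∣d = gcd[m,n]∣n ρ d

      2g≤d : 2 ℕ.* g ℕ.≤ d
      2g≤d = go g∣d
        where
        g≤ρ : g ℕ.≤ ρ
        g≤ρ = ℕᵈ.∣⇒≤ {{ℕ.>-nonZero ρ≥1}} (gcd[m,n]∣m ρ d)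
        go : g ℕᵈ.∣ d → 2 ℕ.* g ℕ.≤ d
        go (ℕᵈ.divides zero e) = ⊥-elim (ℕₚ.<⇒≱ ρ<d (ℕₚ.≤-trans (ℕₚ.≤-reflexive e) z≤n))
        go (ℕᵈ.divides (suc zero) e) = ⊥-elim (ℕₚ.<⇒≱ ρ<d (ℕₚ.≤-trans (ℕₚ.≤-reflexive (trans e (ℕₚ.*-identityˡ g))) g≤ρ))
        go (ℕᵈ.divides (suc (suc k)) e) = ℕₚ.≤-trans (ℕₚ.*-monoˡ-≤ g {2} {suc (suc k)} (s≤s (s≤s z≤n))) (ℕₚ.≤-reflexive (sym e))

      bez : ∃[ x ] (+ d ∣ᶻ (x * + ρ - + g))
      bez = go (Bézout.identity (gcd-GCD ρ d))
        where
        lift : ∀ g a b c e → g ℕ.+ a ℕ.* b ≡ c ℕ.* e → + g + + a * + b ≡ + c * + e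
        lift g a b c e h = trans (cong (_+_ (+ g)) (sym (ℤₚ.pos-* a b))) (trans (cong +_ h) (ℤₚ.pos-* c e))
        go : Bézout.Identity g ρ d → ∃[ x ] (+ d ∣ᶻ (x * + ρ - + g))
        go (Bézout.+- x y eq) = + x , divides (+ y) (trans (cong (_- + g) (sym (lift g y d x ρ eq))) (e (+ g) (+ y * + d)))
          where
          e : ∀ a b → a + b - a ≡ b
          e = solve 2 (λ a b → a :+ b :- a := b) refl
        go (Bézout.-+ x y eq) = - (+ x) , divides (- (+ y)) (trans (e (+ x) (+ ρ) (+ g)) (trans (cong -_ (lift g x ρ y d eq)) (e′ (+ y) (+ d))))
          where
          e : ∀ x r g → - x * r - g ≡ - (g + x * r)
          e = solve 3 (λ x r g → :- x :* r :- g := :- (g :+ x :* r)) refl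
          e′ : ∀ a b → - (a * b) ≡ - a * b
          e′ = solve 2 (λ a b → :- (a :* b) := :- a :* b) refl

      open Mod d using (rep; quo; rep<; rep-≡)

      d/g : ∃[ h ] d ≡ h ℕ.* g
      d/g = go g∣d
        where
        go : g ℕᵈ.∣ d → ∃[ h ] d ≡ h ℕ.* g
        go (ℕᵈ.divides h e) = h , e

      residue : ∀ (γs : List (Gadget v W)) → All (λ γ → δ γ % d ≡ ρ) γs → ∀ j → j ℕ.≤ length γs → ∃[ c ] (+ sumδ j γs ≡ + j * + ρ + c * + d)
      residue γs h zero l = 0ℤ , refl
      residue (γ ∷ γs) (e ∷ h) (suc j) (s≤s l) = go (residue γs h j l)
        where
        go : ∃[ c ] (+ sumδ j γs ≡ + j * + ρ + c * + d) → ∃[ c ] (+ sumδ (suc j) (γ ∷ γs) ≡ + suc j * + ρ + c * + d)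
        go (c , eq) = + (δ γ / d) + c , trans (ℤₚ.pos-+ (δ γ) (sumδ j γs)) (trans (cong₂ _+_ (trans (cong +_ (m≡m%n+[m/n]*n (δ γ) d)) (trans (ℤₚ.pos-+ (δ γ % d) (δ γ / d ℕ.* d)) (cong₂ _+_ (cong +_ e) (ℤₚ.pos-* (δ γ / d) d)))) eq)
               (alg (+ ρ) (+ (δ γ / d)) c (+ d) (+ j)))
          where
          alg : ∀ r a c d j → (r + a * d) + (j * r + c * d) ≡ (1ℤ + j) * r + (a + c) * d
          alg = solve 5 (λ r a c d j → (r :+ a :* d) :+ (j :* r :+ c :* d) := (con 1ℤ :+ j) :* r :+ (a :+ c) :* d) refl

      sumδ≤ : ∀ j (γs : List (Gadget v W)) → sumδ j γs ℕ.≤ j ℕ.* W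
      sumδ≤ zero γs = z≤n
      sumδ≤ (suc j) [] = z≤n
      sumδ≤ (suc j) (γ ∷ γs) = ℕₚ.+-mono-≤ (δ≤W γ) (sumδ≤ j γs)

      -- To reach k g, Bézout gives a j < d with j ρ ≡ k g mod d. The upper subsums of the first j
      -- gadgets settle the residue class, and the old progression supplies the missing multiple of
      -- d. The offset d W keeps that multiple nonnegative. There are (ℓ - W) d/g steps, and d/g ≥ 2
      -- with 2 W ≤ ℓ shows that the progression has not become shorter.
      refine : ∀ {U u ℓ} → AP v U u d ℓ → 2 ℕ.* W ℕ.≤ ℓ → (γs : List (Gadget v W)) → length γs ≡ d → All (λ γ → δ γ % d ≡ ρ) γs →
               ∃[ u′ ] ∃[ ℓ′ ] (AP v (U ++ elems γs) u′ g ℓ′ × ℓ ℕ.≤ ℓ′)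
      refine {U} {u} {ℓ} ap 2W≤ℓ γs len res = u + sumβ γs + + (d ℕ.* W) , ℓ′ , ap′ , ℓ≤ℓ′
        where
        h = proj₁ d/g
        W≤ℓ : W ℕ.≤ ℓ
        W≤ℓ = ℕₚ.≤-trans (ℕₚ.m≤m+n W (W ℕ.+ 0)) 2W≤ℓ
        ℓ′ = (ℓ ℕ.∸ W) ℕ.* h
        2≤h : 2 ℕ.≤ h
        2≤h = ℕₚ.*-cancelʳ-≤ 2 h g {{ℕ.>-nonZero g≥1}} (ℕₚ.≤-trans 2g≤d (ℕₚ.≤-reflexive (proj₂ d/g)))
        ℓ≤ℓ′ : ℓ ℕ.≤ ℓ′
        ℓ≤ℓ′ = ℕₚ.≤-trans (ℕₚ.+-cancelʳ-≤ (2 ℕ.* W) ℓ ((ℓ ℕ.∸ W) ℕ.* 2) (ℕₚ.≤-trans (ℕₚ.+-monoʳ-≤ ℓ 2W≤ℓ)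
                 (ℕₚ.≤-reflexive (trans (cong₂ ℕ._+_ (sym (ℕₚ.m∸n+n≡m W≤ℓ)) (sym (ℕₚ.m∸n+n≡m W≤ℓ))) (alg (ℓ ℕ.∸ W) W))))) (ℕₚ.*-monoʳ-≤ (ℓ ℕ.∸ W) 2≤h)
          where
          alg : ∀ a w → (a ℕ.+ w) ℕ.+ (a ℕ.+ w) ≡ a ℕ.* 2 ℕ.+ 2 ℕ.* w
          alg = solveℕ 2 (λ a w → (a ⊹ w) ⊹ (a ⊹ w) ≔ a ⊛ lit 2 ⊹ lit 2 ⊛ w) refl
        ap′ : AP v (U ++ elems γs) (u + sumβ γs + + (d ℕ.* W)) g ℓ′
        ap′ = progression term
         where
         term : ∀ k → k ℕ.≤ ℓ′ → Real v (U ++ elems γs) (u + sumβ γs + + (d ℕ.* W) + + k * + g)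
         term k kl = go bez
          where
          go : ∃[ x ] (+ d ∣ᶻ (x * + ρ - + g)) → Real v (U ++ elems γs) (u + sumβ γs + + (d ℕ.* W) + + k * + g)
          go (x , divides y ey) = go′ (residue γs res j (ℕₚ.≤-trans (ℕₚ.<⇒≤ (rep< (+ k * x))) (ℕₚ.≤-reflexive (sym len))))
            where
            j = rep (+ k * x)
            σ = sumδ j γs
            go′ : ∃[ c ] (+ σ ≡ + j * + ρ + c * + d) → Real v (U ++ elems γs) (u + sumβ γs + + (d ℕ.* W) + + k * + g)
            go′ (c , ec) = go″ (≥0⇒pos i≥0)
              where
              q = quo (+ k * x)
              i : ℤ
              -- The number of old steps, determined by d W + k g = σ + i d.
              i = q * + ρ - + k * y - c + + W
              key : + (d ℕ.* W) + + k * + g ≡ + σ + i * + d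
              key = trans (trans (cong (_+ + k * + g) (ℤₚ.pos-* d W)) (trans (alg₁ (+ k) (+ g) (+ d) (+ W) x (+ ρ)) (trans (cong₂ (λ a b → a * + ρ - + k * b + + d * + W) (rep-≡ (+ k * x)) ey)
                    (alg₂ (+ j) q (+ d) (+ ρ) (+ k) y c (+ W))))) (cong (_+ i * + d) (sym ec))
                where
                alg₁ : ∀ k g d W x r → d * W + k * g ≡ k * x * r - k * (x * r - g) + d * W
                alg₁ = solve 6 (λ k g d W x r → d :* W :+ k :* g := k :* x :* r :- k :* (x :* r :- g) :+ d :* W) refl
                alg₂ : ∀ j q d r k y c W → (j + q * d) * r - k * (y * d) + d * W ≡ (j * r + c * d) + (q * r - k * y - c + W) * d
                alg₂ = solve 8 (λ j q d r k y c W → (j :+ q :* d) :* r :- k :* (y :* d) :+ d :* W := (j :* r :+ c :* d) :+ (q :* r :- k :* y :- c :+ W) :* d) refl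
              σ≤ : σ ℕ.≤ d ℕ.* W
              σ≤ = ℕₚ.≤-trans (sumδ≤ j γs) (ℕₚ.*-monoˡ-≤ W (ℕₚ.<⇒≤ (rep< (+ k * x))))
              d≥1 : 1ℤ ≤ + d
              d≥1 = +≤+ (ℕₚ.≤-trans ρ≥1 (ℕₚ.<⇒≤ ρ<d))
              i≥0 : 0ℤ ≤ i
              i≥0 = *-cancel≥0 {+ d} d≥1 (≤-trans (sub≥0 (+≤+ σ≤) ⊕ (pos {k} ⊗ pos {g})) (≤-reflexive (trans (alg (+ (d ℕ.* W)) (+ σ) (+ k * + g)) (trans (cong (_- + σ) key) (alg′ (+ σ) i (+ d))))))
                where
                alg : ∀ a b c → a - b + c ≡ (a + c) - b
                alg = solve 3 (λ a b c → a :- b :+ c := (a :+ c) :- b) refl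
                alg′ : ∀ s i d → s + i * d - s ≡ d * i
                alg′ = solve 3 (λ s i d → s :+ i :* d :- s := d :* i) refl
              go″ : ∃[ n ] i ≡ + n → Real v (U ++ elems γs) (u + sumβ γs + + (d ℕ.* W) + + k * + g)
              go″ (n , en) = real-≡ v (trans (alg u (+ n * + d) (sumβ γs) (+ σ)) (trans (cong (λ z → u + sumβ γs + (+ σ + z * + d)) (sym en)) (trans (cong (_+_ (u + sumβ γs)) (sym key)) (sym (ℤₚ.+-assoc (u + sumβ γs) (+ (d ℕ.* W)) (+ k * + g))))))
                   (real-++ v (at ap n n≤ℓ) (prefix-real γs j))
                where
                alg : ∀ u i b s → u + i + (b + s) ≡ u + b + (s + i)
                alg = solve 4 (λ u i b s → u :+ i :+ (b :+ s) := u :+ b :+ (s :+ i)) refl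
                n≤ℓ : n ℕ.≤ ℓ
                n≤ℓ = +≤+⁻ (*-cancel-≤ {+ d} d≥1 (≤-by _ (pos {σ} ⊕ pos {g} ⊗ sub≥0 (+≤+ kl)) chain))
                  where
                  open ≡-Reasoning
                  a = ℓ ℕ.∸ W
                  alg₁ : ∀ d l n s → d * l - d * n ≡ d * l + s - (s + n * d)
                  alg₁ = solve 4 (λ d l n s → d :* l :- d :* n := d :* l :+ s :- (s :+ n :* d)) refl
                  alg₂ : ∀ d a w s k g → d * (a + w) + s - (d * w + k * g) ≡ s + (d * a - g * k)
                  alg₂ = solve 6 (λ d a w s k g → d :* (a :+ w) :+ s :- (d :* w :+ k :* g) := s :+ (d :* a :- g :* k)) refl
                  alg₃ : ∀ s h g a k → s + (h * g * a - g * k) ≡ s + g * (a * h - k)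
                  alg₃ = solve 5 (λ s h g a k → s :+ (h :* g :* a :- g :* k) := s :+ g :* (a :* h :- k)) refl
                  chain : + d * + ℓ - + d * + n ≡ + σ + + g * (+ ℓ′ - + k)
                  chain = begin
                    + d * + ℓ - + d * + n                           ≡⟨ alg₁ (+ d) (+ ℓ) (+ n) (+ σ) ⟩
                    + d * + ℓ + + σ - (+ σ + + n * + d)             ≡⟨ cong (λ z → + d * + ℓ + + σ - (+ σ + z * + d)) (sym en) ⟩
                    + d * + ℓ + + σ - (+ σ + i * + d)               ≡⟨ cong (λ z → + d * + ℓ + + σ - z) (sym key) ⟩
                    + d * + ℓ + + σ - (+ (d ℕ.* W) + + k * + g)     ≡⟨ cong₂ (λ b c → + d * b + + σ - (c + + k * + g)) (trans (cong +_ (sym (ℕₚ.m∸n+n≡m W≤ℓ))) (ℤₚ.pos-+ a W)) (ℤₚ.pos-* d W) ⟩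
                    + d * (+ a + + W) + + σ - (+ d * + W + + k * + g) ≡⟨ alg₂ (+ d) (+ a) (+ W) (+ σ) (+ k) (+ g) ⟩
                    + σ + (+ d * + a - + g * + k)                   ≡⟨ cong (λ z → + σ + (z * + a - + g * + k)) (trans (cong +_ (proj₂ d/g)) (ℤₚ.pos-* h g)) ⟩
                    + σ + (+ h * + g * + a - + g * + k)             ≡⟨ alg₃ (+ σ) (+ h) (+ g) (+ a) (+ k) ⟩
                    + σ + + g * (+ a * + h - + k)                   ≡⟨ cong (λ z → + σ + + g * (z - + k)) (sym (ℤₚ.pos-* a h)) ⟩
                    + σ + + g * (+ ℓ′ - + k) ∎

    Mult : (E → ℤ) → ℕ → List E → Set
    Mult v m xs = ∀ z ys zs → xs ↭ ys ++ zs → All (λ x → v x ≡ z) ys → length ys ℕ.≤ m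

    mult-sub : ∀ {v m xs} as bs → xs ↭ as ++ bs → Mult v m xs → Mult v m as
    mult-sub as bs e M z ys zs e′ h = M z ys (zs ++ bs) (↭-trans e (↭-trans (++⁺ʳ bs e′) (++-assoc ys zs bs))) h

    InRange : (E → ℤ) → ℕ → E → Set
    InRange v X x = ∃[ n ] (v x ≡ + n × 1 ℕ.≤ n × n ℕ.≤ X)

    Pair : (E → ℤ) → ℕ → ℕ → ℕ → List E → Set
    Pair v r W d rem = ∃[ γ ] ∃[ rem′ ] (rem ↭ es {v} {W} γ ++ rem′ × length (es γ) ≡ 2 × ((¬ d ℕᵈ.∣ δ γ) ⊎ (∃[ k ] (δ γ ≡ k ℕ.* d × r ℕ.≤ k))))

    -- Two applications of the pigeonhole principle. Some box of length W contains more than r m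
    -- values, so differences inside it are at most W. Compare with its smallest element x: if all
    -- differences were multiples of d below r d, only r values would occur, with at most r m terms.
    -- So some y differs from x by a non-multiple of d or by at least r d.
    ext : ∀ v X m r W d .{{_ : NonZero W}} .{{_ : NonZero d}} rem → Mult v m rem → All (InRange v X) rem → 1 ℕ.≤ r →
          suc (X / W) ℕ.* (r ℕ.* m) ℕ.< length rem → Pair v r W d rem
    ext v X m r W d rem M pos-rem r≥1 big = go₁ (pigeonhole (suc (X / W)) (r ℕ.* m) (λ x → ∣ v x ∣ / W) rem (All.map box< pos-rem) big)
      where
      box< : ∀ {x} → InRange v X x → ∣ v x ∣ / W ℕ.< suc (X / W)
      box< (n , e , _ , l) = s≤s (/-monoˡ-≤ W (ℕₚ.≤-trans (ℕₚ.≤-reflexive (cong ∣_∣ e)) l))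
      go₁ : _ → Pair v r W d rem
      go₁ (k , ys , zs , e , same , len) = go₂ (minimum (λ x → ∣ v x ∣) ys (ℕₚ.≤-trans (s≤s z≤n) len))
        where
        go₂ : _ → Pair v r W d rem
        go₂ (x , ys′ , e′ , minx) = go₃ (find P? ys′)
          where
          dl : E → ℕ
          dl y = ∣ v y ∣ ℕ.∸ ∣ v x ∣
          Good : E → Set
          Good y = (¬ d ℕᵈ.∣ dl y) ⊎ (r ℕ.* d ℕ.≤ dl y)
          P? : ∀ y → Dec (Good y)
          P? y with d ℕᵈ.∣? dl y | r ℕ.* d ℕₚ.≤? dl y
          ... | no n | _ = yes (inj₁ n)
          ... | yes _ | yes l = yes (inj₂ l)
          ... | yes a | no b = no λ { (inj₁ n) → n a ; (inj₂ l) → b l }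
          pos-ys : All (InRange v X) (x ∷ ys′)
          pos-ys = All-resp-↭ e′ (Allₚ.++⁻ˡ ys (All-resp-↭ e pos-rem))
          same-ys : All (λ y → ∣ v y ∣ / W ≡ k) (x ∷ ys′)
          same-ys = All-resp-↭ e′ same
          val : ∀ {y} → InRange v X y → v y ≡ + ∣ v y ∣
          val (n , e , _) = trans e (cong +_ (sym (cong ∣_∣ e)))
          go₃ : _ → Pair v r W d rem
          go₃ (inj₁ (y , us , e″ , good)) = record { es = x ∷ y ∷ [] ; β = v x ; δ = dl y
                 ; lo = x ∷ [] , y ∷ [] , ↭-refl , ℤₚ.+-identityʳ (v x)
                 ; hi = y ∷ [] , x ∷ [] , swap x y ↭-refl , trans (ℤₚ.+-identityʳ (v y)) vy
                 ; δ≥1 = nz good ; δ≤W = dW } , us ++ zs ,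
                 ↭-trans e (↭-trans (++⁺ʳ zs e′) (prep x (↭-trans (++⁺ʳ zs e″) ↭-refl))) , refl , res good
            where
            allys : All (λ y → ∣ v x ∣ ℕ.≤ ∣ v y ∣) (y ∷ us)
            allys = All-resp-↭ e″ minx
            x≤y : ∣ v x ∣ ℕ.≤ ∣ v y ∣
            x≤y = All.head allys
            py : InRange v X y
            py = All.head (All-resp-↭ e″ (All.tail pos-ys))
            by : ∣ v y ∣ / W ≡ k
            by = All.head (All-resp-↭ e″ (All.tail same-ys))
            vy : v y ≡ v x + + dl y
            vy = trans (val py) (trans (cong +_ (sym (ℕₚ.m+[n∸m]≡n x≤y))) (trans (ℤₚ.pos-+ ∣ v x ∣ (dl y)) (cong (_+ + dl y) (sym (val (All.head pos-ys))))))
            nz : Good y → 1 ℕ.≤ dl y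
            nz (inj₁ n) = ℕₚ.n≢0⇒n>0 (λ e₀ → n (subst (d ℕᵈ.∣_) (sym e₀) (d ℕᵈ.∣0)))
            nz (inj₂ l) = ℕₚ.≤-trans (ℕₚ.*-mono-≤ r≥1 (ℕ.>-nonZero⁻¹ d)) l
            dW : dl y ℕ.≤ W
            dW = ℕₚ.m≤n+o⇒m∸n≤o ∣ v y ∣ ∣ v x ∣ (ℕₚ.≤-trans (ℕₚ.≤-reflexive (m≡m%n+[m/n]*n ∣ v y ∣ W))
                   (ℕₚ.≤-trans (ℕₚ.+-mono-≤ (ℕₚ.<⇒≤ (m%n<n ∣ v y ∣ W)) (ℕₚ.≤-trans (ℕₚ.≤-reflexive (cong (ℕ._* W) (trans by (sym (All.head same-ys))))) (m/n*n≤m ∣ v x ∣ W))) (ℕₚ.≤-reflexive (ℕₚ.+-comm W ∣ v x ∣))))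
            res : Good y → (¬ d ℕᵈ.∣ dl y) ⊎ (∃[ k ] (dl y ≡ k ℕ.* d × r ℕ.≤ k))
            res (inj₁ n) = inj₁ n
            res (inj₂ l) with d ℕᵈ.∣? dl y
            ... | no n = inj₁ n
            ... | yes (ℕᵈ.divides k ek) = inj₂ (k , ek , ℕₚ.*-cancelʳ-≤ r k d (ℕₚ.≤-trans l (ℕₚ.≤-reflexive ek)))
          go₃ (inj₂ none) = ⊥-elim (go₄ (pigeonhole r m (λ y → dl y / d) (x ∷ ys′) (x<r ∷ All.map y<r none) (ℕₚ.<-≤-trans len (ℕₚ.≤-reflexive (↭-length e′)))))
            where
            dx≡0 : dl x ≡ 0
            dx≡0 = ℕₚ.n∸n≡0 ∣ v x ∣
            div : ∀ {y} → ¬ Good y → d ℕᵈ.∣ dl y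
            div {y} ng with d ℕᵈ.∣? dl y
            ... | yes h = h
            ... | no h = ⊥-elim (ng (inj₁ h))
            divs : All (λ y → (d ℕᵈ.∣ dl y) × (∣ v x ∣ ℕ.≤ ∣ v y ∣)) (x ∷ ys′)
            divs = (subst (d ℕᵈ.∣_) (sym dx≡0) (d ℕᵈ.∣0) , ℕₚ.≤-refl) ∷ All.zipWith (λ { (a , b) → div a , b }) (none , minx)
            x<r : dl x / d ℕ.< r
            x<r = m<n*o⇒m/o<n (ℕₚ.≤-trans (ℕₚ.≤-reflexive (cong suc dx≡0)) (ℕₚ.*-mono-≤ r≥1 (ℕ.>-nonZero⁻¹ d)))
            y<r : ∀ {y} → ¬ Good y → dl y / d ℕ.< r
            y<r ng = m<n*o⇒m/o<n (ℕₚ.≰⇒> (λ l → ng (inj₂ l)))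
            go₄ : _ → ⊥
            go₄ (j , us , ts , e₄ , samej , lenj) = ℕₚ.<⇒≱ lenj (M (+ (∣ v x ∣ ℕ.+ j ℕ.* d)) us (ts ++ zs)
                  (↭-trans e (↭-trans (++⁺ʳ zs e′) (↭-trans (++⁺ʳ zs e₄) (++-assoc us ts zs)))) vals)
              where
              vals : All (λ y → v y ≡ + (∣ v x ∣ ℕ.+ j ℕ.* d)) us
              vals = All.zipWith (λ { (ej , (ℕᵈ.divides q eq , xy) , py) → trans (val py) (cong +_ (trans (sym (ℕₚ.m+[n∸m]≡n xy)) (cong (∣ v x ∣ ℕ.+_) (trans eq (cong (ℕ._* d) (trans (sym (m*n/n≡m q d)) (trans (cong (_/ d) (sym eq)) ej))))))) })
                       (samej , All.zipWith (λ z → z) (Allₚ.++⁻ˡ us (All-resp-↭ e₄ divs) , Allₚ.++⁻ˡ us (All-resp-↭ e₄ pos-ys)))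

    -- If every class had at most d - 1 members there would be fewer than d² elements; class 0 is
    -- empty, so ρ ≥ 1.
    residue-class : ∀ {A : Set} d .{{_ : NonZero d}} (f : A → ℕ) xs → All (λ x → ¬ d ℕᵈ.∣ f x) xs → d ℕ.* d ℕ.≤ length xs →
         ∃[ ρ ] ∃[ ys ] ∃[ zs ] (xs ↭ ys ++ zs × length ys ≡ d × All (λ x → f x % d ≡ ρ) ys × 1 ℕ.≤ ρ × ρ ℕ.< d)
    residue-class {A} d f xs nd big = go (pig d refl)
      where
      pig : ∀ n → n ≡ d → ∃[ k ] ∃[ ys ] ∃[ zs ] (xs ↭ ys ++ zs × All (λ x → f x % d ≡ k) ys × d ℕ.≤ length ys)
      pig zero e = ⊥-elim (ℕ.≢-nonZero⁻¹ d (sym e))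
      pig (suc n) e with pigeonhole (suc n) n (λ x → f x % d) xs (All.universal (λ x → ℕₚ.<-≤-trans (m%n<n (f x) d) (ℕₚ.≤-reflexive (sym e))) xs)
          (ℕₚ.<-≤-trans (ℕₚ.*-monoʳ-< (suc n) {n} {suc n} ℕₚ.≤-refl) (ℕₚ.≤-trans (ℕₚ.≤-reflexive (cong₂ ℕ._*_ e e)) big))
      ... | k , ys , zs , e′ , h , l = k , ys , zs , e′ , h , ℕₚ.≤-trans (ℕₚ.≤-reflexive (sym e)) l
      go : ∃[ k ] ∃[ ys ] ∃[ zs ] (xs ↭ ys ++ zs × All (λ x → f x % d ≡ k) ys × d ℕ.≤ length ys) → _
      go (k , ys , zs , e , h , l) with takeN d ys l
      ... | us , ws , refl , len = k , us , ws ++ zs , ↭-trans e (++-assoc us ws zs) , len , Allₚ.++⁻ˡ us h , k≥1 us len (Allₚ.++⁻ˡ us h) (Allₚ.++⁻ˡ us (Allₚ.++⁻ˡ (us ++ ws) (All-resp-↭ e nd))) , k<d us len (Allₚ.++⁻ˡ us h)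
        where
        k≥1 : ∀ us → length us ≡ d → All (λ x → f x % d ≡ k) us → All (λ x → ¬ d ℕᵈ.∣ f x) us → 1 ℕ.≤ k
        k≥1 [] e _ _ = ⊥-elim (ℕ.≢-nonZero⁻¹ d (sym e))
        k≥1 (x ∷ _) _ (ek ∷ _) (n ∷ _) = ℕₚ.n≢0⇒n>0 (λ k0 → n (ℕᵈ.m%n≡0⇒n∣m (f x) d (trans ek k0)))
        k<d : ∀ us → length us ≡ d → All (λ x → f x % d ≡ k) us → k ℕ.< d
        k<d [] e _ = ⊥-elim (ℕ.≢-nonZero⁻¹ d (sym e))
        k<d (x ∷ _) _ (ek ∷ _) = subst (ℕ._< d) ek (m%n<n (f x) d)

    record Progress (v : E → ℤ) (Q : List E) (ℓ* B d₀ : ℕ) : Set where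
      field
        U rem : List E
        u : ℤ
        d ℓ : ℕ
        perm : Q ↭ U ++ rem
        ap : AP v U u d ℓ
        long : ℓ* ℕ.≤ ℓ
        left : B ℕ.≤ length rem
        d≥1 : 1 ℕ.≤ d
        d≤d₀ : d ℕ.≤ d₀

    module Phase (v : E → ℤ) (X m r W : ℕ) .{{_ : NonZero W}} (r≥1 : 1 ℕ.≤ r) (Q : List E) (M : Mult v m Q) (inR : All (InRange v X) Q)
                 (ℓ* B d₀ : ℕ) (thr : suc (X / W) ℕ.* (r ℕ.* m) ℕ.≤ B) where

      -- Each turn spends two elements on a gadget. If d divides its δ, the progression gains at
      -- least r steps, and c counts the gains still to be made. Otherwise the gadget enters the
      -- pool, and j counts what the pool lacks of d². A full pool allows `refine`, which at least
      -- halves d. The reserve d² pays for the next pool because 3 g² ≤ d² for g ≤ d/2. The elements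
      -- B are never touched, so `ext` always applies.
      loop : ∀ fuel U u d ℓ (pool : List (Gadget v W)) rem c j → length rem ℕ.+ d ℕ.≤ fuel → 1 ℕ.≤ d → d ℕ.≤ d₀ →
             Q ↭ U ++ (elems pool ++ rem) → AP v U u d ℓ → 2 ℕ.* W ℕ.≤ ℓ → All (λ γ → ¬ d ℕᵈ.∣ δ γ) pool →
             j ℕ.+ length pool ≡ d ℕ.* d → ℓ* ℕ.≤ ℓ ℕ.+ c ℕ.* r → B ℕ.+ d ℕ.* d ℕ.+ 2 ℕ.* j ℕ.+ 2 ℕ.* c ℕ.≤ length rem →
             Progress v Q ℓ* B d₀
      loop zero U u d ℓ pool rem c j fu d≥1 _ _ _ _ _ _ _ _ = ⊥-elim (ℕₚ.<⇒≱ d≥1 (ℕₚ.≤-trans (ℕₚ.m≤n+m d (length rem)) fu))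
      loop (suc fuel) U u d ℓ pool rem c j fu d≥1 d≤ perm ap 2W bad jp enough left = go (ℓ* ℕₚ.≤? ℓ) j c jp enough left
        where
        instance
          d-nz : NonZero d
          d-nz = ℕ.>-nonZero d≥1
        W≤ℓ : W ℕ.≤ ℓ
        W≤ℓ = ℕₚ.≤-trans (ℕₚ.m≤m+n W (W ℕ.+ 0)) 2W
        inRem : All (InRange v X) rem
        inRem = Allₚ.++⁻ʳ (elems pool) (Allₚ.++⁻ʳ U (All-resp-↭ perm inR))
        toRem : Q ↭ rem ++ (U ++ elems pool)
        toRem = ↭-trans perm (eq U (elems pool) rem)
          where
          eq : ∀ (a b c : List E) → a ++ (b ++ c) ↭ c ++ (a ++ b)
          eq = PS.solve 3 (λ a b c → (a PS.⊕ (b PS.⊕ c)) PS.⊜ (c PS.⊕ (a PS.⊕ b))) ↭-refl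
            where module PS = PermSolver
        go : Dec (ℓ* ℕ.≤ ℓ) → ∀ j c → j ℕ.+ length pool ≡ d ℕ.* d → ℓ* ℕ.≤ ℓ ℕ.+ c ℕ.* r → B ℕ.+ d ℕ.* d ℕ.+ 2 ℕ.* j ℕ.+ 2 ℕ.* c ℕ.≤ length rem → Progress v Q ℓ* B d₀
        go (yes h) j c jp enough left = record { U = U ++ elems pool ; rem = rem ; u = u ; d = d ; ℓ = ℓ ; perm = ↭-trans perm (↭-sym (++-assoc U (elems pool) rem))
               ; ap = AP-weak v (elems pool) ap ; long = h ; d≥1 = d≥1 ; d≤d₀ = d≤
               ; left = ℕₚ.≤-trans (ℕₚ.≤-trans (ℕₚ.m≤m+n B (d ℕ.* d)) (ℕₚ.≤-trans (ℕₚ.m≤m+n (B ℕ.+ d ℕ.* d) (2 ℕ.* j)) (ℕₚ.m≤m+n (B ℕ.+ d ℕ.* d ℕ.+ 2 ℕ.* j) (2 ℕ.* c)))) left }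
        go (no n) j zero jp enough left = ⊥-elim (n (ℕₚ.≤-trans enough (ℕₚ.≤-reflexive (ℕₚ.+-identityʳ ℓ))))
        go (no n) zero (suc c) jp enough left = refined (residue-class d δ pool bad (ℕₚ.≤-reflexive (sym jp)))
          where
          refined : _ → Progress v Q ℓ* B d₀
          refined (ρ , γs , rest , e , len , res , ρ≥1 , ρ<d) = next (R.refine ap 2W γs len res)
            where
            module R = Refine {v} {W} d ρ ρ≥1 ρ<d
            g = R.g
            junk = elems rest
            perm′ : Q ↭ ((U ++ elems γs) ++ junk) ++ rem
            perm′ = ↭-trans perm (↭-trans (++⁺ˡ U (++⁺ʳ rem (↭-trans (elems-↭ e) (Perm.↭-reflexive (elems-++ γs rest))))) (eq U (elems γs) junk rem))
              where
              eq : ∀ (a b c d : List E) → a ++ ((b ++ c) ++ d) ↭ ((a ++ b) ++ c) ++ d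
              eq = PS.solve 4 (λ a b c d → (a PS.⊕ ((b PS.⊕ c) PS.⊕ d)) PS.⊜ (((a PS.⊕ b) PS.⊕ c) PS.⊕ d)) ↭-refl
                where module PS = PermSolver
            g<d : g ℕ.< d
            g<d = ℕₚ.<-≤-trans (ℕₚ.m<m+n g (ℕₚ.≤-trans R.g≥1 (ℕₚ.m≤m+n g 0))) R.2g≤d
            3gg : g ℕ.* g ℕ.+ 2 ℕ.* (g ℕ.* g) ℕ.≤ d ℕ.* d
            3gg = ℕₚ.≤-trans (ℕₚ.m≤m+n (g ℕ.* g ℕ.+ 2 ℕ.* (g ℕ.* g)) (g ℕ.* g)) (ℕₚ.≤-trans (ℕₚ.≤-reflexive (eq g)) (ℕₚ.*-mono-≤ R.2g≤d R.2g≤d))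
              where
              eq : ∀ g → g ℕ.* g ℕ.+ 2 ℕ.* (g ℕ.* g) ℕ.+ g ℕ.* g ≡ 2 ℕ.* g ℕ.* (2 ℕ.* g)
              eq = solveℕ 1 (λ g → g ⊛ g ⊹ lit 2 ⊛ (g ⊛ g) ⊹ g ⊛ g ≔ lit 2 ⊛ g ⊛ (lit 2 ⊛ g)) refl
            left′ : B ℕ.+ g ℕ.* g ℕ.+ 2 ℕ.* (g ℕ.* g) ℕ.+ 2 ℕ.* suc c ℕ.≤ length rem
            left′ = ℕₚ.≤-trans (ℕₚ.+-monoˡ-≤ (2 ℕ.* suc c) (ℕₚ.≤-trans (ℕₚ.≤-reflexive (ℕₚ.+-assoc B (g ℕ.* g) (2 ℕ.* (g ℕ.* g)))) (ℕₚ.≤-trans (ℕₚ.+-monoʳ-≤ B 3gg) (ℕₚ.≤-reflexive (sym (ℕₚ.+-identityʳ (B ℕ.+ d ℕ.* d))))))) left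
            next : ∃[ u′ ] ∃[ ℓ′ ] (AP v (U ++ elems γs) u′ g ℓ′ × ℓ ℕ.≤ ℓ′) → Progress v Q ℓ* B d₀
            next (u′ , ℓ′ , ap′ , ℓℓ′) = loop fuel ((U ++ elems γs) ++ junk) u′ g ℓ′ [] rem (suc c) (g ℕ.* g)
                (ℕₚ.≤-pred (ℕₚ.<-≤-trans (ℕₚ.+-monoʳ-< (length rem) g<d) fu)) R.g≥1 (ℕₚ.≤-trans (ℕₚ.<⇒≤ g<d) d≤) perm′ (AP-weak v junk ap′)
                (ℕₚ.≤-trans 2W ℓℓ′) [] (ℕₚ.+-identityʳ (g ℕ.* g)) (ℕₚ.≤-trans enough (ℕₚ.+-monoˡ-≤ (suc c ℕ.* r) ℓℓ′)) left′
        go (no n) (suc j) (suc c) jp enough left = found (ext v X m r W d rem (mult-sub rem (U ++ elems pool) toRem M) inRem r≥1 (ℕₚ.≤-<-trans thr big))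
          where
          shapeJ : ∀ B D j c → B ℕ.+ D ℕ.+ 2 ℕ.* suc j ℕ.+ 2 ℕ.* suc c ≡ suc (suc (B ℕ.+ D ℕ.+ 2 ℕ.* j ℕ.+ 2 ℕ.* suc c))
          shapeJ = solveℕ 4 (λ B D j c → B ⊹ D ⊹ lit 2 ⊛ (lit 1 ⊹ j) ⊹ lit 2 ⊛ (lit 1 ⊹ c) ≔ (lit 1 ⊹ ((lit 1 ⊹ (B ⊹ D ⊹ lit 2 ⊛ j ⊹ lit 2 ⊛ (lit 1 ⊹ c)))))) refl
          shapeC : ∀ B D j c → B ℕ.+ D ℕ.+ 2 ℕ.* suc j ℕ.+ 2 ℕ.* suc c ≡ suc (suc (B ℕ.+ D ℕ.+ 2 ℕ.* suc j ℕ.+ 2 ℕ.* c))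
          shapeC = solveℕ 4 (λ B D j c → B ⊹ D ⊹ lit 2 ⊛ (lit 1 ⊹ j) ⊹ lit 2 ⊛ (lit 1 ⊹ c) ≔ (lit 1 ⊹ ((lit 1 ⊹ (B ⊹ D ⊹ lit 2 ⊛ (lit 1 ⊹ j) ⊹ lit 2 ⊛ c))))) refl
          shapeB : ∀ B D j c → B ℕ.+ D ℕ.+ 2 ℕ.* suc j ℕ.+ 2 ℕ.* suc c ≡ suc B ℕ.+ (D ℕ.+ 2 ℕ.* j ℕ.+ 2 ℕ.* c ℕ.+ 3)
          shapeB = solveℕ 4 (λ B D j c → B ⊹ D ⊹ lit 2 ⊛ (lit 1 ⊹ j) ⊹ lit 2 ⊛ (lit 1 ⊹ c) ≔ (lit 1 ⊹ B) ⊹ (D ⊹ lit 2 ⊛ j ⊹ lit 2 ⊛ c ⊹ lit 3)) refl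
          big : B ℕ.< length rem
          big = ℕₚ.≤-trans (ℕₚ.≤-trans (ℕₚ.m≤m+n (suc B) _) (ℕₚ.≤-reflexive (sym (shapeB B (d ℕ.* d) j c)))) left
          found : Pair v r W d rem → Progress v Q ℓ* B d₀
          found (γ , rem′ , e , len2 , alt) = alternatives alt
            where
            len : length rem ≡ suc (suc (length rem′))
            len = trans (↭-length e) (trans (Listₚ.length-++ (es γ)) (cong (ℕ._+ length rem′) len2))
            fu′ : length rem′ ℕ.+ d ℕ.≤ fuel
            fu′ = ℕₚ.≤-trans (ℕₚ.n≤1+n _) (ℕₚ.≤-pred (subst (λ z → z ℕ.+ d ℕ.≤ suc fuel) len fu))
            alternatives : (¬ d ℕᵈ.∣ δ γ) ⊎ (∃[ k ] (δ γ ≡ k ℕ.* d × r ℕ.≤ k)) → Progress v Q ℓ* B d₀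
            alternatives (inj₁ nd) = loop fuel U u d ℓ (γ ∷ pool) rem′ (suc c) j fu′ d≥1 d≤
                 (↭-trans perm (++⁺ˡ U (↭-trans (++⁺ˡ (elems pool) e) (↭-trans (shifts (elems pool) (es γ)) (↭-sym (++-assoc (es γ) (elems pool) rem′))))))
                 ap 2W (nd ∷ bad) (trans (ℕₚ.+-suc j (length pool)) jp) enough
                 (ℕₚ.≤-pred (ℕₚ.≤-pred (subst₂ ℕ._≤_ (shapeJ B (d ℕ.* d) j c) len left)))
            alternatives (inj₂ (k , ek , rk)) = loop fuel (U ++ es γ) (u + β γ) d (ℓ ℕ.+ k) pool rem′ c (suc j) fu′ d≥1 d≤
                 (↭-trans perm (↭-trans (++⁺ˡ U (↭-trans (++⁺ˡ (elems pool) e) (shifts (elems pool) (es γ)))) (↭-sym (++-assoc U (es γ) (elems pool ++ rem′)))))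
                 (extend v ap γ k ek (ℕₚ.m≤n⇒m≤1+n (ℕₚ.≤-trans (ℕₚ.m≤m*n k d) (ℕₚ.≤-trans (ℕₚ.≤-reflexive (sym ek)) (ℕₚ.≤-trans (δ≤W γ) W≤ℓ)))))
                 (ℕₚ.≤-trans 2W (ℕₚ.m≤m+n ℓ k)) bad jp
                 (ℕₚ.≤-trans enough (ℕₚ.≤-trans (ℕₚ.≤-reflexive (sym (ℕₚ.+-assoc ℓ r (c ℕ.* r)))) (ℕₚ.+-monoˡ-≤ (c ℕ.* r) (ℕₚ.+-monoʳ-≤ ℓ rk))))
                 (ℕₚ.≤-pred (ℕₚ.≤-pred (subst₂ ℕ._≤_ (shapeC B (d ℕ.* d) j c) len left)))

      advance : ∀ c → ℓ* ℕ.≤ c ℕ.* r → Progress v Q (2 ℕ.* W) (B ℕ.+ 3 ℕ.* (d₀ ℕ.* d₀) ℕ.+ 2 ℕ.* c) d₀ → Progress v Q ℓ* B d₀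
      advance c enough P = loop (length P.rem ℕ.+ P.d) P.U P.u P.d P.ℓ [] P.rem c (P.d ℕ.* P.d) ℕₚ.≤-refl P.d≥1 P.d≤d₀ P.perm P.ap P.long []
           (ℕₚ.+-identityʳ (P.d ℕ.* P.d)) (ℕₚ.≤-trans enough (ℕₚ.m≤n+m (c ℕ.* r) P.ℓ))
           (ℕₚ.≤-trans (ℕₚ.+-monoˡ-≤ (2 ℕ.* c) (ℕₚ.≤-trans (ℕₚ.≤-reflexive (eq B (P.d ℕ.* P.d))) (ℕₚ.+-monoʳ-≤ B (ℕₚ.*-monoʳ-≤ 3 (ℕₚ.*-mono-≤ P.d≤d₀ P.d≤d₀))))) P.left)
        where
        module P = Progress P
        eq : ∀ B D → B ℕ.+ D ℕ.+ 2 ℕ.* D ≡ B ℕ.+ 3 ℕ.* D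
        eq = solveℕ 2 (λ B D → B ⊹ D ⊹ lit 2 ⊛ D ≔ B ⊹ lit 3 ⊛ D) refl

    -- With d = r = 1 any two distinct values in one box serve as a gadget.
    collect : ∀ v X m W .{{_ : NonZero W}} n rem → Mult v m rem → All (InRange v X) rem → suc (X / W) ℕ.* m ℕ.+ 2 ℕ.* n ℕ.≤ length rem →
              ∃[ γs ] ∃[ rem′ ] (rem ↭ elems {v} {W} γs ++ rem′ × length γs ≡ n × length rem ≡ 2 ℕ.* n ℕ.+ length rem′)
    collect v X m W zero rem M h l = [] , rem , ↭-refl , refl , refl
    collect v X m W (suc n) rem M h l = go (ext v X m 1 W 1 rem M h (s≤s z≤n) (ℕₚ.<-≤-trans (ℕₚ.≤-<-trans (ℕₚ.≤-reflexive (cong (suc (X / W) ℕ.*_) (ℕₚ.*-identityˡ m)))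
          (ℕₚ.m<m+n (suc (X / W) ℕ.* m) (s≤s z≤n))) l))
      where
      eq : ∀ a n → a ℕ.+ 2 ℕ.* suc n ≡ suc (suc (a ℕ.+ 2 ℕ.* n))
      eq = solveℕ 2 (λ a n → a ⊹ lit 2 ⊛ (lit 1 ⊹ n) ≔ (lit 1 ⊹ ((lit 1 ⊹ (a ⊹ lit 2 ⊛ n))))) refl
      eq′ : ∀ n x → suc (suc (2 ℕ.* n ℕ.+ x)) ≡ 2 ℕ.* suc n ℕ.+ x
      eq′ = solveℕ 2 (λ n x → (lit 1 ⊹ ((lit 1 ⊹ (lit 2 ⊛ n ⊹ x)))) ≔ lit 2 ⊛ (lit 1 ⊹ n) ⊹ x) refl
      go : Pair v 1 W 1 rem → _
      go (γ , rem′ , e , len2 , _) = go′ (collect v X m W n rem′ (mult-sub rem′ (es γ) (↭-trans e (++-comm (es γ) rem′)) M) (Allₚ.++⁻ʳ (es γ) (All-resp-↭ e h))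
            (ℕₚ.≤-pred (ℕₚ.≤-pred (subst₂ ℕ._≤_ (eq (suc (X / W) ℕ.* m) n) len l))))
        where
        len : length rem ≡ suc (suc (length rem′))
        len = trans (↭-length e) (trans (Listₚ.length-++ (es γ)) (cong (ℕ._+ length rem′) len2))
        go′ : _ → _
        go′ (γs , rem″ , e′ , lγ , lr) = γ ∷ γs , rem″ , ↭-trans e (↭-trans (++⁺ˡ (es γ) e′) (↭-sym (++-assoc (es γ) (elems γs) rem″))) , cong suc lγ , trans len (trans (cong (λ z → suc (suc z)) lr) (eq′ n (length rem″)))

    -- δ takes at most W values, so one of them is shared by more than c gadgets; these form a
    -- progression.
    popular : ∀ {v W} (γs : List (Gadget v W)) c → W ℕ.* c ℕ.< length γs → ∃[ u ] ∃[ d ] ∃[ ℓ ] (AP v (elems γs) u d ℓ × c ℕ.≤ ℓ × 1 ℕ.≤ d × d ℕ.≤ W)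
    popular {v} {W} γs c l = go (pigeonhole W c (λ γ → δ γ ℕ.∸ 1) γs (All.universal (λ γ → ℕₚ.<-≤-trans (ℕₚ.∸-monoʳ-< {δ γ} {1} {0} (s≤s z≤n) (δ≥1 γ)) (δ≤W γ)) γs) l)
      where
      go : _ → ∃[ u ] ∃[ d ] ∃[ ℓ ] (AP v (elems γs) u d ℓ × c ℕ.≤ ℓ × 1 ℕ.≤ d × d ℕ.≤ W)
      go (k , [] , zs , e , h , ())
      go (k , γ ∷ ys , zs , e , h , lt) = sumβ (γ ∷ ys) , suc k , length (γ ∷ ys) ,
          AP-↭ v (↭-sym (↭-trans (elems-↭ e) (Perm.↭-reflexive (elems-++ (γ ∷ ys) zs)))) (AP-weak v (elems zs) (AP-const v (suc k) (γ ∷ ys) δs)) , ℕₚ.<⇒≤ lt , s≤s z≤n , ℕₚ.≤-trans (ℕₚ.≤-reflexive (sym (All.head δs))) (δ≤W γ)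
        where
        δs : All (λ γ → δ γ ≡ suc k) (γ ∷ ys)
        δs = All.map (λ {γ} ek → trans (sym (ℕₚ.m∸n+n≡m (δ≥1 γ))) (trans (cong (ℕ._+ 1) ek) (ℕₚ.+-comm k 1))) h

    NZ : (E → ℤ) → ℕ → E → Set
    NZ v X x = 1 ℕ.≤ ∣ v x ∣ × ∣ v x ∣ ℕ.≤ X

    single : ∀ v X x → NZ v X x → Gadget v X
    single v X x (h1 , h2) = record { es = x ∷ [] ; β = base (v x) ; δ = ∣ v x ∣ ; lo = low (v x) refl ; hi = high (v x) refl ; δ≥1 = h1 ; δ≤W = h2 }
      where
      low : ∀ z → v x ≡ z → Real v (x ∷ []) (base z)
      low (+ n) e = real-none v (x ∷ [])
      low -[1+ n ] e = x ∷ [] , [] , ↭-refl , trans (ℤₚ.+-identityʳ (v x)) e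
      high : ∀ z → v x ≡ z → Real v (x ∷ []) (base z + + ∣ z ∣)
      high (+ n) e = x ∷ [] , [] , ↭-refl , trans (ℤₚ.+-identityʳ (v x)) (trans e (sym (ℤₚ.+-identityˡ (+ n))))
      high -[1+ n ] e = [] , x ∷ [] , ↭-refl , sym (ℤₚ.+-inverseˡ (+ suc n))

    singles : ∀ v X xs → All (NZ v X) xs → List (Gadget v X)
    singles v X [] [] = []
    singles v X (x ∷ xs) (h ∷ hs) = single v X x h ∷ singles v X xs hs

    singles-elems : ∀ v X xs hs → elems (singles v X xs hs) ≡ xs
    singles-elems v X [] [] = refl
    singles-elems v X (x ∷ xs) (h ∷ hs) = cong (x ∷_) (singles-elems v X xs hs)

    singles-length : ∀ v X xs hs → length (singles v X xs hs) ≡ length xs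
    singles-length v X [] [] = refl
    singles-length v X (x ∷ xs) (h ∷ hs) = cong suc (singles-length v X xs hs)

    singles-res : ∀ v X d .{{_ : NonZero d}} ρ xs hs → All (λ x → ∣ v x ∣ % d ≡ ρ) xs → All (λ γ → δ γ % d ≡ ρ) (singles v X xs hs)
    singles-res v X d ρ [] [] [] = []
    singles-res v X d ρ (x ∷ xs) (h ∷ hs) (e ∷ es) = e ∷ singles-res v X d ρ xs hs es

    cnt : (E → ℤ) → ℕ → List E → ℕ
    cnt v e [] = 0
    cnt v e (x ∷ xs) = bit (e ℕᵈ.∣? ∣ v x ∣) ℕ.+ cnt v e xs

    cnt-++ : ∀ v e xs ys → cnt v e (xs ++ ys) ≡ cnt v e xs ℕ.+ cnt v e ys
    cnt-++ v e [] ys = refl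
    cnt-++ v e (x ∷ xs) ys = trans (cong (bit (e ℕᵈ.∣? ∣ v x ∣) ℕ.+_) (cnt-++ v e xs ys)) (sym (ℕₚ.+-assoc (bit (e ℕᵈ.∣? ∣ v x ∣)) (cnt v e xs) (cnt v e ys)))

    cnt-↭ : ∀ v e {xs ys} → xs ↭ ys → cnt v e xs ≡ cnt v e ys
    cnt-↭ v e Perm.refl = refl
    cnt-↭ v e (prep x p) = cong (bit (e ℕᵈ.∣? ∣ v x ∣) ℕ.+_) (cnt-↭ v e p)
    cnt-↭ v e (swap {xs} {ys} x y p) = trans (cong (λ z → bx ℕ.+ (by ℕ.+ z)) (cnt-↭ v e p)) (eq bx by (cnt v e ys))
      where
      bx = bit (e ℕᵈ.∣? ∣ v x ∣)
      by = bit (e ℕᵈ.∣? ∣ v y ∣)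
      eq : ∀ a b c → a ℕ.+ (b ℕ.+ c) ≡ b ℕ.+ (a ℕ.+ c)
      eq = solveℕ 3 (λ a b c → a ⊹ (b ⊹ c) ≔ b ⊹ (a ⊹ c)) refl
    cnt-↭ v e (Perm.trans p q) = trans (cnt-↭ v e p) (cnt-↭ v e q)

    cnt-≤ : ∀ v e xs → cnt v e xs ℕ.≤ length xs
    cnt-≤ v e [] = z≤n
    cnt-≤ v e (x ∷ xs) = ℕₚ.+-mono-≤ (bit≤1 (e ℕᵈ.∣? ∣ v x ∣)) (cnt-≤ v e xs)

    cnt-0 : ∀ v e xs → All (λ x → e ℕᵈ.∣ ∣ v x ∣) xs → cnt v e xs ≡ 0
    cnt-0 v e [] [] = refl
    cnt-0 v e (x ∷ xs) (h ∷ hs) = cong₂ ℕ._+_ (bit-yes (e ℕᵈ.∣? ∣ v x ∣) h) (cnt-0 v e xs hs)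

    -- At least d² elements of Y are not divisible by d, so d of them lie in one residue class and
    -- refine d to g ≤ d/2. Using them up costs d of the reserve K, and g² + g ≤ d² restores the
    -- hypothesis. At most d + d/2 + d/4 + ... ≤ 2 d elements are spent.
    finish : ∀ v X fuel U u d ℓ Y K → d ℕ.≤ fuel → 1 ℕ.≤ d → d ℕ.≤ X → AP v U u d ℓ → 2 ℕ.* X ℕ.≤ ℓ → All (NZ v X) Y →
             (∀ e → 2 ℕ.≤ e → e ℕ.≤ X → K ℕ.≤ cnt v e Y) → d ℕ.* d ℕ.+ d ℕ.≤ K →
             ∃[ R ] ∃[ Y′ ] ∃[ u′ ] ∃[ ℓ′ ] (Y ↭ R ++ Y′ × AP v (U ++ R) u′ 1 ℓ′ × 2 ℕ.* X ℕ.≤ ℓ′ × length R ℕ.≤ 2 ℕ.* d)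
    finish v X zero U u (suc d) ℓ Y K () _ _ _ _ _ _ _
    finish v X (suc fuel) U u 0 ℓ Y K _ () _ _ _ _ _ _
    finish v X (suc fuel) U u 1 ℓ Y K _ _ _ ap 2X _ _ _ = [] , Y , u , ℓ , ↭-refl , AP-weak v [] ap , 2X , z≤n
    finish v X (suc fuel) U u d@(suc (suc d′)) ℓ Y K fu d≥1 dX ap 2X nz rob dK = go (split (λ x → ¬? (d ℕᵈ.∣? ∣ v x ∣)) Y)
      where
      dne : ∀ {x} → ¬ ¬ d ℕᵈ.∣ ∣ v x ∣ → d ℕᵈ.∣ ∣ v x ∣
      dne {x} h with d ℕᵈ.∣? ∣ v x ∣
      ... | yes k = k
      ... | no k = ⊥-elim (h k)
      Out = ∃[ R ] ∃[ Y′ ] ∃[ u′ ] ∃[ ℓ′ ] (Y ↭ R ++ Y′ × AP v (U ++ R) u′ 1 ℓ′ × 2 ℕ.* X ℕ.≤ ℓ′ × length R ℕ.≤ 2 ℕ.* d)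
      go : ∃[ ys ] ∃[ zs ] (Y ↭ ys ++ zs × All (λ x → ¬ d ℕᵈ.∣ ∣ v x ∣) ys × All (λ x → ¬ ¬ d ℕᵈ.∣ ∣ v x ∣) zs) → Out
      go (ys , zs , e , a , b) = go₁ (residue-class d (λ x → ∣ v x ∣) ys a (ℕₚ.≤-trans (ℕₚ.≤-trans (ℕₚ.m≤m+n (d ℕ.* d) d) dK) (ℕₚ.≤-trans (rob d (s≤s (s≤s z≤n)) dX)
           (ℕₚ.≤-trans (ℕₚ.≤-reflexive (trans (cnt-↭ v d e) (trans (cnt-++ v d ys zs) (trans (cong (cnt v d ys ℕ.+_) (cnt-0 v d zs (All.map dne b))) (ℕₚ.+-identityʳ (cnt v d ys)))))) (cnt-≤ v d ys)))))
        where
        go₁ : ∃[ ρ ] ∃[ rs ] ∃[ ts ] (ys ↭ rs ++ ts × length rs ≡ d × All (λ x → ∣ v x ∣ % d ≡ ρ) rs × 1 ℕ.≤ ρ × ρ ℕ.< d) → Out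
        go₁ (ρ , rs , ts , e₁ , len , res , ρ≥1 , ρ<d) = go₂ (R.refine ap 2X (singles v X rs nzr) (trans (singles-length v X rs nzr) len) (singles-res v X d ρ rs nzr res))
          where
          module R = Refine {v} {X} d ρ ρ≥1 ρ<d
          perm : Y ↭ rs ++ (ts ++ zs)
          perm = ↭-trans e (↭-trans (++⁺ʳ zs e₁) (++-assoc rs ts zs))
          nzr : All (NZ v X) rs
          nzr = Allₚ.++⁻ˡ rs (All-resp-↭ perm nz)
          g = R.g
          g<d : g ℕ.< d
          g<d = ℕₚ.<-≤-trans (ℕₚ.m<m+n g (ℕₚ.≤-trans R.g≥1 (ℕₚ.m≤m+n g 0))) R.2g≤d
          gg : g ℕ.* g ℕ.+ g ℕ.≤ d ℕ.* d
          gg = ℕₚ.≤-trans (ℕₚ.+-mono-≤ (ℕₚ.*-monoʳ-≤ g (ℕₚ.<⇒≤ g<d)) (ℕₚ.m≤m*n g d)) (ℕₚ.≤-trans (ℕₚ.≤-reflexive (eq g d)) (ℕₚ.*-monoˡ-≤ d R.2g≤d))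
            where
            eq : ∀ g d → g ℕ.* d ℕ.+ g ℕ.* d ≡ 2 ℕ.* g ℕ.* d
            eq = solveℕ 2 (λ g d → g ⊛ d ⊹ g ⊛ d ≔ lit 2 ⊛ g ⊛ d) refl
          rob′ : ∀ e → 2 ℕ.≤ e → e ℕ.≤ X → K ℕ.∸ d ℕ.≤ cnt v e (ts ++ zs)
          rob′ e h1 h2 = ℕₚ.m≤n+o⇒m∸n≤o K d (ℕₚ.≤-trans (rob e h1 h2) (ℕₚ.≤-trans (ℕₚ.≤-reflexive (trans (cnt-↭ v e perm) (cnt-++ v e rs (ts ++ zs))))
               (ℕₚ.+-monoˡ-≤ (cnt v e (ts ++ zs)) (ℕₚ.≤-trans (cnt-≤ v e rs) (ℕₚ.≤-reflexive len)))))
          gK : g ℕ.* g ℕ.+ g ℕ.≤ K ℕ.∸ d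
          gK = ℕₚ.≤-trans (ℕₚ.≤-reflexive (sym (ℕₚ.m+n∸n≡m (g ℕ.* g ℕ.+ g) d))) (ℕₚ.∸-monoˡ-≤ d (ℕₚ.≤-trans (ℕₚ.+-monoˡ-≤ d gg) dK))
          go₂ : ∃[ u′ ] ∃[ ℓ′ ] (AP v (U ++ elems (singles v X rs nzr)) u′ g ℓ′ × ℓ ℕ.≤ ℓ′) → Out
          go₂ (u′ , ℓ′ , ap′ , ll) = go₃ (finish v X fuel (U ++ rs) u′ g ℓ′ (ts ++ zs) (K ℕ.∸ d) (ℕₚ.≤-pred (ℕₚ.≤-trans g<d fu)) R.g≥1 (ℕₚ.≤-trans (ℕₚ.<⇒≤ g<d) dX)
                (subst (λ z → AP v (U ++ z) u′ g ℓ′) (singles-elems v X rs nzr) ap′) (ℕₚ.≤-trans 2X ll) (Allₚ.++⁻ʳ rs (All-resp-↭ perm nz)) rob′ gK)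
            where
            go₃ : ∃[ R ] ∃[ Y′ ] ∃[ u′ ] ∃[ ℓ′ ] ((ts ++ zs) ↭ R ++ Y′ × AP v ((U ++ rs) ++ R) u′ 1 ℓ′ × 2 ℕ.* X ℕ.≤ ℓ′ × length R ℕ.≤ 2 ℕ.* g) → Out
            go₃ (R , Y′ , u″ , ℓ″ , e₃ , ap″ , 2X″ , lenR) = rs ++ R , Y′ , u″ , ℓ″ , ↭-trans perm (↭-trans (++⁺ˡ rs e₃) (↭-sym (++-assoc rs R Y′))) ,
               AP-↭ v (++-assoc U rs R) ap″ , 2X″ , ℕₚ.≤-trans (ℕₚ.≤-reflexive (trans (Listₚ.length-++ rs) (cong (ℕ._+ length R) len)))
                 (ℕₚ.≤-trans (ℕₚ.+-monoʳ-≤ d (ℕₚ.≤-trans lenR R.2g≤d)) (ℕₚ.≤-reflexive (cong (d ℕ.+_) (sym (ℕₚ.+-identityʳ d)))))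

-- Choice of the scales for the interval construction

module LinearArithmetic where

  open import Data.Nat using (_≤_; _+_; _*_; _∸_; _<_)
  open IntegerSums using (≥0⇒pos)
  open Progressions

  -- Linear arithmetic by certificate: k is the slack, and the equation is a semiring identity.
  lin : ∀ {l r a b} k → l ≤ r → a + r + k ≡ b + l → a ≤ b
  lin {l} {r} {a} {b} k h e = ℕₚ.+-cancelʳ-≤ l a b (ℕₚ.≤-trans (ℕₚ.+-monoʳ-≤ a h) (ℕₚ.≤-trans (ℕₚ.m≤m+n (a + r) k) (ℕₚ.≤-reflexive e)))

  infixl 6 _⊞_
  infixr 7 _⊠_
  _⊞_ : ∀ {a b c d} → a ≤ b → c ≤ d → a + c ≤ b + d
  _⊞_ = ℕₚ.+-mono-≤

  _⊠_ : ∀ c {a b} → a ≤ b → c * a ≤ c * b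
  c ⊠ h = ℕₚ.*-monoʳ-≤ c h

  cancel : ∀ c {a b} → 1 ≤ c → c * a ≤ c * b → a ≤ b
  cancel c h k = ℕₚ.*-cancelˡ-≤ c {{ℕ.>-nonZero h}} k

  <div : ∀ a b .{{_ : NonZero b}} → a ≤ suc (a / b) * b
  <div a b = ℕₚ.≤-trans (ℕₚ.≤-reflexive (m≡m%n+[m/n]*n a b)) (ℕₚ.+-monoˡ-≤ (a / b * b) (ℕₚ.<⇒≤ (m%n<n a b)))

  -- Z stands for m X. G ≈ 16 Z / N bounds all differences of progressions, and `hc` is the
  -- statement that pools of G² gadgets are affordable, 64 G² ≤ N. The 17 = 16 + 1 absorbs the
  -- rounding of G, using N ≤ Z.
  module Gaps (N Z : ℕ) (N≥1 : 1 ≤ N) (N≤Z : N ≤ Z) (hc : 64 * (17 * (17 * (Z * Z))) ≤ N * N * N) where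

    instance
      N-nz : NonZero N
      N-nz = ℕ.>-nonZero N≥1

    G : ℕ
    G = suc (16 * Z / N)

    16Z≤ : 16 * Z ≤ G * N
    16Z≤ = <div (16 * Z) N

    GN≤ : G * N ≤ 17 * Z
    GN≤ = lin 0 (m/n*n≤m (16 * Z) N ⊞ N≤Z) (eq (16 * Z / N) N Z)
      where
      eq : ∀ q N Z → (N + q * N) + (16 * Z + Z) + 0 ≡ 17 * Z + (q * N + N)
      eq = solveℕ 3 (λ q N Z → (N ⊹ q ⊛ N) ⊹ (lit 16 ⊛ Z ⊹ Z) ⊹ lit 0 ≔ lit 17 ⊛ Z ⊹ (q ⊛ N ⊹ N)) refl

    64GG≤N : 64 * (G * G) ≤ N
    64GG≤N = cancel (N * N) (ℕₚ.*-mono-≤ N≥1 N≥1) (ℕₚ.≤-trans (lin 0 (64 ⊠ ℕₚ.*-mono-≤ GN≤ GN≤) (eq G N Z)) hc)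
      where
      eq : ∀ G N Z → N * N * (64 * (G * G)) + 64 * (17 * Z * (17 * Z)) + 0 ≡ 64 * (17 * (17 * (Z * Z))) + 64 * (G * N * (G * N))
      eq = solveℕ 3 (λ G N Z → N ⊛ N ⊛ (lit 64 ⊛ (G ⊛ G)) ⊹ lit 64 ⊛ (lit 17 ⊛ Z ⊛ (lit 17 ⊛ Z)) ⊹ lit 0 ≔ lit 64 ⊛ (lit 17 ⊛ (lit 17 ⊛ (Z ⊛ Z))) ⊹ lit 64 ⊛ (G ⊛ N ⊛ (G ⊛ N))) refl

    GG≥G : G ≤ G * G
    GG≥G = ℕₚ.m≤n*m G G

    N≥64 : 64 ≤ N
    N≥64 = ℕₚ.≤-trans (64 ⊠ ℕₚ.*-mono-≤ {1} {G} {1} {G} (s≤s z≤n) (s≤s z≤n)) 64GG≤N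

    1088Z≤ : 64 * (17 * (Z * Z)) ≤ N * N * N
    1088Z≤ = ℕₚ.≤-trans (64 ⊠ (17 ⊠ ℕₚ.m≤m+n (Z * Z) (16 * (Z * Z)))) hc

    -- For G < X the progression grows in two phases. Boxes of length G bring it to 2 W₁ steps,
    -- gaining at least one step at a time; then boxes of length W₁ = ⌊N/16⌋ bring it to 2 X,
    -- gaining at least r₁ steps at a time. r₁ is the largest gain that the pigeonhole in `ext`
    -- permits while N/8 elements remain.
    module Big (m X : ℕ) (Z≡ : Z ≡ m * X) (G<X : G < X) (m≥1 : 1 ≤ m) where
      W₁ s T r₁ q c₂ : ℕ

      X≤Z : X ≤ Z
      X≤Z = ℕₚ.≤-trans (ℕₚ.m≤n*m X m {{ℕ.>-nonZero m≥1}}) (ℕₚ.≤-reflexive (sym Z≡))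

      thr₁ : 8 * (suc (X / G) * m) ≤ N
      thr₁ = cancel (2 * G) (ℕₚ.m≤m+n 1 (G ∸ 1 + (G + 0))) (lin 0 (16 ⊠ (m ⊠ h₁) ⊞ 2 ⊠ 16Z≤)
           (trans (eq G N X m (X / G)) (cong (λ z → 2 * G * N + (16 * (m * (suc (X / G) * G)) + 2 * (16 * z))) (sym Z≡))))
        where
        h₁ : suc (X / G) * G ≤ 2 * X
        h₁ = lin 0 (m/n*n≤m X G ⊞ ℕₚ.<⇒≤ G<X) (e (X / G) G X)
          where
          e : ∀ a G X → (G + a * G) + (X + X) + 0 ≡ 2 * X + (a * G + G)
          e = solveℕ 3 (λ a G X → (G ⊹ a ⊛ G) ⊹ (X ⊹ X) ⊹ lit 0 ≔ lit 2 ⊛ X ⊹ (a ⊛ G ⊹ G)) refl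
        eq : ∀ G N X m a → 2 * G * (8 * (suc a * m)) + (16 * (m * (2 * X)) + 2 * (G * N)) + 0 ≡ 2 * G * N + (16 * (m * (suc a * G)) + 2 * (16 * (m * X)))
        eq = solveℕ 5 (λ G N X m a → lit 2 ⊛ G ⊛ (lit 8 ⊛ ((lit 1 ⊹ a) ⊛ m)) ⊹ (lit 16 ⊛ (m ⊛ (lit 2 ⊛ X)) ⊹ lit 2 ⊛ (G ⊛ N)) ⊹ lit 0 ≔ lit 2 ⊛ G ⊛ N ⊹ (lit 16 ⊛ (m ⊛ ((lit 1 ⊹ a) ⊛ G)) ⊹ lit 2 ⊛ (lit 16 ⊛ (m ⊛ X)))) refl

      W₁ = N / 16

      W₁≥1 : 1 ≤ W₁
      W₁≥1 = m≥n⇒m/n>0 (ℕₚ.≤-trans (ℕₚ.m≤m+n 16 48) N≥64)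

      instance
        W₁-nz : NonZero W₁
        W₁-nz = ℕ.>-nonZero W₁≥1

      16W₁≤N : W₁ * 16 ≤ N
      16W₁≤N = m/n*n≤m N 16

      N≤32W₁ : N ≤ 32 * W₁
      N≤32W₁ = lin 0 (<div N 16 ⊞ 16 ⊠ W₁≥1) (eq N W₁)
        where
        eq : ∀ N w → N + (16 + w * 16 + 16 * w) + 0 ≡ 32 * w + (N + 16)
        eq = solveℕ 2 (λ N w → N ⊹ (lit 16 ⊹ w ⊛ lit 16 ⊹ lit 16 ⊛ w) ⊹ lit 0 ≔ lit 32 ⊛ w ⊹ (N ⊹ lit 16)) refl

      G≤W₁ : G ≤ W₁
      G≤W₁ = cancel 64 (s≤s z≤n) (ℕₚ.≤-trans (64 ⊠ GG≥G) (ℕₚ.≤-trans 64GG≤N (ℕₚ.≤-trans N≤32W₁ (ℕₚ.*-monoˡ-≤ W₁ (ℕₚ.m≤m+n 32 32)))))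

      s = X / W₁
      T = suc s

      16m≤N : 16 * m ≤ N
      16m≤N = cancel X (ℕₚ.≤-trans (s≤s z≤n) G<X) (ℕₚ.≤-trans (ℕₚ.≤-reflexive (trans (eq X m) (cong (16 *_) (sym Z≡)))) (ℕₚ.≤-trans 16Z≤ (ℕₚ.*-monoˡ-≤ N (ℕₚ.<⇒≤ G<X))))
        where
        eq : ∀ X m → X * (16 * m) ≡ 16 * (m * X)
        eq = solveℕ 2 (λ X m → X ⊛ (lit 16 ⊛ m) ≔ lit 16 ⊛ (m ⊛ X)) refl

      8mT≤N : 8 * m * T ≤ N
      8mT≤N = cancel (2 * W₁) (ℕₚ.*-mono-≤ {1} {2} (s≤s z≤n) W₁≥1) (lin 0 ((16 * m) ⊠ m/n*n≤m X W₁ ⊞ 16Z≤ ⊞ ℕₚ.*-monoˡ-≤ N G≤W₁ ⊞ W₁ ⊠ 16m≤N)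
           (trans (eq m s W₁ X N G) (cong (λ z → 2 * W₁ * N + (16 * m * (s * W₁) + 16 * z + G * N + W₁ * (16 * m))) (sym Z≡))))
        where
        eq : ∀ m s W X N G → 2 * W * (8 * m * suc s) + (16 * m * X + G * N + W * N + W * N) + 0 ≡ 2 * W * N + (16 * m * (s * W) + 16 * (m * X) + G * N + W * (16 * m))
        eq = solveℕ 6 (λ m s W X N G → lit 2 ⊛ W ⊛ (lit 8 ⊛ m ⊛ (lit 1 ⊹ s)) ⊹ (lit 16 ⊛ m ⊛ X ⊹ G ⊛ N ⊹ W ⊛ N ⊹ W ⊛ N) ⊹ lit 0 ≔ lit 2 ⊛ W ⊛ N ⊹ (lit 16 ⊛ m ⊛ (s ⊛ W) ⊹ lit 16 ⊛ (m ⊛ X) ⊹ G ⊛ N ⊹ W ⊛ (lit 16 ⊛ m))) refl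

      instance
        8mT-nz : NonZero (8 * m * T)
        8mT-nz = ℕ.>-nonZero (ℕₚ.*-mono-≤ {1} {8 * m} {1} {T} (ℕₚ.*-mono-≤ {1} {8} (s≤s z≤n) m≥1) (s≤s z≤n))

      r₁ = N / (8 * m * T)

      r₁≥1 : 1 ≤ r₁
      r₁≥1 = m≥n⇒m/n>0 8mT≤N

      instance
        r₁-nz : NonZero r₁
        r₁-nz = ℕ.>-nonZero r₁≥1

      thr₂ : 8 * (T * (r₁ * m)) ≤ N
      thr₂ = ℕₚ.≤-trans (ℕₚ.≤-reflexive (eq T r₁ m)) (m/n*n≤m N (8 * m * T))
        where
        eq : ∀ T r m → 8 * (T * (r * m)) ≡ r * (8 * m * T)
        eq = solveℕ 3 (λ T r m → lit 8 ⊛ (T ⊛ (r ⊛ m)) ≔ r ⊛ (lit 8 ⊛ m ⊛ T)) refl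

      N≤r₁ : N ≤ r₁ * (16 * m * T)
      N≤r₁ = lin 0 (<div N (8 * m * T) ⊞ ℕₚ.*-monoˡ-≤ (8 * m * T) r₁≥1) (eq N r₁ m T)
        where
        eq : ∀ N r m T → N + (8 * m * T + r * (8 * m * T) + r * (8 * m * T)) + 0 ≡ r * (16 * m * T) + (N + 1 * (8 * m * T))
        eq = solveℕ 4 (λ N r m T → N ⊹ (lit 8 ⊛ m ⊛ T ⊹ r ⊛ (lit 8 ⊛ m ⊛ T) ⊹ r ⊛ (lit 8 ⊛ m ⊛ T)) ⊹ lit 0 ≔ r ⊛ (lit 16 ⊛ m ⊛ T) ⊹ (N ⊹ lit 1 ⊛ (lit 8 ⊛ m ⊛ T))) refl

      q = 2 * X / r₁
      c₂ = suc q

      c₂-enough : 2 * X ≤ c₂ * r₁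
      c₂-enough = <div (2 * X) r₁

      q≤2GT : q ≤ 2 * (G * T)
      q≤2GT = cancel N N≥1 (lin 0 (q ⊠ N≤r₁ ⊞ (16 * m * T) ⊠ m/n*n≤m (2 * X) r₁ ⊞ (2 * T) ⊠ 16Z≤) (trans (eq N q r₁ m T X G)
           (cong (λ z → N * (2 * (G * T)) + (q * N + 16 * m * T * (q * r₁) + 2 * T * (16 * z))) (sym Z≡))))
        where
        eq : ∀ N q r m T X G → N * q + (q * (r * (16 * m * T)) + 16 * m * T * (2 * X) + 2 * T * (G * N)) + 0 ≡ N * (2 * (G * T)) + (q * N + 16 * m * T * (q * r) + 2 * T * (16 * (m * X)))
        eq = solveℕ 7 (λ N q r m T X G → N ⊛ q ⊹ (q ⊛ (r ⊛ (lit 16 ⊛ m ⊛ T)) ⊹ lit 16 ⊛ m ⊛ T ⊛ (lit 2 ⊛ X) ⊹ lit 2 ⊛ T ⊛ (G ⊛ N)) ⊹ lit 0 ≔ N ⊛ (lit 2 ⊛ (G ⊛ T)) ⊹ (q ⊛ N ⊹ lit 16 ⊛ m ⊛ T ⊛ (q ⊛ r) ⊹ lit 2 ⊛ T ⊛ (lit 16 ⊛ (m ⊛ X)))) refl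

      34Gs≤N : 34 * (G * s) ≤ N
      34Gs≤N = cancel N N≥1 (ℕₚ.≤-trans (lin 0 ((34 * (G * s)) ⊠ N≤32W₁ ⊞ (34 * 32 * G) ⊠ m/n*n≤m X W₁) (eq₂ G s N W₁ X)) GX≤)
        where
        eq₁ : ∀ G N X Z → N * (34 * 32 * (G * X)) + (64 * (17 * X) * (17 * Z) + 64 * (17 * (17 * Z)) * Z) + 0 ≡ 64 * (17 * (17 * (Z * Z))) + (64 * (17 * X) * (G * N) + 64 * (17 * (17 * Z)) * X)
        eq₁ = solveℕ 4 (λ G N X Z → N ⊛ (lit 34 ⊛ lit 32 ⊛ (G ⊛ X)) ⊹ (lit 64 ⊛ (lit 17 ⊛ X) ⊛ (lit 17 ⊛ Z) ⊹ lit 64 ⊛ (lit 17 ⊛ (lit 17 ⊛ Z)) ⊛ Z) ⊹ lit 0 ≔ lit 64 ⊛ (lit 17 ⊛ (lit 17 ⊛ (Z ⊛ Z))) ⊹ (lit 64 ⊛ (lit 17 ⊛ X) ⊛ (G ⊛ N) ⊹ lit 64 ⊛ (lit 17 ⊛ (lit 17 ⊛ Z)) ⊛ X)) refl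
        eq₂ : ∀ G s N W X → N * (34 * (G * s)) + (34 * (G * s) * (32 * W) + 34 * 32 * G * X) + 0 ≡ 34 * 32 * (G * X) + (34 * (G * s) * N + 34 * 32 * G * (s * W))
        eq₂ = solveℕ 5 (λ G s N W X → N ⊛ (lit 34 ⊛ (G ⊛ s)) ⊹ (lit 34 ⊛ (G ⊛ s) ⊛ (lit 32 ⊛ W) ⊹ lit 34 ⊛ lit 32 ⊛ G ⊛ X) ⊹ lit 0 ≔ lit 34 ⊛ lit 32 ⊛ (G ⊛ X) ⊹ (lit 34 ⊛ (G ⊛ s) ⊛ N ⊹ lit 34 ⊛ lit 32 ⊛ G ⊛ (s ⊛ W))) refl
        GX≤ : 34 * 32 * (G * X) ≤ N * N
        GX≤ = cancel N N≥1 (ℕₚ.≤-trans (lin 0 ((64 * (17 * X)) ⊠ GN≤ ⊞ (64 * (17 * (17 * Z))) ⊠ X≤Z) (eq₁ G N X Z)) (ℕₚ.≤-trans hc (ℕₚ.≤-reflexive (ℕₚ.*-assoc N N N))))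

      -- The 2 G² + 1 initial gadgets, the untouched reserve N/8, pools of 3 G² for each phase, and
      -- two elements for each of the c₂ and 2 W₁ extensions.
      budget : (2 * (2 * (G * G) + 1)) + (N / 8 + 3 * (G * G) + 2 * c₂ + 3 * (G * G) + 2 * (2 * W₁)) ≤ N
      budget = cancel 64 (s≤s z≤n) (lin 0 (10 ⊠ 64GG≤N ⊞ 6 ⊠ N≥64 ⊞ 16 ⊠ 16W₁≤N ⊞ 8 ⊠ m/n*n≤m N 8 ⊞ 128 ⊠ q≤2GT ⊞ 8 ⊠ 34Gs≤N ⊞ 4 ⊠ 64GG≤N ⊞ 256 ⊠ GG≥G ⊞ z≤n {16 * (G * s) + 128 + 12 * N}) (eq G N W₁ (N / 8) q s))
        where
        eq : ∀ G N W a q s → 64 * ((2 * (2 * (G * G) + 1)) + (a + 3 * (G * G) + 2 * suc q + 3 * (G * G) + 2 * (2 * W)))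
             + (10 * N + 6 * N + 16 * N + 8 * N + 128 * (2 * (G * suc s)) + 8 * N + 4 * N + 256 * (G * G) + (16 * (G * s) + 128 + 12 * N)) + 0
             ≡ 64 * N + (10 * (64 * (G * G)) + 6 * 64 + 16 * (W * 16) + 8 * (a * 8) + 128 * q + 8 * (34 * (G * s)) + 4 * (64 * (G * G)) + 256 * G + 0)
        eq = solveℕ 6 (λ G N W a q s → lit 64 ⊛ ((lit 2 ⊛ (lit 2 ⊛ (G ⊛ G) ⊹ lit 1)) ⊹ (a ⊹ lit 3 ⊛ (G ⊛ G) ⊹ lit 2 ⊛ (lit 1 ⊹ q) ⊹ lit 3 ⊛ (G ⊛ G) ⊹ lit 2 ⊛ (lit 2 ⊛ W))) ⊹ (lit 10 ⊛ N ⊹ lit 6 ⊛ N ⊹ lit 16 ⊛ N ⊹ lit 8 ⊛ N ⊹ lit 128 ⊛ (lit 2 ⊛ (G ⊛ (lit 1 ⊹ s))) ⊹ lit 8 ⊛ N ⊹ lit 4 ⊛ N ⊹ lit 256 ⊛ (G ⊛ G) ⊹ (lit 16 ⊛ (G ⊛ s) ⊹ lit 128 ⊹ lit 12 ⊛ N)) ⊹ lit 0 ≔ lit 64 ⊛ N ⊹ (lit 10 ⊛ (lit 64 ⊛ (G ⊛ G)) ⊹ lit 6 ⊛ lit 64 ⊹ lit 16 ⊛ (W ⊛ lit 16) ⊹ lit 8 ⊛ (a ⊛ lit 8) ⊹ lit 128 ⊛ q ⊹ lit 8 ⊛ (lit 34 ⊛ (G ⊛ s)) ⊹ lit 4 ⊛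 (lit 64 ⊛ (G ⊛ G)) ⊹ lit 256 ⊛ G ⊹ lit 0)) refl

-- Intervals of subsums

module Intervals where

  open import Data.Nat using (_≤_; _+_; _*_; _∸_; _<_)
  open IntegerSums using (≥0⇒pos; ≤-by; sub≥0; _⊕_; _⊗_; pos; ≤-or; ≤-absurd; +≤+⁻)
  open Progressions
  open LinearArithmetic

  posp : ℤ → ℤ
  posp (+ n) = + n
  posp -[1+ n ] = 0ℤ

  posp≥ : ∀ z → z ℤ.≤ posp z
  posp≥ (+ n) = ℤₚ.≤-refl
  posp≥ -[1+ n ] = ℤ.-≤+

  posp≥0 : ∀ z → 0ℤ ℤ.≤ posp z
  posp≥0 (+ n) = pos
  posp≥0 -[1+ n ] = pos

  posp≤ : ∀ z → posp z ℤ.≤ + ∣ z ∣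
  posp≤ (+ n) = ℤₚ.≤-refl
  posp≤ -[1+ n ] = pos

  posp-split : ∀ z → z ≡ posp z ℤ.- posp (ℤ.- z)
  posp-split (+ zero) = refl
  posp-split (+ suc n) = sym (ℤₚ.+-identityʳ (+ suc n))
  posp-split -[1+ n ] = refl

  module _ {E : Set} where

    in⇒NZ : ∀ (v : E → ℤ) X {x} → InRange v X x → NZ v X x
    in⇒NZ v X (n , e , a , b) = subst (λ z → 1 ≤ ∣ z ∣ × ∣ z ∣ ≤ X) (sym e) (a , b)

    range-bound : ∀ (v : E → ℤ) X m Q → Mult v m Q → All (InRange v X) Q → length Q ≤ m * X
    range-bound v X m Q M inR with length Q ℕₚ.≤? m * X
    ... | yes h = h
    ... | no n = ⊥-elim (go (pigeonhole X m (λ x → ∣ v x ∣ ∸ 1) Q (All.map small inR) (ℕₚ.≤-<-trans (ℕₚ.≤-reflexive (ℕₚ.*-comm X m)) (ℕₚ.≰⇒> n))))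
      where
      small : ∀ {x} → InRange v X x → ∣ v x ∣ ∸ 1 < X
      small {x} (suc n , e , a , b) = subst (λ z → ∣ z ∣ ∸ 1 < X) (sym e) b
      go : ∃[ k ] ∃[ ys ] ∃[ zs ] (Q ↭ ys ++ zs × All (λ x → ∣ v x ∣ ∸ 1 ≡ k) ys × m < length ys) → ⊥
      go (k , ys , zs , e , h , l) = ℕₚ.<⇒≱ l (M (+ suc k) ys zs e (All.zipWith (λ { {x} (ek , (suc n , e , _)) → trans e (cong (λ z → + suc z) (trans (sym (cong (λ z → ∣ z ∣ ∸ 1) e)) ek)) }) (h , Allₚ.++⁻ˡ ys (All-resp-↭ e inR))))

    Found : (E → ℤ) → ℕ → ℕ → List E → List E → Set
    Found v X G Q Y = ∃[ R ] ∃[ Y′ ] ∃[ u ] ∃[ ℓ ] (Y ↭ R ++ Y′ × AP v (Q ++ R) u 1 ℓ × 2 * X ≤ ℓ × length R ≤ 2 * G)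

    -- If X ≤ G, single terms are gadgets and 2 X² < N of them already share a long enough common
    -- difference. If X > G, the two phases of `Big` are run. Either way `finish` refines the
    -- resulting difference d ≤ G to 1.
    interval : ∀ (v : E → ℤ) X m N Q Y (N≥1 : 1 ≤ N) (N≤Z : N ≤ m * X) (hc : 64 * (17 * (17 * (m * X * (m * X)))) ≤ N * N * N) →
               1 ≤ m → 1 ≤ X → length Q ≡ N → Mult v m Q → All (InRange v X) Q → All (NZ v X) Y → (∀ e → 2 ≤ e → e ≤ X → N ≤ cnt v e Y) →
               Found v X (Gaps.G N (m * X) N≥1 N≤Z hc) Q Y
    interval v X m N Q Y N≥1 N≤Z hc m≥1 X≥1 len M inR nz rob = cases (G ℕₚ.<? X)
      where
      open Gaps N (m * X) N≥1 N≤Z hc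
      instance
        X-nz : NonZero X
        X-nz = ℕ.>-nonZero X≥1
      2GG≤N : G * G + G ≤ N
      2GG≤N = ℕₚ.≤-trans (lin (62 * (G * G)) (ℕₚ.+-monoʳ-≤ (G * G) GG≥G) (eq G)) 64GG≤N
        where
        eq : ∀ G → G * G + G + (G * G + G * G) + 62 * (G * G) ≡ 64 * (G * G) + (G * G + G)
        eq = solveℕ 1 (λ G → G ⊛ G ⊹ G ⊹ (G ⊛ G ⊹ G ⊛ G) ⊹ lit 62 ⊛ (G ⊛ G) ≔ lit 64 ⊛ (G ⊛ G) ⊹ (G ⊛ G ⊹ G)) refl
      done : ∀ {U u d ℓ rem} → Q ↭ U ++ rem → AP v U u d ℓ → 2 * X ≤ ℓ → 1 ≤ d → d ≤ G → d ≤ X → Found v X G Q Y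
      done {U} {u} {d} {ℓ} {rem} perm ap 2X d≥1 dG dX = out (finish v X d Q u d ℓ Y N ℕₚ.≤-refl d≥1 dX (AP-↭ v (↭-sym perm) (AP-weak v rem ap)) 2X nz rob
           (ℕₚ.≤-trans (ℕₚ.+-mono-≤ (ℕₚ.*-mono-≤ dG dG) dG) 2GG≤N))
        where
        out : ∃[ R ] ∃[ Y′ ] ∃[ u′ ] ∃[ ℓ′ ] (Y ↭ R ++ Y′ × AP v (Q ++ R) u′ 1 ℓ′ × 2 * X ≤ ℓ′ × length R ≤ 2 * d) → Found v X G Q Y
        out (R , Y′ , u′ , ℓ′ , a , b , c , e) = R , Y′ , u′ , ℓ′ , a , b , c , ℕₚ.≤-trans e (2 ⊠ dG)
      cases : Dec (G < X) → Found v X G Q Y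
      cases (no G≮X) = go (popular (singles v X Q nzQ) (2 * X) (ℕₚ.<-≤-trans small (ℕₚ.≤-reflexive (sym (trans (singles-length v X Q nzQ) len)))))
        where
        X≤G = ℕₚ.≮⇒≥ G≮X
        nzQ : All (NZ v X) Q
        nzQ = All.map (in⇒NZ v X) inR
        small : X * (2 * X) < N
        small = ℕₚ.<-≤-trans (ℕₚ.≤-<-trans (ℕₚ.*-mono-≤ X≤G (2 ⊠ X≤G)) (ℕₚ.≤-trans (ℕₚ.+-monoˡ-≤ (G * (2 * G)) {1} {62 * (G * G)} (ℕₚ.*-mono-≤ {1} {62} (s≤s z≤n) (ℕₚ.*-mono-≤ {1} {G} {1} {G} (s≤s z≤n) (s≤s z≤n)))) (ℕₚ.≤-reflexive (eq G)))) 64GG≤N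
          where
          eq : ∀ G → 62 * (G * G) + G * (2 * G) ≡ 64 * (G * G)
          eq = solveℕ 1 (λ G → lit 62 ⊛ (G ⊛ G) ⊹ G ⊛ (lit 2 ⊛ G) ≔ lit 64 ⊛ (G ⊛ G)) refl
        go : ∃[ u ] ∃[ d ] ∃[ ℓ ] (AP v (elems (singles v X Q nzQ)) u d ℓ × 2 * X ≤ ℓ × 1 ≤ d × d ≤ X) → Found v X G Q Y
        go (u , d , ℓ , ap , l , d≥1 , dX) = done {rem = []} (↭-sym (++-identityʳ Q)) (subst (λ z → AP v z u d ℓ) (singles-elems v X Q nzQ) ap) l d≥1 (ℕₚ.≤-trans dX X≤G) dX
      cases (yes G<X) = start (collect v X m G n Q M inR (ℕₚ.≤-trans (ℕₚ.+-monoˡ-≤ (2 * n) (ℕₚ.≤-trans t₁ (tail₁ _ _ _ _ _))) (ℕₚ.≤-trans (ℕₚ.≤-reflexive (ℕₚ.+-comm _ (2 * n))) (ℕₚ.≤-trans budget (ℕₚ.≤-reflexive (sym len))))))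
        where
        open Big m X refl G<X m≥1
        n = 2 * (G * G) + 1
        eighth : ∀ t → 8 * t ≤ N → t ≤ N / 8
        eighth t h = ℕₚ.≤-trans (ℕₚ.≤-reflexive (sym (m*n/n≡m t 8))) (/-monoˡ-≤ 8 (ℕₚ.≤-trans (ℕₚ.≤-reflexive (ℕₚ.*-comm t 8)) h))
        t₁ : suc (X / G) * m ≤ N / 8
        t₁ = eighth _ thr₁
        tail₁ : ∀ a b c d e → a ≤ a + b + c + d + e
        tail₁ a b c d e = ℕₚ.≤-trans (ℕₚ.≤-trans (ℕₚ.m≤m+n a b) (ℕₚ.m≤m+n (a + b) c)) (ℕₚ.≤-trans (ℕₚ.m≤m+n (a + b + c) d) (ℕₚ.m≤m+n (a + b + c + d) e))
        B₁ = N / 8 + 3 * (G * G) + 2 * c₂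
        module Ph₁ = Phase v X m 1 G (s≤s z≤n) Q M inR (2 * W₁) B₁ G
            (ℕₚ.≤-trans (ℕₚ.≤-reflexive (cong (suc (X / G) *_) (ℕₚ.*-identityˡ m))) (ℕₚ.≤-trans t₁ (ℕₚ.≤-trans (ℕₚ.m≤m+n (N / 8) (3 * (G * G))) (ℕₚ.m≤m+n (N / 8 + 3 * (G * G)) (2 * c₂)))))
        module Ph₂ = Phase v X m r₁ W₁ r₁≥1 Q M inR (2 * X) (N / 8) G (eighth _ thr₂)
        start : ∃[ γs ] ∃[ rem ] (Q ↭ elems {v = v} {G} γs ++ rem × length γs ≡ n × length Q ≡ 2 * n + length rem) → Found v X G Q Y
        start (γs , rem , perm , lγ , lr) = phases (popular γs (2 * G) (ℕₚ.<-≤-trans small (ℕₚ.≤-reflexive (sym lγ))))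
          where
          small : G * (2 * G) < n
          small = ℕₚ.≤-trans (ℕₚ.≤-reflexive (eq G)) ℕₚ.≤-refl
            where
            eq : ∀ G → suc (G * (2 * G)) ≡ 2 * (G * G) + 1
            eq = solveℕ 1 (λ G → (lit 1 ⊹ (G ⊛ (lit 2 ⊛ G))) ≔ lit 2 ⊛ (G ⊛ G) ⊹ lit 1) refl
          left : B₁ + 3 * (G * G) + 2 * (2 * W₁) ≤ length rem
          left = ℕₚ.+-cancelˡ-≤ (2 * n) _ _ (ℕₚ.≤-trans budget (ℕₚ.≤-reflexive (trans (sym len) lr)))
          phases : ∃[ u ] ∃[ d ] ∃[ ℓ ] (AP v (elems γs) u d ℓ × 2 * G ≤ ℓ × 1 ≤ d × d ≤ G) → Found v X G Q Y
          phases (u , d , ℓ , ap , l , d≥1 , dG) = last (Ph₂.advance c₂ c₂-enough (Ph₁.advance (2 * W₁) (ℕₚ.≤-reflexive (sym (ℕₚ.*-identityʳ (2 * W₁)))) P₀))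
            where
            P₀ : Progress v Q (2 * G) (B₁ + 3 * (G * G) + 2 * (2 * W₁)) G
            P₀ = record { U = elems γs ; rem = rem ; u = u ; d = d ; ℓ = ℓ ; perm = perm ; ap = ap ; long = l ; left = left ; d≥1 = d≥1 ; d≤d₀ = dG }
            last : Progress v Q (2 * X) (N / 8) G → Found v X G Q Y
            last P = done P.perm P.ap P.long P.d≥1 P.d≤d₀ (ℕₚ.≤-trans P.d≤d₀ (ℕₚ.<⇒≤ G<X))
              where module P = Progress P

    up dn : (E → ℤ) → E → ℤ
    up v x = posp (v x)
    dn v x = posp (ℤ.- v x)

    sumv-mono : ∀ {f g : E → ℤ} xs → (∀ x → f x ℤ.≤ g x) → sumv f xs ℤ.≤ sumv g xs
    sumv-mono [] h = ℤₚ.≤-refl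
    sumv-mono (x ∷ xs) h = ℤₚ.+-mono-≤ (h x) (sumv-mono xs h)

    sumv-≥0 : ∀ {f : E → ℤ} xs → (∀ x → 0ℤ ℤ.≤ f x) → 0ℤ ℤ.≤ sumv f xs
    sumv-≥0 [] h = ℤₚ.≤-refl
    sumv-≥0 (x ∷ xs) h = h x ⊕ sumv-≥0 xs h

    sumv-≤ : ∀ {f : E → ℤ} X xs → All (λ x → f x ℤ.≤ + X) xs → sumv f xs ℤ.≤ + length xs ℤ.* + X
    sumv-≤ X [] [] = ℤₚ.≤-reflexive (sym (ℤₚ.*-zeroˡ (+ X)))
    sumv-≤ {f} X (x ∷ xs) (h ∷ hs) = ≤-by _ (sub≥0 h ⊕ sub≥0 (sumv-≤ X xs hs)) (eq (f x) (sumv f xs) (+ length xs) (+ X))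
      where
      eq : ∀ a b n X → (1ℤ ℤ.+ n) ℤ.* X ℤ.- (a ℤ.+ b) ≡ (X ℤ.- a) ℤ.+ (n ℤ.* X ℤ.- b)
      eq = solve 4 (λ a b n X → (con 1ℤ :+ n) :* X :- (a :+ b) := (X :- a) :+ (n :* X :- b)) refl

    sumv-cong : ∀ {f g : E → ℤ} xs → All (λ x → f x ≡ g x) xs → sumv f xs ≡ sumv g xs
    sumv-cong [] [] = refl
    sumv-cong (x ∷ xs) (h ∷ hs) = cong₂ ℤ._+_ h (sumv-cong xs hs)

    real-≤ : ∀ v L z → Real v L z → z ℤ.≤ sumv (up v) L
    real-≤ v L z (C , C′ , e , s) = ≤-by _ (sub≥0 (sumv-mono {v} {up v} C (λ x → posp≥ (v x))) ⊕ sumv-≥0 {up v} C′ (λ x → posp≥0 (v x)))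
        (trans (cong₂ ℤ._-_ (trans (sumv-↭ (up v) e) (sumv-++ (up v) C C′)) (sym s)) (eq (sumv (up v) C) (sumv (up v) C′) (sumv v C)))
      where
      eq : ∀ a b c → a ℤ.+ b ℤ.- c ≡ a ℤ.- c ℤ.+ b
      eq = solve 3 (λ a b c → a :+ b :- c := a :- c :+ b) refl

    real-≥ : ∀ v L z → Real v L z → ℤ.- z ℤ.≤ sumv (dn v) L
    real-≥ v L z (C , C′ , e , s) = ≤-by _ (sub≥0 (sumv-mono {λ x → ℤ.- v x} {dn v} C (λ x → posp≥ (ℤ.- v x))) ⊕ sumv-≥0 {dn v} C′ (λ x → posp≥0 (ℤ.- v x)))
        (trans (cong₂ ℤ._-_ (trans (sumv-↭ (dn v) e) (sumv-++ (dn v) C C′)) (trans (cong ℤ.-_ (sym s)) (neg C))) (eq (sumv (dn v) C) (sumv (dn v) C′) (sumv (λ x → ℤ.- v x) C)))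
      where
      eq : ∀ a b c → a ℤ.+ b ℤ.- c ≡ a ℤ.- c ℤ.+ b
      eq = solve 3 (λ a b c → a :+ b :- c := a :- c :+ b) refl
      neg : ∀ C → ℤ.- sumv v C ≡ sumv (λ x → ℤ.- v x) C
      neg [] = refl
      neg (x ∷ xs) = trans (ℤₚ.neg-distrib-+ (v x) (sumv v xs)) (cong (ℤ._+_ (ℤ.- v x)) (neg xs))

    Fills : (E → ℤ) → List E → ℤ → ℤ → Set
    Fills v L lo hi = ∀ z → lo ℤ.≤ z → z ℤ.≤ hi → Real v L z

    -- A positive term extends the interval upwards and a negative one downwards. No gap arises
    -- because the interval is at least X long, and its length never decreases.
    slide : ∀ v X L lo hi Y → lo ℤ.+ + X ℤ.≤ hi → All (NZ v X) Y → Fills v L lo hi → Fills v (L ++ Y) (lo ℤ.- sumv (dn v) Y) (hi ℤ.+ sumv (up v) Y)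
    slide v X L lo hi [] wide [] F z a b = real-weak v [] (F z (subst (ℤ._≤ z) (ℤₚ.+-identityʳ lo) a) (subst (z ℤ.≤_) (ℤₚ.+-identityʳ hi) b))
    slide v X L lo hi (x ∷ Y) wide ((_ , h) ∷ hs) F z a b = real-↭ v (↭-trans (++-assoc L (x ∷ []) Y) ↭-refl)
        (slide v X (L ++ (x ∷ [])) lo′ hi′ Y wide′ hs F′ z (subst (ℤ._≤ z) (e₁ lo (dn v x) (sumv (dn v) Y)) a) (subst (z ℤ.≤_) (e₂ hi (up v x) (sumv (up v) Y)) b))
      where
      lo′ = lo ℤ.- dn v x
      hi′ = hi ℤ.+ up v x
      e₁ : ∀ l a b → l ℤ.- (a ℤ.+ b) ≡ l ℤ.- a ℤ.- b
      e₁ = solve 3 (λ l a b → l :- (a :+ b) := l :- a :- b) refl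
      e₂ : ∀ l a b → l ℤ.+ (a ℤ.+ b) ≡ l ℤ.+ a ℤ.+ b
      e₂ = solve 3 (λ l a b → l :+ (a :+ b) := l :+ a :+ b) refl
      wide′ : lo′ ℤ.+ + X ℤ.≤ hi′
      wide′ = ≤-by _ (sub≥0 wide ⊕ (posp≥0 (v x) ⊕ posp≥0 (ℤ.- v x))) (eq lo hi (+ X) (up v x) (dn v x))
        where
        eq : ∀ l h X a b → h ℤ.+ a ℤ.- (l ℤ.- b ℤ.+ X) ≡ (h ℤ.- (l ℤ.+ X)) ℤ.+ (a ℤ.+ b)
        eq = solve 5 (λ l h X a b → h :+ a :- (l :- b :+ X) := (h :- (l :+ X)) :+ (a :+ b)) refl
      F′ : Fills v (L ++ (x ∷ [])) lo′ hi′
      F′ z a b = inside (≤-or lo z) (≤-or z hi)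
        where
        none : lo ℤ.≤ z → z ℤ.≤ hi → Real v (L ++ (x ∷ [])) z
        none h k = real-weak v (x ∷ []) (F z h k)
        take : lo ℤ.≤ z ℤ.- v x → z ℤ.- v x ℤ.≤ hi → Real v (L ++ (x ∷ [])) z
        take h k = real-≡ v (e z (v x)) (real-++ v (F (z ℤ.- v x) h k) (real-all v (x ∷ [])))
          where
          e : ∀ z c → z ℤ.- c ℤ.+ (c ℤ.+ 0ℤ) ≡ z
          e = solve 2 (λ z c → z :- c :+ (c :+ con 0ℤ) := z) refl
        small : + ∣ v x ∣ ℤ.≤ + X
        small = +≤+ h
        -- outside [lo , hi] on the upper (lower) side the positive (negative) x has to be used
        inside : lo ℤ.≤ z ⊎ 1ℤ ℤ.+ z ℤ.≤ lo → z ℤ.≤ hi ⊎ 1ℤ ℤ.+ hi ℤ.≤ z → Real v (L ++ (x ∷ [])) z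
        inside (inj₁ p) (inj₁ q) = none p q
        inside _ (inj₂ q) = take
           (≤-by _ (sub≥0 q ⊕ sub≥0 wide ⊕ sub≥0 small ⊕ sub≥0 (posp≤ (v x)) ⊕ posp≥0 (ℤ.- v x) ⊕ pos {1}) (trans (cong (λ y → z ℤ.- y ℤ.- lo) (posp-split (v x))) (eq z lo hi (+ X) (up v x) (dn v x) (+ ∣ v x ∣))))
           (≤-by _ (sub≥0 b ⊕ extra q) (trans (cong (λ y → hi ℤ.- (z ℤ.- y)) (posp-split (v x))) (eq′ z hi (up v x) (dn v x))))
          where
          eq : ∀ z l h X a b s → z ℤ.- (a ℤ.- b) ℤ.- l ≡ (z ℤ.- (1ℤ ℤ.+ h)) ℤ.+ (h ℤ.- (l ℤ.+ X)) ℤ.+ (X ℤ.- s) ℤ.+ (s ℤ.- a) ℤ.+ b ℤ.+ 1ℤ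
          eq = solve 7 (λ z l h X a b s → z :- (a :- b) :- l := (z :- (con 1ℤ :+ h)) :+ (h :- (l :+ X)) :+ (X :- s) :+ (s :- a) :+ b :+ con 1ℤ) refl
          eq′ : ∀ z h a b → h ℤ.- (z ℤ.- (a ℤ.- b)) ≡ (h ℤ.+ a ℤ.- z) ℤ.+ (0ℤ ℤ.- b)
          eq′ = solve 4 (λ z h a b → h :- (z :- (a :- b)) := (h :+ a :- z) :+ (con 0ℤ :- b)) refl
          extra : 1ℤ ℤ.+ hi ℤ.≤ z → 0ℤ ℤ.≤ 0ℤ ℤ.- dn v x
          extra q = sgn (v x) refl
            where
            sgn : ∀ y → v x ≡ y → 0ℤ ℤ.≤ 0ℤ ℤ.- dn v x
            sgn (+ zero) e = ℤₚ.≤-reflexive (sym (cong (λ y → 0ℤ ℤ.- posp (ℤ.- y)) e))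
            sgn (+ suc n) e = ℤₚ.≤-reflexive (sym (cong (λ y → 0ℤ ℤ.- posp (ℤ.- y)) e))
            sgn -[1+ n ] e = ⊥-elim (≤-absurd {hi} {hi} ℤₚ.≤-refl (ℤₚ.≤-trans q (ℤₚ.≤-trans b (ℤₚ.≤-reflexive (trans (cong (λ y → hi ℤ.+ posp y) e) (ℤₚ.+-identityʳ hi))))))
        inside (inj₂ p) (inj₁ q) = take
           (≤-by _ (sub≥0 a ⊕ extra p) (trans (cong (λ y → z ℤ.- y ℤ.- lo) (posp-split (v x))) (eq′ z lo (up v x) (dn v x))))
           (≤-by _ (sub≥0 p ⊕ sub≥0 wide ⊕ sub≥0 small ⊕ sub≥0 (posp≤ (ℤ.- v x)) ⊕ posp≥0 (v x) ⊕ pos {1}) (trans (cong (λ y → hi ℤ.- (z ℤ.- y)) (posp-split (v x))) (trans (eq z lo hi (+ X) (up v x) (dn v x) (+ ∣ v x ∣))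
              (cong (λ y → (lo ℤ.- (1ℤ ℤ.+ z)) ℤ.+ (hi ℤ.- (lo ℤ.+ + X)) ℤ.+ (+ X ℤ.- + ∣ v x ∣) ℤ.+ (y ℤ.- dn v x) ℤ.+ up v x ℤ.+ 1ℤ) (cong +_ (sym (ℤₚ.∣-i∣≡∣i∣ (v x))))))))
          where
          eq : ∀ z l h X a b s → h ℤ.- (z ℤ.- (a ℤ.- b)) ≡ (l ℤ.- (1ℤ ℤ.+ z)) ℤ.+ (h ℤ.- (l ℤ.+ X)) ℤ.+ (X ℤ.- s) ℤ.+ (s ℤ.- b) ℤ.+ a ℤ.+ 1ℤ
          eq = solve 7 (λ z l h X a b s → h :- (z :- (a :- b)) := (l :- (con 1ℤ :+ z)) :+ (h :- (l :+ X)) :+ (X :- s) :+ (s :- b) :+ a :+ con 1ℤ) refl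
          eq′ : ∀ z l a b → z ℤ.- (a ℤ.- b) ℤ.- l ≡ (z ℤ.- (l ℤ.- b)) ℤ.+ (0ℤ ℤ.- a)
          eq′ = solve 4 (λ z l a b → z :- (a :- b) :- l := (z :- (l :- b)) :+ (con 0ℤ :- a)) refl
          extra : 1ℤ ℤ.+ z ℤ.≤ lo → 0ℤ ℤ.≤ 0ℤ ℤ.- up v x
          extra p = sgn (v x) refl
            where
            sgn : ∀ y → v x ≡ y → 0ℤ ℤ.≤ 0ℤ ℤ.- up v x
            sgn -[1+ n ] e = ℤₚ.≤-reflexive (sym (cong (λ y → 0ℤ ℤ.- posp y) e))
            sgn (+ zero) e = ℤₚ.≤-reflexive (sym (cong (λ y → 0ℤ ℤ.- posp y) e))
            sgn (+ suc n) e = ⊥-elim (≤-absurd {lo} {lo} ℤₚ.≤-refl (ℤₚ.≤-trans (ℤₚ.+-monoʳ-≤ 1ℤ (ℤₚ.≤-trans (ℤₚ.≤-reflexive (sym (trans (cong (λ y → lo ℤ.- posp (ℤ.- y)) e) (ℤₚ.+-identityʳ lo)))) a)) p))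

    -- Put h = ⌊N/2m⌋. At most m h ≤ N/2 terms have a value up to h, so at least half of them exceed
    -- N/2m after rounding up.
    sum-large : ∀ (v : E → ℤ) X m Q → 1 ≤ m → Mult v m Q → All (InRange v X) Q → + (length Q * length Q) ℤ.≤ + (4 * m) ℤ.* sumv v Q
    sum-large v X m Q m≥1 M inR = go (split (λ x → ∣ v x ∣ ℕₚ.≤? h) Q)
      where
      N = length Q
      instance
        m2 : NonZero (2 * m)
        m2 = ℕ.>-nonZero (ℕₚ.*-mono-≤ {1} {2} (s≤s z≤n) m≥1)
      h = N / (2 * m)
      lower : ∀ zs → All (InRange v X) zs → All (λ x → ¬ ∣ v x ∣ ≤ h) zs → + (length zs * suc h) ℤ.≤ sumv v zs
      lower [] [] [] = ℤₚ.≤-refl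
      lower (x ∷ zs) ((n , e , _) ∷ a) (b ∷ c) = ℤₚ.≤-trans (ℤₚ.≤-reflexive (ℤₚ.pos-+ (suc h) (length zs * suc h)))
         (ℤₚ.+-mono-≤ (ℤₚ.≤-trans (+≤+ (ℕₚ.≤-trans (ℕₚ.≰⇒> b) (ℕₚ.≤-reflexive (cong ∣_∣ e)))) (ℤₚ.≤-reflexive (sym e))) (lower zs a c))
      nonneg : ∀ ys → All (InRange v X) ys → 0ℤ ℤ.≤ sumv v ys
      nonneg [] [] = ℤₚ.≤-refl
      nonneg (x ∷ ys) ((n , e , _) ∷ a) = ℤₚ.≤-trans pos (ℤₚ.≤-reflexive (sym e)) ⊕ nonneg ys a
      go : ∃[ ys ] ∃[ zs ] (Q ↭ ys ++ zs × All (λ x → ∣ v x ∣ ≤ h) ys × All (λ x → ¬ ∣ v x ∣ ≤ h) zs) → + (N * N) ℤ.≤ + (4 * m) ℤ.* sumv v Q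
      go (ys , zs , e , a , b) = ℤₚ.≤-trans (+≤+ nat) (ℤₚ.≤-trans (ℤₚ.≤-reflexive (ℤₚ.pos-* (4 * m) (length zs * suc h)))
            (≤-by _ (pos {4 * m} ⊗ (sub≥0 (lower zs (Allₚ.++⁻ʳ ys allr) b) ⊕ nonneg ys (Allₚ.++⁻ˡ ys allr)))
               (trans (cong (λ z → + (4 * m) ℤ.* z ℤ.- + (4 * m) ℤ.* + (length zs * suc h)) (trans (sumv-↭ v e) (sumv-++ v ys zs))) (eq (+ (4 * m)) (sumv v ys) (sumv v zs) (+ (length zs * suc h))))))
        where
        allr = All-resp-↭ e inR
        eq : ∀ c y z k → c ℤ.* (y ℤ.+ z) ℤ.- c ℤ.* k ≡ c ℤ.* (z ℤ.- k ℤ.+ y)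
        eq = solve 4 (λ c y z k → c :* (y :+ z) :- c :* k := c :* (z :- k :+ y)) refl
        ys≤ : length ys ≤ m * h
        ys≤ = range-bound v h m ys (mult-sub ys zs e M) (All.zipWith (λ { ((n , e , l , _) , k) → n , e , l , ℕₚ.≤-trans (ℕₚ.≤-reflexive (cong ∣_∣ (sym e))) k }) (Allₚ.++⁻ˡ ys allr , a))
        lenE : N ≡ length ys + length zs
        lenE = trans (↭-length e) (Listₚ.length-++ ys)
        half : N ≤ 2 * length zs
        half = lin 0 (2 ⊠ ys≤ ⊞ m/n*n≤m N (2 * m)) (trans (cong (λ z → z + (2 * (m * h) + z) + 0) lenE) (eq₁ (length ys) (length zs) m h))
          where
          eq₁ : ∀ y z m h → y + z + (2 * (m * h) + (y + z)) + 0 ≡ 2 * z + (2 * y + h * (2 * m))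
          eq₁ = solveℕ 4 (λ y z m h → y ⊹ z ⊹ (lit 2 ⊛ (m ⊛ h) ⊹ (y ⊹ z)) ⊹ lit 0 ≔ lit 2 ⊛ z ⊹ (lit 2 ⊛ y ⊹ h ⊛ (lit 2 ⊛ m))) refl
        nat : N * N ≤ 4 * m * (length zs * suc h)
        nat = ℕₚ.≤-trans (ℕₚ.*-mono-≤ half (<div N (2 * m))) (ℕₚ.≤-reflexive (eq₂ (length zs) (suc h) m))
          where
          eq₂ : ∀ z h m → 2 * z * (h * (2 * m)) ≡ 4 * m * (z * h)
          eq₂ = solveℕ 3 (λ z h m → lit 2 ⊛ z ⊛ (h ⊛ (lit 2 ⊛ m)) ≔ lit 4 ⊛ m ⊛ (z ⊛ h)) refl

-- Consequences of zero-sum-freeness when there is no common divisor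

module DivisorFree where

  open import Data.Nat using (_≤_; _+_; _*_; _∸_; _<_)
  open IntegerSums using (≥0⇒pos; ≤-by; sub≥0; _⊕_; _⊗_; pos; ≤-or; ≤-absurd; +≤+⁻; *-cancel-≤; module Mod)
  open Translates using (search)
  open Progressions
  open LinearArithmetic
  open Intervals

  module _ {E : Set} where

    ZSF : (E → ℤ) → ℕ → List E → Set
    ZSF v p T = ∀ C C′ → T ↭ C ++ C′ → + p ∣ᶻ sumv v C → C ≡ []

    -- g collects the sign and the common divisors that were divided out; its bound X will keep it
    -- invertible mod p.
    record Out (v : E → ℤ) (p X K : ℕ) (T : List E) : Set where
      field
        J R : List E
        g : ℤ
        w : E → ℤ
        perm : T ↭ J ++ R
        short : length J ≤ K
        g≥1 : 1 ≤ ∣ g ∣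
        g≤X : ∣ g ∣ ≤ X
        scaled : All (λ x → v x ≡ g ℤ.* w x × 0ℤ ℤ.≤ w x) R
        total : 1ℤ ℤ.+ sumv w R ℤ.≤ + p

    module Core (v : E → ℤ) (p X m N : ℕ) .{{_ : NonZero p}} (N≥1 : 1 ≤ N) (m≥1 : 1 ≤ m) (X≥1 : 1 ≤ X) (N≤Z : N ≤ m * X)
                (hc : 64 * (17 * (17 * (m * X * (m * X)))) ≤ N * N * N) where
      open Gaps N (m * X) N≥1 N≤Z hc

      -- x₀ is set aside because z may be the empty subsum: v x₀ + z is always the sum of a
      -- non-empty subsequence, and thus not a multiple of p.
      record Window (Q : List E) (x₀ : E) (Y : List E) : Set where
        field
          R Y′ : List E
          u : ℤ
          ℓ : ℕ
          perm : Y ↭ R ++ Y′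
          real-u : Real v (Q ++ R) u
          short : length R ≤ 2 * G
          free : ∀ z → u ℤ.- sumv (dn v) Y′ ℤ.≤ z → z ℤ.≤ u ℤ.+ + ℓ ℤ.+ sumv (up v) Y′ → ¬ (+ p ∣ᶻ (v x₀ ℤ.+ z))

      core : ∀ T Q x₀ Y → T ↭ Q ++ (x₀ ∷ Y) → length Q ≡ N → Mult v m T → All (InRange v X) Q → All (NZ v X) Y →
             (∀ e → 2 ≤ e → e ≤ X → N ≤ cnt v e Y) → ZSF v p T → Window Q x₀ Y
      core T Q x₀ Y perm len M inR nz rob zs = go (interval v X m N Q Y N≥1 N≤Z hc m≥1 X≥1 len (mult-sub Q (x₀ ∷ Y) perm M) inR nz rob)
        where
        go : Found v X G Q Y → Window Q x₀ Y
        go (R , Y′ , u , ℓ , e , ap , 2X , lenR) = record { R = R ; Y′ = Y′ ; u = u ; ℓ = ℓ ; perm = e ; short = lenR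
              ; real-u = real-≡ v (ℤₚ.+-identityʳ u) (AP.at ap 0 z≤n) ; free = free }
          where
          fills : Fills v (Q ++ R) u (u ℤ.+ + ℓ)
          fills z a b = at-i (≥0⇒pos (sub≥0 a))
            where
            at-i : ∃[ i ] z ℤ.- u ≡ + i → Real v (Q ++ R) z
            at-i (i , ei) = real-≡ v (trans (cong (λ y → u ℤ.+ y ℤ.* 1ℤ) (sym ei)) (eq u z)) (AP.at ap i (+≤+⁻ (≤-by _ (sub≥0 b) (trans (cong (λ y → + ℓ ℤ.- y) (sym ei)) (eq′ u z (+ ℓ))))))
              where
              eq : ∀ u z → u ℤ.+ (z ℤ.- u) ℤ.* 1ℤ ≡ z
              eq = solve 2 (λ u z → u :+ (z :- u) :* con 1ℤ := z) refl
              eq′ : ∀ u z l → l ℤ.- (z ℤ.- u) ≡ u ℤ.+ l ℤ.- z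
              eq′ = solve 3 (λ u z l → l :- (z :- u) := u :+ l :- z) refl
          wide : u ℤ.+ + X ℤ.≤ u ℤ.+ + ℓ
          wide = ℤₚ.+-monoʳ-≤ u (+≤+ (ℕₚ.≤-trans (ℕₚ.m≤m+n X (X + 0)) 2X))
          slid = slide v X (Q ++ R) u (u ℤ.+ + ℓ) Y′ wide (Allₚ.++⁻ʳ R (All-resp-↭ e nz)) fills
          free : ∀ z → u ℤ.- sumv (dn v) Y′ ℤ.≤ z → z ℤ.≤ u ℤ.+ + ℓ ℤ.+ sumv (up v) Y′ → ¬ (+ p ∣ᶻ (v x₀ ℤ.+ z))
          free z a b d = absurd (slid z a b)
            where
            permT : T ↭ x₀ ∷ ((Q ++ R) ++ Y′)
            permT = ↭-trans perm (↭-trans (shift x₀ Q Y) (prep x₀ (↭-trans (++⁺ˡ Q e) (↭-sym (++-assoc Q R Y′)))))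
            absurd : Real v ((Q ++ R) ++ Y′) z → ⊥
            absurd (C , C′ , f , s) with zs (x₀ ∷ C) C′ (↭-trans permT (prep x₀ f)) (subst (λ y → + p ∣ᶻ (v x₀ ℤ.+ y)) (sym s) d)
            ... | ()

      nb : ℤ → ℤ
      nb (+ _) = 0ℤ
      nb -[1+ _ ] = 1ℤ

      nb≥0 : ∀ z → 0ℤ ℤ.≤ nb z
      nb≥0 (+ _) = pos
      nb≥0 -[1+ _ ] = pos

      nb≤1 : ∀ z → nb z ℤ.≤ 1ℤ
      nb≤1 (+ _) = pos
      nb≤1 -[1+ _ ] = ℤₚ.≤-refl

      up-in : ∀ Q → All (InRange v X) Q → sumv (up v) Q ≡ sumv v Q
      up-in Q h = sumv-cong Q (All.map (λ { {x} (n , e , _) → trans (cong posp e) (sym e) }) h)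

      dn-in : ∀ Q → All (InRange v X) Q → sumv (dn v) Q ≡ 0ℤ
      dn-in [] [] = refl
      dn-in (x ∷ Q) ((suc n , e , _) ∷ h) = cong₂ ℤ._+_ (cong (λ z → posp (ℤ.- z)) e) (dn-in Q h)

      -- If the nonnegative values left added up to p or more, the window would contain a full set
      -- of residues and meet the class of - v x₀. The negative terms left over come from Ms and are
      -- removed as well.
      oneSided : ∀ T P Ms → T ↭ P ++ Ms → suc N ≤ length P → All (InRange v X) P → All (NZ v X) T → Mult v m T →
                 (∀ e → 2 ≤ e → e ≤ X → 2 * N + 1 ≤ cnt v e T) → ZSF v p T → Out v p X (suc N + 2 * G + length Ms) T
      oneSided T P Ms perm big inP nz M rob zs = start (takeN N P (ℕₚ.<⇒≤ big))
        where
        start : ∃[ Q ] ∃[ Z ] (P ≡ Q ++ Z × length Q ≡ N) → _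
        start (Q , [] , e , len) = ⊥-elim (ℕₚ.<⇒≱ big (ℕₚ.≤-reflexive (trans (cong length (trans e (Listₚ.++-identityʳ Q))) len)))
        start (Q , x₀ ∷ P′ , refl , len) = finishing (core T Q x₀ Y permT len M (Allₚ.++⁻ˡ Q inP) (All.tail (Allₚ.++⁻ʳ Q (All-resp-↭ permT nz))) robY zs)
          where
          Y = P′ ++ Ms
          permT : T ↭ Q ++ (x₀ ∷ Y)
          permT = ↭-trans perm (++-assoc Q (x₀ ∷ P′) Ms)
          inP′ : All (InRange v X) P′
          inP′ = All.tail (Allₚ.++⁻ʳ Q inP)
          robY : ∀ e → 2 ≤ e → e ≤ X → N ≤ cnt v e Y
          robY e h k = ℕₚ.+-cancelˡ-≤ (suc N) N (cnt v e Y) (ℕₚ.≤-trans (ℕₚ.≤-reflexive (eq N)) (ℕₚ.≤-trans (rob e h k) (ℕₚ.≤-trans (ℕₚ.≤-reflexive (trans (cnt-↭ v e (↭-trans permT (shift x₀ Q Y))) (cnt-++ v e (x₀ ∷ Q) Y)))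
                 (ℕₚ.+-monoˡ-≤ (cnt v e Y) (ℕₚ.≤-trans (cnt-≤ v e (x₀ ∷ Q)) (ℕₚ.≤-reflexive (cong suc len)))))))
            where
            eq : ∀ N → suc N + N ≡ 2 * N + 1
            eq = solveℕ 1 (λ N → (lit 1 ⊹ N) ⊹ N ≔ lit 2 ⊛ N ⊹ lit 1) refl
          finishing : Window Q x₀ Y → _
          finishing W = signs (split (λ x → 0ℤ ℤₚ.≤? v x) W.Y′)
            where
            module W = Window W
            signs : ∃[ As ] ∃[ Bs ] (W.Y′ ↭ As ++ Bs × All (λ x → 0ℤ ℤ.≤ v x) As × All (λ x → ¬ 0ℤ ℤ.≤ v x) Bs) → _
            signs (As , Bs , e , a , b) = record { J = (x₀ ∷ Q) ++ (W.R ++ Bs) ; R = As ; g = 1ℤ ; w = v ; perm = permJ ; g≥1 = s≤s z≤n ; g≤X = X≥1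
                 ; scaled = All.map (λ {x} h → sym (ℤₚ.*-identityˡ (v x)) , h) a ; total = total ; short = shortJ }
              where
              permJ : T ↭ ((x₀ ∷ Q) ++ (W.R ++ Bs)) ++ As
              permJ = ↭-trans permT (↭-trans (shift x₀ Q Y) (prep x₀ (↭-trans (++⁺ˡ Q (↭-trans W.perm (++⁺ˡ W.R e))) (eq Q W.R As Bs))))
                where
                eq : ∀ (a b c d : List E) → a ++ (b ++ (c ++ d)) ↭ (a ++ (b ++ d)) ++ c
                eq = PS.solve 4 (λ a b c d → (a PS.⊕ (b PS.⊕ (c PS.⊕ d))) PS.⊜ ((a PS.⊕ (b PS.⊕ d)) PS.⊕ c)) ↭-refl
                  where module PS = PermSolver
              lenBs : length Bs ≤ length Ms
              lenBs = +≤+⁻ (ℤₚ.≤-trans (count Bs b) (ℤₚ.≤-trans (≤-by _ (sumv-≥0 W.R (λ x → nb≥0 (v x)) ⊕ sumv-≥0 As (λ x → nb≥0 (v x))) eqn) (ones Ms)))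
                where
                f : E → ℤ
                f x = nb (v x)
                count : ∀ Bs → All (λ x → ¬ 0ℤ ℤ.≤ v x) Bs → + length Bs ℤ.≤ sumv f Bs
                count [] [] = ℤₚ.≤-refl
                count (x ∷ Bs) (h ∷ hs) = ℤₚ.+-mono-≤ {1ℤ} {f x} (neg (v x) h) (count Bs hs)
                  where
                  neg : ∀ z → ¬ 0ℤ ℤ.≤ z → 1ℤ ℤ.≤ nb z
                  neg (+ n) h = ⊥-elim (h pos)
                  neg -[1+ n ] h = ℤₚ.≤-refl
                ones : ∀ Ms → sumv f Ms ℤ.≤ + length Ms
                ones [] = ℤₚ.≤-refl
                ones (x ∷ Ms) = ℤₚ.+-mono-≤ {f x} {1ℤ} (nb≤1 (v x)) (ones Ms)
                zero-P : ∀ P → All (InRange v X) P → sumv f P ≡ 0ℤ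
                zero-P [] [] = refl
                zero-P (x ∷ P) ((n , e , _) ∷ h) = cong₂ ℤ._+_ (cong nb e) (zero-P P h)
                eqn : sumv f Ms ℤ.- sumv f Bs ≡ sumv f W.R ℤ.+ sumv f As
                eqn = trans (cong (ℤ._- sumv f Bs) (trans (sym (trans (cong (ℤ._+ sumv f Ms) (zero-P P′ inP′)) (ℤₚ.+-identityˡ (sumv f Ms)))) (trans (sym (sumv-++ f P′ Ms)) (trans (sumv-↭ f (↭-trans W.perm (++⁺ˡ W.R e)))
                        (trans (sumv-++ f W.R (As ++ Bs)) (cong (ℤ._+_ (sumv f W.R)) (sumv-++ f As Bs))))))) (alg (sumv f W.R) (sumv f As) (sumv f Bs))
                  where
                  alg : ∀ r a b → r ℤ.+ (a ℤ.+ b) ℤ.- b ≡ r ℤ.+ a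
                  alg = solve 3 (λ r a b → r :+ (a :+ b) :- b := r :+ a) refl
              shortJ : length ((x₀ ∷ Q) ++ (W.R ++ Bs)) ≤ suc N + 2 * G + length Ms
              shortJ = ℕₚ.≤-trans (ℕₚ.≤-reflexive (trans (Listₚ.length-++ (x₀ ∷ Q)) (cong₂ _+_ (cong suc len) (Listₚ.length-++ W.R))))
                   (ℕₚ.≤-trans (ℕₚ.+-monoʳ-≤ (suc N) (ℕₚ.+-mono-≤ W.short lenBs)) (ℕₚ.≤-reflexive (sym (ℕₚ.+-assoc (suc N) (2 * G) (length Ms)))))
              open Mod p using (rep; quo; rep<; rep-≡)
              lo = W.u ℤ.- sumv (dn v) W.Y′
              total : 1ℤ ℤ.+ sumv v As ℤ.≤ + p
              total = dichotomy (≤-or (1ℤ ℤ.+ sumv v As) (+ p))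
                where
                dichotomy : 1ℤ ℤ.+ sumv v As ℤ.≤ + p ⊎ 1ℤ ℤ.+ + p ℤ.≤ 1ℤ ℤ.+ sumv v As → 1ℤ ℤ.+ sumv v As ℤ.≤ + p
                dichotomy (inj₁ h) = h
                dichotomy (inj₂ h) = ⊥-elim (W.free z (≤-by _ (pos {rep c}) (alg₁ lo (+ rep c))) below (divides (ℤ.- quo c) dv))
                  where
                  -- z is the first integer from `lo` on that is congruent to - v x₀, so it lies
                  -- below lo + p.
                  c = ℤ.- (v x₀ ℤ.+ lo)
                  z = lo ℤ.+ + rep c
                  alg₁ : ∀ l r → l ℤ.+ r ℤ.- l ≡ r
                  alg₁ = solve 2 (λ l r → l :+ r :- l := r) refl
                  dv : v x₀ ℤ.+ z ≡ ℤ.- quo c ℤ.* + p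
                  dv = trans (alg (v x₀) lo (+ rep c)) (trans (cong (ℤ._+_ (+ rep c)) (cong ℤ.-_ (rep-≡ c))) (alg′ (+ rep c) (quo c) (+ p)))
                    where
                    alg : ∀ x l r → x ℤ.+ (l ℤ.+ r) ≡ r ℤ.+ ℤ.- (ℤ.- (x ℤ.+ l))
                    alg = solve 3 (λ x l r → x :+ (l :+ r) := r :+ :- (:- (x :+ l))) refl
                    alg′ : ∀ r q p → r ℤ.+ ℤ.- (r ℤ.+ q ℤ.* p) ≡ ℤ.- q ℤ.* p
                    alg′ = solve 3 (λ r q p → r :+ :- (r :+ q :* p) := :- q :* p) refl
                  below : z ℤ.≤ W.u ℤ.+ + W.ℓ ℤ.+ sumv (up v) W.Y′
                  below = ≤-by _ (sub≥0 (+≤+ (ℕₚ.<⇒≤ (rep< c))) ⊕ sub≥0 h ⊕ pos {W.ℓ} ⊕ sub≥0 (sumv-mono {f = v} {g = up v} As (λ x → posp≥ (v x))) ⊕ sumv-≥0 {f = up v} Bs (λ x → posp≥0 (v x)) ⊕ sumv-≥0 {f = dn v} W.Y′ (λ x → posp≥0 (ℤ.- v x)))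
                     (trans (cong (λ y → W.u ℤ.+ + W.ℓ ℤ.+ y ℤ.- z) (trans (sumv-↭ (up v) e) (sumv-++ (up v) As Bs)))
                       (alg W.u (+ W.ℓ) (sumv (up v) As) (sumv (up v) Bs) (sumv (dn v) W.Y′) (+ rep c) (+ p) (sumv v As)))
                    where
                    alg : ∀ u l a b d r p s → u ℤ.+ l ℤ.+ (a ℤ.+ b) ℤ.- (u ℤ.- d ℤ.+ r) ≡ (p ℤ.- r) ℤ.+ (1ℤ ℤ.+ s ℤ.- (1ℤ ℤ.+ p)) ℤ.+ l ℤ.+ (a ℤ.- s) ℤ.+ b ℤ.+ d
                    alg = solve 8 (λ u l a b d r p s → u :+ l :+ (a :+ b) :- (u :- d :+ r) := (p :- r) :+ (con 1ℤ :+ s :- (con 1ℤ :+ p)) :+ l :+ (a :- s) :+ b :+ d) refl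

      -- The window contains - v x₀ itself. Downwards, O outweighs both Q₁, which bounds the
      -- starting point u, and Q₂. Upwards, Q₂ alone is enough. By `sum-large` the sum of Q₂ is at
      -- least 4 G X + X, which covers the 2 G X that R may cost in each sign and the size of x₀.
      bothSided : ∀ T Q₁ Q₂ x₀ P′ O M′ → T ↭ (Q₁ ++ (x₀ ∷ (Q₂ ++ P′))) ++ (O ++ M′) → length Q₁ ≡ N → length Q₂ ≡ N → All (InRange v X) (Q₁ ++ (x₀ ∷ (Q₂ ++ P′))) →
                  All (NZ v X) T → Mult v m T → (∀ e → 2 ≤ e → e ≤ X → 2 * N + 1 ≤ cnt v e T) → ZSF v p T →
                  sumv v Q₁ ℤ.+ sumv v Q₂ ℤ.≤ sumv (dn v) O → ⊥
      bothSided T Q₁ Q₂ x₀ P′ O M′ perm len₁ len₂ inP nz M rob zs le = contra (core T Q₁ x₀ Y permT len₁ M in₁ (All.tail (Allₚ.++⁻ʳ Q₁ (All-resp-↭ permT nz))) robY zs)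
        where
        Y = (Q₂ ++ P′) ++ (O ++ M′)
        permT : T ↭ Q₁ ++ (x₀ ∷ Y)
        permT = ↭-trans perm (++-assoc Q₁ (x₀ ∷ (Q₂ ++ P′)) (O ++ M′))
        in₁ : All (InRange v X) Q₁
        in₁ = Allₚ.++⁻ˡ Q₁ inP
        inx : InRange v X x₀
        inx = All.head (Allₚ.++⁻ʳ Q₁ inP)
        in₂ : All (InRange v X) Q₂
        in₂ = Allₚ.++⁻ˡ Q₂ (All.tail (Allₚ.++⁻ʳ Q₁ inP))
        robY : ∀ e → 2 ≤ e → e ≤ X → N ≤ cnt v e Y
        robY e h k = ℕₚ.+-cancelˡ-≤ (suc N) N (cnt v e Y) (ℕₚ.≤-trans (ℕₚ.≤-reflexive (eq N)) (ℕₚ.≤-trans (rob e h k) (ℕₚ.≤-trans (ℕₚ.≤-reflexive (trans (cnt-↭ v e (↭-trans permT (shift x₀ Q₁ Y))) (cnt-++ v e (x₀ ∷ Q₁) Y)))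
               (ℕₚ.+-monoˡ-≤ (cnt v e Y) (ℕₚ.≤-trans (cnt-≤ v e (x₀ ∷ Q₁)) (ℕₚ.≤-reflexive (cong suc len₁)))))))
          where
          eq : ∀ N → suc N + N ≡ 2 * N + 1
          eq = solveℕ 1 (λ N → (lit 1 ⊹ N) ⊹ N ≔ lit 2 ⊛ N ⊹ lit 1) refl
        permQ₂ : T ↭ Q₂ ++ (P′ ++ (O ++ M′) ++ (x₀ ∷ Q₁))
        permQ₂ = ↭-trans permT (↭-trans (shift x₀ Q₁ Y) (↭-trans (++-comm (x₀ ∷ Q₁) Y) (eq Q₂ P′ (O ++ M′) (x₀ ∷ Q₁))))
          where
          eq : ∀ (a b c d : List E) → ((a ++ b) ++ c) ++ d ↭ a ++ (b ++ (c ++ d))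
          eq = PS.solve 4 (λ a b c d → (((a PS.⊕ b) PS.⊕ c) PS.⊕ d) PS.⊜ (a PS.⊕ (b PS.⊕ (c PS.⊕ d)))) ↭-refl
            where module PS = PermSolver
        GX : ℤ
        GX = + (G * X)
        4G+1 : 4 * (4 * G + 1) * (m * X) ≤ N * N
        4G+1 = cancel N N≥1 (ℕₚ.≤-trans (lin (748 * (m * X * (m * X))) ((16 * (m * X)) ⊠ GN≤ ⊞ (4 * (m * X)) ⊠ N≤17Z) (eq G N (m * X))) (ℕₚ.≤-trans 1088Z≤ (ℕₚ.≤-reflexive (ℕₚ.*-assoc N N N))))
          where
          N≤17Z : N ≤ 17 * (m * X)
          N≤17Z = ℕₚ.≤-trans N≤Z (ℕₚ.m≤m+n (m * X) (16 * (m * X)))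
          eq : ∀ G N Z → N * (4 * (4 * G + 1) * Z) + (16 * Z * (17 * Z) + 4 * Z * (17 * Z)) + 748 * (Z * Z) ≡ 64 * (17 * (Z * Z)) + (16 * Z * (G * N) + 4 * Z * N)
          eq = solveℕ 3 (λ G N Z → N ⊛ (lit 4 ⊛ (lit 4 ⊛ G ⊹ lit 1) ⊛ Z) ⊹ (lit 16 ⊛ Z ⊛ (lit 17 ⊛ Z) ⊹ lit 4 ⊛ Z ⊛ (lit 17 ⊛ Z)) ⊹ lit 748 ⊛ (Z ⊛ Z) ≔ lit 64 ⊛ (lit 17 ⊛ (Z ⊛ Z)) ⊹ (lit 16 ⊛ Z ⊛ (G ⊛ N) ⊹ lit 4 ⊛ Z ⊛ N)) refl
        margin : + 4 ℤ.* GX ℤ.+ + X ℤ.≤ sumv v Q₂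
        margin = *-cancel-≤ {+ (4 * m)} (+≤+ (ℕₚ.*-mono-≤ {1} {4} (s≤s z≤n) m≥1)) (ℤₚ.≤-trans (ℤₚ.≤-reflexive eqn) (ℤₚ.≤-trans (+≤+ 4G+1)
                (ℤₚ.≤-trans (ℤₚ.≤-reflexive (cong +_ (cong₂ _*_ (sym len₂) (sym len₂)))) (sum-large v X m Q₂ m≥1 (mult-sub Q₂ _ permQ₂ M) in₂))))
          where
          natE : 4 * (4 * G + 1) * (m * X) ≡ 4 * m * (4 * (G * X) + X)
          natE = eq G m X
            where
            eq : ∀ G m X → 4 * (4 * G + 1) * (m * X) ≡ 4 * m * (4 * (G * X) + X)
            eq = solveℕ 3 (λ G m X → lit 4 ⊛ (lit 4 ⊛ G ⊹ lit 1) ⊛ (m ⊛ X) ≔ lit 4 ⊛ m ⊛ (lit 4 ⊛ (G ⊛ X) ⊹ X)) refl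
          eqn : + (4 * m) ℤ.* (+ 4 ℤ.* GX ℤ.+ + X) ≡ + (4 * (4 * G + 1) * (m * X))
          eqn = trans (cong (ℤ._*_ (+ (4 * m))) (trans (cong (ℤ._+ + X) (sym (ℤₚ.pos-* 4 (G * X)))) (sym (ℤₚ.pos-+ (4 * (G * X)) X)))) (trans (sym (ℤₚ.pos-* (4 * m) (4 * (G * X) + X))) (cong +_ (sym natE)))
        contra : Window Q₁ x₀ Y → ⊥
        contra W = W.free (ℤ.- v x₀) lower upper (divides 0ℤ (ℤₚ.+-inverseʳ (v x₀)))
          where
          module W = Window W
          nzR : All (NZ v X) W.R
          nzR = Allₚ.++⁻ˡ W.R (All-resp-↭ W.perm (All.tail (Allₚ.++⁻ʳ Q₁ (All-resp-↭ permT nz))))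
          RX : + length W.R ℤ.* + X ℤ.≤ + 2 ℤ.* GX
          RX = ℤₚ.≤-trans (ℤₚ.≤-reflexive (sym (ℤₚ.pos-* (length W.R) X))) (ℤₚ.≤-trans (+≤+ (ℕₚ.≤-trans (ℕₚ.*-monoˡ-≤ X W.short) (ℕₚ.≤-reflexive (ℕₚ.*-assoc 2 G X)))) (ℤₚ.≤-reflexive (ℤₚ.pos-* 2 (G * X))))
          upR : sumv (up v) W.R ℤ.≤ + 2 ℤ.* GX
          upR = ℤₚ.≤-trans (sumv-≤ {f = up v} X W.R (All.map (λ {x} (_ , h) → ℤₚ.≤-trans (posp≤ (v x)) (+≤+ h)) nzR)) RX
          dnR : sumv (dn v) W.R ℤ.≤ + 2 ℤ.* GX
          dnR = ℤₚ.≤-trans (sumv-≤ {f = dn v} X W.R (All.map (λ {x} (_ , h) → ℤₚ.≤-trans (posp≤ (ℤ.- v x)) (+≤+ (ℕₚ.≤-trans (ℕₚ.≤-reflexive (ℤₚ.∣-i∣≡∣i∣ (v x))) h))) nzR)) RX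
          upY : sumv v Q₂ ℤ.≤ sumv (up v) W.R ℤ.+ sumv (up v) W.Y′
          upY = ℤₚ.≤-trans (≤-by _ (sumv-≥0 {f = up v} P′ (λ x → posp≥0 (v x)) ⊕ sumv-≥0 {f = up v} (O ++ M′) (λ x → posp≥0 (v x)))
                (trans (cong (ℤ._- sumv v Q₂) (trans (sumv-++ (up v) (Q₂ ++ P′) (O ++ M′)) (cong (ℤ._+ sumv (up v) (O ++ M′)) (trans (sumv-++ (up v) Q₂ P′) (cong (ℤ._+ sumv (up v) P′) (up-in Q₂ in₂))))))
                   (alg (sumv v Q₂) (sumv (up v) P′) (sumv (up v) (O ++ M′))))) (ℤₚ.≤-reflexive (trans (sumv-↭ (up v) W.perm) (sumv-++ (up v) W.R W.Y′)))
            where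
            alg : ∀ q a b → q ℤ.+ a ℤ.+ b ℤ.- q ≡ a ℤ.+ b
            alg = solve 3 (λ q a b → q :+ a :+ b :- q := a :+ b) refl
          dnY : sumv (dn v) O ℤ.≤ sumv (dn v) W.R ℤ.+ sumv (dn v) W.Y′
          dnY = ℤₚ.≤-trans (≤-by _ (sumv-≥0 {f = dn v} (Q₂ ++ P′) (λ x → posp≥0 (ℤ.- v x)) ⊕ sumv-≥0 {f = dn v} M′ (λ x → posp≥0 (ℤ.- v x)))
                (trans (cong (ℤ._- sumv (dn v) O) (trans (sumv-++ (dn v) (Q₂ ++ P′) (O ++ M′)) (cong (ℤ._+_ (sumv (dn v) (Q₂ ++ P′))) (sumv-++ (dn v) O M′))))
                   (alg (sumv (dn v) O) (sumv (dn v) (Q₂ ++ P′)) (sumv (dn v) M′)))) (ℤₚ.≤-reflexive (trans (sumv-↭ (dn v) W.perm) (sumv-++ (dn v) W.R W.Y′)))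
            where
            alg : ∀ q a b → a ℤ.+ (q ℤ.+ b) ℤ.- q ≡ a ℤ.+ b
            alg = solve 3 (λ q a b → a :+ (q :+ b) :- q := a :+ b) refl
          u≤ : W.u ℤ.≤ sumv v Q₁ ℤ.+ sumv (up v) W.R
          u≤ = ℤₚ.≤-trans (real-≤ v (Q₁ ++ W.R) W.u W.real-u) (ℤₚ.≤-reflexive (trans (sumv-++ (up v) Q₁ W.R) (cong (ℤ._+ sumv (up v) W.R) (up-in Q₁ in₁))))
          u≥ : ℤ.- W.u ℤ.≤ sumv (dn v) W.R
          u≥ = ℤₚ.≤-trans (real-≥ v (Q₁ ++ W.R) W.u W.real-u) (ℤₚ.≤-reflexive (trans (sumv-++ (dn v) Q₁ W.R) (trans (cong (ℤ._+ sumv (dn v) W.R) (dn-in Q₁ in₁)) (ℤₚ.+-identityˡ (sumv (dn v) W.R)))))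
          x₀≤ : v x₀ ℤ.≤ + X
          x₀≤ = ℤₚ.≤-trans (ℤₚ.≤-reflexive (proj₁ (proj₂ inx))) (+≤+ (proj₂ (proj₂ (proj₂ inx))))
          x₀≥ : 0ℤ ℤ.≤ v x₀
          x₀≥ = ℤₚ.≤-trans pos (ℤₚ.≤-reflexive (sym (proj₁ (proj₂ inx))))
          lower : W.u ℤ.- sumv (dn v) W.Y′ ℤ.≤ ℤ.- v x₀
          lower = ≤-by _ (sub≥0 u≤ ⊕ sub≥0 dnY ⊕ sub≥0 le ⊕ sub≥0 margin ⊕ sub≥0 upR ⊕ sub≥0 dnR ⊕ sub≥0 x₀≤)
               (alg W.u (sumv (dn v) W.Y′) (v x₀) (sumv v Q₁) (sumv (up v) W.R) (sumv (dn v) W.R) (sumv (dn v) O) (sumv v Q₂) GX (+ X))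
            where
            alg : ∀ u d x q a b o r g X → ℤ.- x ℤ.- (u ℤ.- d) ≡ (q ℤ.+ a ℤ.- u) ℤ.+ (b ℤ.+ d ℤ.- o) ℤ.+ (o ℤ.- (q ℤ.+ r)) ℤ.+ (r ℤ.- (+ 4 ℤ.* g ℤ.+ X)) ℤ.+ (+ 2 ℤ.* g ℤ.- a) ℤ.+ (+ 2 ℤ.* g ℤ.- b) ℤ.+ (X ℤ.- x)
            alg = solve 10 (λ u d x q a b o r g X → :- x :- (u :- d) := (q :+ a :- u) :+ (b :+ d :- o) :+ (o :- (q :+ r)) :+ (r :- (con (+ 4) :* g :+ X)) :+ (con (+ 2) :* g :- a) :+ (con (+ 2) :* g :- b) :+ (X :- x)) refl
          upper : ℤ.- v x₀ ℤ.≤ W.u ℤ.+ + W.ℓ ℤ.+ sumv (up v) W.Y′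
          upper = ≤-by _ (sub≥0 u≥ ⊕ sub≥0 upY ⊕ sub≥0 margin ⊕ sub≥0 upR ⊕ sub≥0 dnR ⊕ x₀≥ ⊕ pos {W.ℓ} ⊕ pos {X})
               (alg W.u (sumv (up v) W.Y′) (v x₀) (+ W.ℓ) (sumv (up v) W.R) (sumv (dn v) W.R) (sumv v Q₂) GX (+ X))
            where
            alg : ∀ u d x l a b r g X → u ℤ.+ l ℤ.+ d ℤ.- ℤ.- x ≡ (b ℤ.- ℤ.- u) ℤ.+ (a ℤ.+ d ℤ.- r) ℤ.+ (r ℤ.- (+ 4 ℤ.* g ℤ.+ X)) ℤ.+ (+ 2 ℤ.* g ℤ.- a) ℤ.+ (+ 2 ℤ.* g ℤ.- b) ℤ.+ x ℤ.+ l ℤ.+ X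
            alg = solve 9 (λ u d x l a b r g X → u :+ l :+ d :- :- x := (b :- :- u) :+ (a :+ d :- r) :+ (r :- (con (+ 4) :* g :+ X)) :+ (con (+ 2) :* g :- a) :+ (con (+ 2) :* g :- b) :+ x :+ l :+ X) refl

-- Signs, and division by common divisors

module CommonDivisors where

  open import Data.Nat using (_≤_; _+_; _*_; _∸_; _<_)
  open IntegerSums using (≥0⇒pos; ≤-by; sub≥0; _⊕_; _⊗_; pos; ≤-or; ≤-absurd; +≤+⁻; *-cancel-≤; module Mod)
  open Translates using (search)
  open Progressions
  open LinearArithmetic
  open Intervals
  open DivisorFree

  module _ {E : Set} where

    neg : (E → ℤ) → E → ℤ
    neg v x = ℤ.- v x

    neg-sum : ∀ (v : E → ℤ) xs → sumv (neg v) xs ≡ ℤ.- sumv v xs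
    neg-sum v [] = refl
    neg-sum v (x ∷ xs) = trans (cong (ℤ._+_ (ℤ.- v x)) (neg-sum v xs)) (sym (ℤₚ.neg-distrib-+ (v x) (sumv v xs)))

    neg-NZ : ∀ (v : E → ℤ) X x → NZ v X x → NZ (neg v) X x
    neg-NZ v X x = subst (λ n → 1 ≤ n × n ≤ X) (sym (ℤₚ.∣-i∣≡∣i∣ (v x)))

    neg-Mult : ∀ (v : E → ℤ) {m T} → Mult v m T → Mult (neg v) m T
    neg-Mult v M z ys zs e h = M (ℤ.- z) ys zs e (All.map (λ {x} k → trans (sym (ℤₚ.neg-involutive (v x))) (cong ℤ.-_ k)) h)

    neg-ZSF : ∀ (v : E → ℤ) {p T} → ZSF v p T → ZSF (neg v) p T
    neg-ZSF v {p} zs C C′ e (divides q eq) = zs C C′ e (divides (ℤ.- q) (trans (sym (ℤₚ.neg-involutive (sumv v C))) (trans (cong ℤ.-_ (trans (sym (neg-sum v C)) eq)) (ℤₚ.neg-distribˡ-* q (+ p)))))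

    neg-cnt : ∀ (v : E → ℤ) e xs → cnt (neg v) e xs ≡ cnt v e xs
    neg-cnt v e [] = refl
    neg-cnt v e (x ∷ xs) = cong₂ _+_ (cong (λ n → bit (e ℕᵈ.∣? n)) (ℤₚ.∣-i∣≡∣i∣ (v x))) (neg-cnt v e xs)

    neg-Out : ∀ {v : E → ℤ} {p X K T} → Out (neg v) p X K T → Out v p X K T
    neg-Out {v} {X = X} O = record { J = O.J ; R = O.R ; g = ℤ.- O.g ; w = O.w ; perm = O.perm ; short = O.short
         ; g≥1 = subst (1 ≤_) (sym (ℤₚ.∣-i∣≡∣i∣ O.g)) O.g≥1 ; g≤X = subst (_≤ X) (sym (ℤₚ.∣-i∣≡∣i∣ O.g)) O.g≤X
         ; scaled = All.map (λ {x} (e , h) → trans (sym (ℤₚ.neg-involutive (v x))) (trans (cong ℤ.-_ e) (ℤₚ.neg-distribˡ-* O.g (O.w x))) , h) O.scaled ; total = O.total }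
      where module O = Out O

    Out-≤ : ∀ {v : E → ℤ} {p X K K′ T} → K ≤ K′ → Out v p X K T → Out v p X K′ T
    Out-≤ l O = record { J = O.J ; R = O.R ; g = O.g ; w = O.w ; perm = O.perm ; short = ℕₚ.≤-trans O.short l ; g≥1 = O.g≥1 ; g≤X = O.g≤X ; scaled = O.scaled ; total = O.total }
      where module O = Out O

    trivial-Out : ∀ (v : E → ℤ) p X K T → 1 ≤ p → 1 ≤ X → length T ≤ K → Out v p X K T
    trivial-Out v p X K T p≥1 X≥1 l = record { J = T ; R = [] ; g = 1ℤ ; w = v ; perm = ↭-sym (++-identityʳ T) ; short = l ; g≥1 = s≤s z≤n ; g≤X = X≥1 ; scaled = [] ; total = +≤+ p≥1 }

    positive⇒in : ∀ (v : E → ℤ) X x → 0ℤ ℤ.≤ v x → NZ v X x → InRange v X x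
    positive⇒in v X x h (a , b) = go (≥0⇒pos h)
      where
      go : ∃[ n ] v x ≡ + n → InRange v X x
      go (n , e) = n , e , subst (λ z → 1 ≤ ∣ z ∣) e a , subst (λ z → ∣ z ∣ ≤ X) e b

    module Sides (p X m N : ℕ) .{{_ : NonZero p}} (N≥1 : 1 ≤ N) (m≥1 : 1 ≤ m) (X≥1 : 1 ≤ X)
                 (hc : 64 * (17 * (17 * (m * X * (m * X)))) ≤ N * N * N) where

      one : ∀ (v : E → ℤ) T P Ms → T ↭ P ++ Ms → suc (2 * N) ≤ length P → length Ms ≤ 2 * N → All (InRange v X) P → All (NZ v X) T → Mult v m T →
            (∀ e → 2 ≤ e → e ≤ X → 2 * N + 1 ≤ cnt v e T) → ZSF v p T → Out v p X (8 * N) T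
      one v T P Ms perm big small inP nz M rob zs = go (takeN N P (ℕₚ.≤-trans (ℕₚ.m≤m+n N (N + 0)) (ℕₚ.<⇒≤ big)))
        where
        go : ∃[ ys ] ∃[ zs ] (P ≡ ys ++ zs × length ys ≡ N) → Out v p X (8 * N) T
        go (Q , Z , e , len) = Out-≤ K≤ (oneSided T P Ms perm (ℕₚ.≤-trans (s≤s (ℕₚ.m≤m+n N (N + 0))) big) inP nz M rob zs)
          where
          permQ : T ↭ Q ++ (Z ++ Ms)
          permQ = ↭-trans perm (↭-trans (++⁺ʳ Ms (Perm.↭-reflexive e)) (++-assoc Q Z Ms))
          N≤Z : N ≤ m * X
          N≤Z = ℕₚ.≤-trans (ℕₚ.≤-reflexive (sym len)) (range-bound v X m Q (mult-sub Q (Z ++ Ms) permQ M) (Allₚ.++⁻ˡ Q (subst (All (InRange v X)) e inP)))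
          open Core v p X m N N≥1 m≥1 X≥1 N≤Z hc
          open Gaps N (m * X) N≥1 N≤Z hc
          K≤ : suc N + 2 * G + length Ms ≤ 8 * N
          K≤ = lin (62 * (G * G) + 3 * N) (N≥1 ⊞ 2 ⊠ GG≥G ⊞ 64GG≤N ⊞ small) (eq N G (length Ms))
            where
            eq : ∀ N G M → suc N + 2 * G + M + (N + 2 * (G * G) + N + 2 * N) + (62 * (G * G) + 3 * N) ≡ 8 * N + (1 + 2 * G + 64 * (G * G) + M)
            eq = solveℕ 3 (λ N G M → (lit 1 ⊹ N) ⊹ lit 2 ⊛ G ⊹ M ⊹ (N ⊹ lit 2 ⊛ (G ⊛ G) ⊹ N ⊹ lit 2 ⊛ N) ⊹ (lit 62 ⊛ (G ⊛ G) ⊹ lit 3 ⊛ N) ≔ lit 8 ⊛ N ⊹ (lit 1 ⊹ lit 2 ⊛ G ⊹ lit 64 ⊛ (G ⊛ G) ⊹ M)) refl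

      Blocks : (E → ℤ) → List E → Set
      Blocks v P = ∃[ Q₁ ] ∃[ Q₂ ] ∃[ x₀ ] ∃[ P′ ] (P ↭ Q₁ ++ (x₀ ∷ (Q₂ ++ P′)) × length Q₁ ≡ N × length Q₂ ≡ N)

      blocks : ∀ (v : E → ℤ) P → suc (2 * N) ≤ length P → Blocks v P
      blocks v P big = go₁ (takeN N P (ℕₚ.≤-trans (ℕₚ.m≤m+n N (N + 0)) (ℕₚ.<⇒≤ big)))
        where
        go₁ : ∃[ ys ] ∃[ zs ] (P ≡ ys ++ zs × length ys ≡ N) → Blocks v P
        go₁ (Q₁ , Z , refl , len₁) = go₂ (takeN N Z (ℕₚ.<⇒≤ bigZ))
          where
          bigZ : suc N ≤ length Z
          bigZ = ℕₚ.+-cancelˡ-≤ N (suc N) (length Z) (ℕₚ.≤-trans (ℕₚ.≤-reflexive (eq N)) (ℕₚ.≤-trans big (ℕₚ.≤-reflexive (trans (Listₚ.length-++ Q₁) (cong (_+ length Z) len₁)))))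
            where
            eq : ∀ N → N + suc N ≡ suc (2 * N)
            eq = solveℕ 1 (λ N → N ⊹ (lit 1 ⊹ N) ≔ (lit 1 ⊹ (lit 2 ⊛ N))) refl
          go₂ : ∃[ ys ] ∃[ zs ] (Z ≡ ys ++ zs × length ys ≡ N) → Blocks v P
          go₂ (Q₂ , [] , refl , len₂) = ⊥-elim (ℕₚ.<⇒≱ bigZ (ℕₚ.≤-reflexive (trans (cong length (Listₚ.++-identityʳ Q₂)) len₂)))
          go₂ (Q₂ , x₀ ∷ P′ , refl , len₂) = Q₁ , Q₂ , x₀ , P′ , ++⁺ˡ Q₁ (shift x₀ Q₂ P′) , len₁ , len₂

      -- Two blocks of N terms are taken from each sign. After negating v if necessary the positive
      -- blocks have the smaller sum, and `bothSided` applies.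
      both : ∀ (v : E → ℤ) T P Ms → T ↭ P ++ Ms → suc (2 * N) ≤ length P → suc (2 * N) ≤ length Ms → All (InRange v X) P → All (InRange (neg v) X) Ms → All (NZ v X) T → Mult v m T →
            (∀ e → 2 ≤ e → e ≤ X → 2 * N + 1 ≤ cnt v e T) → ZSF v p T → ⊥
      both v T P Ms perm bigP bigM inP inM nz M rob zs = go (blocks v P bigP) (blocks v Ms bigM)
        where
        go : Blocks v P → Blocks v Ms → ⊥
        go (Q₁ , Q₂ , x₀ , P′ , eP , q₁ , q₂) (O₁ , O₂ , y₀ , M′ , eM , o₁ , o₂) = compare (≤-or a b)
          where
          a = sumv v Q₁ ℤ.+ sumv v Q₂
          b = sumv (neg v) O₁ ℤ.+ sumv (neg v) O₂
          inP′ = All-resp-↭ eP inP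
          inM′ = All-resp-↭ eM inM
          LP = Q₁ ++ (x₀ ∷ (Q₂ ++ P′))
          LM = O₁ ++ (y₀ ∷ (O₂ ++ M′))
          permL : T ↭ LP ++ LM
          permL = ↭-trans perm (++⁺ eP eM)
          N≤Z : N ≤ m * X
          N≤Z = ℕₚ.≤-trans (ℕₚ.≤-reflexive (sym q₁)) (range-bound v X m Q₁ (mult-sub Q₁ ((x₀ ∷ (Q₂ ++ P′)) ++ LM) (↭-trans permL (++-assoc Q₁ (x₀ ∷ (Q₂ ++ P′)) LM)) M) (Allₚ.++⁻ˡ Q₁ inP′))
          module C = Core v p X m N N≥1 m≥1 X≥1 N≤Z hc
          module C⁻ = Core (neg v) p X m N N≥1 m≥1 X≥1 N≤Z hc
          regroup : ∀ (a : List E) y b c → a ++ (y ∷ (b ++ c)) ↭ (a ++ b) ++ (y ∷ c)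
          regroup a y b c = ↭-trans (++⁺ˡ a (↭-sym (shift y b c))) (↭-sym (++-assoc a b (y ∷ c)))
          perm₁ : T ↭ LP ++ ((O₁ ++ O₂) ++ (y₀ ∷ M′))
          perm₁ = ↭-trans permL (++⁺ˡ LP (regroup O₁ y₀ O₂ M′))
          perm₂ : T ↭ LM ++ ((Q₁ ++ Q₂) ++ (x₀ ∷ P′))
          perm₂ = ↭-trans permL (↭-trans (++-comm LP LM) (++⁺ˡ LM (regroup Q₁ x₀ Q₂ P′)))
          compare : a ℤ.≤ b ⊎ 1ℤ ℤ.+ b ℤ.≤ a → ⊥
          compare (inj₁ h) = C.bothSided T Q₁ Q₂ x₀ P′ (O₁ ++ O₂) (y₀ ∷ M′) perm₁ q₁ q₂ inP′ nz M rob zs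
              (ℤₚ.≤-trans h (ℤₚ.≤-reflexive (sym (trans (sumv-++ (dn v) O₁ O₂) (cong₂ ℤ._+_ (C⁻.up-in O₁ (Allₚ.++⁻ˡ O₁ inM′)) (C⁻.up-in O₂ (Allₚ.++⁻ˡ O₂ (All.tail (Allₚ.++⁻ʳ O₁ inM′)))))))))
          compare (inj₂ h) = C⁻.bothSided T O₁ O₂ y₀ M′ (Q₁ ++ Q₂) (x₀ ∷ P′) perm₂ o₁ o₂ inM′ (All.map (λ {x} → neg-NZ v X x) nz) (neg-Mult v M)
              (λ e h k → ℕₚ.≤-trans (rob e h k) (ℕₚ.≤-reflexive (sym (neg-cnt v e T)))) (neg-ZSF v zs)
              (ℤₚ.≤-trans (ℤₚ.≤-trans (ℤₚ.i≤suc[i] b) h) (ℤₚ.≤-reflexive (sym (trans (sumv-++ (dn (neg v)) Q₁ Q₂) (cong₂ ℤ._+_ (dd Q₁ (Allₚ.++⁻ˡ Q₁ inP′)) (dd Q₂ (Allₚ.++⁻ˡ Q₂ (All.tail (Allₚ.++⁻ʳ Q₁ inP′)))))))))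
            where
            dd : ∀ Q → All (InRange v X) Q → sumv (dn (neg v)) Q ≡ sumv v Q
            dd Q h = trans (sumv-cong Q (All.universal (λ x → cong posp (ℤₚ.neg-involutive (v x))) Q)) (C.up-in Q h)

      sides : ∀ (v : E → ℤ) T → All (NZ v X) T → Mult v m T → (∀ e → 2 ≤ e → e ≤ X → 2 * N + 1 ≤ cnt v e T) → ZSF v p T → Out v p X (8 * N) T
      sides v T nz M rob zs = go (split (λ x → 0ℤ ℤₚ.≤? v x) T)
        where
        go : ∃[ P ] ∃[ Ms ] (T ↭ P ++ Ms × All (λ x → 0ℤ ℤ.≤ v x) P × All (λ x → ¬ 0ℤ ℤ.≤ v x) Ms) → Out v p X (8 * N) T
        go (P , Ms , e , a , b) = cases (suc (2 * N) ℕₚ.≤? length P) (suc (2 * N) ℕₚ.≤? length Ms)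
          where
          nz′ = All-resp-↭ e nz
          inP : All (InRange v X) P
          inP = All.zipWith (λ {x} (h , k) → positive⇒in v X x h k) (a , Allₚ.++⁻ˡ P nz′)
          inM : All (InRange (neg v) X) Ms
          inM = All.zipWith (λ {x} (h , k) → positive⇒in (neg v) X x (ℤₚ.neg-mono-≤ (ℤₚ.<⇒≤ (ℤₚ.≰⇒> h))) (neg-NZ v X x k)) (b , Allₚ.++⁻ʳ P nz′)
          cases : Dec (suc (2 * N) ≤ length P) → Dec (suc (2 * N) ≤ length Ms) → Out v p X (8 * N) T
          cases (yes h) (yes k) = ⊥-elim (both v T P Ms e h k inP inM nz M rob zs)
          cases (yes h) (no k) = one v T P Ms e h (ℕₚ.≤-pred (ℕₚ.≰⇒> k)) inP nz M rob zs
          cases (no h) (yes k) = neg-Out (one (neg v) T Ms P (↭-trans e (++-comm P Ms)) k (ℕₚ.≤-pred (ℕₚ.≰⇒> h)) inM (All.map (λ {x} → neg-NZ v X x) nz) (neg-Mult v M)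
              (λ e h k → ℕₚ.≤-trans (rob e h k) (ℕₚ.≤-reflexive (sym (neg-cnt v e T)))) (neg-ZSF v zs))
          cases (no h) (no k) = trivial-Out v p X (8 * N) T (ℕ.>-nonZero⁻¹ p) X≥1 (ℕₚ.≤-trans (ℕₚ.≤-reflexive (trans (↭-length e) (Listₚ.length-++ P)))
              (ℕₚ.≤-trans (ℕₚ.+-mono-≤ (ℕₚ.≤-pred (ℕₚ.≰⇒> h)) (ℕₚ.≤-pred (ℕₚ.≰⇒> k))) (ℕₚ.≤-trans (ℕₚ.≤-reflexive (eq N)) (ℕₚ.*-monoˡ-≤ N {4} {8} (s≤s (s≤s (s≤s (s≤s z≤n))))))))
            where
            eq : ∀ N → 2 * N + 2 * N ≡ 4 * N
            eq = solveℕ 1 (λ N → lit 2 ⊛ N ⊹ lit 2 ⊛ N ≔ lit 4 ⊛ N) refl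

    quot : ∀ e .{{_ : NonZero e}} → ℤ → ℤ
    quot e (+ n) = + (n / e)
    quot e -[1+ n ] = ℤ.- (+ (suc n / e))

    quot-≡ : ∀ e .{{_ : NonZero e}} z → e ℕᵈ.∣ ∣ z ∣ → z ≡ + e ℤ.* quot e z
    quot-≡ e (+ n) (ℕᵈ.divides k eq) = trans (cong +_ (trans (trans eq (ℕₚ.*-comm k e)) (cong (e *_) (trans (sym (m*n/n≡m k e)) (cong (_/ e) (sym eq)))))) (ℤₚ.pos-* e (n / e))
    quot-≡ e -[1+ n ] (ℕᵈ.divides k eq) = trans (cong ℤ.-_ (trans (cong +_ (trans (trans eq (ℕₚ.*-comm k e)) (cong (e *_) (trans (sym (m*n/n≡m k e)) (cong (_/ e) (sym eq)))))) (ℤₚ.pos-* e (suc n / e))))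
        (ℤₚ.neg-distribʳ-* (+ e) (+ (suc n / e)))

    -- If some e ≥ 2 divides all but 2N of the values, divide by e: passing to X / e and 3N/4 preserves the density hypothesis,
    -- and the numbers of removed elements sum as a geometric series.
    robust : ∀ fuel p X m N .{{_ : NonZero p}} (v : E → ℤ) (T : List E) → X ≤ fuel → 1 ≤ N → 1 ≤ m → 1 ≤ X → 64 * (17 * (17 * (m * X * (m * X)))) ≤ N * N * N →
             All (NZ v X) T → Mult v m T → ZSF v p T → Out v p X (8 * N) T
    robust zero p X m N v T f N≥1 m≥1 X≥1 hc nz M zs = ⊥-elim (ℕₚ.<⇒≱ X≥1 f)
    robust (suc fuel) p X m N v T f N≥1 m≥1 X≥1 hc nz M zs = go (search (suc X) {λ e → 2 ≤ e × cnt v e T ≤ 2 * N} {λ e → 2 ≤ e → 2 * N + 1 ≤ cnt v e T} dec)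
      where
      dec : ∀ e → (2 ≤ e × cnt v e T ≤ 2 * N) ⊎ (2 ≤ e → 2 * N + 1 ≤ cnt v e T)
      dec e with 2 ℕₚ.≤? e | cnt v e T ℕₚ.≤? 2 * N
      ... | yes a | yes b = inj₁ (a , b)
      ... | no a | _ = inj₂ (λ h → ⊥-elim (a h))
      ... | _ | no b = inj₂ (λ _ → ℕₚ.≤-trans (ℕₚ.≤-reflexive (ℕₚ.+-comm (2 * N) 1)) (ℕₚ.≰⇒> b))
      go : (∃[ e ] (e < suc X × (2 ≤ e × cnt v e T ≤ 2 * N))) ⊎ (∀ e → e < suc X → 2 ≤ e → 2 * N + 1 ≤ cnt v e T) → Out v p X (8 * N) T
      go (inj₂ rob) = Sides.sides p X m N N≥1 m≥1 X≥1 hc v T nz M (λ e h k → rob e (s≤s k) h) zs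
      go (inj₁ (e , s≤s e≤X , 2≤e , few)) = descend (split (λ x → ¬? (e ℕᵈ.∣? ∣ v x ∣)) T)
        where
        instance
          e-nz : NonZero e
          e-nz = ℕ.>-nonZero (ℕₚ.≤-trans (s≤s z≤n) 2≤e)
        X′ = X / e
        -- X is at least halved, so N³ may drop to a quarter. As `hc` forces N ≥ 9, rounding still
        -- leaves N′ ≥ 2N/3, and 4 · (2/3)³ > 1. The count closes exactly: 2 N + 8 · 3N/4 = 8 N.
        N′ = 3 * N / 4
        w : E → ℤ
        w x = quot e (v x)
        X′≥1 : 1 ≤ X′
        X′≥1 = m≥n⇒m/n>0 e≤X
        eX′≤X : e * X′ ≤ X
        eX′≤X = ℕₚ.≤-trans (ℕₚ.≤-reflexive (ℕₚ.*-comm e X′)) (m/n*n≤m X e)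
        2X′≤X : 2 * X′ ≤ X
        2X′≤X = ℕₚ.≤-trans (ℕₚ.*-monoˡ-≤ X′ 2≤e) eX′≤X
        X′≤fuel : X′ ≤ fuel
        X′≤fuel = ℕₚ.≤-pred (ℕₚ.≤-trans (ℕₚ.≤-trans (ℕₚ.+-monoˡ-≤ X′ X′≥1) (ℕₚ.≤-reflexive (cong (_+_ X′) (sym (ℕₚ.+-identityʳ X′))))) (ℕₚ.≤-trans 2X′≤X f))
        N≥9 : 9 ≤ N
        N≥9 = ℕₚ.≰⇒> (λ N≤8 → ℕₚ.<⇒≱ {8 * 8 * 8} {64 * (17 * 1)} (ℕₚ.m≤m+n 513 575) (ℕₚ.≤-trans (64 ⊠ (17 ⊠ ℕₚ.*-mono-≤ {1} {17} (s≤s z≤n) (ℕₚ.*-mono-≤ (ℕₚ.*-mono-≤ m≥1 X≥1) (ℕₚ.*-mono-≤ m≥1 X≥1))))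
             (ℕₚ.≤-trans hc (ℕₚ.*-mono-≤ (ℕₚ.*-mono-≤ N≤8 N≤8) N≤8))))
        4N′≥ : 3 * N ≤ N′ * 4 + 3
        4N′≥ = ℕₚ.≤-trans (ℕₚ.≤-reflexive (trans (Data.Nat.DivMod.m≡m%n+[m/n]*n (3 * N) 4) (ℕₚ.+-comm (3 * N % 4) (N′ * 4)))) (ℕₚ.+-monoʳ-≤ (N′ * 4) (ℕₚ.≤-pred (Data.Nat.DivMod.m%n<n (3 * N) 4)))
        2N≤3N′ : 2 * N ≤ 3 * N′
        2N≤3N′ = cancel 4 (s≤s z≤n) (lin 0 (3 ⊠ 4N′≥ ⊞ N≥9) (eq N N′))
          where
          eq : ∀ N M → 4 * (2 * N) + (3 * (M * 4 + 3) + N) + 0 ≡ 4 * (3 * M) + (3 * (3 * N) + 9)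
          eq = solveℕ 2 (λ N M → lit 4 ⊛ (lit 2 ⊛ N) ⊹ (lit 3 ⊛ (M ⊛ lit 4 ⊹ lit 3) ⊹ N) ⊹ lit 0 ≔ lit 4 ⊛ (lit 3 ⊛ M) ⊹ (lit 3 ⊛ (lit 3 ⊛ N) ⊹ lit 9)) refl
        N³≤4N′³ : N * N * N ≤ 4 * (N′ * N′ * N′)
        N³≤4N′³ = cancel 27 (s≤s z≤n) (lin (5 * (N * N * N)) (4 ⊠ ℕₚ.*-mono-≤ (ℕₚ.*-mono-≤ 2N≤3N′ 2N≤3N′) 2N≤3N′) (eq N N′))
          where
          eq : ∀ N M → 27 * (N * N * N) + 4 * (3 * M * (3 * M) * (3 * M)) + 5 * (N * N * N) ≡ 27 * (4 * (M * M * M)) + 4 * (2 * N * (2 * N) * (2 * N))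
          eq = solveℕ 2 (λ N M → lit 27 ⊛ (N ⊛ N ⊛ N) ⊹ lit 4 ⊛ (lit 3 ⊛ M ⊛ (lit 3 ⊛ M) ⊛ (lit 3 ⊛ M)) ⊹ lit 5 ⊛ (N ⊛ N ⊛ N) ≔ lit 27 ⊛ (lit 4 ⊛ (M ⊛ M ⊛ M)) ⊹ lit 4 ⊛ (lit 2 ⊛ N ⊛ (lit 2 ⊛ N) ⊛ (lit 2 ⊛ N))) refl
        hc′ : 64 * (17 * (17 * (m * X′ * (m * X′)))) ≤ N′ * N′ * N′
        hc′ = cancel 4 (s≤s z≤n) (ℕₚ.≤-trans (ℕₚ.≤-trans (ℕₚ.≤-reflexive (eq 64 17 m X′)) (64 ⊠ (17 ⊠ (17 ⊠ ℕₚ.*-mono-≤ (m ⊠ 2X′≤X) (m ⊠ 2X′≤X))))) (ℕₚ.≤-trans hc N³≤4N′³))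
          where
          eq : ∀ a b m X → 4 * (a * (b * (b * (m * X * (m * X))))) ≡ a * (b * (b * (m * (2 * X) * (m * (2 * X)))))
          eq = solveℕ 4 (λ a b m X → lit 4 ⊛ (a ⊛ (b ⊛ (b ⊛ (m ⊛ X ⊛ (m ⊛ X))))) ≔ a ⊛ (b ⊛ (b ⊛ (m ⊛ (lit 2 ⊛ X) ⊛ (m ⊛ (lit 2 ⊛ X)))))) refl
        N′≥1 : 1 ≤ N′
        N′≥1 = m≥n⇒m/n>0 (ℕₚ.≤-trans (ℕₚ.m≤m+n 4 23) (3 ⊠ N≥9))
        descend : ∃[ J ] ∃[ T′ ] (T ↭ J ++ T′ × All (λ x → ¬ e ℕᵈ.∣ ∣ v x ∣) J × All (λ x → ¬ ¬ e ℕᵈ.∣ ∣ v x ∣) T′) → Out v p X (8 * N) T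
        descend (J , T′ , perm , a , b) = lift (robust fuel p X′ m N′ w T′ X′≤fuel N′≥1 m≥1 X′≥1 hc′ nz′ M′ zs′)
          where
          dne : ∀ {x} → ¬ ¬ e ℕᵈ.∣ ∣ v x ∣ → e ℕᵈ.∣ ∣ v x ∣
          dne {x} h with e ℕᵈ.∣? ∣ v x ∣
          ... | yes k = k
          ... | no k = ⊥-elim (h k)
          vw : All (λ x → v x ≡ + e ℤ.* w x) T′
          vw = All.map (λ {x} h → quot-≡ e (v x) (dne h)) b
          nz′ : All (NZ w X′) T′
          nz′ = All.zipWith (λ { {x} ((h , k) , eq) → each {x} h k eq }) (Allₚ.++⁻ʳ J (All-resp-↭ perm nz) , vw)
            where
            each : ∀ {x} → 1 ≤ ∣ v x ∣ → ∣ v x ∣ ≤ X → v x ≡ + e ℤ.* w x → NZ w X′ x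
            each {x} h k eq = ℕₚ.n≢0⇒n>0 (λ z → ℕₚ.<⇒≢ h (sym (trans absE (trans (cong (e *_) z) (ℕₚ.*-zeroʳ e))))) ,
                 ℕₚ.≤-trans (ℕₚ.≤-reflexive (sym (m*n/n≡m ∣ w x ∣ e))) (/-monoˡ-≤ e (ℕₚ.≤-trans (ℕₚ.≤-reflexive (trans (ℕₚ.*-comm ∣ w x ∣ e) (sym absE))) k))
              where
              absE : ∣ v x ∣ ≡ e * ∣ w x ∣
              absE = trans (cong ∣_∣ eq) (ℤₚ.∣i*j∣≡∣i∣*∣j∣ (+ e) (w x))
          M′ : Mult w m T′
          M′ z ys zs f h = M (+ e ℤ.* z) ys (zs ++ J) (↭-trans perm (↭-trans (++-comm J T′) (↭-trans (++⁺ʳ J f) (++-assoc ys zs J))))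
                (All.zipWith (λ { (a , b) → trans b (cong (ℤ._*_ (+ e)) a) }) (h , Allₚ.++⁻ˡ ys (All-resp-↭ f vw)))
          zs′ : ZSF w p T′
          zs′ C C′ f (divides q eq) = zs C (C′ ++ J) (↭-trans perm (↭-trans (++-comm J T′) (↭-trans (++⁺ʳ J f) (++-assoc C C′ J))))
                (divides (+ e ℤ.* q) (trans (scaleSum C (Allₚ.++⁻ˡ C (All-resp-↭ f vw))) (trans (cong (ℤ._*_ (+ e)) eq) (sym (ℤₚ.*-assoc (+ e) q (+ p))))))
            where
            scaleSum : ∀ C → All (λ x → v x ≡ + e ℤ.* w x) C → sumv v C ≡ + e ℤ.* sumv w C
            scaleSum [] [] = sym (ℤₚ.*-zeroʳ (+ e))
            scaleSum (x ∷ C) (h ∷ hs) = trans (cong₂ ℤ._+_ h (scaleSum C hs)) (sym (ℤₚ.*-distribˡ-+ (+ e) (w x) (sumv w C)))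
          lenJ : length J ≤ 2 * N
          lenJ = ℕₚ.≤-trans (ℕₚ.≤-trans (count J a) (ℕₚ.≤-trans (ℕₚ.m≤m+n (cnt v e J) (cnt v e T′)) (ℕₚ.≤-reflexive (sym (trans (cnt-↭ v e perm) (cnt-++ v e J T′)))))) few
            where
            bit-no : ∀ {P : Set} (d : Dec P) → ¬ P → 1 ≤ bit d
            bit-no (yes h) n = ⊥-elim (n h)
            bit-no (no _) n = ℕₚ.≤-refl
            count : ∀ J → All (λ x → ¬ e ℕᵈ.∣ ∣ v x ∣) J → length J ≤ cnt v e J
            count [] [] = z≤n
            count (x ∷ J) (h ∷ hs) = ℕₚ.+-mono-≤ (bit-no (e ℕᵈ.∣? ∣ v x ∣) h) (count J hs)
          lift : Out w p X′ (8 * N′) T′ → Out v p X (8 * N) T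
          lift O = record { J = J ++ O.J ; R = O.R ; g = + e ℤ.* O.g ; w = O.w ; perm = ↭-trans perm (↭-trans (++⁺ˡ J O.perm) (↭-sym (++-assoc J O.J O.R)))
               ; short = ℕₚ.≤-trans (ℕₚ.≤-reflexive (Listₚ.length-++ J)) (ℕₚ.≤-trans (ℕₚ.+-mono-≤ lenJ O.short) (lin 0 (2 ⊠ m/n*n≤m (3 * N) 4) (eq N N′)))
               ; g≥1 = ℕₚ.≤-trans (ℕₚ.*-mono-≤ (ℕₚ.≤-trans (s≤s z≤n) 2≤e) O.g≥1) (ℕₚ.≤-reflexive (sym absg))
               ; g≤X = ℕₚ.≤-trans (ℕₚ.≤-reflexive absg) (ℕₚ.≤-trans (e ⊠ O.g≤X) eX′≤X)
               ; scaled = All.zipWith (λ { {x} ((a , b) , h) → trans h (trans (cong (ℤ._*_ (+ e)) a) (sym (ℤₚ.*-assoc (+ e) O.g (O.w x)))) , b }) (O.scaled , Allₚ.++⁻ʳ O.J (All-resp-↭ O.perm vw))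
               ; total = O.total }
            where
            module O = Out O
            absg : ∣ + e ℤ.* O.g ∣ ≡ e * ∣ O.g ∣
            absg = ℤₚ.∣i*j∣≡∣i∣*∣j∣ (+ e) O.g
            eq : ∀ N M → 2 * N + 8 * M + 2 * (3 * N) + 0 ≡ 8 * N + 2 * (M * 4)
            eq = solveℕ 2 (λ N M → lit 2 ⊛ N ⊹ lit 8 ⊛ M ⊹ lit 2 ⊛ (lit 3 ⊛ N) ⊹ lit 0 ≔ lit 8 ⊛ N ⊹ lit 2 ⊛ (M ⊛ lit 4)) refl

-- Growing sets of subset sums mod p

module SubsetSums where

  open import Data.Integer using (_+_; _-_; _*_; -_; _≤_)
  open ℤₚ using (≤-trans; ≤-refl; ≤-reflexive)
  open IntegerSums
  open NearestMultiple
  open Translates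
  open FourfoldOscillation
  open Rectification
  open Progressions
  open Intervals
  open DivisorFree
  open CommonDivisors

  prime-inv : ∀ {p} → Prime p → ∀ x → ¬ (+ p ∣ᶻ x) → ∃[ x⁻ ] (+ p ∣ᶻ (x * x⁻ - 1ℤ))
  prime-inv {p} pr x n = coprime-inv x p coprime
    where
    coprime : Coprime ∣ x ∣ p
    coprime {d} (a , b) with prime⇒irreducible pr b
    ... | inj₁ e = e
    ... | inj₂ refl = ⊥-elim (n (∣ᵤ⇒∣ a))

  val : ∀ {p} → Fin p → ℤ
  val a = + toℕ a

  bool : ∀ {P : Set} → Dec P → ℕ
  bool (yes _) = 1
  bool (no _) = 0

  mult-∷ : ∀ {p} (a x : Fin p) xs → mult a (x ∷ xs) ≡ bool (a Finₚ.≟ x) ℕ.+ mult a xs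
  mult-∷ a x xs with a Finₚ.≟ x
  ... | yes _ = refl
  ... | no _ = refl

  mult-++ : ∀ {p} (a : Fin p) xs ys → mult a (xs ++ ys) ≡ mult a xs ℕ.+ mult a ys
  mult-++ a [] ys = refl
  mult-++ a (x ∷ xs) ys = trans (mult-∷ a x (xs ++ ys)) (trans (cong (bool (a Finₚ.≟ x) ℕ.+_) (mult-++ a xs ys))
     (trans (sym (ℕₚ.+-assoc (bool (a Finₚ.≟ x)) (mult a xs) (mult a ys))) (cong (ℕ._+ mult a ys) (sym (mult-∷ a x xs)))))

  mult-↭ : ∀ {p} (a : Fin p) {xs ys} → xs ↭ ys → mult a xs ≡ mult a ys
  mult-↭ a Perm.refl = refl
  mult-↭ a (prep {xs} {ys} x e) = trans (mult-∷ a x xs) (trans (cong (bool (a Finₚ.≟ x) ℕ.+_) (mult-↭ a e)) (sym (mult-∷ a x ys)))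
  mult-↭ a (swap {xs} {ys} x y e) = trans (two x y xs) (trans (cong (λ z → bx ℕ.+ (by ℕ.+ z)) (mult-↭ a e)) (trans (eq bx by (mult a ys)) (sym (two y x ys))))
    where
    bx = bool (a Finₚ.≟ x)
    by = bool (a Finₚ.≟ y)
    two : ∀ x y xs → mult a (x ∷ y ∷ xs) ≡ bool (a Finₚ.≟ x) ℕ.+ (bool (a Finₚ.≟ y) ℕ.+ mult a xs)
    two x y xs = trans (mult-∷ a x (y ∷ xs)) (cong (bool (a Finₚ.≟ x) ℕ.+_) (mult-∷ a y xs))
    eq : ∀ a b c → a ℕ.+ (b ℕ.+ c) ≡ b ℕ.+ (a ℕ.+ c)
    eq = solveℕ 3 (λ a b c → a ⊹ (b ⊹ c) ≔ b ⊹ (a ⊹ c)) refl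
  mult-↭ a (Perm.trans e f) = trans (mult-↭ a e) (mult-↭ a f)

  bool-yes : ∀ {P : Set} (d : Dec P) → P → bool d ≡ 1
  bool-yes (yes _) _ = refl
  bool-yes (no n) h = ⊥-elim (n h)

  mult-all : ∀ {p} (a : Fin p) xs → All (a ≡_) xs → mult a xs ≡ length xs
  mult-all a [] [] = refl
  mult-all a (x ∷ xs) (e ∷ es) = trans (mult-∷ a x xs) (cong₂ ℕ._+_ (bool-yes (a Finₚ.≟ x) e) (mult-all a xs es))

  sumv-val : ∀ {p} (xs : List (Fin p)) → sumv val xs ≡ + sum (map toℕ xs)
  sumv-val [] = refl
  sumv-val (x ∷ xs) = trans (cong (_+_ (val x)) (sumv-val xs)) (sym (ℤₚ.pos-+ (toℕ x) (sum (map toℕ xs))))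

  zero-sum-free : ∀ p .{{_ : NonZero p}} A → ZeroSumFree p A → ZSF val p A
  zero-sum-free p A h [] C′ e d = refl
  zero-sum-free p A h (x ∷ C) C′ e d = ⊥-elim (h (x ∷ C) C′ e (λ ()) (ℕᵈ.n∣m⇒m%n≡0 _ p (∣⇒∣ᵤ (subst (+ p ∣ᶻ_) (sumv-val (x ∷ C)) d))))

  residue-≡ : ∀ p .{{_ : NonZero p}} i j → i ℕ.< p → j ℕ.< p → + p ∣ᶻ (+ i - + j) → i ≡ j
  residue-≡ p i j li lj d = go (ℕₚ.<-cmp i j)
    where
    open Mod p
    apart : ∀ i j → i ℕ.< j → j ℕ.< p → ¬ (N ∣ᶻ (+ j - + i))
    apart i j l lp d with ℕₚ.m≤n⇒∃[o]m+o≡n l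
    ... | o , refl = small-∤ {o} (ℕₚ.≤-<-trans (s≤s (ℕₚ.m≤n+m o i)) lp) (subst (N ∣ᶻ_) (alg (+ i) (+ o)) d)
      where
      alg : ∀ i o → 1ℤ + (i + o) - i ≡ 1ℤ + o
      alg = solve 2 (λ i o → con 1ℤ :+ (i :+ o) :- i := con 1ℤ :+ o) refl
    flip : N ∣ᶻ (+ i - + j) → N ∣ᶻ (+ j - + i)
    flip (divides k e) = divides (- k) (trans (alg (+ i) (+ j)) (trans (cong -_ e) (alg′ k N)))
      where
      alg : ∀ i j → j - i ≡ - (i - j)
      alg = solve 2 (λ i j → j :- i := :- (i :- j)) refl
      alg′ : ∀ k n → - (k * n) ≡ - k * n
      alg′ = solve 2 (λ k n → :- (k :* n) := :- k :* n) refl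
    go : Relation.Binary.Tri (i ℕ.< j) (i ≡ j) (j ℕ.< i) → i ≡ j
    go (Relation.Binary.tri≈ _ e _) = e
    go (Relation.Binary.tri> _ _ g) = ⊥-elim (apart j i g li d)
    go (Relation.Binary.tri< g _ _) = ⊥-elim (apart i j g lj (flip d))

  module Sumsets (p : ℕ) .{{nz : NonZero p}} (inv : ∀ x → ¬ (+ p ∣ᶻ x) → ∃[ x⁻ ] (+ p ∣ᶻ (x * x⁻ - 1ℤ))) where
    open Mod p
    open Growth p

    Sums : List (Fin p) → Sub → Set
    Sums B A = ∀ x → Sub.χ A x ≡ 1ℤ → ∃[ z ] (Real val B z × N ∣ᶻ (x - z))

    start : Sub
    start = record { χ = δ ; per = δ-per ; bin = λ x → go (δ-case x) }
      where
      go : ∀ {x} → (N ∣ᶻ x × δ x ≡ 1ℤ) ⊎ (¬ (N ∣ᶻ x) × δ x ≡ 0ℤ) → δ x ≡ 0ℤ ⊎ δ x ≡ 1ℤ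
      go (inj₁ (_ , e)) = inj₂ e
      go (inj₂ (_ , e)) = inj₁ e

    start-size : Sub.size start ≡ 1ℤ
    start-size = trans (S-cong (λ x → cong δ (sym (ℤₚ.+-identityʳ x)))) (S-δ 0ℤ)

    start-sums : Sums [] start
    start-sums x e = 0ℤ , real-none val [] , go (δ-case x)
      where
      go : (N ∣ᶻ x × δ x ≡ 1ℤ) ⊎ (¬ (N ∣ᶻ x) × δ x ≡ 0ℤ) → N ∣ᶻ (x - 0ℤ)
      go (inj₁ (d , _)) = subst (N ∣ᶻ_) (sym (ℤₚ.+-identityʳ x)) d
      go (inj₂ (_ , e′)) with trans (sym e) e′
      ... | ()

    -- A ∪ (A + a), with the translate counted only outside A, so that the size grows by exactly
    -- `lam a`.
    grow : Sub → ℤ → Sub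
    grow A a = record { χ = χ′ ; per = per-+ {χ} {λ x → (1ℤ - χ x) * χ (x - a)} per (per-* {λ x → 1ℤ - χ x} {λ x → χ (x - a)} (per-- {λ _ → 1ℤ} {χ} (per-const 1ℤ) per) (per-shift {χ} (- a) per)) ; bin = λ x → go x (bin x) (bin (x - a)) }
      where
      open Sub A
      χ′ : ℤ → ℤ
      χ′ x = χ x + (1ℤ - χ x) * χ (x - a)
      go : ∀ x → χ x ≡ 0ℤ ⊎ χ x ≡ 1ℤ → χ (x - a) ≡ 0ℤ ⊎ χ (x - a) ≡ 1ℤ → χ′ x ≡ 0ℤ ⊎ χ′ x ≡ 1ℤ
      go x (inj₁ e) (inj₁ f) = inj₁ (cong₂ (λ u v → u + (1ℤ - u) * v) e f)
      go x (inj₁ e) (inj₂ f) = inj₂ (cong₂ (λ u v → u + (1ℤ - u) * v) e f)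
      go x (inj₂ e) (inj₁ f) = inj₂ (cong₂ (λ u v → u + (1ℤ - u) * v) e f)
      go x (inj₂ e) (inj₂ f) = inj₂ (cong₂ (λ u v → u + (1ℤ - u) * v) e f)

    grow-size : ∀ A a → Sub.size (grow A a) ≡ Sub.size A + Sub.lam A a
    grow-size A a = S-+ (Sub.χ A) (λ x → (1ℤ - Sub.χ A x) * Sub.χ A (x - a))

    grow-sums : ∀ {B A} a → Sums B A → Sums (a ∷ B) (grow A (val a))
    grow-sums {B} {A} a h x e = go (Sub.bin A x) (Sub.bin A (x - val a))
      where
      open Sub A
      go : χ x ≡ 0ℤ ⊎ χ x ≡ 1ℤ → χ (x - val a) ≡ 0ℤ ⊎ χ (x - val a) ≡ 1ℤ → ∃[ z ] (Real val (a ∷ B) z × N ∣ᶻ (x - z))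
      go (inj₂ f) _ = old (h x f)
        where
        old : ∃[ z ] (Real val B z × N ∣ᶻ (x - z)) → ∃[ z ] (Real val (a ∷ B) z × N ∣ᶻ (x - z))
        old (z , r , d) = z , real-↭ val (++-comm B (a ∷ [])) (real-weak val (a ∷ []) r) , d
      go (inj₁ f) (inj₂ f′) = new (h (x - val a) f′)
        where
        eq : ∀ x a z → x - a - z ≡ x - (a + 0ℤ + z)
        eq = solve 3 (λ x a z → x :- a :- z := x :- (a :+ con 0ℤ :+ z)) refl
        new : ∃[ z ] (Real val B z × N ∣ᶻ (x - val a - z)) → ∃[ z ] (Real val (a ∷ B) z × N ∣ᶻ (x - z))
        new (z , r , d) = val a + 0ℤ + z , real-++ val (real-all val (a ∷ [])) r , subst (N ∣ᶻ_) (eq x (val a) z) d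
      go (inj₁ f) (inj₁ f′) with trans (sym e) (cong₂ (λ u v → u + (1ℤ - u) * v) f f′)
      ... | ()

    Nonzero : Fin p → Set
    Nonzero a = ¬ (N ∣ᶻ val a)

    record Stock (m : ℕ) (T : List (Fin p)) : Set where
      field
        nonzero : All Nonzero T
        mult≤ : ∀ a → mult a T ℕ.≤ m

    stock-sub : ∀ {m T} D T′ → T ↭ D ++ T′ → Stock m T → Stock m T′
    stock-sub D T′ e s = record { nonzero = Allₚ.++⁻ʳ D (All-resp-↭ e (Stock.nonzero s))
       ; mult≤ = λ a → ℕₚ.≤-trans (ℕₚ.m≤n+m (mult a T′) (mult a D)) (ℕₚ.≤-trans (ℕₚ.≤-reflexive (sym (trans (mult-↭ a e) (mult-++ a D T′)))) (Stock.mult≤ s a)) }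

    mult-δ : ∀ {m T} → Stock m T → ∀ x → ∑ˡ (map val T) (λ t → δ (t - x)) ≤ + m
    mult-δ {m} {T} s x = ≤-trans (go T) (+≤+ (Stock.mult≤ s a))
      where
      a : Fin p
      a = fromℕ< (rep< x)
      ra : toℕ a ≡ rep x
      ra = Finₚ.toℕ-fromℕ< (rep< x)
      eq₁ : ∀ t r q n → t - (r + q * n) ≡ (t - r) - q * n
      eq₁ = solve 4 (λ t r q n → t :- (r :+ q :* n) := (t :- r) :- q :* n) refl
      same : ∀ t → N ∣ᶻ (val t - x) → a ≡ t
      same t d = Finₚ.toℕ-injective (trans ra (sym (residue-≡ p (toℕ t) (rep x) (Finₚ.toℕ<n t) (rep< x) (shifted d))))
        where
        shifted : N ∣ᶻ (val t - x) → N ∣ᶻ (val t - + rep x)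
        shifted (divides k e) = divides (k + quo x) (trans (alg (val t) (+ rep x) (quo x) N) (trans (cong (_+ quo x * N) (trans (cong (λ z → val t - z) (sym (rep-≡ x))) e)) (alg′ k (quo x) N)))
          where
          alg : ∀ t r q n → t - r ≡ t - (r + q * n) + q * n
          alg = solve 4 (λ t r q n → t :- r := t :- (r :+ q :* n) :+ q :* n) refl
          alg′ : ∀ k q n → k * n + q * n ≡ (k + q) * n
          alg′ = solve 3 (λ k q n → k :* n :+ q :* n := (k :+ q) :* n) refl
      go : ∀ T → ∑ˡ (map val T) (λ t → δ (t - x)) ≤ + mult a T
      go [] = ≤-refl
      go (t ∷ T) = ≤-trans (ℤₚ.+-mono-≤ (each (δ-case (val t - x))) (go T)) (≤-reflexive (trans (sym (ℤₚ.pos-+ (bool (a Finₚ.≟ t)) (mult a T))) (cong +_ (sym (mult-∷ a t T)))))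
        where
        each : (N ∣ᶻ (val t - x) × δ (val t - x) ≡ 1ℤ) ⊎ (¬ (N ∣ᶻ (val t - x)) × δ (val t - x) ≡ 0ℤ) → δ (val t - x) ≤ + bool (a Finₚ.≟ t)
        each (inj₁ (d , e)) = ≤-reflexive (trans e (cong +_ (sym (bool-yes (a Finₚ.≟ t) (same t d)))))
        each (inj₂ (_ , e)) = ≤-trans (≤-reflexive e) pos

    Pick : Sub → ℕ → List (Fin p) → Set
    Pick A κ T = ∃[ a ] ∃[ T′ ] (T ↭ a ∷ T′ × + κ ≤ Sub.lam A (val a))

    pick-any : ∀ {m} A T → Stock m T → 1 ℕ.≤ length T → + 2 * Sub.size A ≤ N → 1ℤ ≤ Sub.size A → Pick A 1 T
    pick-any A (a ∷ T) s _ half one = a , T , ↭-refl , go (inv (val a) (All.head (Stock.nonzero s)))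
      where
      go : ∃[ x⁻ ] (N ∣ᶻ (val a * x⁻ - 1ℤ)) → 1ℤ ≤ Sub.lam A (val a)
      go (a⁻ , d) = Sub.lam≥1 A half one (val a) a⁻ d

    -- `few-small` bounds the number of terms with `lam` at most ℓ by 8 m (3ℓ + 1); a longer list
    -- contains a better term.
    pick-large : ∀ {m} A ℓ T → Stock m T → + 2 * (+ 3 * + ℓ + 1ℤ) ≤ Sub.size A → + 2 * Sub.size A ≤ N → 8 ℕ.* (m ℕ.* (3 ℕ.* ℓ ℕ.+ 1)) ℕ.< length T → Pick A (suc ℓ) T
    pick-large {m} A ℓ T s big half long = go (find (λ a → + suc ℓ ℤₚ.≤? Sub.lam A (val a)) T)
      where
      go : (∃[ a ] ∃[ T′ ] (T ↭ a ∷ T′ × + suc ℓ ≤ Sub.lam A (val a))) ⊎ All (λ a → ¬ + suc ℓ ≤ Sub.lam A (val a)) T → Pick A (suc ℓ) T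
      go (inj₁ h) = h
      go (inj₂ none) = ⊥-elim (ℕₚ.<⇒≱ long (+≤+⁻ (≤-trans (≤-reflexive (cong +_ (sym (Listₚ.length-map val T)))) (≤-trans
           (Sub.few-small A ℓ m big half (map val T) (Allₚ.map⁺ (All.map small none)) (mult-δ s) (Allₚ.map⁺ (All.map (λ {a} n → inv (val a) n) (Stock.nonzero s)))) (≤-reflexive (sym eqn))))))
        where
        small : ∀ {a} → ¬ + suc ℓ ≤ Sub.lam A (val a) → Sub.lam A (val a) ≤ + ℓ
        small {a} n = go′ (≤-or (Sub.lam A (val a)) (+ ℓ))
          where
          go′ : Sub.lam A (val a) ≤ + ℓ ⊎ 1ℤ + + ℓ ≤ Sub.lam A (val a) → Sub.lam A (val a) ≤ + ℓ
          go′ (inj₁ h) = h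
          go′ (inj₂ h) = ⊥-elim (n h)
        eqn : + (8 ℕ.* (m ℕ.* (3 ℕ.* ℓ ℕ.+ 1))) ≡ + 8 * (+ m * (+ 3 * + ℓ + 1ℤ))
        eqn = trans (ℤₚ.pos-* 8 (m ℕ.* (3 ℕ.* ℓ ℕ.+ 1))) (cong (_*_ (+ 8)) (trans (ℤₚ.pos-* m (3 ℕ.* ℓ ℕ.+ 1)) (cong (_*_ (+ m)) (trans (ℤₚ.pos-+ (3 ℕ.* ℓ) 1) (cong (_+ 1ℤ) (ℤₚ.pos-* 3 ℓ))))))

    record Grown (m : ℕ) (B T : List (Fin p)) (n : ℕ) (goal : ℤ → Set) : Set where
      field
        D T′ : List (Fin p)
        A : Sub
        perm : T ↭ D ++ T′
        short : length D ℕ.≤ n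
        sums : Sums (D ++ B) A
        reached : goal (Sub.size A)

    -- Greedy growth by n picks. It stops once s* is reached, so that every set passed to `pick`
    -- still has size at most s*, within the range of the averaging argument.
    grow-by : ∀ m κ M s₀ s* → (∀ A T → Stock m T → M ℕ.≤ length T → + s₀ ≤ Sub.size A → Sub.size A ≤ + s* → Pick A κ T) →
              ∀ n B A T → Sums B A → Stock m T → M ℕ.+ n ℕ.≤ length T → + s₀ ≤ Sub.size A →
              Grown m B T n (λ z → + s* ≤ z ⊎ + (s₀ ℕ.+ n ℕ.* κ) ≤ z)
    grow-by m κ M s₀ s* pick zero B A T sums st long h = record { D = [] ; T′ = T ; A = A ; perm = ↭-refl ; short = z≤n ; sums = sums ; reached = inj₂ (subst (λ k → + k ≤ Sub.size A) (sym (ℕₚ.+-identityʳ s₀)) h) }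
    grow-by m κ M s₀ s* pick (suc n) B A T sums st long h = step (grow-by m κ M s₀ s* pick n B A T sums st (ℕₚ.≤-trans (ℕₚ.+-monoʳ-≤ M (ℕₚ.n≤1+n n)) long) h)
      where
      Goal = Grown m B T (suc n) (λ z → + s* ≤ z ⊎ + (s₀ ℕ.+ suc n ℕ.* κ) ≤ z)
      step : Grown m B T n (λ z → + s* ≤ z ⊎ + (s₀ ℕ.+ n ℕ.* κ) ≤ z) → Goal
      step g = go g.reached (≤-or (Sub.size g.A) (+ s*))
        where
        module g = Grown g
        keep : + s* ≤ Sub.size g.A → Goal
        keep k = record { D = g.D ; T′ = g.T′ ; A = g.A ; perm = g.perm ; short = ℕₚ.m≤n⇒m≤1+n g.short ; sums = g.sums ; reached = inj₁ k }
        go : + s* ≤ Sub.size g.A ⊎ + (s₀ ℕ.+ n ℕ.* κ) ≤ Sub.size g.A → Sub.size g.A ≤ + s* ⊎ 1ℤ + + s* ≤ Sub.size g.A → Goal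
        go (inj₁ k) _ = keep k
        go _ (inj₂ k) = keep (≤-trans (ℤₚ.i≤suc[i] (+ s*)) k)
        go (inj₂ k) (inj₁ small) = add (pick g.A g.T′ (stock-sub g.D g.T′ g.perm st) longT (≤-trans (+≤+ (ℕₚ.m≤m+n s₀ (n ℕ.* κ))) k) small)
          where
          longT : M ℕ.≤ length g.T′
          longT = ℕₚ.+-cancelˡ-≤ n M (length g.T′) (ℕₚ.≤-trans (ℕₚ.≤-reflexive (ℕₚ.+-comm n M)) (ℕₚ.≤-trans (ℕₚ.+-monoʳ-≤ M (ℕₚ.n≤1+n n)) (ℕₚ.≤-trans long
                (ℕₚ.≤-trans (ℕₚ.≤-reflexive (trans (↭-length g.perm) (Listₚ.length-++ g.D))) (ℕₚ.+-monoˡ-≤ (length g.T′) g.short)))))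
          add : Pick g.A κ g.T′ → Goal
          add (a , T″ , e , la) = record { D = a ∷ g.D ; T′ = T″ ; A = grow g.A (val a) ; perm = ↭-trans g.perm (↭-trans (++⁺ˡ g.D e) (shift a g.D T″)) ; short = s≤s g.short
                ; sums = grow-sums {g.D ++ B} {g.A} a g.sums ; reached = inj₂ (≤-trans (≤-reflexive eqn) (≤-trans (ℤₚ.+-mono-≤ k la) (≤-reflexive (sym (grow-size g.A (val a)))))) }
            where
            eqn : + (s₀ ℕ.+ suc n ℕ.* κ) ≡ + (s₀ ℕ.+ n ℕ.* κ) + + κ
            eqn = trans (cong +_ (alg s₀ n κ)) (ℤₚ.pos-+ (s₀ ℕ.+ n ℕ.* κ) κ)
              where
              alg : ∀ s n k → s ℕ.+ suc n ℕ.* k ≡ s ℕ.+ n ℕ.* k ℕ.+ k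
              alg = solveℕ 3 (λ s n k → s ⊹ (lit 1 ⊹ n) ⊛ k ≔ s ⊹ n ⊛ k ⊹ k) refl

    -- Two rounds of N₀ picks with ℓ = ⌊N₀/32m⌋. The first gains 1 per pick and leads to a size
    -- above N₀, enough for `few-small` to apply at ℓ. The second gains ℓ + 1 per pick, in total N₀
    -- (ℓ + 1) ≥ N₀²/32m ≥ s*.
    build : ∀ m N₀ s* → 1 ℕ.≤ m → 1 ℕ.≤ N₀ → 32 ℕ.* m ℕ.* s* ℕ.≤ N₀ ℕ.* N₀ → + 2 * + s* ≤ N → ∀ T → Stock m T → 3 ℕ.* N₀ ℕ.+ 1 ℕ.≤ length T →
            Grown m [] T (2 ℕ.* N₀) (λ z → + s* ≤ z)
    build m N₀ s* m≥1 N₀≥1 hs half T st long = second (grow-by m 1 (suc N₀) 1 s* pickA N₀ [] start T start-sums st long₁ (≤-reflexive (sym start-size)))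
      where
      instance
        32m : NonZero (32 ℕ.* m)
        32m = ℕ.>-nonZero (ℕₚ.*-mono-≤ {1} {32} (s≤s z≤n) m≥1)
      ℓ = N₀ / (32 ℕ.* m)
      halve : ∀ {z} → z ≤ + s* → + 2 * z ≤ N
      halve {z} h = ≤-trans (≤-by _ (pos {2} ⊗ sub≥0 h) (alg z (+ s*))) half
        where
        alg : ∀ z s → + 2 * s - + 2 * z ≡ + 2 * (s - z)
        alg = solve 2 (λ z s → con (+ 2) :* s :- con (+ 2) :* z := con (+ 2) :* (s :- z)) refl
      pickA : ∀ A T → Stock m T → suc N₀ ℕ.≤ length T → + 1 ≤ Sub.size A → Sub.size A ≤ + s* → Pick A 1 T
      pickA A T st long h k = pick-any A T st (ℕₚ.≤-trans (s≤s z≤n) long) (halve k) h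
      8ℓ≤N₀ : 32 ℕ.* m ℕ.* ℓ ℕ.≤ N₀
      8ℓ≤N₀ = ℕₚ.≤-trans (ℕₚ.≤-reflexive (ℕₚ.*-comm (32 ℕ.* m) ℓ)) (m/n*n≤m N₀ (32 ℕ.* m))
      pickB : ∀ k → 32 ℕ.* m ℕ.* k ℕ.≤ N₀ → ∀ A T → Stock m T → suc N₀ ℕ.≤ length T → + suc N₀ ≤ Sub.size A → Sub.size A ≤ + s* → Pick A (suc k) T
      pickB zero _ A T st long h k = pickA A T st long (≤-trans (+≤+ (s≤s z≤n)) h) k
      pickB (suc j) hj A T st long h k = pick-large A (suc j) T st big (halve k) (ℕₚ.<-≤-trans (s≤s few) long)
        where
        few : 8 ℕ.* (m ℕ.* (3 ℕ.* suc j ℕ.+ 1)) ℕ.≤ N₀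
        few = ℕₚ.≤-trans (ℕₚ.≤-trans (ℕₚ.m≤m+n _ (8 ℕ.* (m ℕ.* j))) (ℕₚ.≤-reflexive (alg m j))) hj
          where
          alg : ∀ m j → 8 ℕ.* (m ℕ.* (3 ℕ.* suc j ℕ.+ 1)) ℕ.+ 8 ℕ.* (m ℕ.* j) ≡ 32 ℕ.* m ℕ.* suc j
          alg = solveℕ 2 (λ m j → lit 8 ⊛ (m ⊛ (lit 3 ⊛ (lit 1 ⊹ j) ⊹ lit 1)) ⊹ lit 8 ⊛ (m ⊛ j) ≔ lit 32 ⊛ m ⊛ (lit 1 ⊹ j)) refl
        nat : 2 ℕ.* (3 ℕ.* suc j ℕ.+ 1) ℕ.≤ N₀
        nat = ℕₚ.≤-trans (ℕₚ.*-mono-≤ {2} {8} (s≤s (s≤s z≤n)) (ℕₚ.m≤n*m (3 ℕ.* suc j ℕ.+ 1) m {{ℕ.>-nonZero m≥1}})) few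
        big : + 2 * (+ 3 * + suc j + 1ℤ) ≤ Sub.size A
        big = ≤-trans (≤-reflexive (sym (trans (ℤₚ.pos-* 2 (3 ℕ.* suc j ℕ.+ 1)) (cong (_*_ (+ 2)) (trans (ℤₚ.pos-+ (3 ℕ.* suc j) 1) (cong (_+ 1ℤ) (ℤₚ.pos-* 3 (suc j)))))))) (≤-trans (+≤+ (ℕₚ.≤-trans nat (ℕₚ.n≤1+n N₀))) h)
      long₁ : suc N₀ ℕ.+ N₀ ℕ.≤ length T
      long₁ = ℕₚ.≤-trans (ℕₚ.≤-trans (ℕₚ.m≤m+n _ N₀) (ℕₚ.≤-reflexive (alg N₀))) long
        where
        alg : ∀ n → suc n ℕ.+ n ℕ.+ n ≡ 3 ℕ.* n ℕ.+ 1
        alg = solveℕ 1 (λ n → (lit 1 ⊹ n) ⊹ n ⊹ n ≔ lit 3 ⊛ n ⊹ lit 1) refl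
      s*≤ : s* ℕ.≤ N₀ ℕ.* suc ℓ
      s*≤ = ℕₚ.*-cancelˡ-≤ (32 ℕ.* m) (ℕₚ.≤-trans hs (ℕₚ.≤-trans (ℕₚ.*-monoʳ-≤ N₀ (<div′ N₀ (32 ℕ.* m))) (ℕₚ.≤-reflexive (alg N₀ (suc ℓ) (32 ℕ.* m)))))
        where
        alg : ∀ n l c → n ℕ.* (l ℕ.* c) ≡ c ℕ.* (n ℕ.* l)
        alg = solveℕ 3 (λ n l c → n ⊛ (l ⊛ c) ≔ c ⊛ (n ⊛ l)) refl
        open LinearArithmetic using () renaming (<div to <div′)
      Goal = Grown m [] T (2 ℕ.* N₀) (λ z → + s* ≤ z)
      second : Grown m [] T N₀ (λ z → + s* ≤ z ⊎ + (1 ℕ.+ N₀ ℕ.* 1) ≤ z) → Goal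
      second g = go g.reached
        where
        module g = Grown g
        go : + s* ≤ Sub.size g.A ⊎ + (1 ℕ.+ N₀ ℕ.* 1) ≤ Sub.size g.A → Goal
        go (inj₁ k) = record { D = g.D ; T′ = g.T′ ; A = g.A ; perm = g.perm ; short = ℕₚ.≤-trans g.short (ℕₚ.m≤m+n N₀ (N₀ ℕ.+ 0)) ; sums = g.sums ; reached = k }
        go (inj₂ k) = third (grow-by m (suc ℓ) (suc N₀) (suc N₀) s* (pickB ℓ 8ℓ≤N₀) N₀ (g.D ++ []) g.A g.T′ g.sums (stock-sub g.D g.T′ g.perm st) long₂ (subst (λ y → + suc y ≤ Sub.size g.A) (ℕₚ.*-identityʳ N₀) k))
          where
          long₂ : suc N₀ ℕ.+ N₀ ℕ.≤ length g.T′
          long₂ = ℕₚ.+-cancelˡ-≤ N₀ (suc N₀ ℕ.+ N₀) (length g.T′) (ℕₚ.≤-trans (ℕₚ.≤-reflexive (alg N₀)) (ℕₚ.≤-trans long (ℕₚ.≤-trans (ℕₚ.≤-reflexive (trans (↭-length g.perm) (Listₚ.length-++ g.D))) (ℕₚ.+-monoˡ-≤ (length g.T′) g.short))))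
            where
            alg : ∀ n → n ℕ.+ (suc n ℕ.+ n) ≡ 3 ℕ.* n ℕ.+ 1
            alg = solveℕ 1 (λ n → n ⊹ ((lit 1 ⊹ n) ⊹ n) ≔ lit 3 ⊛ n ⊹ lit 1) refl
          third : Grown m (g.D ++ []) g.T′ N₀ (λ z → + s* ≤ z ⊎ + (suc N₀ ℕ.+ N₀ ℕ.* suc ℓ) ≤ z) → Goal
          third h = record { D = h.D ++ g.D ; T′ = h.T′ ; A = h.A ; perm = ↭-trans g.perm (↭-trans (++⁺ˡ g.D h.perm) (↭-trans (shifts g.D h.D) (↭-sym (++-assoc h.D g.D h.T′))))
               ; short = ℕₚ.≤-trans (ℕₚ.≤-reflexive (Listₚ.length-++ h.D)) (ℕₚ.≤-trans (ℕₚ.+-mono-≤ h.short g.short) (ℕₚ.≤-reflexive (cong (N₀ ℕ.+_) (sym (ℕₚ.+-identityʳ N₀)))))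
               ; sums = subst (λ L → Sums L h.A) (sym (Listₚ.++-assoc h.D g.D [])) h.sums ; reached = fin h.reached }
            where
            module h = Grown h
            fin : + s* ≤ Sub.size h.A ⊎ + (suc N₀ ℕ.+ N₀ ℕ.* suc ℓ) ≤ Sub.size h.A → + s* ≤ Sub.size h.A
            fin (inj₁ k) = k
            fin (inj₂ k) = ≤-trans (+≤+ (ℕₚ.≤-trans s*≤ (ℕₚ.m≤n+m (N₀ ℕ.* suc ℓ) (suc N₀)))) k

    -- `size≥` records the gain of at least L per added term; it bounds the number of such terms, as
    -- no set has more than p elements.
    record Saturated (B : List (Fin p)) (A₀ : Sub) (T : List (Fin p)) (L : ℕ) : Set where
      field
        D T′ : List (Fin p)
        A : Sub
        perm : T ↭ D ++ T′
        sums : Sums (D ++ B) A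
        size≥ : Sub.size A₀ + + length D * + L ≤ Sub.size A
        settled : All (λ a → Sub.lam A (val a) ≤ + L) T′

    saturate : ∀ L B A T → Sums B A → ∀ fuel → length T ℕ.≤ fuel → Saturated B A T L
    saturate L B A T sums fuel lf = go fuel lf (find (λ a → ¬? (Sub.lam A (val a) ℤₚ.≤? + L)) T)
      where
      dne : ∀ {a} → ¬ ¬ Sub.lam A (val a) ≤ + L → Sub.lam A (val a) ≤ + L
      dne {a} h = cases (Sub.lam A (val a) ℤₚ.≤? + L)
        where
        cases : Dec (Sub.lam A (val a) ≤ + L) → Sub.lam A (val a) ≤ + L
        cases (yes k) = k
        cases (no k) = ⊥-elim (h k)
      go : ∀ fuel → length T ℕ.≤ fuel → (∃[ a ] ∃[ T′ ] (T ↭ a ∷ T′ × ¬ Sub.lam A (val a) ≤ + L)) ⊎ All (λ a → ¬ ¬ Sub.lam A (val a) ≤ + L) T → Saturated B A T L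
      go fuel lf (inj₂ h) = record { D = [] ; T′ = T ; A = A ; perm = ↭-refl ; sums = sums ; settled = All.map (λ {a} → dne {a}) h
         ; size≥ = ≤-reflexive (trans (cong (_+_ (Sub.size A)) (ℤₚ.*-zeroˡ (+ L))) (ℤₚ.+-identityʳ (Sub.size A))) }
      go zero lf (inj₁ (a , T′ , e , n)) = ⊥-elim (ℕₚ.<⇒≱ (s≤s z≤n) (ℕₚ.≤-trans (ℕₚ.≤-reflexive (sym (↭-length e))) lf))
      go (suc fuel) lf (inj₁ (a , T′ , e , n)) = lift (saturate L (a ∷ B) (grow A (val a)) T′ (grow-sums {B} {A} a sums) fuel (ℕₚ.≤-pred (ℕₚ.≤-trans (ℕₚ.≤-reflexive (sym (↭-length e))) lf)))
        where
        lift : Saturated (a ∷ B) (grow A (val a)) T′ L → Saturated B A T L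
        lift s = record { D = s.D ++ (a ∷ []) ; T′ = s.T′ ; A = s.A ; perm = ↭-trans e (↭-trans (prep a s.perm) (↭-trans (↭-sym (shift a s.D s.T′)) (↭-sym (++-assoc s.D (a ∷ []) s.T′))))
             ; sums = subst (λ K → Sums K s.A) (sym (Listₚ.++-assoc s.D (a ∷ []) B)) s.sums ; settled = s.settled
             ; size≥ = ≤-trans (≤-by _ (sub≥0 (ℤₚ.<⇒≤ (ℤₚ.≰⇒> n))) (trans (cong₂ (λ y z → y + + length s.D * + L - (Sub.size A + z * + L)) (grow-size A (val a)) (trans (cong +_ (Listₚ.length-++ s.D)) (ℤₚ.pos-+ (length s.D) 1)))
                  (alg (Sub.size A) (Sub.lam A (val a)) (+ length s.D) (+ L)))) s.size≥ }
          where
          module s = Saturated s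
          alg : ∀ z l d L → z + l + d * L - (z + (d + 1ℤ) * L) ≡ l - L
          alg = solve 4 (λ z l d L → z :+ l :+ d :* L :- (z :+ (d :+ con 1ℤ) :* L) := l :- L) refl

-- Rational bounds for the exponential series

module Logarithm where

  /-≤ : ∀ a b c d → + a ℤ.* + suc d ℤ.≤ + c ℤ.* + suc b → (+ a) ℚ./ suc b ℚ.≤ (+ c) ℚ./ suc d
  /-≤ a b c d h = ℚₚ.toℚᵘ-cancel-≤ (ℚᵘₚ.≤-respˡ-≃ (ℚᵘₚ.≃-sym (ℚₚ.toℚᵘ-fromℚᵘ (mkℚᵘ (+ a) b))) (ℚᵘₚ.≤-respʳ-≃ (ℚᵘₚ.≃-sym (ℚₚ.toℚᵘ-fromℚᵘ (mkℚᵘ (+ c) d))) (*≤* h)))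

  ℕtoℚ-mono : ∀ a b → a ℕ.≤ b → ℕtoℚ a ℚ.≤ ℕtoℚ b
  ℕtoℚ-mono a b h = /-≤ a 0 b 0 (subst₂ ℤ._≤_ (sym (ℤₚ.*-identityʳ (+ a))) (sym (ℤₚ.*-identityʳ (+ b))) (+≤+ h))

  mul-≥0 : ∀ {a b} → 0ℚ ℚ.≤ a → 0ℚ ℚ.≤ b → 0ℚ ℚ.≤ a ℚ.* b
  mul-≥0 {a} {b} h k = subst (ℚ._≤ a ℚ.* b) (ℚₚ.*-zeroˡ b) (ℚₚ.*-monoʳ-≤-nonNeg b {{ℚ.nonNegative k}} h)

  mul-≤ : ∀ {a b c} → 0ℚ ℚ.≤ c → a ℚ.≤ b → c ℚ.* a ℚ.≤ c ℚ.* b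
  mul-≤ {a} {b} {c} h k = ℚₚ.*-monoˡ-≤-nonNeg c {{ℚ.nonNegative h}} k

  pow-≥1 : ∀ {t} → 1ℚ ℚ.≤ t → ∀ n → 1ℚ ℚ.≤ t ^ℚ n
  pow-≥1 h zero = ℚₚ.≤-refl
  pow-≥1 {t} h (suc n) = ℚₚ.≤-trans (pow-≥1 h n) (subst (ℚ._≤ t ^ℚ n ℚ.* t) (ℚₚ.*-identityʳ (t ^ℚ n)) (mul-≤ (ℚₚ.≤-trans (/-≤ 0 0 1 0 (+≤+ z≤n)) (pow-≥1 h n)) h))

  ½ : ℚ
  ½ = (+ 1) ℚ./ 2

  module Exponential {t : ℚ} (t≥0 : 0ℚ ℚ.≤ t) (t≤1 : t ℚ.≤ 1ℚ) where

    0≤1 : 0ℚ ℚ.≤ 1ℚ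
    0≤1 = /-≤ 0 0 1 0 (+≤+ z≤n)

    inv≥0 : ∀ n → 0ℚ ℚ.≤ (+ 1) ℚ./ suc n
    inv≥0 n = /-≤ 0 0 1 n (+≤+ z≤n)

    expTerm≥0 : ∀ n → 0ℚ ℚ.≤ expTerm t n
    expTerm≥0 zero = 0≤1
    expTerm≥0 (suc n) = mul-≥0 (mul-≥0 (expTerm≥0 n) t≥0) (inv≥0 n)

    step : ∀ n c → (+ 1) ℚ./ suc n ℚ.≤ c → 0ℚ ℚ.≤ c → expTerm t (suc n) ℚ.≤ expTerm t n ℚ.* c
    step n c h c≥0 = ℚₚ.≤-trans (mul-≤ (mul-≥0 (expTerm≥0 n) t≥0) h) (subst (expTerm t n ℚ.* t ℚ.* c ℚ.≤_) (cong (ℚ._* c) (ℚₚ.*-identityʳ (expTerm t n)))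
       (ℚₚ.*-monoʳ-≤-nonNeg c {{ℚ.nonNegative c≥0}} (mul-≤ (expTerm≥0 n) t≤1)))

    expTerm-halves : ∀ n → expTerm t (suc (suc n)) ℚ.+ expTerm t (suc (suc n)) ℚ.≤ expTerm t (suc n)
    expTerm-halves n = ℚₚ.≤-trans (ℚₚ.+-mono-≤ h h) (ℚₚ.≤-reflexive (trans (sym (ℚₚ.*-distribˡ-+ (expTerm t (suc n)) ½ ½)) (ℚₚ.*-identityʳ (expTerm t (suc n)))))
      where
      h : expTerm t (suc (suc n)) ℚ.≤ expTerm t (suc n) ℚ.* ½
      h = step (suc n) ½ (/-≤ 1 (suc n) 1 1 (+≤+ (s≤s (s≤s z≤n)))) (/-≤ 0 0 1 1 (+≤+ z≤n))

    expTerm-1 : expTerm t 1 ℚ.≤ 1ℚ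
    expTerm-1 = step 0 1ℚ ℚₚ.≤-refl 0≤1

    -- Counting the last term twice makes the induction work: two copies of the next term fit into
    -- one copy of it by `expTerm-halves`.
    partial : ∀ n → expPartial t (suc n) ℚ.+ expTerm t (suc n) ℚ.≤ ℕtoℚ 3
    partial zero = ℚₚ.+-mono-≤ (ℚₚ.+-mono-≤ {1ℚ} ℚₚ.≤-refl expTerm-1) expTerm-1
    partial (suc n) = ℚₚ.≤-trans (ℚₚ.≤-reflexive (ℚₚ.+-assoc (expPartial t (suc n)) (expTerm t (suc (suc n))) (expTerm t (suc (suc n)))))
       (ℚₚ.≤-trans (ℚₚ.+-monoʳ-≤ (expPartial t (suc n)) (expTerm-halves n)) (partial n))

    exp≤3 : ∀ n → expPartial t n ℚ.≤ ℕtoℚ 3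
    exp≤3 zero = ℕtoℚ-mono 1 3 (s≤s z≤n)
    exp≤3 (suc n) = ℚₚ.≤-trans (subst (ℚ._≤ expPartial t (suc n) ℚ.+ expTerm t (suc n)) (ℚₚ.+-identityʳ (expPartial t (suc n))) (ℚₚ.+-monoʳ-≤ (expPartial t (suc n)) (expTerm≥0 (suc n)))) (partial n)

  -- For p ≥ 3 the logarithm is at least 1, so (p m)^(6/13) itself is an admissible bound.
  FLeq-root : ∀ p m k → 3 ℕ.≤ p → k ℕ.^ 13 ℕ.≤ (p ℕ.* m) ℕ.^ 6 → FLeq p m k
  FLeq-root p m k p≥3 h t t≥0 lt n = ℚₚ.≤-trans (Exponential.exp≤3 t≥0 (small (1ℚ ℚₚ.≤? t)) n) (ℕtoℚ-mono 3 p p≥3)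
    where
    F = ℕtoℚ ((p ℕ.* m) ℕ.^ 6)
    F≥0 : 0ℚ ℚ.≤ F
    F≥0 = ℕtoℚ-mono 0 ((p ℕ.* m) ℕ.^ 6) z≤n
    small : Dec (1ℚ ℚ.≤ t) → t ℚ.≤ 1ℚ
    small (no n) = ℚₚ.<⇒≤ (ℚₚ.≰⇒> n)
    small (yes t≥1) = ⊥-elim (ℚₚ.<-irrefl refl (ℚₚ.<-≤-trans lt (ℚₚ.≤-trans (ℕtoℚ-mono (k ℕ.^ 13) ((p ℕ.* m) ℕ.^ 6) h)
       (subst (ℚ._≤ t ^ℚ 26 ℚ.* F) (ℚₚ.*-identityˡ F) (ℚₚ.*-monoʳ-≤-nonNeg F {{ℚ.nonNegative F≥0}} (pow-≥1 t≥1 26))))))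

  -- For k = 0 the premise of `FLeq` asks for a negative product of nonnegative numbers.
  FLeq-zero : ∀ p m → FLeq p m 0
  FLeq-zero p m t t≥0 lt = ⊥-elim (ℚₚ.<-irrefl refl (ℚₚ.<-≤-trans lt (mul-≥0 (pow≥0 26) (ℕtoℚ-mono 0 ((p ℕ.* m) ℕ.^ 6) z≤n))))
    where
    pow≥0 : ∀ n → 0ℚ ℚ.≤ t ^ℚ n
    pow≥0 zero = ℕtoℚ-mono 0 1 z≤n
    pow≥0 (suc n) = mul-≥0 (pow≥0 n) t≥0

-- Numerical relations between the scales s, L, w, J and X

module Parameters where

  open import Data.Nat using (_≤_; _+_; _*_; _∸_; _<_; _^_)
  open LinearArithmetic

  square-cancel : ∀ {x y} → x * x ≤ y * y → x ≤ y
  square-cancel {x} {y} h with x ℕₚ.≤? y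
  ... | yes k = k
  ... | no n = ⊥-elim (ℕₚ.<⇒≱ (ℕₚ.*-mono-< (ℕₚ.≰⇒> n) (ℕₚ.≰⇒> n)) h)

  cube-cancel : ∀ {x y} → x * x * x ≤ y * y * y → x ≤ y
  cube-cancel {x} {y} h with x ℕₚ.≤? y
  ... | yes k = k
  ... | no n = ⊥-elim (ℕₚ.<⇒≱ (ℕₚ.*-mono-< (ℕₚ.*-mono-< (ℕₚ.≰⇒> n) (ℕₚ.≰⇒> n)) (ℕₚ.≰⇒> n)) h)

  -- c, K and k stand for 2^39, 180000 and 1536000; as variables they do not slow down the ring normaliser.
  module Scales (p m N c K k : ℕ) (p≥1 : 1 ≤ p) (m≥1 : 1 ≤ m) (N≥1 : 1 ≤ N) (m≤p : m ≤ p) (N² : N * N ≤ 16 * (p * m))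
                (N¹³ : c * c * ((p * m) ^ 6) ≤ N ^ 13)
                (c₁ : 64 * 64 * 64 * (5 * K) ≤ c) (c₂ : 64 * (17 * (17 * (k * k))) ≤ c * c) (c₃ : 32 * 32 * 32 * 32 < c)
                (k≡ : k ≡ 64 * 64 * (75 * 5)) (K≡ : 2 * K ≡ 600 * 600) (K≥75 : 75 ≤ K) (p-large : 600 * 600 * 600 ≤ K * (p * p)) where

    instance
      p-nz : NonZero p
      p-nz = ℕ.>-nonZero p≥1
      N-nz : NonZero N
      N-nz = ℕ.>-nonZero N≥1
      32m-nz : NonZero (32 * m)
      32m-nz = ℕ.>-nonZero (ℕₚ.*-mono-≤ {1} {32} (s≤s z≤n) m≥1)

    a : ℕ
    a = p * m * (p * m) * (p * m)

    a² : (p * m) ^ 6 ≡ a * a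
    a² = eq (p * m)
      where
      eq : ∀ x → x * (x * (x * (x * (x * (x * 1))))) ≡ x * x * x * (x * x * x)
      eq = solveℕ 1 (λ x → x ⊛ (x ⊛ (x ⊛ (x ⊛ (x ⊛ (x ⊛ lit 1))))) ≔ x ⊛ x ⊛ x ⊛ (x ⊛ x ⊛ x)) refl

    -- The square root of c² (pm)⁶ ≤ N¹³ ≤ N¹⁴.
    N⁷ : c * a ≤ N ^ 7
    N⁷ = square-cancel (ℕₚ.≤-trans (ℕₚ.≤-reflexive (trans (eq c a) (cong (c * c *_) (sym a²)))) (ℕₚ.≤-trans N¹³ (ℕₚ.≤-trans (ℕₚ.m≤n*m (N ^ 13) N) (ℕₚ.≤-reflexive (ℕₚ.^-distribˡ-+-* N 7 7)))))
      where
      eq : ∀ c a → c * a * (c * a) ≡ c * c * (a * a)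
      eq = solveℕ 2 (λ c a → c ⊛ a ⊛ (c ⊛ a) ≔ c ⊛ c ⊛ (a ⊛ a)) refl

    N≤4p : N ≤ 4 * p
    N≤4p = square-cancel (ℕₚ.≤-trans N² (ℕₚ.≤-trans (16 ⊠ (p ⊠ m≤p)) (ℕₚ.≤-reflexive (eq p))))
      where
      eq : ∀ p → 16 * (p * p) ≡ 4 * p * (4 * p)
      eq = solveℕ 1 (λ p → lit 16 ⊛ (p ⊛ p) ≔ lit 4 ⊛ p ⊛ (lit 4 ⊛ p)) refl

    -- N² ≤ t m would give N⁷ ≤ N⁸ ≤ t⁴m⁴, whereas N⁷ ≥ c (pm)³ ≥ c m⁴.
    N²-large : ∀ t → t * t * t * t < c → ¬ N * N ≤ t * m
    N²-large t h N²< = ℕₚ.<⇒≱ h (cancel (m * m * m * m) m⁴≥1 (ℕₚ.≤-trans low (ℕₚ.≤-trans N⁷ high)))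
      where
      m⁴≥1 : 1 ≤ m * m * m * m
      m⁴≥1 = ℕₚ.*-mono-≤ {1} {m * m * m} (ℕₚ.*-mono-≤ {1} {m * m} (ℕₚ.*-mono-≤ {1} {m} m≥1 m≥1) m≥1) m≥1
      e₁ : ∀ m c → m * m * m * m * c ≡ c * (m * m * (m * m))
      e₁ = solveℕ 2 (λ m c → m ⊛ m ⊛ m ⊛ m ⊛ c ≔ c ⊛ (m ⊛ m ⊛ (m ⊛ m))) refl
      m≤ν : m ≤ p * m
      m≤ν = ℕₚ.m≤n*m m p
      m²≤ν : m * m ≤ p * m
      m²≤ν = ℕₚ.*-monoˡ-≤ m m≤p
      low : m * m * m * m * c ≤ c * a
      low = ℕₚ.≤-trans (ℕₚ.≤-reflexive (e₁ m c)) (c ⊠ ℕₚ.*-mono-≤ {m * m} {p * m * (p * m)} {m * m} {p * m} (ℕₚ.*-mono-≤ {m} {p * m} {m} {p * m} m≤ν m≤ν) m²≤ν)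
      e₃ : ∀ N → N * (N * (N * (N * (N * (N * (N * 1)))))) ≡ N * N * (N * N) * (N * N) * N
      e₃ = solveℕ 1 (λ N → N ⊛ (N ⊛ (N ⊛ (N ⊛ (N ⊛ (N ⊛ (N ⊛ lit 1)))))) ≔ N ⊛ N ⊛ (N ⊛ N) ⊛ (N ⊛ N) ⊛ N) refl
      e₄ : ∀ t m → t * m * (t * m) * (t * m) * (t * m) ≡ m * m * m * m * (t * t * t * t)
      e₄ = solveℕ 2 (λ t m → t ⊛ m ⊛ (t ⊛ m) ⊛ (t ⊛ m) ⊛ (t ⊛ m) ≔ m ⊛ m ⊛ m ⊛ m ⊛ (t ⊛ t ⊛ t ⊛ t)) refl
      high : N ^ 7 ≤ m * m * m * m * (t * t * t * t)
      high = ℕₚ.≤-trans (ℕₚ.≤-reflexive (e₃ N)) (ℕₚ.≤-trans (ℕₚ.*-mono-≤ (ℕₚ.*-mono-≤ (ℕₚ.*-mono-≤ N²< N²<) N²<) (ℕₚ.≤-trans (ℕₚ.m≤n*m N N) N²<)) (ℕₚ.≤-reflexive (e₄ t m)))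

    32m≤N² : 32 * m ≤ N * N
    32m≤N² = ℕₚ.<⇒≤ (ℕₚ.≰⇒> (N²-large 32 c₃))

    -- s is the size that `build` guarantees for each group. L is the least integer with L N > p, so
    -- that saturation adds at most N terms.
    s L : ℕ
    s = N * N / (32 * m)
    L = suc (p / N)

    s≥1 : 1 ≤ s
    s≥1 = m≥n⇒m/n>0 32m≤N²

    s-upper : 32 * m * s ≤ N * N
    s-upper = ℕₚ.≤-trans (ℕₚ.≤-reflexive (ℕₚ.*-comm (32 * m) s)) (m/n*n≤m (N * N) (32 * m))

    s-lower : N * N ≤ 64 * m * s
    s-lower = lin 0 (<div (N * N) (32 * m) ⊞ (32 * m) ⊠ s≥1) (eq 32 N m s)
      where
      eq : ∀ t N m s → N * N + (t * m + s * (t * m) + t * m * s) + 0 ≡ (t + t) * m * s + (N * N + t * m * 1)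
      eq = solveℕ 4 (λ t N m s → N ⊛ N ⊹ (t ⊛ m ⊹ s ⊛ (t ⊛ m) ⊹ t ⊛ m ⊛ s) ⊹ lit 0 ≔ (t ⊹ t) ⊛ m ⊛ s ⊹ (N ⊛ N ⊹ t ⊛ m ⊛ lit 1)) refl

    2s≤p : 2 * s ≤ p
    2s≤p = cancel (16 * m) (ℕₚ.*-mono-≤ {1} {16} (s≤s z≤n) m≥1) (lin 0 (s-upper ⊞ N²) (eq N m s p))
      where
      eq : ∀ N m s p → 16 * m * (2 * s) + (N * N + 16 * (p * m)) + 0 ≡ 16 * m * p + (32 * m * s + N * N)
      eq = solveℕ 4 (λ N m s p → lit 16 ⊛ m ⊛ (lit 2 ⊛ s) ⊹ (N ⊛ N ⊹ lit 16 ⊛ (p ⊛ m)) ⊹ lit 0 ≔ lit 16 ⊛ m ⊛ p ⊹ (lit 32 ⊛ m ⊛ s ⊹ N ⊛ N)) refl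

    s≤p : s ≤ p
    s≤p = ℕₚ.≤-trans (ℕₚ.m≤m+n s (s + 0)) 2s≤p

    LN≤5p : L * N ≤ 5 * p
    LN≤5p = ℕₚ.≤-trans (ℕₚ.+-mono-≤ N≤4p (m/n*n≤m p N)) (ℕₚ.≤-reflexive (eq p))
      where
      eq : ∀ p → 4 * p + p ≡ 5 * p
      eq = solveℕ 1 (λ p → lit 4 ⊛ p ⊹ p ≔ lit 5 ⊛ p) refl

    p<LN : p < L * N
    p<LN = ℕₚ.≤-trans (s≤s (ℕₚ.≤-reflexive (m≡m%n+[m/n]*n p N))) (ℕₚ.+-monoˡ-≤ (p / N * N) (m%n<n p N))

    -- With s ≫ N²/m and L ≪ p/N this is N⁷ ≫ (pm)³. It supplies the coarse bound: w ≈ s and Ω ≫ s²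
    -- have to satisfy w Ω ≫ p²L.
    cubic-from : ∀ t → 1 ≤ t → N * N ≤ t * m * s → t * t * t * (5 * K) ≤ c → K * (p * p) * L ≤ s * s * s
    cubic-from t t≥1 low h = cancel N N≥1 (ℕₚ.≤-trans (lin 0 ((K * (p * p)) ⊠ LN≤5p) (e₁ N K p L)) (ℕₚ.≤-trans big (ℕₚ.≤-reflexive (ℕₚ.*-comm (s * s * s) N))))
      where
      e₁ : ∀ N K p L → N * (K * (p * p) * L) + K * (p * p) * (5 * p) + 0 ≡ 5 * K * (p * p * p) + K * (p * p) * (L * N)
      e₁ = solveℕ 4 (λ N K p L → N ⊛ (K ⊛ (p ⊛ p) ⊛ L) ⊹ K ⊛ (p ⊛ p) ⊛ (lit 5 ⊛ p) ⊹ lit 0 ≔ lit 5 ⊛ K ⊛ (p ⊛ p ⊛ p) ⊹ K ⊛ (p ⊛ p) ⊛ (L ⊛ N)) refl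
      e₂ : ∀ t m p K → t * m * (t * m) * (t * m) * (5 * K * (p * p * p)) ≡ t * t * t * (5 * K) * (p * m * (p * m) * (p * m))
      e₂ = solveℕ 4 (λ t m p K → t ⊛ m ⊛ (t ⊛ m) ⊛ (t ⊛ m) ⊛ (lit 5 ⊛ K ⊛ (p ⊛ p ⊛ p)) ≔ t ⊛ t ⊛ t ⊛ (lit 5 ⊛ K) ⊛ (p ⊛ m ⊛ (p ⊛ m) ⊛ (p ⊛ m))) refl
      e₃ : ∀ N → N * (N * (N * (N * (N * (N * (N * 1)))))) ≡ N * N * (N * N) * (N * N) * N
      e₃ = solveℕ 1 (λ N → N ⊛ (N ⊛ (N ⊛ (N ⊛ (N ⊛ (N ⊛ (N ⊛ lit 1)))))) ≔ N ⊛ N ⊛ (N ⊛ N) ⊛ (N ⊛ N) ⊛ N) refl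
      e₄ : ∀ x s N → x * s * (x * s) * (x * s) * N ≡ x * x * x * (s * s * s * N)
      e₄ = solveℕ 3 (λ x s N → x ⊛ s ⊛ (x ⊛ s) ⊛ (x ⊛ s) ⊛ N ≔ x ⊛ x ⊛ x ⊛ (s ⊛ s ⊛ s ⊛ N)) refl
      tm≥1 : 1 ≤ t * m
      tm≥1 = ℕₚ.*-mono-≤ {1} {t} {1} {m} t≥1 m≥1
      big : 5 * K * (p * p * p) ≤ s * s * s * N
      big = cancel (t * m * (t * m) * (t * m)) (ℕₚ.*-mono-≤ {1} {t * m * (t * m)} (ℕₚ.*-mono-≤ {1} {t * m} tm≥1 tm≥1) tm≥1)
          (ℕₚ.≤-trans (ℕₚ.≤-reflexive (e₂ t m p K)) (ℕₚ.≤-trans (ℕₚ.*-monoˡ-≤ a h) (ℕₚ.≤-trans N⁷ (ℕₚ.≤-trans (ℕₚ.≤-reflexive (e₃ N))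
             (ℕₚ.≤-trans (ℕₚ.*-monoˡ-≤ N (ℕₚ.*-mono-≤ (ℕₚ.*-mono-≤ low low) low)) (ℕₚ.≤-reflexive (e₄ (t * m) s N)))))))

    cubic : K * (p * p) * L ≤ s * s * s
    cubic = cubic-from 64 (s≤s z≤n) s-lower c₁

    s≥-from : ∀ t → t * t * t ≤ K * (p * p) → t ≤ s
    s≥-from t h = cube-cancel {t} {s} (ℕₚ.≤-trans h (ℕₚ.≤-trans (ℕₚ.m≤m*n (K * (p * p)) L) cubic))

    s≥600 : 600 ≤ s
    s≥600 = s≥-from 600 p-large

    -- The largest w for which 8 |A| w is at most the bound 2 |A| s / 75 for Ω.
    w : ℕ
    w = s / 300

    300w≤s : 300 * w ≤ s
    300w≤s = ℕₚ.≤-trans (ℕₚ.≤-reflexive (ℕₚ.*-comm 300 w)) (m/n*n≤m s 300)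

    w≥1 : 1 ≤ w
    w≥1 = m≥n⇒m/n>0 (ℕₚ.≤-trans (ℕₚ.m≤m+n 300 300) s≥600)

    s≤600w : s ≤ 600 * w
    s≤600w = lin 0 (<div s 300 ⊞ 300 ⊠ w≥1) (eq 300 s w)
      where
      eq : ∀ t s w → s + (t + w * t + t * w) + 0 ≡ (t + t) * w + (s + t * 1)
      eq = solveℕ 3 (λ t s w → s ⊹ (t ⊹ w ⊛ t ⊹ t ⊛ w) ⊹ lit 0 ≔ (t ⊹ t) ⊛ w ⊹ (s ⊹ t ⊛ lit 1)) refl

    w≥2 : 2 ≤ w
    w≥2 = ℕₚ.≤-trans (ℕₚ.≤-reflexive (sym (m*n/n≡m 2 300))) (/-monoˡ-≤ 300 s≥600)

    w-cubic-from : ∀ t → 1 ≤ t → 2 * K ≡ t * t → s ≤ t * w → t * (p * p * L) ≤ 2 * (w * (s * s))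
    w-cubic-from t t≥1 K≡t s≤ = cancel t t≥1 (ℕₚ.≤-trans (ℕₚ.≤-reflexive (trans (e₁ t (p * p * L)) (trans (cong (_* (p * p * L)) (sym K≡t)) (e₂ K p L)))) (ℕₚ.≤-trans (2 ⊠ cubic) (ℕₚ.≤-trans (2 ⊠ ℕₚ.*-monoʳ-≤ (s * s) s≤) (ℕₚ.≤-reflexive (e₃ t s w)))))
      where
      e₁ : ∀ t x → t * (t * x) ≡ t * t * x
      e₁ = solveℕ 2 (λ t x → t ⊛ (t ⊛ x) ≔ t ⊛ t ⊛ x) refl
      e₂ : ∀ K p L → 2 * K * (p * p * L) ≡ 2 * (K * (p * p) * L)
      e₂ = solveℕ 3 (λ K p L → lit 2 ⊛ K ⊛ (p ⊛ p ⊛ L) ≔ lit 2 ⊛ (K ⊛ (p ⊛ p) ⊛ L)) refl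
      e₃ : ∀ t s w → 2 * (s * s * (t * w)) ≡ t * (2 * (w * (s * s)))
      e₃ = solveℕ 3 (λ t s w → lit 2 ⊛ (s ⊛ s ⊛ (t ⊛ w)) ≔ t ⊛ (lit 2 ⊛ (w ⊛ (s ⊛ s)))) refl

    w-cubic : 600 * (p * p * L) ≤ 2 * (w * (s * s))
    w-cubic = w-cubic-from 600 (s≤s z≤n) K≡ s≤600w

    instance
      75pL : NonZero (75 * (p * L))
      75pL = ℕ.>-nonZero (ℕₚ.*-mono-≤ {1} {75} (s≤s z≤n) (ℕₚ.*-mono-≤ p≥1 (s≤s {0} {p / N} z≤n)))

    -- The largest J with p J L ≤ 2 s²/75; the right side is a lower bound for Ω, so `far` applies.
    J : ℕ
    J = 2 * (s * s) / (75 * (p * L))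

    J-upper : J * (75 * (p * L)) ≤ 2 * (s * s)
    J-upper = m/n*n≤m (2 * (s * s)) (75 * (p * L))

    KpL≤s² : K * (p * L) ≤ s * s
    KpL≤s² = cancel p p≥1 (ℕₚ.≤-trans (ℕₚ.≤-reflexive (e K p L)) (ℕₚ.≤-trans cubic (ℕₚ.≤-trans (ℕₚ.*-monoʳ-≤ (s * s) s≤p) (ℕₚ.≤-reflexive (ℕₚ.*-comm (s * s) p)))))
      where
      e : ∀ K p L → p * (K * (p * L)) ≡ K * (p * p) * L
      e = solveℕ 3 (λ K p L → p ⊛ (K ⊛ (p ⊛ L)) ≔ K ⊛ (p ⊛ p) ⊛ L) refl

    div≥2 : ∀ y t .{{_ : NonZero t}} → 2 * t ≤ y → 2 ≤ y / t
    div≥2 y t h = ℕₚ.≤-trans (ℕₚ.≤-reflexive (sym (m*n/n≡m 2 t))) (/-monoˡ-≤ t h)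

    J≥2 : 2 ≤ J
    J≥2 = div≥2 (2 * (s * s)) (75 * (p * L)) (2 ⊠ ℕₚ.≤-trans (ℕₚ.*-monoˡ-≤ (p * L) K≥75) KpL≤s²)

    instance
      J-nz : NonZero J
      J-nz = ℕ.>-nonZero (ℕₚ.≤-trans (s≤s z≤n) J≥2)

    -- `far` yields ‖β a‖ J < p for the settled terms.
    X : ℕ
    X = p / J

    J≤p : J ≤ p
    J≤p = cancel (p * L) (ℕₚ.*-mono-≤ p≥1 (s≤s {0} {p / N} z≤n)) (cancel 2 (s≤s z≤n) (ℕₚ.≤-trans (ℕₚ.≤-trans (ℕₚ.m≤m+n _ (73 * (J * (p * L)))) (ℕₚ.≤-reflexive (e J (p * L))))
        (ℕₚ.≤-trans J-upper (2 ⊠ ℕₚ.≤-trans (ℕₚ.*-mono-≤ s≤p s≤p) (ℕₚ.≤-trans (ℕₚ.m≤m*n (p * p) L) (ℕₚ.≤-reflexive (e′ p L)))))))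
      where
      e : ∀ J x → 2 * (x * J) + 73 * (J * x) ≡ J * (75 * x)
      e = solveℕ 2 (λ J x → lit 2 ⊛ (x ⊛ J) ⊹ lit 73 ⊛ (J ⊛ x) ≔ J ⊛ (lit 75 ⊛ x)) refl
      e′ : ∀ p L → p * p * L ≡ p * L * p
      e′ = solveℕ 2 (λ p L → p ⊛ p ⊛ L ≔ p ⊛ L ⊛ p) refl

    X≥1 : 1 ≤ X
    X≥1 = m≥n⇒m/n>0 J≤p

    2X≤p : 2 * X ≤ p
    2X≤p = ℕₚ.≤-trans (ℕₚ.*-monoˡ-≤ X J≥2) (ℕₚ.≤-trans (ℕₚ.≤-reflexive (ℕₚ.*-comm J X)) (m/n*n≤m p J))

    s²≤ : s * s ≤ 75 * (J * (p * L))
    s²≤ = cancel 2 (s≤s z≤n) (lin 0 (<div (2 * (s * s)) (75 * (p * L)) ⊞ (75 * (p * L)) ⊠ ℕₚ.≤-trans (s≤s {0} z≤n) J≥2) (e 75 (s * s) J (p * L)))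
      where
      e : ∀ u t J x → 2 * t + (u * x + J * (u * x) + u * x * J) + 0 ≡ 2 * (u * (J * x)) + (2 * t + u * x * 1)
      e = solveℕ 4 (λ u t J x → lit 2 ⊛ t ⊹ (u ⊛ x ⊹ J ⊛ (u ⊛ x) ⊹ u ⊛ x ⊛ J) ⊹ lit 0 ≔ lit 2 ⊛ (u ⊛ (J ⊛ x)) ⊹ (lit 2 ⊛ t ⊹ u ⊛ x ⊛ lit 1)) refl

    -- N⁵ m X ≪ (pm)³ is squared and compared with N¹³ ≫ (pm)⁶. This inequality determines the
    -- exponent 6/13. The numerals are variables here and are inserted in `density`.
    density-from : ∀ t u q v → N * N ≤ t * m * s → s * s ≤ u * (J * (p * L)) → k ≡ t * t * (u * 5) → q * (v * (v * (k * k))) ≤ c * c → q * (v * (v * (m * X * (m * X)))) ≤ N * N * N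
    density-from t u q v low s²≤u k≡t h = cancel (N ^ 10) (ℕₚ.m^n>0 N 10) (ℕₚ.≤-trans (ℕₚ.≤-reflexive (trans (cong (_* (q * (v * (v * (m * X * (m * X)))))) (ℕₚ.^-distribˡ-+-* N 5 5)) (e₁ q v (N ^ 5) (m * X)))) (ℕₚ.≤-trans (q ⊠ (v ⊠ (v ⊠ ℕₚ.*-mono-≤ mX mX)))
         (ℕₚ.≤-trans (ℕₚ.≤-reflexive (e₂ q v k a)) (ℕₚ.≤-trans (ℕₚ.*-monoˡ-≤ (a * a) h) (ℕₚ.≤-trans (ℕₚ.≤-reflexive (cong (c * c *_) (sym a²))) (ℕₚ.≤-trans N¹³ (ℕₚ.≤-reflexive (trans (ℕₚ.^-distribˡ-+-* N 10 3) (cong (N ^ 10 *_) (e₃ N))))))))))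
      where
      e₁ : ∀ t u y z → y * y * (t * (u * (u * (z * z)))) ≡ t * (u * (u * (y * z * (y * z))))
      e₁ = solveℕ 4 (λ t u y z → y ⊛ y ⊛ (t ⊛ (u ⊛ (u ⊛ (z ⊛ z)))) ≔ t ⊛ (u ⊛ (u ⊛ (y ⊛ z ⊛ (y ⊛ z))))) refl
      e₂ : ∀ t u k a → t * (u * (u * (k * a * (k * a)))) ≡ t * (u * (u * (k * k))) * (a * a)
      e₂ = solveℕ 4 (λ t u k a → t ⊛ (u ⊛ (u ⊛ (k ⊛ a ⊛ (k ⊛ a)))) ≔ t ⊛ (u ⊛ (u ⊛ (k ⊛ k))) ⊛ (a ⊛ a)) refl
      e₃ : ∀ N → N * (N * (N * 1)) ≡ N * N * N
      e₃ = solveℕ 1 (λ N → N ⊛ (N ⊛ (N ⊛ lit 1)) ≔ N ⊛ N ⊛ N) refl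
      Xs² : X * (s * s) * N ≤ u * 5 * (p * p * p)
      Xs² = lin 0 ((X * N) ⊠ s²≤u ⊞ (u * (p * L) * N) ⊠ m/n*n≤m p J ⊞ (u * (p * p)) ⊠ LN≤5p) (e u X (s * s) N J p L)
        where
        e : ∀ u X t N J p L → X * t * N + (X * N * (u * (J * (p * L))) + u * (p * L) * N * p + u * (p * p) * (5 * p)) + 0 ≡ u * 5 * (p * p * p) + (X * N * t + u * (p * L) * N * (X * J) + u * (p * p) * (L * N))
        e = solveℕ 7 (λ u X t N J p L → X ⊛ t ⊛ N ⊹ (X ⊛ N ⊛ (u ⊛ (J ⊛ (p ⊛ L))) ⊹ u ⊛ (p ⊛ L) ⊛ N ⊛ p ⊹ u ⊛ (p ⊛ p) ⊛ (lit 5 ⊛ p)) ⊹ lit 0 ≔ u ⊛ lit 5 ⊛ (p ⊛ p ⊛ p) ⊹ (X ⊛ N ⊛ t ⊹ u ⊛ (p ⊛ L) ⊛ N ⊛ (X ⊛ J) ⊹ u ⊛ (p ⊛ p) ⊛ (L ⊛ N))) refl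
      mX : N ^ 5 * (m * X) ≤ k * a
      mX = ℕₚ.≤-trans (lin 0 ((N * (m * X)) ⊠ ℕₚ.*-mono-≤ low low ⊞ (t * t * (m * m * m)) ⊠ Xs²) (e t u N m X s p)) (ℕₚ.≤-reflexive (cong (_* a) (sym k≡t)))
        where
        e : ∀ t u N m X s p → N * (N * (N * (N * (N * 1)))) * (m * X) + (N * (m * X) * (t * m * s * (t * m * s)) + t * t * (m * m * m) * (u * 5 * (p * p * p))) + 0
              ≡ t * t * (u * 5) * (p * m * (p * m) * (p * m)) + (N * (m * X) * (N * N * (N * N)) + t * t * (m * m * m) * (X * (s * s) * N))
        e = solveℕ 7 (λ t u N m X s p → N ⊛ (N ⊛ (N ⊛ (N ⊛ (N ⊛ lit 1)))) ⊛ (m ⊛ X) ⊹ (N ⊛ (m ⊛ X) ⊛ (t ⊛ m ⊛ s ⊛ (t ⊛ m ⊛ s)) ⊹ t ⊛ t ⊛ (m ⊛ m ⊛ m) ⊛ (u ⊛ lit 5 ⊛ (p ⊛ p ⊛ p))) ⊹ lit 0 ≔ t ⊛ t ⊛ (u ⊛ lit 5) ⊛ (p ⊛ m ⊛ (p ⊛ m) ⊛ (p ⊛ m)) ⊹ (N ⊛ (m ⊛ X) ⊛ (N ⊛ N ⊛ (N ⊛ N)) ⊹ t ⊛ t ⊛ (m ⊛ m ⊛ m) ⊛ (X ⊛ (s ⊛ s) ⊛ N))) refl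

    density : 64 * (17 * (17 * (m * X * (m * X)))) ≤ N * N * N
    density = density-from 64 75 64 17 s-lower s²≤ k≡ c₂

-- A dilation making all settled terms small

module Dilations where

  open import Data.Integer using (_+_; _-_; _*_; -_; _≤_)
  open ℤₚ using (≤-trans; ≤-refl; ≤-reflexive)
  open IntegerSums
  open NearestMultiple
  open Translates
  open FourfoldOscillation
  open Rectification

  -- 75 = 3 · 5² comes from `osc-lower` with n ≤ 5 g. Since s₂ and s₃ are at least s, 2 s₂ s₃ ≥ s
  -- (s₂ + s₃), which removes the factor s₂ + s₃.
  Ω-lower : ∀ g n s s₁ s₂ s₃ Ω → 1ℤ ≤ g → 0ℤ ≤ n → n ≤ + 5 * g → 1ℤ ≤ s → s ≤ s₁ → s ≤ s₂ → s ≤ s₃ → 0ℤ ≤ Ω →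
            + 4 * (g * g) * (s₁ * (s₂ * s₃)) ≤ + 3 * Ω * (n * n) * (s₂ + s₃) → + 2 * (s₁ * s) ≤ + 75 * Ω
  Ω-lower g n s s₁ s₂ s₃ Ω g≥1 n≥0 n≤ s≥1 h₁ h₂ h₃ Ω≥0 h = *-cancel-≤ {(g * g) * (s₂ + s₃)} c≥1
      (≤-by _ (sub≥0 h ⊕ ((((pos {3} ⊗ Ω≥0) ⊗ (s₂≥0 ⊕ s₃≥0)) ⊗ (sub≥0 n≤ ⊗ (n≥0 ⊕ (pos {5} ⊗ g≥0))))
                       ⊕ ((pos {2} ⊗ (sq≥0 g)) ⊗ (s₁≥0 ⊗ ((sub≥0 h₂ ⊗ s₃≥0) ⊕ (sub≥0 h₃ ⊗ s₂≥0)))))) (eq g n s s₁ s₂ s₃ Ω))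
    where
    one : ∀ {x} → 1ℤ ≤ x → 0ℤ ≤ x
    one = ≤-trans (+≤+ z≤n)
    g≥0 = one g≥1
    s≥0 = one s≥1
    s₁≥0 = ≤-trans s≥0 h₁
    s₂≥0 = ≤-trans s≥0 h₂
    s₃≥0 = ≤-trans s≥0 h₃
    c≥1 : 1ℤ ≤ (g * g) * (s₂ + s₃)
    c≥1 = ≤-by _ (((sub≥0 g≥1 ⊗ (g≥0 ⊕ pos {1})) ⊗ (s₂≥0 ⊕ s₃≥0)) ⊕ (sub≥0 (≤-trans s≥1 h₂) ⊕ s₃≥0)) (e g s₂ s₃)
      where
      e : ∀ g b c → g * g * (b + c) - 1ℤ ≡ ((g - 1ℤ) * (g + 1ℤ)) * (b + c) + ((b - 1ℤ) + c)
      e = solve 3 (λ g b c → g :* g :* (b :+ c) :- con 1ℤ := ((g :- con 1ℤ) :* (g :+ con 1ℤ)) :* (b :+ c) :+ ((b :- con 1ℤ) :+ c)) refl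
    eq : ∀ g n s s₁ s₂ s₃ Ω → (g * g) * (s₂ + s₃) * (+ 75 * Ω) - (g * g) * (s₂ + s₃) * (+ 2 * (s₁ * s))
         ≡ (+ 3 * Ω * (n * n) * (s₂ + s₃) - + 4 * (g * g) * (s₁ * (s₂ * s₃)))
           + (((+ 3 * Ω) * (s₂ + s₃)) * ((+ 5 * g - n) * (n + + 5 * g)) + (+ 2 * (g * g)) * (s₁ * ((s₂ - s) * s₃ + (s₃ - s) * s₂)))
    eq = solve 7 (λ g n s s₁ s₂ s₃ Ω → (g :* g) :* (s₂ :+ s₃) :* (con (+ 75) :* Ω) :- (g :* g) :* (s₂ :+ s₃) :* (con (+ 2) :* (s₁ :* s)) := (con (+ 3) :* Ω :* (n :* n) :* (s₂ :+ s₃) :- con (+ 4) :* (g :* g) :* (s₁ :* (s₂ :* s₃))) :+ (((con (+ 3) :* Ω) :* (s₂ :+ s₃)) :* ((con (+ 5) :* g :- n) :* (n :+ con (+ 5) :* g)) :+ (con (+ 2) :* (g :* g)) :* (s₁ :* ((s₂ :- s) :* s₃ :+ (s₃ :- s) :* s₂)))) refl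

  module Dilation (p : ℕ) .{{nz : NonZero p}} (inv : ∀ x → ¬ (+ p ∣ᶻ x) → ∃[ x⁻ ] (+ p ∣ᶻ (x * x⁻ - 1ℤ)))
      (A V W : Growth.Sub p) (w₀ : ℤ)
      (nosol : ∀ x y z → Growth.Sub.χ A x ≡ 1ℤ → Growth.Sub.χ V y ≡ 1ℤ → Growth.Sub.χ W z ≡ 1ℤ → ¬ (+ p ∣ᶻ (x + y + z + w₀)))
      (g s w L J : ℕ) (4g≤p : + 4 * + g ≤ + p) (p≤5g : + p ≤ + 5 * + g) (g≥1 : 1ℤ ≤ + g) (p≥2 : 2 ℕ.≤ p)
      (s≥1 : 1ℤ ≤ + s) (sA : + s ≤ Growth.Sub.size A) (sV : + s ≤ Growth.Sub.size V) (sW : + s ≤ Growth.Sub.size W)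
      (w≥1 : 1 ℕ.≤ w) (w≤p : w ℕ.≤ p) (Q<p : suc (p / suc (w ℕ.∸ 1)) ℕ.< p)
      (75w : + 75 * (+ 4 * + w) ≤ + s) (w-cubic : + 8 * (+ 75 * (+ p * + p * + L)) ≤ + 2 * (+ w * (+ s * + s)))
      (J-upper : + 75 * (+ p * + J * + L) ≤ + 2 * (+ s * + s)) where
    open Mod p
    open Tri p
    open Growth p
    open Rectify p inv A using (Peak; peak; conv; module Use)

    open Peak (peak p≥2)

    private
      s₁ : ℤ
      s₁ = Sub.size A
      s₁≥1 : 1ℤ ≤ s₁
      s₁≥1 = ≤-trans s≥1 sA
      s≥0 : 0ℤ ≤ + s
      s≥0 = pos

    Ω≥0 : 0ℤ ≤ Ω
    Ω≥0 = ≤-trans (≤-reflexive (eq (conv b t₀))) (osc b b≢0 t₀ t₀)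
      where
      eq : ∀ x → 0ℤ ≡ x - x
      eq = solve 1 (λ x → con 0ℤ := x :- x) refl

    Ω-large : + 2 * (s₁ * + s) ≤ + 75 * Ω
    Ω-large = Ω-lower (+ g) N (+ s) s₁ (Sub.size V) (Sub.size W) Ω g≥1 pos p≤5g s≥1 sA sV sW Ω≥0
       (Oscillation.Main.osc-lower p inv g 4g≤p A V W w₀ nosol Ω osc Ω≥0 g≥1)

    private
      absorb : ∀ {x} → + 75 * x ≤ + 2 * (s₁ * + s) → x ≤ Ω
      absorb h = *-cancel-≤ {+ 75} (+≤+ (s≤s z≤n)) (≤-trans h Ω-large)

      Ω≥1 : 1ℤ ≤ Ω
      Ω≥1 = go (≤-or Ω 0ℤ)
        where
        go : Ω ≤ 0ℤ ⊎ 1ℤ + 0ℤ ≤ Ω → 1ℤ ≤ Ω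
        go (inj₂ h) = h
        go (inj₁ h) = ⊥-elim (≤-absurd {1ℤ} {0ℤ} (≤-by _ (sub≥0 Ω-large ⊕ ((pos {75} ⊗ sub≥0 h) ⊕ ((pos {2} ⊗ (sub≥0 s₁≥1 ⊗ s≥0)) ⊕ ((pos {2} ⊗ sub≥0 s≥1) ⊕ pos {1})))) (eq s₁ (+ s) Ω)) ≤-refl)
          where
          eq : ∀ a s o → 0ℤ - 1ℤ ≡ (+ 75 * o - + 2 * (a * s)) + (+ 75 * (0ℤ - o) + (+ 2 * ((a - 1ℤ) * s) + (+ 2 * (s - 1ℤ) + 1ℤ)))
          eq = solve 3 (λ a s o → con 0ℤ :- con 1ℤ := (con (+ 75) :* o :- con (+ 2) :* (a :* s)) :+ (con (+ 75) :* (con 0ℤ :- o) :+ (con (+ 2) :* ((a :- con 1ℤ) :* s) :+ (con (+ 2) :* (s :- con 1ℤ) :+ con 1ℤ)))) refl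

      8sw : + 8 * (s₁ * + w) ≤ Ω
      8sw = absorb (≤-by _ ((pos {2} ⊗ ≤-trans (+≤+ z≤n) s₁≥1) ⊗ sub≥0 75w) (eq s₁ (+ s) (+ w)))
        where
        eq : ∀ a s w → + 2 * (a * s) - + 75 * (+ 8 * (a * w)) ≡ (+ 2 * a) * (s - + 75 * (+ 4 * w))
        eq = solve 3 (λ a s w → con (+ 2) :* (a :* s) :- con (+ 75) :* (con (+ 8) :* (a :* w)) := (con (+ 2) :* a) :* (s :- con (+ 75) :* (con (+ 4) :* w))) refl

    open Use (peak p≥2) Ω≥1 w w≥1 w≤p Q<p 8sw

    -- `near` gives the coarse bound w, which `far` takes as its hypothesis.
    dilate : ∃[ β ] (¬ (N ∣ᶻ β) × (∀ a → Sub.lam A a ≤ + L → 1ℤ + tri (β * a) * + J ≤ N))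
    dilate = b , b≢0 , λ a h → far a L J h J-small (near a (≤-trans (≤-by _ (pos {8} ⊗ (pos {p} ⊗ (pos {p} ⊗ sub≥0 h))) (e₁ N (Sub.lam A a) (+ L))) w-small))
      where
      e₁ : ∀ n l L → + 8 * (n * (n * L)) - + 8 * (n * (n * l)) ≡ + 8 * (n * (n * (L - l)))
      e₁ = solve 3 (λ n l L → con (+ 8) :* (n :* (n :* L)) :- con (+ 8) :* (n :* (n :* l)) := con (+ 8) :* (n :* (n :* (L :- l)))) refl
      J-small : N * (+ J * + L) ≤ Ω
      J-small = absorb (≤-by _ (sub≥0 J-upper ⊕ (pos {2} ⊗ (sub≥0 sA ⊗ s≥0))) (eq N (+ J) (+ L) (+ s) s₁))
        where
        eq : ∀ n J L s a → + 2 * (a * s) - + 75 * (n * (J * L)) ≡ (+ 2 * (s * s) - + 75 * (n * J * L)) + + 2 * ((a - s) * s)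
        eq = solve 5 (λ n J L s a → con (+ 2) :* (a :* s) :- con (+ 75) :* (n :* (J :* L)) := (con (+ 2) :* (s :* s) :- con (+ 75) :* (n :* J :* L)) :+ con (+ 2) :* ((a :- s) :* s)) refl
      w-small : + 8 * (N * (N * + L)) ≤ + w * Ω
      w-small = *-cancel-≤ {+ 75} (+≤+ (s≤s z≤n)) (≤-by _ (sub≥0 w-cubic ⊕ (pos {w} ⊗ (sub≥0 Ω-large ⊕ (pos {2} ⊗ (sub≥0 sA ⊗ s≥0))))) (eq N (+ L) (+ s) s₁ Ω (+ w)))
        where
        eq : ∀ n L s a o w → + 75 * (w * o) - + 75 * (+ 8 * (n * (n * L)))
             ≡ (+ 2 * (w * (s * s)) - + 8 * (+ 75 * (n * n * L))) + w * ((+ 75 * o - + 2 * (a * s)) + + 2 * ((a - s) * s))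
        eq = solve 6 (λ n L s a o w → con (+ 75) :* (w :* o) :- con (+ 75) :* (con (+ 8) :* (n :* (n :* L))) := (con (+ 2) :* (w :* (s :* s)) :- con (+ 8) :* (con (+ 75) :* (n :* n :* L))) :+ w :* ((con (+ 75) :* o :- con (+ 2) :* (a :* s)) :+ con (+ 2) :* ((a :- s) :* s))) refl

-- From integer representatives back to residues

module Dilates where

  open import Data.Integer using (_+_; _-_; _*_; -_; _≤_)
  open ℤₚ using (≤-trans; ≤-refl; ≤-reflexive)
  open IntegerSums
  open NearestMultiple
  open Translates
  open Rectification
  open Progressions
  open Intervals
  open DivisorFree
  open CommonDivisors
  open SubsetSums

  Concentrated : (p : ℕ) .{{_ : NonZero p}} → ℕ → List (Fin p) → Set
  Concentrated p K A = ∃[ b ] (1 ℕ.≤ b × b ℕ.< p × ∃[ A♭ ] ∃[ R ] (A ↭ A♭ ++ R × length A♭ ℕ.≤ K × scaledSum p b R ℕ.< p))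

  module Dilated (p : ℕ) .{{nz : NonZero p}} (inv : ∀ x → ¬ (+ p ∣ᶻ x) → ∃[ x⁻ ] (+ p ∣ᶻ (x * x⁻ - 1ℤ))) where
    open Mod p
    open Tri p

    div-cancel : ∀ {c} x → ¬ (N ∣ᶻ c) → N ∣ᶻ (c * x) → N ∣ᶻ x
    div-cancel {c} x c≢0 d = go (inv c c≢0)
      where
      eq : ∀ c c⁻ x → c⁻ * (c * x) - x * (c * c⁻ - 1ℤ) ≡ x
      eq = solve 3 (λ c c⁻ x → c⁻ :* (c :* x) :- x :* (c :* c⁻ :- con 1ℤ) := x) refl
      go : ∃[ c⁻ ] (N ∣ᶻ (c * c⁻ - 1ℤ)) → N ∣ᶻ x
      go (c⁻ , e) = subst (N ∣ᶻ_) (eq c c⁻ x) (∣m∣n⇒∣m-n (∣n⇒∣m*n c⁻ d) (∣n⇒∣m*n x e))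

    -- The residue is the least natural number in its class.
    %-least : ∀ a n → N ∣ᶻ (+ a - + n) → a % p ℕ.≤ n
    %-least a n d = ℕₚ.≤-trans (ℕₚ.≤-reflexive (residue-≡ p (a % p) (n % p) (m%n<n a p) (m%n<n n p) (subst (N ∣ᶻ_) (sym (eq (+ a) (+ n) (+ (a % p)) (+ (n % p)) (+ (a / p)) (+ (n / p)) N (euclid a) (euclid n)))
         (∣m∣n⇒∣m+n d (∣n⇒∣m*n (+ (n / p) - + (a / p)) (divides 1ℤ (sym (ℤₚ.*-identityˡ N)))))))) (m%n≤m n p)
      where
      euclid : ∀ a → + a ≡ + (a % p) + + (a / p) * N
      euclid a = trans (cong +_ (m≡m%n+[m/n]*n a p)) (trans (ℤₚ.pos-+ (a % p) (a / p ℕ.* p)) (cong (_+_ (+ (a % p))) (ℤₚ.pos-* (a / p) p)))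
      eq : ∀ a n a′ n′ q r N → a ≡ a′ + q * N → n ≡ n′ + r * N → a′ - n′ ≡ a - n + (r - q) * N
      eq a n a′ n′ q r N refl refl = alg a′ n′ q r N
        where
        alg : ∀ a n q r N → a - n ≡ a + q * N - (n + r * N) + (r - q) * N
        alg = solve 5 (λ a n q r N → a :- n := a :+ q :* N :- (n :+ r :* N) :+ (r :- q) :* N) refl

    module Scaled (β : ℤ) (β≢0 : ¬ (N ∣ᶻ β)) where

      shift-k : Fin p → ℤ
      shift-k a = proj₁ (tri-wit (β * val a))

      -- A representative of β a of least absolute value, so that |v a| = ‖β a‖.
      v : Fin p → ℤ
      v a = β * val a - shift-k a * N

      v-tri : ∀ a → tri (β * val a) ≡ abs (v a)
      v-tri a = proj₂ (tri-wit (β * val a))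

      v-cong : ∀ a → N ∣ᶻ (β * val a - v a)
      v-cong a = divides (shift-k a) (eq (β * val a) (shift-k a * N))
        where
        eq : ∀ x y → x - (x - y) ≡ y
        eq = solve 2 (λ x y → x :- (x :- y) := y) refl

      sumv-cong-v : ∀ C → N ∣ᶻ (β * sumv val C - sumv v C)
      sumv-cong-v [] = divides 0ℤ (trans (eq β) (sym (ℤₚ.*-zeroˡ N)))
        where
        eq : ∀ β → β * 0ℤ - 0ℤ ≡ 0ℤ
        eq = solve 1 (λ β → β :* con 0ℤ :- con 0ℤ := con 0ℤ) refl
      sumv-cong-v (a ∷ C) = subst (N ∣ᶻ_) (eq β (val a) (v a) (sumv val C) (sumv v C)) (∣m∣n⇒∣m+n (v-cong a) (sumv-cong-v C))
        where
        eq : ∀ β a v A V → (β * a - v) + (β * A - V) ≡ β * (a + A) - (v + V)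
        eq = solve 5 (λ β a v A V → (β :* a :- v) :+ (β :* A :- V) := β :* (a :+ A) :- (v :+ V)) refl

      div-v : ∀ C → N ∣ᶻ sumv v C → N ∣ᶻ sumv val C
      div-v C d = div-cancel (sumv val C) β≢0 (subst (N ∣ᶻ_) (eq (β * sumv val C) (sumv v C)) (∣m∣n⇒∣m+n (sumv-cong-v C) d))
        where
        eq : ∀ x y → x - y + y ≡ x
        eq = solve 2 (λ x y → x :- y :+ y := x) refl

      zsf-v : ∀ {T} → ZSF val p T → ZSF v p T
      zsf-v z C C′ e d = z C C′ e (div-v C d)

      v-injective : ∀ a b → v a ≡ v b → a ≡ b
      v-injective a b e = Finₚ.toℕ-injective (residue-≡ p (toℕ a) (toℕ b) (Finₚ.toℕ<n a) (Finₚ.toℕ<n b) (div-cancel (val a - val b) β≢0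
          (subst (N ∣ᶻ_) (trans (cong (λ z → β * val a - z - (β * val b - v b)) e) (eq β (val a) (val b) (v b))) (∣m∣n⇒∣m-n (v-cong a) (v-cong b)))))
        where
        eq : ∀ β a b v → β * a - v - (β * b - v) ≡ β * (a - b)
        eq = solve 4 (λ β a b v → β :* a :- v :- (β :* b :- v) := β :* (a :- b)) refl

      -- β is invertible, so v is injective and equal values come from equal residues.
      mult-v : ∀ {m T} → (∀ a → mult a T ℕ.≤ m) → Mult v m T
      mult-v h z [] zs e same = z≤n
      mult-v {m} {T} h z (y ∷ ys) zs e (ey ∷ same) = ℕₚ.≤-trans (ℕₚ.≤-reflexive (sym (mult-all y (y ∷ ys) (refl ∷ All.map (λ {x} ex → v-injective y x (trans ey (sym ex))) same))))
        (ℕₚ.≤-trans (ℕₚ.m≤m+n (mult y (y ∷ ys)) (mult y zs)) (ℕₚ.≤-trans (ℕₚ.≤-reflexive (sym (trans (mult-↭ y e) (mult-++ y (y ∷ ys) zs)))) (h y)))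

      abs-∣∣ : ∀ x → abs x ≡ + ∣ x ∣
      abs-∣∣ x = go (abs-cases x)
        where
        go : (0ℤ ≤ x × abs x ≡ x) ⊎ (0ℤ ≤ - x × abs x ≡ - x) → abs x ≡ + ∣ x ∣
        go (inj₁ (h , e)) = trans e (sym (ℤₚ.0≤i⇒+∣i∣≡i h))
        go (inj₂ (h , e)) = trans e (trans (sym (ℤₚ.0≤i⇒+∣i∣≡i h)) (cong +_ (ℤₚ.∣-i∣≡∣i∣ x)))

      nz-v : ∀ J .{{_ : NonZero J}} a → ¬ (N ∣ᶻ val a) → 1ℤ + tri (β * val a) * + J ≤ N → NZ v (p / J) a
      nz-v J a a≢0 h = positive ∣ v a ∣ refl , bound
        where
        positive : ∀ k → ∣ v a ∣ ≡ k → 1 ℕ.≤ ∣ v a ∣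
        positive zero e = ⊥-elim (a≢0 (div-cancel (val a) β≢0 (subst (N ∣ᶻ_) (trans (cong (λ z → β * val a - z) (ℤₚ.∣i∣≡0⇒i≡0 e)) (ℤₚ.+-identityʳ (β * val a))) (v-cong a))))
        positive (suc k) e = subst (1 ℕ.≤_) (sym e) (s≤s z≤n)
        nat : ∣ v a ∣ ℕ.* J ℕ.≤ p
        nat = +≤+⁻ (≤-trans (≤-reflexive (trans (ℤₚ.pos-* ∣ v a ∣ J) (cong (_* + J) (sym (trans (v-tri a) (abs-∣∣ (v a))))))) (≤-trans (ℤₚ.i≤suc[i] (tri (β * val a) * + J)) h))
        bound : ∣ v a ∣ ℕ.≤ p / J
        bound = ℕₚ.≤-trans (ℕₚ.≤-reflexive (sym (m*n/n≡m ∣ v a ∣ J))) (/-monoˡ-≤ J nat)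

      module Divided (g : ℤ) (g≥1 : 1 ℕ.≤ ∣ g ∣) (g<p : ∣ g ∣ ℕ.< p) where

        g≢0 : ¬ (N ∣ᶻ g)
        g≢0 d = go ∣ g ∣ refl g≥1
          where
          go : ∀ k → ∣ g ∣ ≡ k → 1 ℕ.≤ k → ⊥
          go (suc k) e _ = small-∤ {k} (subst (ℕ._< p) e g<p) (subst (λ z → N ∣ᶻ + z) e (∣ᵤ⇒∣ (∣⇒∣ᵤ d)))

        g⁻ : ℤ
        g⁻ = proj₁ (inv g g≢0)

        gg⁻ : N ∣ᶻ (g * g⁻ - 1ℤ)
        gg⁻ = proj₂ (inv g g≢0)

        -- β a ≡ v a = g w with g invertible, so the dilation by β/g sends a to the class of the
        -- small integer w.
        b′ : ℕ
        b′ = rep (β * g⁻)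

        b′-cong : N ∣ᶻ (+ b′ - β * g⁻)
        b′-cong = divides (- quo (β * g⁻)) (trans (cong (λ z → + b′ - z) (rep-≡ (β * g⁻))) (eq (+ b′) (quo (β * g⁻)) N))
          where
          eq : ∀ b q n → b - (b + q * n) ≡ - q * n
          eq = solve 3 (λ b q n → b :- (b :+ q :* n) := :- q :* n) refl

        b′≥1 : 1 ℕ.≤ b′
        b′≥1 = go b′ refl
          where
          eq : ∀ β g g⁻ → β * (g * g⁻ - 1ℤ) + g * (0ℤ - β * g⁻) ≡ (- 1ℤ) * β
          eq = solve 3 (λ β g g⁻ → β :* (g :* g⁻ :- con 1ℤ) :+ g :* (con 0ℤ :- β :* g⁻) := (:- con 1ℤ) :* β) refl
          eq′ : ∀ β → - 1ℤ * (- 1ℤ * β) ≡ β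
          eq′ = solve 1 (λ β → :- con 1ℤ :* (:- con 1ℤ :* β) := β) refl
          go : ∀ k → b′ ≡ k → 1 ℕ.≤ b′
          go (suc k) e = subst (1 ℕ.≤_) (sym e) (s≤s z≤n)
          go zero e = ⊥-elim (β≢0 (subst (N ∣ᶻ_) (trans (cong (_*_ (- 1ℤ)) (eq β g g⁻)) (eq′ β)) (∣n⇒∣m*n (- 1ℤ) (∣m∣n⇒∣m+n (∣n⇒∣m*n β gg⁻) (∣n⇒∣m*n g (subst (λ z → N ∣ᶻ (+ z - β * g⁻)) e b′-cong))))))

        residue : ∀ a w → v a ≡ g * w → N ∣ᶻ (+ b′ * val a - w)
        residue a w e = subst (N ∣ᶻ_) (eq β g g⁻ (+ b′) (val a) w) (∣m∣n⇒∣m+n (∣n⇒∣m*n (val a) b′-cong) (∣m∣n⇒∣m+n (∣n⇒∣m*n g⁻ (subst (λ z → N ∣ᶻ (β * val a - z)) e (v-cong a))) (∣n⇒∣m*n w gg⁻)))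
          where
          eq : ∀ β g g⁻ b a w → a * (b - β * g⁻) + (g⁻ * (β * a - g * w) + w * (g * g⁻ - 1ℤ)) ≡ b * a - w
          eq = solve 6 (λ β g g⁻ b a w → a :* (b :- β :* g⁻) :+ (g⁻ :* (β :* a :- g :* w) :+ w :* (g :* g⁻ :- con 1ℤ)) := b :* a :- w) refl

        -- Each residue is at most the nonnegative w x congruent to it.
        scaled≤ : ∀ w R → All (λ x → v x ≡ g * w x × 0ℤ ≤ w x) R → + scaledSum p b′ R ≤ sumv w R
        scaled≤ w [] [] = ≤-refl
        scaled≤ w (x ∷ R) ((e , h) ∷ hs) = ≤-trans (≤-reflexive (ℤₚ.pos-+ ((b′ ℕ.* toℕ x) % p) (scaledSum p b′ R))) (ℤₚ.+-mono-≤ (go (≥0⇒pos h)) (scaled≤ w R hs))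
          where
          go : ∃[ n ] (w x ≡ + n) → + ((b′ ℕ.* toℕ x) % p) ≤ w x
          go (n , en) = ≤-trans (+≤+ (%-least (b′ ℕ.* toℕ x) n (subst (N ∣ᶻ_) (cong₂ (λ y z → y - z) (sym (ℤₚ.pos-* b′ (toℕ x))) en) (residue x (w x) e)))) (≤-reflexive (sym en))

      concentrate : ∀ X K T → 2 ℕ.* X ℕ.≤ p → 1 ℕ.≤ X → Out v p X K T → Concentrated p K T
      concentrate X K T 2X≤p X≥1 o = b′ , b′≥1 , rep< (β * g⁻) , J , R , perm , short , +≤+⁻ (≤-trans (≤-reflexive (ℤₚ.pos-+ 1 (scaledSum p b′ R))) (≤-trans (ℤₚ.+-monoʳ-≤ 1ℤ (scaled≤ w R scaled)) total))
        where
        open Out o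
        open Divided g g≥1 (ℕₚ.<-≤-trans (s≤s g≤X) (ℕₚ.≤-trans (ℕₚ.+-mono-≤ X≥1 (ℕₚ.m≤m+n X 0)) 2X≤p))

-- Sequences with at least 8 N terms

module LongSequences where

  open import Data.Integer using (_+_; _-_; _*_; -_; _≤_)
  open ℤₚ using (≤-trans; ≤-refl; ≤-reflexive)
  open IntegerSums
  open NearestMultiple
  open Translates
  open Rectification
  open Progressions
  open LinearArithmetic using (lin; _⊞_; _⊠_)
  open Intervals
  open DivisorFree
  open CommonDivisors
  open SubsetSums
  open Parameters
  open Dilations
  open Dilates

  regroup : ∀ t a b x y → t ≡ a ℕ.* b → t ℕ.* x ℕ.≤ y → a ℕ.* (b ℕ.* x) ℕ.≤ y
  regroup t a b x y e h = ℕₚ.≤-trans (ℕₚ.≤-reflexive (trans (sym (ℕₚ.*-assoc a b x)) (cong (ℕ._* x) (sym e)))) h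

  pos-*₃ : ∀ a b c → + (a ℕ.* b ℕ.* c) ≡ + a * + b * + c
  pos-*₃ a b c = trans (ℤₚ.pos-* (a ℕ.* b) c) (cong (_* + c) (ℤₚ.pos-* a b))

  pos-*ʳ : ∀ a {b z} → + b ≡ z → + (a ℕ.* b) ≡ + a * z
  pos-*ʳ a {b} e = trans (ℤₚ.pos-* a b) (cong (_*_ (+ a)) e)

  lift-≤ : ∀ {a b x y} → + a ≡ x → + b ≡ y → a ℕ.≤ b → x ≤ y
  lift-≤ e f h = subst₂ _≤_ e f (+≤+ h)

  rest : ∀ {E : Set} {T : List E} D T′ d k → T ↭ D ++ T′ → length D ℕ.≤ d → d ℕ.+ k ℕ.≤ length T → k ℕ.≤ length T′
  rest D T′ d k e h l = ℕₚ.+-cancelˡ-≤ d k (length T′) (ℕₚ.≤-trans l (ℕₚ.≤-trans (ℕₚ.≤-reflexive (trans (↭-length e) (Listₚ.length-++ D))) (ℕₚ.+-monoˡ-≤ (length T′) h)))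

  -- Here n is the N of the overview.
  module Long (p m n c K k : ℕ) .{{nz : NonZero p}} (inv : ∀ x → ¬ (+ p ∣ᶻ x) → ∃[ x⁻ ] (+ p ∣ᶻ (x * x⁻ - 1ℤ)))
              (p≥16 : 16 ℕ.≤ p) (p≥1 : 1 ℕ.≤ p) (m≥1 : 1 ℕ.≤ m) (n≥1 : 1 ℕ.≤ n) (m≤p : m ℕ.≤ p) (n² : n ℕ.* n ℕ.≤ 16 ℕ.* (p ℕ.* m))
              (n¹³ : c ℕ.* c ℕ.* ((p ℕ.* m) ℕ.^ 6) ℕ.≤ n ℕ.^ 13)
              (c₁ : 64 ℕ.* 64 ℕ.* 64 ℕ.* (5 ℕ.* K) ℕ.≤ c) (c₂ : 64 ℕ.* (17 ℕ.* (17 ℕ.* (k ℕ.* k))) ℕ.≤ c ℕ.* c) (c₃ : 32 ℕ.* 32 ℕ.* 32 ℕ.* 32 ℕ.< c)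
              (k≡ : k ≡ 64 ℕ.* 64 ℕ.* (75 ℕ.* 5)) (K≡ : 2 ℕ.* K ≡ 600 ℕ.* 600) (K≥75 : 75 ℕ.≤ K) (p-large : 600 ℕ.* 600 ℕ.* 600 ℕ.≤ K ℕ.* (p ℕ.* p)) where

    open Mod p
    open Tri p using (tri)
    open Growth p
    open Sumsets p inv
    open Dilated p inv
    module Sc = Scales p m n c K k p≥1 m≥1 n≥1 m≤p n² n¹³ c₁ c₂ c₃ k≡ K≡ K≥75 p-large
    open Sc using (s; L; w; J; X)

    instance
      J-nz : NonZero J
      J-nz = ℕ.>-nonZero (ℕₚ.≤-trans (s≤s z≤n) Sc.J≥2)

    -- 4 g ≤ p puts the window of `D` on the rising slope of the wave; p ≤ 5 g, which uses p ≥ 16,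
    -- enters the constant 75.
    g : ℕ
    g = p / 4

    g≥4 : 4 ℕ.≤ g
    g≥4 = /-monoˡ-≤ 4 p≥16

    4g≤p : + 4 * + g ≤ N
    4g≤p = lift-≤ (ℤₚ.pos-* 4 g) refl (ℕₚ.≤-trans (ℕₚ.≤-reflexive (ℕₚ.*-comm 4 g)) (m/n*n≤m p 4))

    p≤5g : N ≤ + 5 * + g
    p≤5g = lift-≤ refl (ℤₚ.pos-* 5 g) (ℕₚ.≤-trans (ℕₚ.≤-reflexive (m≡m%n+[m/n]*n p 4)) (ℕₚ.≤-trans (ℕₚ.+-monoˡ-≤ (g ℕ.* 4) (ℕₚ.≤-trans (ℕₚ.<⇒≤ (m%n<n p 4)) g≥4)) (ℕₚ.≤-reflexive (eq g))))
      where
      eq : ∀ g → g ℕ.+ g ℕ.* 4 ≡ 5 ℕ.* g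
      eq = solveℕ 1 (λ g → g ⊹ g ⊛ lit 4 ≔ lit 5 ⊛ g) refl

    Q<p : suc (p / suc (w ℕ.∸ 1)) ℕ.< p
    Q<p = ℕₚ.≤-trans (s≤s (s≤s (/-monoʳ-≤ p (ℕₚ.≤-trans Sc.w≥2 (ℕₚ.m≤n+m∸n w 1)))))
            (ℕₚ.≤-trans (ℕₚ.+-monoˡ-≤ (p / 2) p/2≥2) (ℕₚ.≤-trans (ℕₚ.≤-reflexive (eq (p / 2))) (m/n*n≤m p 2)))
      where
      p≥4 : 4 ℕ.≤ p
      p≥4 = ℕₚ.≤-trans (s≤s (s≤s (s≤s (s≤s z≤n)))) p≥16
      p/2≥2 : 2 ℕ.≤ p / 2
      p/2≥2 = /-monoˡ-≤ 2 p≥4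
      eq : ∀ q → q ℕ.+ q ≡ q ℕ.* 2
      eq = solveℕ 1 (λ q → q ⊹ q ≔ q ⊛ lit 2) refl

    w≤p : w ℕ.≤ p
    w≤p = ℕₚ.≤-trans (ℕₚ.m≤n*m w 300) (ℕₚ.≤-trans Sc.300w≤s Sc.s≤p)

    75w : + 75 * (+ 4 * + w) ≤ + s
    75w = lift-≤ (pos-*ʳ 75 (ℤₚ.pos-* 4 w)) refl (regroup 300 75 4 w s refl Sc.300w≤s)

    w-cubic : + 8 * (+ 75 * (N * N * + L)) ≤ + 2 * (+ w * (+ s * + s))
    w-cubic = lift-≤ (pos-*ʳ 8 (pos-*ʳ 75 (pos-*₃ p p L))) (pos-*ʳ 2 (pos-*ʳ w (ℤₚ.pos-* s s))) (regroup 600 8 75 (p ℕ.* p ℕ.* L) (2 ℕ.* (w ℕ.* (s ℕ.* s))) refl Sc.w-cubic)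

    J-upper : + 75 * (N * + J * + L) ≤ + 2 * (+ s * + s)
    J-upper = lift-≤ (pos-*ʳ 75 (pos-*₃ p J L)) (pos-*ʳ 2 (ℤₚ.pos-* s s)) (ℕₚ.≤-trans (ℕₚ.≤-reflexive (eq 75 p J L)) Sc.J-upper)
      where
      eq : ∀ u p J L → u ℕ.* (p ℕ.* J ℕ.* L) ≡ J ℕ.* (u ℕ.* (p ℕ.* L))
      eq = solveℕ 4 (λ u p J L → u ⊛ (p ⊛ J ⊛ L) ≔ J ⊛ (u ⊛ (p ⊛ L))) refl

    half : + 2 * + s ≤ N
    half = lift-≤ (ℤₚ.pos-* 2 s) refl Sc.2s≤p

    nonzero : ∀ A → ZSF val p A → All Nonzero A
    nonzero A z = go (find (λ a → N ∣?ᶻ val a) A)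
      where
      go : (∃[ a ] ∃[ T ] (A ↭ a ∷ T × N ∣ᶻ val a)) ⊎ All Nonzero A → All Nonzero A
      go (inj₂ h) = h
      go (inj₁ (a , T , e , d)) with z (a ∷ []) T e (subst (N ∣ᶻ_) (sym (ℤₚ.+-identityʳ (val a))) d)
      ... | ()

    -- The first group was built to size s before saturation. It is saturated only after the other
    -- two groups and a₀ have been taken, so that the settled terms are exactly those left over.
    module Assembled (A : List (Fin p)) (zs : ZSF val p A) (mA : ∀ a → mult a A ℕ.≤ m)
                     (D₁ T₁ : List (Fin p)) (perm₁ : A ↭ D₁ ++ T₁) (short₁ : length D₁ ℕ.≤ 2 ℕ.* n) (A₁ : Sub) (s≤₁ : + s ≤ Sub.size A₁)
                     (G₂ : Grown m [] T₁ (2 ℕ.* n) (λ z → + s ≤ z)) (G₃ : Grown m [] (Grown.T′ G₂) (2 ℕ.* n) (λ z → + s ≤ z))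
                     (a₀ : Fin p) (T₄ : List (Fin p)) (perm₄ : Grown.T′ G₃ ≡ a₀ ∷ T₄) (Z : Saturated (D₁ ++ []) A₁ T₄ L) where
      module G₂ = Grown G₂
      module G₃ = Grown G₃
      module Z = Saturated Z

      U : List (Fin p)
      U = ((Z.D ++ (D₁ ++ [])) ++ (G₂.D ++ [])) ++ (G₃.D ++ [])

      perm : A ↭ (a₀ ∷ U) ++ Z.T′
      perm = ↭-trans perm₁ (↭-trans (++⁺ˡ D₁ (↭-trans G₂.perm (++⁺ˡ G₂.D (↭-trans G₃.perm (++⁺ˡ G₃.D (↭-trans (↭-reflexive perm₄) (prep a₀ Z.perm)))))))
               (shuffle D₁ G₂.D G₃.D (a₀ ∷ []) Z.D Z.T′))
        where
        shuffle : ∀ (a b c o d t : List (Fin p)) → a ++ (b ++ (c ++ (o ++ (d ++ t)))) ↭ (o ++ (((d ++ (a ++ [])) ++ (b ++ [])) ++ (c ++ []))) ++ t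
        shuffle = PS.solve 6 (λ a b c o d t → (a PS.⊕ (b PS.⊕ (c PS.⊕ (o PS.⊕ (d PS.⊕ t))))) PS.⊜ ((o PS.⊕ (((d PS.⊕ (a PS.⊕ PS.id)) PS.⊕ (b PS.⊕ PS.id)) PS.⊕ (c PS.⊕ PS.id))) PS.⊕ t)) ↭-refl
          where module PS = PermSolver

      sized : Sub.size A₁ + + length Z.D * + L ≤ N
      sized = ≤-trans Z.size≥ (Sub.size≤ Z.A)

      steps≥0 : 0ℤ ≤ + length Z.D * + L
      steps≥0 = pos {length Z.D} ⊗ pos {L}

      s≤Z : + s ≤ Sub.size Z.A
      s≤Z = ≤-trans (≤-trans s≤₁ (≤-by _ steps≥0 (eq (Sub.size A₁) (+ length Z.D * + L)))) Z.size≥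
        where
        eq : ∀ a b → a + b - a ≡ b
        eq = solve 2 (λ a b → a :+ b :- a := b) refl

      -- Every saturation step adds at least L residues, and p < L n.
      few : length Z.D ℕ.≤ n
      few = go (n ℕₚ.≤? length Z.D)
        where
        eq : ∀ a d → a + d - d ≡ a
        eq = solve 2 (λ a d → a :+ d :- d := a) refl
        nat : length Z.D ℕ.* L ℕ.≤ p
        nat = +≤+⁻ (≤-trans (≤-reflexive (ℤₚ.pos-* (length Z.D) L)) (≤-trans (≤-by _ (Sub.size≥0 A₁) (eq (Sub.size A₁) (+ length Z.D * + L))) sized))
        go : Dec (n ℕ.≤ length Z.D) → length Z.D ℕ.≤ n
        go (no h) = ℕₚ.<⇒≤ (ℕₚ.≰⇒> h)
        go (yes h) = ⊥-elim (ℕₚ.<⇒≱ Sc.p<LN (ℕₚ.≤-trans (ℕₚ.≤-trans (ℕₚ.*-monoʳ-≤ L h) (ℕₚ.≤-reflexive (ℕₚ.*-comm L (length Z.D)))) nat))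

      -- At most n terms from saturation, 2 n from each group, and a₀: together 7 n + 1.
      U-short : length (a₀ ∷ U) ℕ.≤ 8 ℕ.* n
      U-short = ℕₚ.≤-trans (ℕₚ.≤-reflexive (cong suc (trans (Listₚ.length-++ ((Z.D ++ (D₁ ++ [])) ++ (G₂.D ++ []))) (cong₂ ℕ._+_ (trans (Listₚ.length-++ (Z.D ++ (D₁ ++ []))) (cong₂ ℕ._+_ (trans (Listₚ.length-++ Z.D) (cong (length Z.D ℕ.+_) (len D₁))) (len G₂.D))) (len G₃.D)))))
          (lin 0 (few ⊞ short₁ ⊞ G₂.short ⊞ G₃.short ⊞ n≥1) (eq (length Z.D) (length D₁) (length G₂.D) (length G₃.D) n))
        where
        len : ∀ (D : List (Fin p)) → length (D ++ []) ≡ length D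
        len D = cong length (Listₚ.++-identityʳ D)
        eq : ∀ d a b c n → suc (d ℕ.+ a ℕ.+ b ℕ.+ c) ℕ.+ (n ℕ.+ 2 ℕ.* n ℕ.+ 2 ℕ.* n ℕ.+ 2 ℕ.* n ℕ.+ n) ℕ.+ 0 ≡ 8 ℕ.* n ℕ.+ (d ℕ.+ a ℕ.+ b ℕ.+ c ℕ.+ 1)
        eq = solveℕ 5 (λ d a b c n → (lit 1 ⊹ (d ⊹ a ⊹ b ⊹ c)) ⊹ (n ⊹ lit 2 ⊛ n ⊹ lit 2 ⊛ n ⊹ lit 2 ⊛ n ⊹ n) ⊹ lit 0 ≔ lit 8 ⊛ n ⊹ (d ⊹ a ⊹ b ⊹ c ⊹ lit 1)) refl

      -- A zero of x + y + z + a₀ would be a zero-sum subsequence containing a₀.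
      nosol : ∀ x y z → Sub.χ Z.A x ≡ 1ℤ → Sub.χ G₂.A y ≡ 1ℤ → Sub.χ G₃.A z ≡ 1ℤ → ¬ (N ∣ᶻ (x + y + z + val a₀))
      nosol x y z hx hy hz d = go (Z.sums x hx) (G₂.sums y hy) (G₃.sums z hz)
        where
        eq : ∀ x y z a x′ y′ z′ → x + y + z + a - (x - x′ + (y - y′) + (z - z′)) ≡ a + (x′ + y′ + z′)
        eq = solve 7 (λ x y z a x′ y′ z′ → x :+ y :+ z :+ a :- (x :- x′ :+ (y :- y′) :+ (z :- z′)) := a :+ (x′ :+ y′ :+ z′)) refl
        go : ∃[ x′ ] (Real val (Z.D ++ (D₁ ++ [])) x′ × N ∣ᶻ (x - x′)) → ∃[ y′ ] (Real val (G₂.D ++ []) y′ × N ∣ᶻ (y - y′)) → ∃[ z′ ] (Real val (G₃.D ++ []) z′ × N ∣ᶻ (z - z′)) → ⊥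
        go (x′ , rx , dx) (y′ , ry , dy) (z′ , rz , dz) = fin (real-++ val (real-++ val rx ry) rz)
          where
          fin : Real val U (x′ + y′ + z′) → ⊥
          fin (C , C′ , e , t) = nonempty (zs (a₀ ∷ C) (C′ ++ Z.T′) (↭-trans perm (prep a₀ (↭-trans (++⁺ʳ Z.T′ e) (++-assoc C C′ Z.T′))))
                                     (subst (N ∣ᶻ_) (trans (eq x y z (val a₀) x′ y′ z′) (cong (_+_ (val a₀)) (sym t))) (∣m∣n⇒∣m-n d (∣m∣n⇒∣m+n (∣m∣n⇒∣m+n dx dy) dz))))
            where
            nonempty : ¬ (a₀ ∷ C ≡ [])
            nonempty ()

      conclusion : Concentrated p (16 ℕ.* n) A
      conclusion = go (Dilation.dilate p inv Z.A G₂.A G₃.A (val a₀) nosol g s w L J 4g≤p p≤5g (+≤+ (ℕₚ.≤-trans (s≤s z≤n) g≥4)) (ℕₚ.≤-trans (s≤s (s≤s z≤n)) p≥16)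
                     (+≤+ Sc.s≥1) s≤Z G₂.reached G₃.reached Sc.w≥1 w≤p Q<p 75w w-cubic J-upper)
        where
        zsT : ZSF val p Z.T′
        zsT C C′ e d = zs C (C′ ++ (a₀ ∷ U)) (↭-trans perm (↭-trans (swap++ (a₀ ∷ U) Z.T′) (↭-trans (++⁺ʳ (a₀ ∷ U) e) (++-assoc C C′ (a₀ ∷ U))))) d
          where
          swap++ : ∀ (a b : List (Fin p)) → a ++ b ↭ b ++ a
          swap++ = PS.solve 2 (λ a b → (a PS.⊕ b) PS.⊜ (b PS.⊕ a)) ↭-refl
            where module PS = PermSolver
        multT : ∀ a → mult a Z.T′ ℕ.≤ m
        multT a = ℕₚ.≤-trans (ℕₚ.m≤n+m (mult a Z.T′) (mult a (a₀ ∷ U))) (ℕₚ.≤-trans (ℕₚ.≤-reflexive (sym (trans (mult-↭ a perm) (mult-++ a (a₀ ∷ U) Z.T′)))) (mA a))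
        go : ∃[ β ] (¬ (N ∣ᶻ β) × (∀ a → Sub.lam Z.A a ≤ + L → 1ℤ + tri (β * a) * + J ≤ N)) → Concentrated p (16 ℕ.* n) A
        go (β , β≢0 , h) = fin (concentrate X (8 ℕ.* n) Z.T′ Sc.2X≤p Sc.X≥1
                (robust X p X m n v Z.T′ ℕₚ.≤-refl n≥1 m≥1 Sc.X≥1 Sc.density nzT (mult-v multT) (zsf-v zsT)))
          where
          open Scaled β β≢0
          nzT : All (NZ v X) Z.T′
          nzT = All.zipWith (λ {a} (a≢0 , settled) → nz-v J a a≢0 (h (val a) settled)) (nonzero Z.T′ zsT , Z.settled)
          fin : Concentrated p (8 ℕ.* n) Z.T′ → Concentrated p (16 ℕ.* n) A
          fin (b , b≥1 , b<p , A♭ , R , e , l , small) = b , b≥1 , b<p , (a₀ ∷ U) ++ A♭ , R , ↭-trans perm (↭-trans (++⁺ˡ (a₀ ∷ U) e) (↭-sym (++-assoc (a₀ ∷ U) A♭ R)))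
             , ℕₚ.≤-trans (ℕₚ.≤-reflexive (Listₚ.length-++ (a₀ ∷ U))) (ℕₚ.≤-trans (ℕₚ.+-mono-≤ U-short l) (ℕₚ.≤-reflexive (eq n))) , small
            where
            eq : ∀ n → 8 ℕ.* n ℕ.+ 8 ℕ.* n ≡ 16 ℕ.* n
            eq = solveℕ 1 (λ n → lit 8 ⊛ n ⊹ lit 8 ⊛ n ≔ lit 16 ⊛ n) refl

    -- With 8 n terms available, at least 4 n ≥ 3 n + 1 are left whenever `build` is called, and 2 n
    -- afterwards, from which a₀ is taken.
    long : ∀ A → ZeroSumFree p A → (∀ a → mult a A ℕ.≤ m) → 8 ℕ.* n ℕ.≤ length A → Concentrated p (16 ℕ.* n) A
    long A zsf mA l = go₁ (grow-next A st (lin (4 ℕ.* n) n≥1 (e₁ n)) l)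
      where
      zs : ZSF val p A
      zs = zero-sum-free p A zsf
      st : Stock m A
      st = record { nonzero = nonzero A zs ; mult≤ = mA }
      e₁ : ∀ n → 3 ℕ.* n ℕ.+ 1 ℕ.+ n ℕ.+ 4 ℕ.* n ≡ 8 ℕ.* n ℕ.+ 1
      e₁ = solveℕ 1 (λ n → lit 3 ⊛ n ⊹ lit 1 ⊹ n ⊹ lit 4 ⊛ n ≔ lit 8 ⊛ n ⊹ lit 1) refl
      e₂ : ∀ n → 3 ℕ.* n ℕ.+ 1 ℕ.+ n ℕ.+ 2 ℕ.* n ≡ 6 ℕ.* n ℕ.+ 1
      e₂ = solveℕ 1 (λ n → lit 3 ⊛ n ⊹ lit 1 ⊹ n ⊹ lit 2 ⊛ n ≔ lit 6 ⊛ n ⊹ lit 1) refl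
      e₃ : ∀ n → 3 ℕ.* n ℕ.+ 1 ℕ.+ n ℕ.+ 0 ≡ 4 ℕ.* n ℕ.+ 1
      e₃ = solveℕ 1 (λ n → lit 3 ⊛ n ⊹ lit 1 ⊹ n ⊹ lit 0 ≔ lit 4 ⊛ n ⊹ lit 1) refl
      d₁ : ∀ n → 2 ℕ.* n ℕ.+ 6 ℕ.* n ≡ 8 ℕ.* n
      d₁ = solveℕ 1 (λ n → lit 2 ⊛ n ⊹ lit 6 ⊛ n ≔ lit 8 ⊛ n) refl
      d₂ : ∀ n → 2 ℕ.* n ℕ.+ 4 ℕ.* n ≡ 6 ℕ.* n
      d₂ = solveℕ 1 (λ n → lit 2 ⊛ n ⊹ lit 4 ⊛ n ≔ lit 6 ⊛ n) refl
      d₃ : ∀ n → 2 ℕ.* n ℕ.+ 2 ℕ.* n ≡ 4 ℕ.* n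
      d₃ = solveℕ 1 (λ n → lit 2 ⊛ n ⊹ lit 2 ⊛ n ≔ lit 4 ⊛ n) refl
      Step : List (Fin p) → Set
      Step T = Grown m [] T (2 ℕ.* n) (λ z → + s ≤ z)
      grow-next : ∀ T {q} → Stock m T → 3 ℕ.* n ℕ.+ 1 ℕ.≤ q → q ℕ.≤ length T → Step T
      grow-next T st h l = build m n s m≥1 n≥1 Sc.s-upper half T st (ℕₚ.≤-trans h l)
      go₁ : Step A → Concentrated p (16 ℕ.* n) A
      go₁ G₁ = go₂ (grow-next G₁.T′ st₁ (lin (2 ℕ.* n) n≥1 (e₂ n)) l₁)
        where
        module G₁ = Grown G₁
        st₁ : Stock m G₁.T′
        st₁ = stock-sub G₁.D G₁.T′ G₁.perm st
        l₁ : 6 ℕ.* n ℕ.≤ length G₁.T′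
        l₁ = rest G₁.D G₁.T′ (2 ℕ.* n) (6 ℕ.* n) G₁.perm G₁.short (ℕₚ.≤-trans (ℕₚ.≤-reflexive (d₁ n)) l)
        go₂ : Step G₁.T′ → Concentrated p (16 ℕ.* n) A
        go₂ G₂ = go₃ (grow-next G₂.T′ st₂ (lin 0 n≥1 (e₃ n)) l₂)
          where
          module G₂ = Grown G₂
          st₂ : Stock m G₂.T′
          st₂ = stock-sub G₂.D G₂.T′ G₂.perm st₁
          l₂ : 4 ℕ.* n ℕ.≤ length G₂.T′
          l₂ = rest G₂.D G₂.T′ (2 ℕ.* n) (4 ℕ.* n) G₂.perm G₂.short (ℕₚ.≤-trans (ℕₚ.≤-reflexive (d₂ n)) l₁)
          go₃ : Step G₂.T′ → Concentrated p (16 ℕ.* n) A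
          go₃ G₃ = go₄ G₃.T′ refl l₃
            where
            module G₃ = Grown G₃
            l₃ : 2 ℕ.* n ℕ.≤ length G₃.T′
            l₃ = rest G₃.D G₃.T′ (2 ℕ.* n) (2 ℕ.* n) G₃.perm G₃.short (ℕₚ.≤-trans (ℕₚ.≤-reflexive (d₃ n)) l₂)
            go₄ : ∀ T → G₃.T′ ≡ T → 2 ℕ.* n ℕ.≤ length T → Concentrated p (16 ℕ.* n) A
            go₄ [] e h = ⊥-elim (ℕₚ.<⇒≱ n≥1 (ℕₚ.≤-trans (ℕₚ.m≤m+n n (n ℕ.+ 0)) h))
            go₄ (a₀ ∷ T₄) e h = Assembled.conclusion A zs mA G₁.D G₁.T′ G₁.perm G₁.short G₁.A G₁.reached G₂ G₃ a₀ T₄ e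
                                   (saturate L (G₁.D ++ []) G₁.A T₄ G₁.sums (length T₄) ℕₚ.≤-refl)

-- Constants, small cases and conclusion

open import Data.Nat using (_≤_; _<_; _*_; _+_; _^_)
open Rectification using (least)
open Progressions using (pigeonhole)
open LinearArithmetic using (lin; _⊞_; _⊠_)
open SubsetSums using (prime-inv; mult-++; mult-↭; mult-all)
open Dilates using (Concentrated)
open LongSequences using (module Long)
open Logarithm using (FLeq-root; FLeq-zero)

-- c = 2^39 and B = 2^130; abstract, because unfolding such numerals in unary is hopeless.
abstract
  d e c K k B : ℕ
  d = 1024
  e = 128
  c = 549755813888
  K = 180000
  k = 1536000
  B = d ^ 13

  B≡ : B ≡ d ^ 13
  B≡ = refl
  e² : e * e ≡ 16 * d
  e² = refl
  e¹³ : c * c * 2 ^ 13 ≡ e ^ 13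
  e¹³ = refl
  e≥1 : 1 ≤ e
  e≥1 = ℕₚ.≤ᵇ⇒≤ 1 e tt
  B≥16e : 16 * e ≤ B
  B≥16e = ℕₚ.≤ᵇ⇒≤ (16 * e) B tt
  B≥1600 : 40 * 40 ≤ B
  B≥1600 = ℕₚ.≤ᵇ⇒≤ (40 * 40) B tt
  K-c : 64 * 64 * 64 * (5 * K) ≤ c
  K-c = ℕₚ.≤ᵇ⇒≤ (64 * 64 * 64 * (5 * K)) c tt
  k-c : 64 * (17 * (17 * (k * k))) ≤ c * c
  k-c = ℕₚ.≤ᵇ⇒≤ (64 * (17 * (17 * (k * k)))) (c * c) tt
  c-large : 32 * 32 * 32 * 32 < c
  c-large = ℕₚ.≤ᵇ⇒≤ (suc (32 * 32 * 32 * 32)) c tt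
  k≡ : k ≡ 64 * 64 * (75 * 5)
  k≡ = refl
  K≡ : 2 * K ≡ 600 * 600
  K≡ = refl
  K≥75 : 75 ≤ K
  K≥75 = ℕₚ.≤ᵇ⇒≤ 75 K tt
  K-large : 600 * 600 * 600 ≤ K * (40 * 40)
  K-large = ℕₚ.≤ᵇ⇒≤ (600 * 600 * 600) (K * (40 * 40)) tt

^-distribʳ-* : ∀ o m n → (m * n) ^ o ≡ m ^ o * n ^ o
^-distribʳ-* zero m n = refl
^-distribʳ-* (suc o) m n = trans (cong (m * n *_) (^-distribʳ-* o m n)) (eq m n (m ^ o) (n ^ o))
  where
  eq : ∀ m n x y → m * n * (x * y) ≡ m * x * (n * y)
  eq = solveℕ 4 (λ m n x y → m ⊛ n ⊛ (x ⊛ y) ≔ m ⊛ x ⊛ (n ⊛ y)) refl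

-- n is the integer part of the 13th root of y; n + n replaces n + 1 so that the loss is a plain
-- factor.
root : ∀ y → 1 ≤ y → ∃[ n ] (1 ≤ n × n ^ 13 ≤ y × y < (n + n) ^ 13)
root y y≥1 = go (least (λ n → y ℕₚ.<? suc n ^ 13) y (ℕₚ.m≤m*n (suc y) (suc y ^ 12) {{ℕₚ.m^n≢0 (suc y) 12}}))
  where
  go : ∃[ n ] (n ≤ y × y < suc n ^ 13 × (∀ j → j < n → ¬ y < suc j ^ 13)) → ∃[ n ] (1 ≤ n × n ^ 13 ≤ y × y < (n + n) ^ 13)
  go (zero , _ , h , _) = ⊥-elim (ℕₚ.<⇒≱ h y≥1)
  go (suc n , _ , h , least) = suc n , s≤s z≤n , ℕₚ.≮⇒≥ (least n ℕₚ.≤-refl) , ℕₚ.<-≤-trans h (ℕₚ.^-monoˡ-≤ 13 (s≤s (ℕₚ.m≤n+m (suc n) n)))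

bounded : ∀ {p} m (A : List (Fin p)) → (∀ a → mult a A ≤ m) → length A ≤ p * m
bounded {p} m A h = ℕₚ.≮⇒≥ λ l → go (pigeonhole p m toℕ A (All.universal Finₚ.toℕ<n A) l)
  where
  go : ¬ (∃[ k ] ∃[ ys ] ∃[ zs ] (A ↭ ys ++ zs × All (λ x → toℕ x ≡ k) ys × m < length ys))
  go (k , y ∷ ys , zs , e , ey ∷ es , l) = ℕₚ.<⇒≱ l (ℕₚ.≤-trans (ℕₚ.≤-reflexive (sym (mult-all y (y ∷ ys) (refl ∷ All.map (λ ex → Finₚ.toℕ-injective (trans ey (sym ex))) es))))
    (ℕₚ.≤-trans (ℕₚ.m≤m+n (mult y (y ∷ ys)) (mult y zs)) (ℕₚ.≤-trans (ℕₚ.≤-reflexive (sym (trans (mult-↭ y e) (mult-++ y (y ∷ ys) zs)))) (h y))))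

remove-all : ∀ p .{{_ : NonZero p}} K A → 2 ≤ p → length A ≤ K → Concentrated p K A
remove-all p K A p≥2 h = 1 , s≤s z≤n , p≥2 , A , [] , ↭-reflexive (sym (Listₚ.++-identityʳ A)) , h , ℕₚ.≤-trans (s≤s z≤n) p≥2

weaken : ∀ {p} .{{_ : NonZero p}} {K K′ A} → K ≤ K′ → Concentrated p K A → Concentrated p K′ A
weaken h (b , b≥1 , b<p , A♭ , R , e , l , small) = b , b≥1 , b<p , A♭ , R , e , ℕₚ.≤-trans l h , small

-- p = 2 is treated apart because `FLeq-root` asks for p ≥ 3. It is settled with k = 0, so nothing
-- may be removed: a zero-sum-free sequence mod 2 has at most one term.
mod-2 : ∀ A → ZeroSumFree 2 A → Concentrated 2 0 A
mod-2 [] h = remove-all 2 0 [] (s≤s (s≤s z≤n)) z≤n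
mod-2 (a ∷ []) h = 1 , s≤s z≤n , s≤s (s≤s z≤n) , [] , a ∷ [] , ↭-refl , z≤n , ℕₚ.≤-<-trans (ℕₚ.≤-reflexive (ℕₚ.+-identityʳ _)) (m%n<n (1 * toℕ a) 2)
mod-2 (zero ∷ b ∷ A) h = ⊥-elim (h (zero ∷ []) (b ∷ A) ↭-refl (λ ()) refl)
mod-2 (suc zero ∷ zero ∷ A) h = ⊥-elim (h (zero ∷ []) (suc zero ∷ A) (_↭_.swap (suc zero) zero ↭-refl) (λ ()) refl)
mod-2 (suc zero ∷ suc zero ∷ A) h = ⊥-elim (h (suc zero ∷ suc zero ∷ []) A ↭-refl (λ ()) refl)

module _ {p m n : ℕ} (n≥1 : 1 ≤ n) (n-small : n ^ 13 ≤ (p * m) ^ 6) (n-large : (p * m) ^ 6 < (n + n) ^ 13) where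

  -- (pm)⁶ < (2n)¹³, and e is chosen with e¹³ = c² · 2¹³: 2⁹¹ = 2⁷⁸ · 2¹³.
  scale-large : c * c * (p * m) ^ 6 ≤ (e * n) ^ 13
  scale-large = ℕₚ.≤-trans ((c * c) ⊠ ℕₚ.<⇒≤ n-large) (ℕₚ.≤-reflexive (trans (cong (λ z → c * c * z ^ 13) (dbl n)) (trans (cong (c * c *_) (^-distribʳ-* 13 2 n))
        (trans (sym (ℕₚ.*-assoc (c * c) (2 ^ 13) (n ^ 13))) (trans (cong (_* n ^ 13) e¹³) (sym (^-distribʳ-* 13 e n)))))))
    where
    dbl : ∀ n → n + n ≡ 2 * n
    dbl = solveℕ 1 (λ n → n ⊹ n ≔ lit 2 ⊛ n) refl

  -- As e² = 16 d it has to be shown that d n² ≤ p m. The 13th power of the left side is B n²⁶ ≤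
  -- (pm) (pm)¹², which is where B = d¹³ comes from.
  scale-small : B ≤ p * m → e * n * (e * n) ≤ 16 * (p * m)
  scale-small hB = ℕₚ.≤-trans (ℕₚ.≤-reflexive (trans (eq e n) (trans (cong (_* (n * n)) e²) (ℕₚ.*-assoc 16 d (n * n))))) (16 ⊠ dn²≤ν)
    where
    eq : ∀ e n → e * n * (e * n) ≡ e * e * (n * n)
    eq = solveℕ 2 (λ e n → e ⊛ n ⊛ (e ⊛ n) ≔ e ⊛ e ⊛ (n ⊛ n)) refl
    bound : (d * (n * n)) ^ 13 ≤ (p * m) ^ 13
    bound = ℕₚ.≤-trans (ℕₚ.≤-reflexive (trans (^-distribʳ-* 13 d (n * n)) (cong₂ _*_ (sym B≡) (^-distribʳ-* 13 n n))))
         (ℕₚ.≤-trans (ℕₚ.*-mono-≤ hB (ℕₚ.*-mono-≤ n-small n-small)) (ℕₚ.≤-reflexive (cong (p * m *_) (sym (ℕₚ.^-distribˡ-+-* (p * m) 6 6)))))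
    dn²≤ν : d * (n * n) ≤ p * m
    dn²≤ν = ℕₚ.≮⇒≥ λ l → ℕₚ.<⇒≱ (ℕₚ.^-monoˡ-< 13 {p * m} {d * (n * n)} l) bound

  -- With N = e n, either A has fewer than 8 N terms or at most 16 N are removed; 16 e ≤ B covers
  -- both.
  large : ∀ .{{_ : NonZero p}} → Prime p → 2 ≤ p → 1 ≤ m → m ≤ p → B ≤ p * m → ∀ A → ZeroSumFree p A → (∀ a → mult a A ≤ m) → Concentrated p (B * n) A
  large pr p≥2 m≥1 m≤p hB A zsf mA = go (8 * (e * n) ℕₚ.≤? length A)
    where
    p≥40 : 40 ≤ p
    p≥40 = ℕₚ.≮⇒≥ λ l → ℕₚ.<⇒≱ (ℕₚ.*-mono-< l l) (ℕₚ.≤-trans B≥1600 (ℕₚ.≤-trans hB (ℕₚ.*-monoʳ-≤ p m≤p)))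
    room : 16 * (e * n) ≤ B * n
    room = ℕₚ.≤-trans (ℕₚ.≤-reflexive (sym (ℕₚ.*-assoc 16 e n))) (ℕₚ.*-monoˡ-≤ n B≥16e)
    en≥1 : 1 ≤ e * n
    en≥1 = ℕₚ.*-mono-≤ {1} {e} {1} {n} e≥1 n≥1
    go : Dec (8 * (e * n) ≤ length A) → Concentrated p (B * n) A
    go (no h) = remove-all p (B * n) A p≥2 (ℕₚ.≤-trans (ℕₚ.<⇒≤ (ℕₚ.≰⇒> h)) (ℕₚ.≤-trans (ℕₚ.*-monoˡ-≤ (e * n) (ℕₚ.m≤m+n 8 8)) room))
    go (yes h) = weaken room (Long.long p m (e * n) c K k (prime-inv pr) (ℕₚ.≤-trans (ℕₚ.m≤m+n 16 24) p≥40) (ℕₚ.≤-trans (s≤s z≤n) p≥2) m≥1 en≥1 m≤p (scale-small hB) scale-large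
        K-c k-c c-large k≡ K≡ K≥75 (ℕₚ.≤-trans K-large (K ⊠ ℕₚ.*-mono-≤ p≥40 p≥40)) A zsf mA h)

B≥1 : 1 ≤ B
B≥1 = ℕₚ.≤-trans (s≤s z≤n) B≥1600

theorem2p1 : ∃[ c₁ ] (1 ≤ c₁ × (∀ (p : ℕ) .{{_ : NonZero p}} → Prime p → (m : ℕ) → 1 ≤ m → m ≤ p
      → (A : List (Fin p)) → ZeroSumFree p A → (∀ (a : Fin p) → mult a A ≤ m)
      → ∃[ b ] (1 ≤ b × b < p × ∃[ k ] (FLeq p m k × ∃[ A♭ ] ∃[ R ] (A ↭ A♭ ++ R × length A♭ ≤ c₁ * k × scaledSum p b R < p)))))
theorem2p1 = B , B≥1 , λ p pr → main p pr (ℕₚ.<-cmp 2 p)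
  where
  open import Relation.Binary using (Tri; tri<; tri≈; tri>)
  Goal : ∀ p .{{_ : NonZero p}} → ℕ → List (Fin p) → Set
  Goal p m A = ∃[ b ] (1 ≤ b × b < p × ∃[ k ] (FLeq p m k × ∃[ A♭ ] ∃[ R ] (A ↭ A♭ ++ R × length A♭ ≤ B * k × scaledSum p b R < p)))
  pack : ∀ p m A .{{_ : NonZero p}} k → FLeq p m k → Concentrated p (B * k) A → Goal p m A
  pack p m A k f (b , b≥1 , b<p , A♭ , R , e , l , small) = b , b≥1 , b<p , k , f , A♭ , R , e , l , small
  main : ∀ p .{{_ : NonZero p}} → Prime p → Tri (2 < p) (2 ≡ p) (p < 2) → ∀ m → 1 ≤ m → m ≤ p → ∀ A → ZeroSumFree p A → (∀ a → mult a A ≤ m) → Goal p m A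
  main p pr (tri> _ _ l) m m≥1 m≤p A zsf mA = ⊥-elim (ℕₚ.<⇒≱ l (ℕ.nonTrivial⇒n>1 p {{prime⇒nonTrivial pr}}))
  main p pr (tri≈ _ refl _) m m≥1 m≤p A zsf mA = pack 2 m A 0 (FLeq-zero 2 m) (weaken z≤n (mod-2 A zsf))
  main p pr (tri< p≥3 _ _) m m≥1 m≤p A zsf mA = go (root ((p * m) ^ 6) ν⁶≥1) (B ℕₚ.≤? p * m)
    where
    p≥2 : 2 ≤ p
    p≥2 = ℕₚ.<⇒≤ p≥3
    ν⁶≥1 : 1 ≤ (p * m) ^ 6
    ν⁶≥1 = ℕₚ.m^n>0 (p * m) {{ℕ.>-nonZero {p * m} (ℕₚ.≤-trans m≥1 (ℕₚ.m≤n*m m p))}} 6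
    go : ∃[ n ] (1 ≤ n × n ^ 13 ≤ (p * m) ^ 6 × (p * m) ^ 6 < (n + n) ^ 13) → Dec (B ≤ p * m) → Goal p m A
    go (n , n≥1 , lo , hi) (yes h) = pack p m A n (FLeq-root p m n p≥3 lo) (large n≥1 lo hi pr p≥2 m≥1 m≤p h A zsf mA)
    -- A has at most p m < B terms, so all of it may be removed as n ≥ 1.
    go (n , n≥1 , lo , hi) (no h) = pack p m A n (FLeq-root p m n p≥3 lo) (remove-all p (B * n) A p≥2
       (ℕₚ.≤-trans (bounded m A mA) (ℕₚ.≤-trans (ℕₚ.<⇒≤ (ℕₚ.≰⇒> h)) (ℕₚ.≤-trans (ℕₚ.≤-reflexive (sym (ℕₚ.*-identityʳ B))) (B ⊠ n≥1)))))
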